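{- Let $m_1\le m_2$ be positive integers with $\frac{1}{m_1}+\frac{1}{m_2}<1$, let $p$ be a prime with $p>2m_1m_2$, and let $J$ be the Hauptmodul of the triangle group of type $(m_1,m_2,\infty)$, i.e. $J=1/z(\kappa q)$ with $\kappa=-2m_1^2m_2^2$ (notation as in the context). Then $J$ is $p$-integral if and only if there exist $\epsilon,\epsilon'\in\{1,-1\}$ such that $$\big(p\equiv \epsilon \pmod{2m_1}\ \text{and}\ p\equiv \epsilon'\epsilon \pmod{2m_2}\big)\quad\text{or}\quad \big(p\equiv m_1+\epsilon \pmod{2m_1}\ \text{and}\ p\equiv m_2+\epsilon'\epsilon \pmod{2m_2}\big).$$ Moreover, for the triangle group of type $(m,\infty,\infty)$ with $m\ge 2$ an integer and a prime $p>2m$, the Hauptmodul $J=1/z(\kappa q)$ (with $\kappa$ a nonzero rational number that is a $p$-adic unit) is $p$-integral if and only if $p\equiv \pm 1\pmod{2m}$.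
   Context: For $m_1,m_2\in\mathbb{N}\cup\{\infty\}$ with $2\le m_1\le m_2$ and $\frac1{m_1}+\frac1{m_2}<1$ (with $1/\infty=0$) put $a=\frac12(1-\frac1{m_1}+\frac1{m_2})$, $b=\frac12(1-\frac1{m_1}-\frac1{m_2})$. Let $(x)_n=x(x+1)\cdots(x+n-1)$ and $F(a,b|z)=1+\sum_{n\ge1}\frac{(a)_n(b)_n}{n!^2}z^n$, $G(a,b|z)=\sum_{n\ge1}\frac{(a)_n(b)_n}{n!^2}\Big(\sum_{i=0}^{n-1}\big(\frac1{a+i}+\frac1{b+i}-\frac2{1+i}\big)\Big)z^n$, $D(a,b|z)=G(a,b|z)/F(a,b|z)$ and $q(a,b|z)=z\exp(D(a,b|z))\in z+z^2\mathbb{Q}[[z]]$. Let $z(q)\in q+q^2\mathbb{Q}[[q]]$ be the compositional inverse of $q(a,b|z)$. The Hauptmodul of the triangle group of type $(m_1,m_2,\infty)$ is the Laurent series $J=1/z(\kappa q)$ in $q$, where the paper takes $\kappa=-2m_1^2m_2^2$ (this agrees with the paper's definition $J=(t_3-t_2)/(t_3-t_1)$ via the Halphen system). A (Laurent) power series $f$ with rational coefficients is called $p$-integral if some nonzero constant multiple of $f$ has all its coefficients in $\mathbb{Z}_p$ (the $p$-adic integers). -}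

module Defs where

open import Data.Nat as ℕ using (ℕ; zero; suc)
open import Data.Integer as ℤ using (ℤ; +_)
open import Data.Rational as ℚ using (ℚ; 0ℚ; 1ℚ; ½; _+_; _*_; _-_; -_; 1/_)
open import Data.Rational.Properties using (_≟_)
open import Data.Nat.Divisibility using (_∣_)
open import Relation.Nullary using (¬_; yes; no)
open import Data.Product using (∃; _×_; _,_)
open import Data.Sum using (_⊎_)
open import Relation.Binary.PropositionalEquality using (_≡_; _≢_)

Series : Set
Series = ℕ → ℚ

ℕ→ℚ : ℕ → ℚ
ℕ→ℚ n = (+ n) ℚ./ 1

-- total inverse on ℚ (inv 0 = 0); only ever applied to nonzero arguments below
inv : ℚ → ℚ
inv x with x ≟ 0ℚ
... | yes _ = 0ℚ
... | no x≢0 = 1/_ x {{ℚ.≢-nonZero x≢0}}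

sumTo : ℕ → (ℕ → ℚ) → ℚ
sumTo zero    f = 0ℚ
sumTo (suc n) f = sumTo n f + f n

poch : ℚ → ℕ → ℚ
poch x zero    = 1ℚ
poch x (suc n) = poch x n * (x + ℕ→ℚ n)

qpow : ℚ → ℕ → ℚ
qpow x zero    = 1ℚ
qpow x (suc n) = qpow x n * x

_⋆_ : Series → Series → Series
(f ⋆ g) n = sumTo (suc n) (λ i → f i * g (n ℕ.∸ i))

δ₀ : Series
δ₀ zero    = 1ℚ
δ₀ (suc _) = 0ℚ

pow : Series → ℕ → Series
pow f zero    = δ₀
pow f (suc k) = f ⋆ pow f k

-- Course-of-values definition of a series: coefficient n is  step n P  where
-- P is the series whose coefficients below n are the already defined ones
-- (and which is 0 from index n on).
prefix : (ℕ → Series → ℚ) → ℕ → Series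
prefix step zero    i = 0ℚ
prefix step (suc n) i with i ℕ.≟ n
... | yes _ = step n (prefix step n)
... | no  _ = prefix step n i

cov : (ℕ → Series → ℚ) → Series
cov step n = step n (prefix step n)

hypCoeff : ℚ → ℚ → ℕ → ℚ
hypCoeff a b n = poch a n * poch b n * inv (ℕ→ℚ (n ℕ.! ℕ.* n ℕ.!))

Fser : ℚ → ℚ → Series
Fser a b = hypCoeff a b

Gser : ℚ → ℚ → Series
Gser a b n = hypCoeff a b n *
  sumTo n (λ i → inv (a + ℕ→ℚ i) + inv (b + ℕ→ℚ i) - ℕ→ℚ 2 * inv (ℕ→ℚ (suc i)))

-- D = G / F  (F has constant term 1):  D_n = G_n - Σ_{k=1}^{n} F_k D_{n-k}
Dser : ℚ → ℚ → Series
Dser a b = cov (λ n P → Gser a b n - sumTo n (λ j → Fser a b (suc j) * P (n ℕ.∸ suc j)))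

-- exp of a series E with E 0 = 0:  e_0 = 1,  n e_n = Σ_{k=1}^{n} k E_k e_{n-k}
expSer : Series → Series
expSer E = cov step
  where
  step : ℕ → Series → ℚ
  step zero    P = 1ℚ
  step (suc n) P = inv (ℕ→ℚ (suc n)) *
    sumTo (suc n) (λ j → ℕ→ℚ (suc j) * E (suc j) * P (suc n ℕ.∸ suc j))

qser : ℚ → ℚ → Series
qser a b zero    = 0ℚ
qser a b (suc n) = expSer (Dser a b) n

-- compositional inverse of a series Q ∈ z + z²ℚ[[z]]:
-- w_n = [n = 1] - Σ_{k=2}^{n} Q_k (w^k)_n  (the right side only uses w_i, i < n)
δ₁ : Series
δ₁ (suc zero) = 1ℚ
δ₁ _          = 0ℚ

compInv : Series → Series
compInv Q = cov (λ n P → δ₁ n - sumTo (n ℕ.∸ 1) (λ j → Q (2 ℕ.+ j) * pow P (2 ℕ.+ j) n))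

zser : ℚ → ℚ → Series
zser a b = compInv (qser a b)

invSer : Series → Series
invSer Y = cov (λ n P → step n P)
  where
  step : ℕ → Series → ℚ
  step zero    P = inv (Y 0)
  step (suc n) P = - (inv (Y 0) * sumTo (suc n) (λ j → Y (suc j) * P (suc n ℕ.∸ suc j)))

-- The Hauptmodul J = 1/z(κ q) is a Laurent series with a simple pole:
-- J = q⁻¹ · H(q)  where  H = 1 / (z(κq)/q).  hauptH a b κ is the series H,
-- so the coefficient of q^(n-1) in J is  hauptH a b κ n.
hauptH : ℚ → ℚ → ℚ → Series
hauptH a b κ = invSer (λ n → qpow κ (suc n) * zser a b (suc n))

InZp : ℕ → ℚ → Set
InZp p x = ¬ (p ∣ ℚ.denominatorℕ x)

pUnit : ℕ → ℚ → Set
pUnit p x = ¬ (p ∣ ℤ.∣ ℚ.numerator x ∣) × ¬ (p ∣ ℚ.denominatorℕ x)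

PIntegral : ℕ → Series → Set
PIntegral p f = ∃ λ c → c ≢ 0ℚ × (∀ n → InZp p (c * f n))

aFin bFin : ℕ → ℕ → ℚ
aFin m₁ m₂ = ½ * (1ℚ - inv (ℕ→ℚ m₁) + inv (ℕ→ℚ m₂))
bFin m₁ m₂ = ½ * (1ℚ - inv (ℕ→ℚ m₁) - inv (ℕ→ℚ m₂))

aInf : ℕ → ℚ
aInf m = ½ * (1ℚ - inv (ℕ→ℚ m))

κFin : ℕ → ℕ → ℚ
κFin m₁ m₂ = - (ℕ→ℚ (2 ℕ.* (m₁ ℕ.* m₁) ℕ.* (m₂ ℕ.* m₂)))

-- Hauptmodul (as H with J = q⁻¹ H(q))
JFin : ℕ → ℕ → Series
JFin m₁ m₂ = hauptH (aFin m₁ m₂) (bFin m₁ m₂) (κFin m₁ m₂)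

JInf : ℕ → ℚ → Series
JInf m κ = hauptH (aInf m) (aInf m) κ

-- Write q = z exp(D(z)) = z E(z), let z(q) = q/h(q) be the inverse, and put W = 1 + z dD/dz.
-- Lagrange inversion gives W_n = [qⁿ] hⁿ, so h is p-integral if and only if W satisfies the Gauss
-- congruences W_{np} ≡ W_n modulo p^(v(n)+1), because f(q)^p ≡ f(q^p) modulo p.  Dwork's theorem
-- says W_{np} ≡ W′_n instead, where W′ belongs to the parameters a′, b′ such that p a′ - a and
-- p b′ - b are digits in [0, p-1].  If {a′, b′} is {a, b} or {1-a, 1-b}, then W′ = W by symmetry
-- and Euler's transformation; conversely, W₁ and W₂ modulo p determine {a, b} up to the
-- involution x ↦ 1 - x.
--
-- That h has bounded denominators only if it is integral is again Lagrange inversion: the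
-- coefficients of E^(-(N-1)p^e) up to degree N p^e have denominators bounded independently of e,
-- whereas those of h^(p^e) in degree N p^e grow with e if h_N is the first coefficient with the
-- worst denominator.
{-# OPTIONS --safe #-}
module Submission where

open import Defs
open Defs using () renaming (ℕ→ℚ to ι)
open import Data.Nat as ℕ using (ℕ; zero; suc; z≤n; s≤s)
import Data.Nat.Properties as ℕₚ
open import Data.Rational as ℚ using (ℚ; 0ℚ; 1ℚ)
open import Data.Product
open import Data.Sum
open import Data.Empty using (⊥; ⊥-elim)
open import Function using (_∘_)
open import Relation.Nullary
open import Relation.Binary.PropositionalEquality

-- Dwork's congruence is proved here, not quoted. The obstacle is that `a′` differs from `a`, so an
-- induction cannot stay with one hypergeometric series: it runs over the whole orbit of the
-- parameters under the digit map, and its outcome is that `G(z) F′(z^p) - F(z) G′(z^p) / p` is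
-- p-integral. `F` and `G` are handled together as the two components of one product of dual
-- numbers, because `G` is the derivative of `F` when `a`, `b` and the lower parameters 1 are all
-- shifted by ε. Both parameters are written over one denominator `N` (2 m₁ m₂ or 2 m). As `p > N`,
-- the digit map is multiplication by the inverse of `p` on numerators modulo `N`, and congruent
-- numerators are equal. The shape of the final condition comes from 1 - 2a = 1/m₁ - 1/m₂ and 1 - 2b
-- = 1/m₁ + 1/m₂: ε is the sign left open by x ↦ 1 - x, ε′ records whether the parameters are
-- exchanged, and recovering the multiples of 1/m₁ and 1/m₂ from their sum and difference leaves a
-- common parity, hence two alternatives.

-- Rational arithmetic and the commutative ring of formal power series.

module FormalSeries where

  open import Data.Integer as ℤ using (ℤ; +_)
  import Data.Integer.Properties as ℤₚ
  open import Data.Rational using (_+_; _*_; _-_; -_)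
  open import Data.Rational.Properties
  open import Data.Rational.Solver
  import Data.Rational.Unnormalised as ℚᵘ
  import Data.Rational.Unnormalised.Properties as ℚᵘₚ
  open import Data.Maybe using (Maybe; just; nothing)
  open import Algebra.Bundles using (CommutativeRing)
  open import Level using (0ℓ)
  import Algebra.Solver.Ring as RingSolver
  open import Algebra.Solver.Ring.AlmostCommutativeRing using (fromCommutativeRing; _-Raw-AlmostCommutative⟶_)

  module QSol = +-*-Solver

  ιℤ : ℤ → ℚ
  ιℤ z = z ℚ./ 1

  -- `z ℚ./ 1` is defined through a gcd and does not compute for a variable `z`. As an unnormalised
  -- fraction it is just `z` over 1, so the homomorphism laws below are proved there and pulled back
  -- by injectivity.
  toℚᵘ-ιℤ : ∀ z → ℚ.toℚᵘ (ιℤ z) ℚᵘ.≃ ℚᵘ.mkℚᵘ z 0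
  toℚᵘ-ιℤ z = toℚᵘ-fromℚᵘ (ℚᵘ.mkℚᵘ z 0)

  ιℤ-+ : ∀ x y → ιℤ (x ℤ.+ y) ≡ ιℤ x + ιℤ y
  ιℤ-+ x y = toℚᵘ-injective (ℚᵘₚ.≃-trans (toℚᵘ-ιℤ (x ℤ.+ y)) (ℚᵘₚ.≃-sym
    (ℚᵘₚ.≃-trans (toℚᵘ-homo-+ (ιℤ x) (ιℤ y))
    (ℚᵘₚ.≃-trans (ℚᵘₚ.+-cong (toℚᵘ-ιℤ x) (toℚᵘ-ιℤ y))
     (ℚᵘ.*≡* (cong (ℤ._* + 1) (cong₂ ℤ._+_ (ℤₚ.*-identityʳ x) (ℤₚ.*-identityʳ y))))))))

  ιℤ-* : ∀ x y → ιℤ (x ℤ.* y) ≡ ιℤ x * ιℤ y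
  ιℤ-* x y = toℚᵘ-injective (ℚᵘₚ.≃-trans (toℚᵘ-ιℤ (x ℤ.* y)) (ℚᵘₚ.≃-sym
    (ℚᵘₚ.≃-trans (toℚᵘ-homo-* (ιℤ x) (ιℤ y))
    (ℚᵘₚ.≃-trans (ℚᵘₚ.*-cong (toℚᵘ-ιℤ x) (toℚᵘ-ιℤ y))
     (ℚᵘ.*≡* refl)))))

  ιℤ-neg : ∀ x → ιℤ (ℤ.- x) ≡ - ιℤ x
  ιℤ-neg x = toℚᵘ-injective (ℚᵘₚ.≃-trans (toℚᵘ-ιℤ (ℤ.- x)) (ℚᵘₚ.≃-sym
    (ℚᵘₚ.≃-trans (toℚᵘ-homo‿- (ιℤ x))
    (ℚᵘₚ.≃-trans (ℚᵘₚ.-‿cong (toℚᵘ-ιℤ x)) (ℚᵘ.*≡* refl)))))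

  ιℤ-injective : ∀ {x y} → ιℤ x ≡ ιℤ y → x ≡ y
  ιℤ-injective {x} {y} e with ℚᵘₚ.≃-trans (ℚᵘₚ.≃-sym (toℚᵘ-ιℤ x)) (ℚᵘₚ.≃-trans (ℚᵘₚ.≃-reflexive (cong ℚ.toℚᵘ e)) (toℚᵘ-ιℤ y))
  ... | ℚᵘ.*≡* q = trans (sym (ℤₚ.*-identityʳ x)) (trans q (ℤₚ.*-identityʳ y))

  *-denominator : ∀ x → x * ι (ℚ.denominatorℕ x) ≡ ιℤ (ℚ.numerator x)
  *-denominator x = toℚᵘ-injective (ℚᵘₚ.≃-trans (toℚᵘ-homo-* x _)
    (ℚᵘₚ.≃-trans (ℚᵘₚ.*-cong (ℚᵘₚ.≃-refl {ℚ.toℚᵘ x}) (toℚᵘ-ιℤ (ℚ.denominator x)))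
    (ℚᵘₚ.≃-trans (aux x) (ℚᵘₚ.≃-sym (toℚᵘ-ιℤ (ℚ.numerator x))))))
    where
    aux : ∀ x → ℚ.toℚᵘ x ℚᵘ.* ℚᵘ.mkℚᵘ (ℚ.denominator x) 0 ℚᵘ.≃ ℚᵘ.mkℚᵘ (ℚ.numerator x) 0
    aux (ℚ.mkℚ n d c) = ℚᵘ.*≡* (trans (ℤₚ.*-identityʳ _) (cong (n ℤ.*_) (cong (λ t → + suc t) (sym (ℕₚ.*-identityʳ d)))))

  ι-+ : ∀ m n → ι (m ℕ.+ n) ≡ ι m + ι n
  ι-+ m n = ιℤ-+ (+ m) (+ n)

  ι-* : ∀ m n → ι (m ℕ.* n) ≡ ι m * ι n
  ι-* m n = trans (cong ιℤ (ℤₚ.pos-* m n)) (ιℤ-* (+ m) (+ n))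

  ι-suc : ∀ n → ι (suc n) ≡ 1ℚ + ι n
  ι-suc n = ι-+ 1 n

  ι-injective : ∀ {m n} → ι m ≡ ι n → m ≡ n
  ι-injective e = ℤₚ.+-injective (ιℤ-injective e)

  ι-suc≢0 : ∀ n → ι (suc n) ≢ 0ℚ
  ι-suc≢0 n e with ι-injective {suc n} {0} e
  ... | ()

  inv-right : ∀ {x} → x ≢ 0ℚ → x * inv x ≡ 1ℚ
  inv-right {x} x≢0 with x ≟ 0ℚ
  ... | yes e = ⊥-elim (x≢0 e)
  ... | no ne = *-inverseʳ x {{ℚ.≢-nonZero ne}}

  *-cancel : ∀ {x} y z → x ≢ 0ℚ → x * y ≡ x * z → y ≡ z
  *-cancel {x} y z x≢0 e = begin
    y               ≡⟨ lem y ⟩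
    inv x * (x * y) ≡⟨ cong (inv x *_) e ⟩
    inv x * (x * z) ≡⟨ sym (lem z) ⟩
    z ∎
    where
    open ≡-Reasoning
    lem : ∀ y → y ≡ inv x * (x * y)
    lem y = trans (sym (*-identityˡ y)) (trans (cong (_* y) (sym (inv-right x≢0)))
      (solve 3 (λ x i y → x :* i :* y := i :* (x :* y)) refl x (inv x) y))
      where open QSol

  *-≢0 : ∀ {x y} → x ≢ 0ℚ → y ≢ 0ℚ → x * y ≢ 0ℚ
  *-≢0 {x} {y} x≢0 y≢0 e = y≢0 (*-cancel y 0ℚ x≢0 (trans e (sym (*-zeroʳ x))))

  inv-unique : ∀ {x y} → x * y ≡ 1ℚ → inv x ≡ y
  inv-unique {x} {y} e = *-cancel (inv x) y x≢0 (trans (inv-right x≢0) (sym e))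
    where
    x≢0 : x ≢ 0ℚ
    x≢0 refl with trans (sym e) (*-zeroˡ y)
    ... | ()

  sum-cong : ∀ n {f g} → (∀ i → i ℕ.< n → f i ≡ g i) → sumTo n f ≡ sumTo n g
  sum-cong zero    e = refl
  sum-cong (suc n) e = cong₂ _+_ (sum-cong n (λ i i<n → e i (ℕₚ.m<n⇒m<1+n i<n))) (e n ℕₚ.≤-refl)

  sum-cong′ : ∀ n {f g} → (∀ i → f i ≡ g i) → sumTo n f ≡ sumTo n g
  sum-cong′ n e = sum-cong n (λ i _ → e i)

  sum-0 : ∀ n {f} → (∀ i → i ℕ.< n → f i ≡ 0ℚ) → sumTo n f ≡ 0ℚ
  sum-0 zero    e = refl
  sum-0 (suc n) e = cong₂ _+_ (sum-0 n (λ i i<n → e i (ℕₚ.m<n⇒m<1+n i<n))) (e n ℕₚ.≤-refl)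

  sum-+ : ∀ n f g → sumTo n (λ i → f i + g i) ≡ sumTo n f + sumTo n g
  sum-+ zero    f g = refl
  sum-+ (suc n) f g = trans (cong (_+ (f n + g n)) (sum-+ n f g))
    (solve 4 (λ a b c d → (a :+ b) :+ (c :+ d) := (a :+ c) :+ (b :+ d)) refl (sumTo n f) (sumTo n g) (f n) (g n))
    where open QSol

  sum-*ˡ : ∀ n c f → sumTo n (λ i → c * f i) ≡ c * sumTo n f
  sum-*ˡ zero    c f = sym (*-zeroʳ c)
  sum-*ˡ (suc n) c f = trans (cong (_+ c * f n) (sum-*ˡ n c f)) (sym (*-distribˡ-+ c (sumTo n f) (f n)))

  sum-first : ∀ n f → sumTo (suc n) f ≡ f 0 + sumTo n (f ∘ suc)
  sum-first zero    f = +-comm 0ℚ (f 0)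
  sum-first (suc n) f = trans (cong (_+ f (suc n)) (sum-first n f)) (+-assoc (f 0) _ _)

  sum-reverse : ∀ n f → sumTo (suc n) f ≡ sumTo (suc n) (λ i → f (n ℕ.∸ i))
  sum-reverse zero    f = refl
  sum-reverse (suc n) f = begin
    sumTo (suc n) f + f (suc n)
      ≡⟨ cong (_+ f (suc n)) (sum-reverse n f) ⟩
    sumTo (suc n) (λ i → f (n ℕ.∸ i)) + f (suc n)
      ≡⟨ +-comm _ (f (suc n)) ⟩
    f (suc n) + sumTo (suc n) (λ i → f (n ℕ.∸ i))
      ≡⟨ sym (sum-first (suc n) (λ i → f (suc n ℕ.∸ i))) ⟩
    sumTo (suc (suc n)) (λ i → f (suc n ℕ.∸ i)) ∎
    where open ≡-Reasoning

  sum-swap : ∀ m n (f : ℕ → ℕ → ℚ) →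
    sumTo m (λ i → sumTo n (f i)) ≡ sumTo n (λ j → sumTo m (λ i → f i j))
  sum-swap zero    n f = sym (sum-0 n (λ _ _ → refl))
  sum-swap (suc m) n f = trans (cong (_+ sumTo n (f m)) (sum-swap m n f))
    (sym (sum-+ n (λ j → sumTo m (λ i → f i j)) (f m)))

  -- A record, so that the series can be recovered from the type of an equality.
  infix 4 _≈_
  record _≈_ (f g : Series) : Set where
    constructor mk≈
    field at : ∀ n → f n ≡ g n
  open _≈_ public

  ≈-refl : ∀ {f} → f ≈ f
  ≈-refl = mk≈ λ _ → refl

  ≈-sym : ∀ {f g} → f ≈ g → g ≈ f
  ≈-sym e = mk≈ λ n → sym (at e n)

  ≈-trans : ∀ {f g h} → f ≈ g → g ≈ h → f ≈ h
  ≈-trans d e = mk≈ λ n → trans (at d n) (at e n)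

  0S : Series
  0S _ = 0ℚ

  tail : Series → Series
  tail f n = f (suc n)

  infixl 6 _⊕_ _⊖_
  infixl 7 _·_
  infix  8 ⊝_
  infixr 8 _∙_

  -- Opaque, so that the operands can be inferred from a series expression.
  opaque

    _·_ : Series → Series → Series
    f · g = f ⋆ g

    _⊕_ : Series → Series → Series
    (f ⊕ g) n = f n + g n

    ⊝_ : Series → Series
    (⊝ f) n = - f n

    _∙_ : ℚ → Series → Series
    (c ∙ f) n = c * f n

    ⊕-cong : ∀ {f f′ g g′} → f ≈ f′ → g ≈ g′ → (f ⊕ g) ≈ (f′ ⊕ g′)
    ⊕-cong d e = mk≈ λ n → cong₂ _+_ (at d n) (at e n)

    ⊝-cong : ∀ {f g} → f ≈ g → (⊝ f) ≈ (⊝ g)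
    ⊝-cong e = mk≈ λ n → cong -_ (at e n)

    -- Multiplication is causal: degree `n` sees only degrees up to `n`. This justifies replacing a
    -- series by a truncation or by its already computed prefix.
    ·-local : ∀ n {f f′ g g′} → (∀ i → i ℕ.≤ n → f i ≡ f′ i) → (∀ i → i ℕ.≤ n → g i ≡ g′ i) →
      (f · g) n ≡ (f′ · g′) n
    ·-local n d e = sum-cong (suc n) (λ i i<n → cong₂ _*_ (d i (ℕₚ.≤-pred i<n)) (e (n ℕ.∸ i) (ℕₚ.m∸n≤m n i)))

    ·-cong : ∀ {f f′ g g′} → f ≈ f′ → g ≈ g′ → (f · g) ≈ (f′ · g′)
    ·-cong d e = mk≈ λ n → ·-local n (λ i _ → at d i) (λ i _ → at e i)

    ·-zero : ∀ f g → (f · g) 0 ≡ f 0 * g 0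
    ·-zero f g = +-identityˡ _

    ·-suc : ∀ f g n → (f · g) (suc n) ≡ f 0 * g (suc n) + (tail f · g) n
    ·-suc f g n = sum-first (suc n) (λ i → f i * g (suc n ℕ.∸ i))

    ·-sucʳ : ∀ f g n → (f · g) (suc n) ≡ (f · tail g) n + f (suc n) * g 0
    ·-sucʳ f g n = cong₂ _+_
      (sum-cong (suc n) (λ i i<sn → cong (λ k → f i * g k) (ℕₚ.+-∸-assoc 1 (ℕₚ.≤-pred i<sn))))
      (cong (λ k → f (suc n) * g k) (ℕₚ.n∸n≡0 n))

    -- Induction on the degree with `f` varying: `·-suc` takes the constant term off the left factor
    -- and `·-sucʳ` takes it off the right one, so both sides reduce to `tail f`.
    ·-comm′ : ∀ n f g → (f · g) n ≡ (g · f) n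
    ·-comm′ zero    f g = trans (·-zero f g) (trans (*-comm (f 0) (g 0)) (sym (·-zero g f)))
    ·-comm′ (suc n) f g = begin
      (f · g) (suc n)                     ≡⟨ ·-suc f g n ⟩
      f 0 * g (suc n) + (tail f · g) n    ≡⟨ +-comm (f 0 * g (suc n)) _ ⟩
      (tail f · g) n + f 0 * g (suc n)    ≡⟨ cong₂ _+_ (·-comm′ n (tail f) g) (*-comm (f 0) _) ⟩
      (g · tail f) n + g (suc n) * f 0    ≡⟨ sym (·-sucʳ g f n) ⟩
      (g · f) (suc n) ∎
      where open ≡-Reasoning

    ·-comm : ∀ f g → (f · g) ≈ (g · f)
    ·-comm f g = mk≈ λ n → ·-comm′ n f g

    ·-distribʳ : ∀ h f g → ((f ⊕ g) · h) ≈ (f · h ⊕ g · h)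
    ·-distribʳ h f g = mk≈ λ n → trans (sum-cong′ (suc n) (λ i → *-distribʳ-+ (h (n ℕ.∸ i)) (f i) (g i)))
      (sum-+ (suc n) _ _)

    ·-distribˡ : ∀ h f g → (h · (f ⊕ g)) ≈ (h · f ⊕ h · g)
    ·-distribˡ h f g = ≈-trans (·-comm h (f ⊕ g)) (≈-trans (·-distribʳ h f g) (⊕-cong (·-comm f h) (·-comm g h)))

    ∙-· : ∀ c f g → ((c ∙ f) · g) ≈ (c ∙ (f · g))
    ∙-· c f g = mk≈ λ n → trans (sum-cong′ (suc n) (λ i → *-assoc c (f i) _)) (sum-*ˡ (suc n) c _)

    ·-assoc′ : ∀ n f g h → ((f · g) · h) n ≡ (f · (g · h)) n
    ·-assoc′ zero    f g h = begin
      ((f · g) · h) 0       ≡⟨ ·-zero (f · g) h ⟩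
      (f · g) 0 * h 0       ≡⟨ cong (_* h 0) (·-zero f g) ⟩
      f 0 * g 0 * h 0       ≡⟨ *-assoc (f 0) (g 0) (h 0) ⟩
      f 0 * (g 0 * h 0)     ≡⟨ cong (f 0 *_) (sym (·-zero g h)) ⟩
      f 0 * (g · h) 0       ≡⟨ sym (·-zero f (g · h)) ⟩
      (f · (g · h)) 0 ∎
      where open ≡-Reasoning
    ·-assoc′ (suc n) f g h = begin
      ((f · g) · h) (suc n)
        ≡⟨ ·-suc (f · g) h n ⟩
      (f · g) 0 * h (suc n) + (tail (f · g) · h) n
        ≡⟨ cong₂ _+_ (cong (_* h (suc n)) (·-zero f g))
            (at (≈-trans (·-cong {g = h} (mk≈ (·-suc f g)) ≈-refl) (·-distribʳ h (f 0 ∙ tail g) (tail f · g))) n) ⟩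
      f 0 * g 0 * h (suc n) + (((f 0 ∙ tail g) · h) n + ((tail f · g) · h) n)
        ≡⟨ cong (λ t → f 0 * g 0 * h (suc n) + t) (cong₂ _+_ (at (∙-· (f 0) (tail g) h) n) (·-assoc′ n (tail f) g h)) ⟩
      f 0 * g 0 * h (suc n) + (f 0 * (tail g · h) n + (tail f · (g · h)) n)
        ≡⟨ solve 5 (λ a b c d e → a :* b :* c :+ (a :* d :+ e) := a :* (b :* c :+ d) :+ e) refl
            (f 0) (g 0) (h (suc n)) ((tail g · h) n) ((tail f · (g · h)) n) ⟩
      f 0 * (g 0 * h (suc n) + (tail g · h) n) + (tail f · (g · h)) n
        ≡⟨ cong (λ t → f 0 * t + (tail f · (g · h)) n) (sym (·-suc g h n)) ⟩
      f 0 * (g · h) (suc n) + (tail f · (g · h)) n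
        ≡⟨ sym (·-suc f (g · h) n) ⟩
      (f · (g · h)) (suc n) ∎
      where
      open ≡-Reasoning
      open QSol using (solve; _:*_; _:+_; _:=_)

    ·-identityˡ : ∀ f → (δ₀ · f) ≈ f
    ·-identityˡ f = mk≈ λ
      { zero    → trans (·-zero δ₀ f) (*-identityˡ (f 0))
      ; (suc n) → trans (·-suc δ₀ f n) (trans (cong₂ _+_ (*-identityˡ (f (suc n)))
                    (sum-0 (suc n) (λ i _ → *-zeroˡ (f (n ℕ.∸ i))))) (+-identityʳ _)) }

    ⊕-at : ∀ f g n → (f ⊕ g) n ≡ f n + g n
    ⊕-at f g n = refl

    ⊝-at : ∀ f n → (⊝ f) n ≡ - f n
    ⊝-at f n = refl

    ∙-at : ∀ c f n → (c ∙ f) n ≡ c * f n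
    ∙-at c f n = refl

    ·-at : ∀ f g n → (f · g) n ≡ sumTo (suc n) (λ i → f i * g (n ℕ.∸ i))
    ·-at f g n = refl

    ⊕-assoc : ∀ f g h → ((f ⊕ g) ⊕ h) ≈ (f ⊕ (g ⊕ h))
    ⊕-assoc f g h = mk≈ λ n → +-assoc (f n) (g n) (h n)

    ⊕-comm : ∀ f g → (f ⊕ g) ≈ (g ⊕ f)
    ⊕-comm f g = mk≈ λ n → +-comm (f n) (g n)

    ⊕-identityˡ : ∀ f → (0S ⊕ f) ≈ f
    ⊕-identityˡ f = mk≈ λ n → +-identityˡ (f n)

    ⊕-identityʳ : ∀ f → (f ⊕ 0S) ≈ f
    ⊕-identityʳ f = mk≈ λ n → +-identityʳ (f n)

    ⊕-inverseˡ : ∀ f → ((⊝ f) ⊕ f) ≈ 0S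
    ⊕-inverseˡ f = mk≈ λ n → +-inverseˡ (f n)

    ⊕-inverseʳ : ∀ f → (f ⊕ (⊝ f)) ≈ 0S
    ⊕-inverseʳ f = mk≈ λ n → +-inverseʳ (f n)

  _⊖_ : Series → Series → Series
  f ⊖ g = f ⊕ (⊝ g)

  seriesRing : CommutativeRing 0ℓ 0ℓ
  seriesRing = record
    { Carrier = Series ; _≈_ = _≈_ ; _+_ = _⊕_ ; _*_ = _·_ ; -_ = ⊝_ ; 0# = 0S ; 1# = δ₀
    ; isCommutativeRing = record
      { isRing = record
        { +-isAbelianGroup = record
          { isGroup = record
            { isMonoid = record
              { isSemigroup = record
                { isMagma = record
                  { isEquivalence = record { refl = ≈-refl ; sym = ≈-sym ; trans = ≈-trans }
                  ; ∙-cong = ⊕-cong }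
                ; assoc = ⊕-assoc }
              ; identity = ⊕-identityˡ , ⊕-identityʳ }
            ; inverse = ⊕-inverseˡ , ⊕-inverseʳ
            ; ⁻¹-cong = ⊝-cong }
          ; comm = ⊕-comm }
        ; *-cong = ·-cong
        ; *-assoc = λ f g h → mk≈ λ n → ·-assoc′ n f g h
        ; *-identity = ·-identityˡ , λ f → ≈-trans (·-comm f δ₀) (·-identityˡ f)
        ; distrib = ·-distribˡ , ·-distribʳ }
      ; *-comm = ·-comm } }

  module SR = CommutativeRing seriesRing

  ·-congˡ : ∀ f {g g′} → g ≈ g′ → (f · g) ≈ (f · g′)
  ·-congˡ f e = ·-cong ≈-refl e

  ·-congʳ : ∀ g {f f′} → f ≈ f′ → (f · g) ≈ (f′ · g)
  ·-congʳ g e = ·-cong e ≈-refl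

  const : ℚ → Series
  const c = c ∙ δ₀

  opaque
    unfolding _⊕_ _∙_ _·_ ⊝_

    ∙-cong : ∀ c {f g} → f ≈ g → (c ∙ f) ≈ (c ∙ g)
    ∙-cong c e = mk≈ λ n → cong (c *_) (at e n)

    const-· : ∀ c f → (const c · f) ≈ (c ∙ f)
    const-· c f = ≈-trans (∙-· c δ₀ f) (mk≈ λ n → cong (c *_) (at (·-identityˡ f) n))

    const-+ : ∀ x y → const (x + y) ≈ (const x ⊕ const y)
    const-+ x y = mk≈ λ n → *-distribʳ-+ (δ₀ n) x y

    const-* : ∀ x y → const (x * y) ≈ (const x · const y)
    const-* x y = mk≈ λ n → trans (*-assoc x y (δ₀ n)) (sym (at (const-· x (const y)) n))

    const-neg : ∀ x → const (- x) ≈ (⊝ const x)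
    const-neg x = mk≈ λ n → sym (neg-distribˡ-* x (δ₀ n))

    const-0 : const 0ℚ ≈ 0S
    const-0 = mk≈ λ n → *-zeroˡ (δ₀ n)

    const-1 : const 1ℚ ≈ δ₀
    const-1 = mk≈ λ n → *-identityˡ (δ₀ n)

  -- Lets the ring solver for series carry rational constants: a coefficient `c` of a polynomial
  -- identity is read as the constant series `const c`.
  constHom : CommutativeRing.rawRing +-*-commutativeRing -Raw-AlmostCommutative⟶ fromCommutativeRing seriesRing
  constHom = record
    { ⟦_⟧ = const ; +-homo = const-+ ; *-homo = const-* ; -‿homo = const-neg ; 0-homo = const-0 ; 1-homo = const-1 }

  const-≟ : ∀ x y → Maybe (const x ≈ const y)
  const-≟ x y with x ≟ y
  ... | yes refl = just ≈-refl
  ... | no _ = nothing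

  module SSol = RingSolver (CommutativeRing.rawRing +-*-commutativeRing) (fromCommutativeRing seriesRing) constHom const-≟

-- The Euler operator, power series recursions, and substitution.

module Composition where

  open import Data.Rational using (_+_; _*_; _-_; -_)
  open import Data.Rational.Properties
  open FormalSeries

  opaque
    unfolding _·_

    -- The Euler operator `z d/dz`. Unlike `d/dz` it preserves degrees, so differential equations
    -- become coefficient identities without index shifts.
    θ : Series → Series
    θ f n = ι n * f n

    θ-cong : ∀ {f g} → f ≈ g → θ f ≈ θ g
    θ-cong e = mk≈ λ n → cong (ι n *_) (at e n)

    θ-⊕ : ∀ f g → θ (f ⊕ g) ≈ (θ f ⊕ θ g)
    θ-⊕ f g = mk≈ λ n → *-distribˡ-+ (ι n) (f n) (g n)

    θ-const : ∀ c → θ (const c) ≈ 0S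
    θ-const c = mk≈ λ
      { zero    → *-zeroˡ (const c 0)
      ; (suc n) → trans (cong (ι (suc n) *_) (*-zeroʳ c)) (*-zeroʳ (ι (suc n))) }

    θ-δ₀ : θ δ₀ ≈ 0S
    θ-δ₀ = mk≈ λ { zero → refl ; (suc n) → *-zeroʳ (ι (suc n)) }

    θ-· : ∀ f g → θ (f · g) ≈ (θ f · g ⊕ f · θ g)
    θ-· f g = mk≈ λ n → begin
      ι n * (f · g) n
        ≡⟨ sym (sum-*ˡ (suc n) (ι n) _) ⟩
      sumTo (suc n) (λ i → ι n * (f i * g (n ℕ.∸ i)))
        ≡⟨ sum-cong (suc n) (λ i i<n → term n i (ℕₚ.≤-pred i<n)) ⟩
      sumTo (suc n) (λ i → ι i * f i * g (n ℕ.∸ i) + f i * (ι (n ℕ.∸ i) * g (n ℕ.∸ i)))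
        ≡⟨ sum-+ (suc n) _ _ ⟩
      (θ f · g ⊕ f · θ g) n ∎
      where
      open ≡-Reasoning
      term : ∀ n i → i ℕ.≤ n → ι n * (f i * g (n ℕ.∸ i)) ≡ ι i * f i * g (n ℕ.∸ i) + f i * (ι (n ℕ.∸ i) * g (n ℕ.∸ i))
      term n i i≤n = trans (cong (_* (f i * g (n ℕ.∸ i))) (trans (cong ι (sym (ℕₚ.m+[n∸m]≡n i≤n))) (ι-+ i (n ℕ.∸ i))))
        (QSol.solve 4 (λ a b x y → (a :+ b) :* (x :* y) := a :* x :* y :+ x :* (b :* y)) refl (ι i) (ι (n ℕ.∸ i))
            (f i) (g (n ℕ.∸ i)))
        where open QSol

    tail-θ : ∀ f → tail (θ f) ≈ (tail f ⊕ θ (tail f))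
    tail-θ f = mk≈ λ n → trans (cong (_* f (suc n)) (ι-suc n))
      (QSol.solve 2 (λ i x → (con 1ℚ :+ i) :* x := x :+ i :* x) refl (ι n) (f (suc n)))
      where open QSol

    θ-at : ∀ f n → θ f n ≡ ι n * f n
    θ-at f n = refl

  infixr 8 _^_
  _^_ : Series → ℕ → Series
  f ^ zero  = δ₀
  f ^ suc k = f · f ^ k

  opaque
    unfolding _·_ _∙_

    pow-^ : ∀ k f n → pow f k n ≡ (f ^ k) n
    pow-^ zero    f n = refl
    pow-^ (suc k) f n = sum-cong′ (suc n) (λ i → cong (f i *_) (pow-^ k f (n ℕ.∸ i)))

    ι-∙-suc : ∀ k f → (ι (suc k) ∙ f) ≈ (f ⊕ (ι k ∙ f))
    ι-∙-suc k f = mk≈ λ n → trans (cong (_* f n) (ι-suc k)) (trans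
      (QSol.solve 2 (λ i x → (con 1ℚ :+ i) :* x := x :+ i :* x) refl (ι k) (f n)) (sym (⊕-at f (ι k ∙ f) n)))
      where open QSol

    1∙ : ∀ f → (ι 1 ∙ f) ≈ f
    1∙ f = mk≈ λ n → *-identityˡ (f n)

    0∙ : ∀ f → (ι 0 ∙ f) ≈ 0S
    0∙ f = mk≈ λ n → *-zeroˡ (f n)

  ∙-·ʳ : ∀ c f g → (f · (c ∙ g)) ≈ (c ∙ (f · g))
  ∙-·ʳ c f g = ≈-trans (·-comm f _) (≈-trans (∙-· c g f) (∙-cong c (·-comm g f)))

  ^-cong : ∀ k {f g} → f ≈ g → (f ^ k) ≈ (g ^ k)
  ^-cong zero    e = ≈-refl
  ^-cong (suc k) e = ·-cong e (^-cong k e)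

  ^-+ : ∀ f j k → (f ^ (j ℕ.+ k)) ≈ (f ^ j · f ^ k)
  ^-+ f zero    k = ≈-sym (·-identityˡ _)
  ^-+ f (suc j) k = ≈-trans (·-congˡ f (^-+ f j k)) (≈-sym (SR.*-assoc f (f ^ j) (f ^ k)))

  ^-* : ∀ f j k → (f ^ (j ℕ.* k)) ≈ ((f ^ k) ^ j)
  ^-* f zero    k = ≈-refl
  ^-* f (suc j) k = ≈-trans (^-+ f k (j ℕ.* k)) (·-congˡ (f ^ k) (^-* f j k))

  ·-^ : ∀ k f g → ((f · g) ^ k) ≈ (f ^ k · g ^ k)
  ·-^ zero    f g = ≈-sym (·-identityˡ _)
  ·-^ (suc k) f g = ≈-trans (·-congˡ (f · g) (·-^ k f g))
    (SSol.solve 4 (λ f g F G → (f :* g) :* (F :* G) := (f :* F) :* (g :* G)) ≈-refl f g (f ^ k) (g ^ k))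
    where open SSol

  δ₀-^ : ∀ k → (δ₀ ^ k) ≈ δ₀
  δ₀-^ zero    = ≈-refl
  δ₀-^ (suc k) = ≈-trans (·-identityˡ _) (δ₀-^ k)

  ^-0 : ∀ {f} k → f 0 ≡ 1ℚ → (f ^ k) 0 ≡ 1ℚ
  ^-0 zero    e = refl
  ^-0 {f} (suc k) e = trans (·-zero f (f ^ k)) (trans (cong₂ _*_ e (^-0 k e)) refl)

  ^-local : ∀ k n {f g} → (∀ i → i ℕ.≤ n → f i ≡ g i) → (f ^ k) n ≡ (g ^ k) n
  ^-local zero    n e = refl
  ^-local (suc k) n e = ·-local n e (λ i i≤n → ^-local k i (λ j j≤i → e j (ℕₚ.≤-trans j≤i i≤n)))

  θ-^ : ∀ f k → θ (f ^ suc k) ≈ (ι (suc k) ∙ (f ^ k · θ f))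
  θ-^ f zero = ≈-trans (θ-cong (SR.*-identityʳ f)) (≈-sym (≈-trans (1∙ (δ₀ · θ f)) (·-identityˡ (θ f))))
  θ-^ f (suc k) = ≈-trans (θ-· f (f ^ suc k))
    (≈-trans (⊕-cong (·-comm (θ f) _) (≈-trans (·-congˡ f (θ-^ f k)) (≈-trans (∙-·ʳ (ι (suc k)) f _)
       (∙-cong _ (≈-sym (SR.*-assoc f (f ^ k) (θ f)))))))
     (≈-sym (ι-∙-suc (suc k) _)))

  -- `g` is the logarithmic derivative of `f`, and logarithmic derivatives add under multiplication.
  θ-^-log : ∀ {f g} k → θ f ≈ (f · g) → θ (f ^ k) ≈ (ι k ∙ (f ^ k · g))
  θ-^-log zero e = ≈-trans θ-δ₀ (≈-sym (0∙ _))
  θ-^-log {f} {g} (suc k) e = ≈-trans (θ-^ f k) (∙-cong _ (≈-trans (·-congˡ (f ^ k) e)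
    (SSol.solve 3 (λ p f g → p :* (f :* g) := (f :* p) :* g) ≈-refl (f ^ k) f g)))
    where open SSol

  prefix-≥ : ∀ step n i → n ℕ.≤ i → prefix step n i ≡ 0ℚ
  prefix-≥ step zero    i _ = refl
  prefix-≥ step (suc n) i n<i with i ℕ.≟ n
  ... | yes refl = ⊥-elim (ℕₚ.<-irrefl refl n<i)
  ... | no _     = prefix-≥ step n i (ℕₚ.<⇒≤ n<i)

  -- The unfolding rule for `cov`: inside `step n` the prefix may be replaced by the finished series
  -- wherever the index is below `n`.
  prefix-< : ∀ step n i → i ℕ.< n → prefix step n i ≡ cov step i
  prefix-< step (suc n) i i<sn with i ℕ.≟ n
  ... | yes refl = refl
  ... | no  i≢n  = prefix-< step n i (ℕₚ.≤∧≢⇒< (ℕₚ.≤-pred i<sn) i≢n)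

  opaque
    unfolding _·_ θ

    -- The recursion defining `expSer` is this differential equation compared coefficient by
    -- coefficient; in degree 0 both sides vanish because `θ` kills constant terms.
    θ-expSer : ∀ E → θ (expSer E) ≈ (expSer E · θ E)
    θ-expSer E = mk≈ λ
      { zero → trans (*-zeroˡ (expSer E 0)) (sym (trans (·-zero (expSer E) (θ E))
          (trans (cong (expSer E 0 *_) (*-zeroˡ (E 0))) (*-zeroʳ (expSer E 0)))))
      ; (suc n) → begin
          ι (suc n) * expSer E (suc n)
            ≡⟨ cong (λ t → ι (suc n) * (inv (ι (suc n)) * t))
                 (sum-cong (suc n) (λ j j<n → cong (ι (suc j) * E (suc j) *_)
                     (prefix-< _ (suc n) (n ℕ.∸ j) (s≤s (ℕₚ.m∸n≤m n j))))) ⟩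
          ι (suc n) * (inv (ι (suc n)) * (tail (θ E) · expSer E) n)
            ≡⟨ sym (*-assoc (ι (suc n)) _ _) ⟩
          ι (suc n) * inv (ι (suc n)) * (tail (θ E) · expSer E) n
            ≡⟨ cong (_* (tail (θ E) · expSer E) n) (inv-right (ι-suc≢0 n)) ⟩
          1ℚ * (tail (θ E) · expSer E) n
            ≡⟨ *-identityˡ _ ⟩
          (tail (θ E) · expSer E) n
            ≡⟨ sym (+-identityˡ _) ⟩
          0ℚ + (tail (θ E) · expSer E) n
            ≡⟨ cong (_+ (tail (θ E) · expSer E) n)
                (sym (trans (cong (_* expSer E (suc n)) (*-zeroˡ (E 0))) (*-zeroˡ (expSer E (suc n))))) ⟩
          θ E 0 * expSer E (suc n) + (tail (θ E) · expSer E) n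
            ≡⟨ sym (·-suc (θ E) (expSer E) n) ⟩
          (θ E · expSer E) (suc n)
            ≡⟨ at (·-comm (θ E) (expSer E)) (suc n) ⟩
          (expSer E · θ E) (suc n) ∎ }
      where open ≡-Reasoning

    F-Dser : ∀ a b → (Fser a b · Dser a b) ≈ Gser a b
    F-Dser a b = mk≈ λ
      { zero → trans (·-zero (Fser a b) (Dser a b)) (trans (*-identityˡ (Dser a b 0)) (+-identityʳ (Gser a b 0)))
      ; (suc n) → begin
          (Fser a b · Dser a b) (suc n)
            ≡⟨ ·-suc (Fser a b) (Dser a b) n ⟩
          1ℚ * Dser a b (suc n) + T n
            ≡⟨ cong (_+ T n) (*-identityˡ (Dser a b (suc n))) ⟩
          Dser a b (suc n) + T n
            ≡⟨ cong (λ t → (Gser a b (suc n) - t) + T n) (sum-cong (suc n) (λ j j<n →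
                 cong (Fser a b (suc j) *_) (prefix-< _ (suc n) (n ℕ.∸ j) (s≤s (ℕₚ.m∸n≤m n j))))) ⟩
          (Gser a b (suc n) - T n) + T n
            ≡⟨ QSol.solve 2 (λ g t → (g :- t) :+ t := g) refl (Gser a b (suc n)) (T n) ⟩
          Gser a b (suc n) ∎ }
      where
      open ≡-Reasoning
      open QSol using (_:-_; _:+_; _:=_)
      T : Series
      T = tail (Fser a b) · Dser a b

    invSer-· : ∀ {Y} → Y 0 ≢ 0ℚ → (Y · invSer Y) ≈ δ₀
    invSer-· {Y} Y₀≢0 = mk≈ λ
      { zero → trans (·-zero Y (invSer Y)) (inv-right Y₀≢0)
      ; (suc n) → begin
          (Y · invSer Y) (suc n)
            ≡⟨ ·-suc Y (invSer Y) n ⟩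
          Y 0 * invSer Y (suc n) + T n
            ≡⟨ cong (λ t → Y 0 * (- (inv (Y 0) * t)) + T n) (sum-cong (suc n) (λ j j<n →
                 cong (Y (suc j) *_) (prefix-< _ (suc n) (n ℕ.∸ j) (s≤s (ℕₚ.m∸n≤m n j))))) ⟩
          Y 0 * (- (inv (Y 0) * T n)) + T n
            ≡⟨ QSol.solve 3 (λ y i t → y :* (:- (i :* t)) :+ t := t :- (y :* i) :* t) refl (Y 0) (inv (Y 0)) (T n) ⟩
          T n - Y 0 * inv (Y 0) * T n
            ≡⟨ cong (λ u → T n - u * T n) (inv-right Y₀≢0) ⟩
          T n - 1ℚ * T n
            ≡⟨ QSol.solve 1 (λ t → t :- con 1ℚ :* t := con 0ℚ) refl (T n) ⟩
          0ℚ ∎ }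
      where
      open ≡-Reasoning
      open QSol using (_:-_; _:+_; _:*_; :-_; con; _:=_)
      T : Series
      T = tail Y · invSer Y

  inverse-unique : ∀ {Y A B} → (Y · A) ≈ δ₀ → (Y · B) ≈ δ₀ → A ≈ B
  inverse-unique {Y} {A} {B} a b = ≈-trans (≈-sym (·-identityˡ A)) (≈-trans (·-congʳ A (≈-sym b))
    (≈-trans (SSol.solve 3 (λ y a b → (y :* b) :* a := (y :* a) :* b) ≈-refl Y A B)
    (≈-trans (·-congʳ B a) (·-identityˡ B))))
    where open SSol

  module Substitution (w : Series) (w₀ : w 0 ≡ 0ℚ) where

    w·-suc : ∀ X n → (w · X) (suc n) ≡ (tail w · X) n
    w·-suc X n = trans (·-suc w X n) (trans (cong (_+ (tail w · X) n)
      (trans (cong (_* X (suc n)) w₀) (*-zeroˡ (X (suc n))))) (+-identityˡ _))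

    w·-zero : ∀ X → (w · X) 0 ≡ 0ℚ
    w·-zero X = trans (·-zero w X) (trans (cong (_* X 0) w₀) (*-zeroˡ (X 0)))

    -- As `w` has no constant term, multiplication by it raises degrees. This keeps the inductions
    -- on the degree below well founded although the outer series changes from `f` to `tail f`.
    w·-guard : ∀ n {X Y} → (∀ i → i ℕ.< n → X i ≡ Y i) → (w · X) n ≡ (w · Y) n
    w·-guard zero    {X} {Y} e = trans (w·-zero X) (sym (w·-zero Y))
    w·-guard (suc n) {X} {Y} e = trans (w·-suc X n)
      (trans (·-local n {tail w} (λ _ _ → refl) (λ i i≤n → e i (s≤s i≤n))) (sym (w·-suc Y n)))

    opaque
      unfolding _·_ _⊕_ _∙_

      ^-low : ∀ k n → n ℕ.< k → (w ^ k) n ≡ 0ℚ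
      ^-low (suc k) zero    _         = w·-zero (w ^ k)
      ^-low (suc k) (suc n) (s≤s n<k) = trans (w·-suc (w ^ k) n)
        (sum-0 (suc n) (λ i i<n → trans (cong (tail w i *_) (^-low k (n ℕ.∸ i) (ℕₚ.≤-<-trans (ℕₚ.m∸n≤m n i) n<k)))
          (*-zeroʳ (tail w i))))

      -- The composition `f(w(q))`. The sum may stop at `i = n` because `w ^ i` starts in degree
      -- `i`.
      sub : Series → Series
      sub f n = sumTo (suc n) (λ i → f i * (w ^ i) n)

      sub-at : ∀ f n → sub f n ≡ sumTo (suc n) (λ i → f i * (w ^ i) n)
      sub-at f n = refl

      sub-cong : ∀ {f g} → f ≈ g → sub f ≈ sub g
      sub-cong e = mk≈ λ n → sum-cong′ (suc n) (λ i → cong (_* (w ^ i) n) (at e i))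

      sub-⊕ : ∀ f g → sub (f ⊕ g) ≈ (sub f ⊕ sub g)
      sub-⊕ f g = mk≈ λ n → trans (sum-cong′ (suc n) (λ i → *-distribʳ-+ ((w ^ i) n) (f i) (g i)))
        (sum-+ (suc n) (λ i → f i * (w ^ i) n) (λ i → g i * (w ^ i) n))

      sub-∙ : ∀ c f → sub (c ∙ f) ≈ (c ∙ sub f)
      sub-∙ c f = mk≈ λ n → trans (sum-cong′ (suc n) (λ i → *-assoc c (f i) ((w ^ i) n)))
        (sum-*ˡ (suc n) c (λ i → f i * (w ^ i) n))

      private
        extend : ∀ n k (f : Series) → sumTo (suc n) (λ i → f i * (w ^ i) n) ≡ sumTo (k ℕ.+ suc n) (λ i → f i * (w ^ i) n)
        extend n zero    f = refl
        extend n (suc k) f = trans (extend n k f) (sym (trans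
          (cong (S +_) (trans (cong (f m *_) (^-low m n (ℕₚ.m≤n+m (suc n) k))) (*-zeroʳ (f m)))) (+-identityʳ S)))
          where
          m : ℕ
          m = k ℕ.+ suc n
          S : ℚ
          S = sumTo m (λ i → f i * (w ^ i) n)

      sub-extend : ∀ N n (f : Series) → n ℕ.< N → sub f n ≡ sumTo N (λ i → f i * (w ^ i) n)
      sub-extend N n f n<N = trans (extend n (N ℕ.∸ suc n) f)
        (cong (λ N → sumTo N (λ i → f i * (w ^ i) n)) (ℕₚ.m∸n+n≡m n<N))

      -- Horner's rule, from which the product and chain rules for `sub` follow by induction on the
      -- degree.
      sub-step : ∀ f → sub f ≈ (const (f 0) ⊕ w · sub (tail f))
      sub-step f = mk≈ λ
        { zero → trans (+-identityˡ (f 0 * 1ℚ))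
            (sym (trans (cong (const (f 0) 0 +_) (w·-zero (sub (tail f)))) (+-identityʳ (const (f 0) 0))))
        ; (suc n) → trans (sum-first (suc n) (λ i → f i * (w ^ i) (suc n))) (cong (const (f 0) (suc n) +_) (begin
            sumTo (suc n) (λ i → f (suc i) * (w · w ^ i) (suc n))
              ≡⟨ sum-cong′ (suc n) (λ i → cong (f (suc i) *_) (w·-suc (w ^ i) n)) ⟩
            sumTo (suc n) (λ i → f (suc i) * sumTo (suc n) (λ j → w (suc j) * (w ^ i) (n ℕ.∸ j)))
              ≡⟨ sum-cong′ (suc n) (λ i → trans (sym (sum-*ˡ (suc n) (f (suc i)) (λ j → w (suc j) * (w ^ i) (n ℕ.∸ j))))
                   (sum-cong′ (suc n) (λ j → QSol.solve 3 (λ a b c → a :* (b :* c) := b :* (a :* c)) refl (f (suc i))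
                       (w (suc j)) ((w ^ i) (n ℕ.∸ j))))) ⟩
            sumTo (suc n) (λ i → sumTo (suc n) (λ j → w (suc j) * (f (suc i) * (w ^ i) (n ℕ.∸ j))))
              ≡⟨ sum-swap (suc n) (suc n) (λ i j → w (suc j) * (f (suc i) * (w ^ i) (n ℕ.∸ j))) ⟩
            sumTo (suc n) (λ j → sumTo (suc n) (λ i → w (suc j) * (f (suc i) * (w ^ i) (n ℕ.∸ j))))
              ≡⟨ sum-cong′ (suc n) (λ j → trans (sum-*ˡ (suc n) (w (suc j)) (λ i → f (suc i) * (w ^ i) (n ℕ.∸ j)))
                   (cong (w (suc j) *_) (sym (sub-extend (suc n) (n ℕ.∸ j) (tail f) (s≤s (ℕₚ.m∸n≤m n j)))))) ⟩
            (tail w · sub (tail f)) n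
              ≡⟨ sym (w·-suc (sub (tail f)) n) ⟩
            (w · sub (tail f)) (suc n) ∎)) }
        where
        open ≡-Reasoning
        open QSol using (_:*_; _:=_)

      sub-δ₀ : sub δ₀ ≈ δ₀
      sub-δ₀ = mk≈ λ n → trans (at (sub-step δ₀) n) (trans
        (cong₂ _+_ (*-identityˡ (δ₀ n)) (trans (w·-guard n {Y = 0S} (λ i _ → sum-0 (suc i) (λ j _ → *-zeroˡ ((w ^ j) i))))
          (at (SR.zeroʳ w) n))) (+-identityʳ (δ₀ n)))

      private
        -- Both factors are expanded by Horner's rule. What carries a factor `w` involves
        -- compositions with `tail f` in lower degrees, so the induction is over all `f`, and the
        -- bound `N` on the degree decreases.
        sub-·-bounded : ∀ N n f g → n ℕ.< N → sub (f · g) n ≡ (sub f · sub g) n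
        sub-·-bounded (suc N) n f g (s≤s n≤N) = begin
          sub (f · g) n
            ≡⟨ at (sub-step (f · g)) n ⟩
          (const ((f · g) 0) ⊕ w · sub (tail (f · g))) n
            ≡⟨ cong₂ _+_ (trans (cong (_* δ₀ n) (·-zero f g)) (at (const-* (f 0) (g 0)) n))
                 (w·-guard n lower) ⟩
          (a · b ⊕ w · (a · Y ⊕ X · S)) n
            ≡⟨ at (SSol.solve 6 (λ a b w x y s → a :* b :+ w :* (a :* y :+ x :* s) := a :* (b :+ w :* y) :+ w :* x :*
                s) ≈-refl a b w X Y S) n ⟩
          (a · (b ⊕ w · Y) ⊕ w · X · S) n
            ≡⟨ at (⊕-cong (·-cong (≈-refl {a}) (≈-sym (sub-step g))) (≈-refl {w · X · S})) n ⟩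
          (a · S ⊕ w · X · S) n
            ≡⟨ at (≈-trans (≈-sym (·-distribʳ S a (w · X))) (·-cong (≈-sym (sub-step f)) (≈-refl {S}))) n ⟩
          (sub f · S) n ∎
          where
          open ≡-Reasoning
          open SSol using (_:*_; _:+_; _:=_)
          a b X Y S : Series
          a = const (f 0)
          b = const (g 0)
          X = sub (tail f)
          Y = sub (tail g)
          S = sub g
          lower : ∀ i → i ℕ.< n → sub (tail (f · g)) i ≡ (a · Y ⊕ X · S) i
          lower i i<n = begin
            sub (tail (f · g)) i
              ≡⟨ at (≈-trans (sub-cong {tail (f · g)} {f 0 ∙ tail g ⊕ tail f · g} (mk≈ (·-suc f g)))
                  (sub-⊕ (f 0 ∙ tail g) (tail f · g))) i ⟩
            sub (f 0 ∙ tail g) i + sub (tail f · g) i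
              ≡⟨ cong₂ _+_ (at (≈-trans (sub-∙ (f 0) (tail g)) (≈-sym (const-· (f 0) Y))) i)
                   (sub-·-bounded N i (tail f) g (ℕₚ.<-≤-trans i<n n≤N)) ⟩
            (a · Y ⊕ X · S) i ∎

      sub-· : ∀ f g → sub (f · g) ≈ (sub f · sub g)
      sub-· f g = mk≈ λ n → sub-·-bounded (suc n) n f g ℕₚ.≤-refl

    sub-^ : ∀ f k → sub (f ^ k) ≈ (sub f ^ k)
    sub-^ f zero    = sub-δ₀
    sub-^ f (suc k) = ≈-trans (sub-· f (f ^ k)) (·-congˡ (sub f) (sub-^ f k))

    module Chain (ℓ : Series) (θw : θ w ≈ (w · ℓ)) where

      opaque
        unfolding _·_ _⊕_ _∙_

        private
          θ-sub-bounded : ∀ N n f → n ℕ.< N → θ (sub f) n ≡ (sub (θ f) · ℓ) n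
          θ-sub-bounded (suc N) n f (s≤s n≤N) = begin
            θ (sub f) n
              ≡⟨ at (≈-trans (θ-cong (sub-step f)) (≈-trans (θ-⊕ (const (f 0)) (w · S))
                   (⊕-cong (θ-const (f 0)) (≈-trans (θ-· w S) (⊕-cong (·-cong θw (≈-refl {S})) (≈-refl {w · θ S})))))) n ⟩
            (0S ⊕ (w · ℓ · S ⊕ w · θ S)) n
              ≡⟨ at (≈-trans (SR.+-identityˡ (w · ℓ · S ⊕ w · θ S))
                   (SSol.solve 4 (λ w l s t → w :* l :* s :+ w :* t := w :* (s :* l :+ t)) ≈-refl w ℓ S (θ S))) n ⟩
            (w · (S · ℓ ⊕ θ S)) n
              ≡⟨ w·-guard n (λ i i<n → cong ((S · ℓ) i +_) (θ-sub-bounded N i (tail f) (ℕₚ.<-≤-trans i<n n≤N))) ⟩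
            (w · (S · ℓ ⊕ T · ℓ)) n
              ≡⟨ at (SSol.solve 4 (λ w l s t → w :* (s :* l :+ t :* l) := (w :* (s :+ t)) :* l) ≈-refl w ℓ S T) n ⟩
            (w · (S ⊕ T) · ℓ) n
              ≡⟨ at (·-cong (≈-sym sub-θ) (≈-refl {ℓ})) n ⟩
            (sub (θ f) · ℓ) n ∎
            where
            open ≡-Reasoning
            open SSol using (_:*_; _:+_; _:=_)
            S T : Series
            S = sub (tail f)
            T = sub (θ (tail f))
            θf₀ : ∀ k → const (θ f 0) k ≡ 0ℚ
            θf₀ k = trans (cong (_* δ₀ k) (trans (θ-at f 0) (*-zeroˡ (f 0)))) (*-zeroˡ (δ₀ k))
            sub-θ : sub (θ f) ≈ (w · (S ⊕ T))
            sub-θ = ≈-trans (sub-step (θ f)) (≈-trans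
              (⊕-cong {const (θ f 0)} {0S} (mk≈ θf₀)
                (·-cong (≈-refl {w}) (≈-trans (sub-cong (tail-θ f)) (sub-⊕ (tail f) (θ (tail f))))))
              (SR.+-identityˡ (w · (S ⊕ T))))

        -- Chain rule: `w ^ i` has the logarithmic derivative `i ℓ`. The proof again goes through
        -- Horner's rule and so never differentiates the sum over `i`.
        θ-sub : ∀ f → θ (sub f) ≈ (sub (θ f) · ℓ)
        θ-sub f = mk≈ λ n → θ-sub-bounded (suc n) n f ℕₚ.≤-refl

-- Lagrange inversion for `q = z E(z)`, and the Hauptmodul as `h(κq)/κ`.

module LagrangeInversion where

  open import Data.Rational using (_+_; _*_; _-_; -_)
  open import Data.Rational.Properties
  open FormalSeries
  open Composition

  -- In a product of at least two factors of positive order, each factor leaves a degree of at least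
  -- 1 to the others, so none is needed in degree `n`. Hence the recursion of `compInv`, which
  -- provides `w i` only for `i < n`, is well posed.
  ^-below : ∀ n k {f g} → f 0 ≡ 0ℚ → g 0 ≡ 0ℚ → (∀ i → i ℕ.< n → f i ≡ g i) →
    (f ^ suc (suc k)) n ≡ (g ^ suc (suc k)) n
  ^-below zero k {f} {g} f₀ g₀ e = trans (Substitution.w·-zero f f₀ _) (sym (Substitution.w·-zero g g₀ _))
  ^-below (suc zero) k {f} {g} f₀ g₀ e = trans (one f f₀) (sym (one g g₀))
    where
    one : ∀ f → f 0 ≡ 0ℚ → (f ^ suc (suc k)) 1 ≡ 0ℚ
    one f f₀ = trans (Substitution.w·-suc f f₀ (f ^ suc k) 0) (trans (·-zero (tail f) (f ^ suc k))
      (trans (cong (f 1 *_) (Substitution.w·-zero f f₀ (f ^ k))) (*-zeroʳ (f 1))))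
  ^-below (suc (suc m)) k {f} {g} f₀ g₀ e = trans (two f f₀) (trans
    (·-local m tails (λ i i≤m → ·-local i (λ j j≤i → tails j (ℕₚ.≤-trans j≤i i≤m))
      (λ j j≤i → ^-local k j (λ l l≤j → e l (s≤s (ℕₚ.m≤n⇒m≤1+n (ℕₚ.≤-trans l≤j (ℕₚ.≤-trans j≤i i≤m))))))))
    (sym (two g g₀)))
    where
    tails : ∀ i → i ℕ.≤ m → f (suc i) ≡ g (suc i)
    tails i i≤m = e (suc i) (s≤s (s≤s i≤m))
    two : ∀ f → f 0 ≡ 0ℚ → (f ^ suc (suc k)) (suc (suc m)) ≡ (tail f · (tail f · f ^ k)) m
    two f f₀ = trans (Substitution.w·-suc f f₀ (f ^ suc k) (suc m)) (trans
      (at (SSol.solve 3 (λ t f p → t :* (f :* p) := f :* (t :* p)) ≈-refl (tail f) f (f ^ k)) (suc m))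
      (Substitution.w·-suc f f₀ (tail f · f ^ k) m))
      where open SSol using (_:*_; _:=_)

  -- `Q = z E(z)` with `E = tail Q`, and `V` is the logarithmic derivative of `E`; in the
  -- application `E = exp D`.
  module Inversion (Q V : Series) (Q₀ : Q 0 ≡ 0ℚ) (Q₁ : Q 1 ≡ 1ℚ) (θE : θ (tail Q) ≈ (tail Q · V)) where

    w : Series
    w = compInv Q

    w₀ : w 0 ≡ 0ℚ
    w₀ = refl

    open Substitution w w₀ public

    private
      prefix-w : ℕ → Series
      prefix-w n = prefix (λ n P → δ₁ n - sumTo (n ℕ.∸ 1) (λ j → Q (2 ℕ.+ j) * pow P (2 ℕ.+ j) n)) n

      prefix-w₀ : ∀ n → prefix-w n 0 ≡ 0ℚ
      prefix-w₀ zero    = refl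
      prefix-w₀ (suc n) = prefix-< _ (suc n) 0 (s≤s z≤n)

      recursion : ∀ n → w n + sumTo (n ℕ.∸ 1) (λ j → Q (2 ℕ.+ j) * (w ^ (2 ℕ.+ j)) n) ≡ δ₁ n
      recursion n = trans (cong (λ s → (δ₁ n - s) + S) (sum-cong′ (n ℕ.∸ 1) (λ j → cong (Q (2 ℕ.+ j) *_)
          (trans (pow-^ (2 ℕ.+ j) (prefix-w n) n) (^-below n j (prefix-w₀ n) w₀ (λ i i<n → prefix-< _ n i i<n))))))
        (QSol.solve 2 (λ d s → (d :- s) :+ s := d) refl (δ₁ n) S)
        where
        open QSol using (_:-_; _:+_; _:=_)
        S = sumTo (n ℕ.∸ 1) (λ j → Q (2 ℕ.+ j) * (w ^ (2 ℕ.+ j)) n)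

    sub-Q : sub Q ≈ δ₁
    sub-Q = mk≈ λ
      { zero → trans (sub-at Q 0) (trans (+-identityˡ (Q 0 * 1ℚ)) (trans (*-identityʳ (Q 0)) Q₀))
      ; (suc m) → let n = suc m in begin
          sub Q n
            ≡⟨ sub-at Q n ⟩
          sumTo (suc (suc m)) (λ i → Q i * (w ^ i) n)
            ≡⟨ sum-first (suc m) (λ i → Q i * (w ^ i) n) ⟩
          Q 0 * (w ^ 0) n + sumTo (suc m) (λ i → Q (suc i) * (w ^ suc i) n)
            ≡⟨ cong₂ _+_ (trans (cong (_* (w ^ 0) n) Q₀) (*-zeroˡ ((w ^ 0) n)))
                (sum-first m (λ i → Q (suc i) * (w ^ suc i) n)) ⟩
          0ℚ + (Q 1 * (w ^ 1) n + S m)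
            ≡⟨ +-identityˡ _ ⟩
          Q 1 * (w ^ 1) n + S m
            ≡⟨ cong (_+ S m) (trans (cong₂ _*_ Q₁ (at (SR.*-identityʳ w) n)) (*-identityˡ (w n))) ⟩
          w n + S m
            ≡⟨ recursion n ⟩
          δ₁ n ∎ }
      where
      open ≡-Reasoning
      S : ℕ → ℚ
      S m = sumTo m (λ j → Q (2 ℕ.+ j) * (w ^ (2 ℕ.+ j)) (suc m))

    -- From `w · E(w) = q` the series `h = E(w)` is `q / w(q)`, which is `q J` up to a constant
    -- factor and a rescaling of `q`.
    h h⁻¹ : Series
    h   = sub (tail Q)
    h⁻¹ = tail w

    private
      tail-δ₁ : ∀ n → δ₁ (suc n) ≡ δ₀ n
      tail-δ₁ zero    = refl
      tail-δ₁ (suc n) = refl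

    h⁻¹·h : (h⁻¹ · h) ≈ δ₀
    h⁻¹·h = mk≈ λ n → begin
      (h⁻¹ · h) n                             ≡⟨ sym (w·-suc h n) ⟩
      (w · h) (suc n)                         ≡⟨ sym (+-identityˡ _) ⟩
      0ℚ + (w · h) (suc n)                    ≡⟨ cong (_+ (w · h) (suc n))
          (sym (trans (∙-at (Q 0) δ₀ (suc n)) (*-zeroʳ (Q 0)))) ⟩
      const (Q 0) (suc n) + (w · h) (suc n)   ≡⟨ sym (⊕-at (const (Q 0)) (w · h) (suc n)) ⟩
      (const (Q 0) ⊕ w · h) (suc n)           ≡⟨ sym (at (sub-step Q) (suc n)) ⟩
      sub Q (suc n)                           ≡⟨ at sub-Q (suc n) ⟩
      δ₁ (suc n)                              ≡⟨ tail-δ₁ n ⟩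
      δ₀ n ∎
      where open ≡-Reasoning

    h₀ : h 0 ≡ 1ℚ
    h₀ = trans (sub-at (tail Q) 0) (trans (+-identityˡ (Q 1 * 1ℚ)) (trans (*-identityʳ (Q 1)) Q₁))

    -- The logarithmic derivative `θ w / w` of `w = q / h`, as `θ q / q = 1`.
    ℓ : Series
    ℓ = δ₀ ⊖ θ h · h⁻¹

    h·ℓ : (h · ℓ) ≈ (h ⊖ θ h)
    h·ℓ = ≈-trans (SSol.solve 4 (λ h o t i → h :* (o :- t :* i) := h :* o :- t :* (i :* h)) ≈-refl h δ₀ (θ h) h⁻¹)
      (⊕-cong (SR.*-identityʳ h) (⊝-cong (≈-trans (·-congˡ (θ h) h⁻¹·h) (SR.*-identityʳ (θ h)))))
      where open SSol using (_:*_; _:-_; _:=_)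

    θw : θ w ≈ (w · ℓ)
    θw = mk≈ λ
      { zero    → trans (θ-at w 0) (trans (*-zeroˡ (w 0)) (sym (w·-zero ℓ)))
      ; (suc n) → trans (at (tail-θ w) n) (trans (at (≈-sym h⁻¹·ℓ) n) (sym (w·-suc ℓ n))) }
      where
      open SSol using (_:*_; _:+_; _:-_; :-_; _:=_; con)
      θ-unit : (θ h⁻¹ · h ⊕ h⁻¹ · θ h) ≈ 0S
      θ-unit = ≈-trans (≈-sym (θ-· h⁻¹ h)) (≈-trans (θ-cong h⁻¹·h) θ-δ₀)
      h⁻¹·ℓ : (h⁻¹ · ℓ) ≈ (h⁻¹ ⊕ θ h⁻¹)
      h⁻¹·ℓ = ≈-trans (SSol.solve 5 (λ i o t u h → i :* (o :- t :* i) := i :* o :+ u :* (i :* h) :- (u :* h :+ i :* t) :* i)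
          ≈-refl h⁻¹ δ₀ (θ h) (θ h⁻¹) h)
        (≈-trans (⊕-cong (⊕-cong (SR.*-identityʳ h⁻¹) (≈-trans (·-congˡ (θ h⁻¹) h⁻¹·h) (SR.*-identityʳ (θ h⁻¹))))
            (⊝-cong (≈-trans (·-congʳ h⁻¹ θ-unit) (SR.zeroˡ h⁻¹))))
          (≈-trans (⊕-cong ≈-refl ⊝0) (SR.+-identityʳ (h⁻¹ ⊕ θ h⁻¹))))
        where
        ⊝0 : (⊝ 0S) ≈ 0S
        ⊝0 = mk≈ λ n → ⊝-at 0S n

    open Chain ℓ θw public

    -- Logarithmic derivative of the identity `w · E(w) = q`, which reads `ℓ + V(w) ℓ = 1`.
    sub-W : (sub (δ₀ ⊕ V) · ℓ) ≈ δ₀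
    sub-W = begin
      sub (δ₀ ⊕ V) · ℓ              ≈⟨ ·-congʳ ℓ (≈-trans (sub-⊕ δ₀ V) (⊕-cong sub-δ₀ ≈-refl)) ⟩
      (δ₀ ⊕ v) · ℓ                  ≈⟨ ≈-sym (·-identityˡ _) ⟩
      δ₀ · ((δ₀ ⊕ v) · ℓ)           ≈⟨ ·-congʳ _ (≈-sym h⁻¹·h) ⟩
      h⁻¹ · h · ((δ₀ ⊕ v) · ℓ)      ≈⟨ SSol.solve 5 (λ i h o v l → i :* h :* ((o :+ v) :* l) := i :*
          (o :* (h :* l) :+ h :* v :* l)) ≈-refl h⁻¹ h δ₀ v ℓ ⟩
      h⁻¹ · (δ₀ · (h · ℓ) ⊕ h · v · ℓ)  ≈⟨ ·-congˡ h⁻¹ (⊕-cong (≈-trans (·-identityˡ _) h·ℓ) (≈-sym θh)) ⟩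
      h⁻¹ · ((h ⊖ θ h) ⊕ θ h)       ≈⟨ ·-congˡ h⁻¹ (SSol.solve 2 (λ h t → h :- t :+ t := h) ≈-refl h (θ h)) ⟩
      h⁻¹ · h                       ≈⟨ h⁻¹·h ⟩
      δ₀ ∎
      where
      open import Relation.Binary.Reasoning.Setoid SR.setoid
      open SSol using (_:*_; _:+_; _:-_; _:=_)
      v : Series
      v = sub V
      θh : θ h ≈ (h · v · ℓ)
      θh = ≈-trans (θ-sub (tail Q)) (·-congʳ ℓ (≈-trans (sub-cong θE) (sub-· (tail Q) V)))

    -- With `K = k + 1`, `ℓ · h^K = h^K - h^(K-1) θ h`, and `K h^(K-1) θ h = θ (h^K)` multiplies
    -- degree `n` by `n`. The factor on the right vanishes for `n = K`, which is the residue
    -- argument behind Lagrange inversion.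
    ℓ-h^ : ∀ k n → ι (suc k) * (ℓ · h ^ suc k) n ≡ (ι (suc k) - ι n) * (h ^ suc k) n
    ℓ-h^ k n = begin
      ι (suc k) * (ℓ · h ^ suc k) n
        ≡⟨ cong (ι (suc k) *_) (at lem n) ⟩
      ι (suc k) * (h ^ suc k ⊖ h ^ k · θ h) n
        ≡⟨ cong (ι (suc k) *_) (trans (⊕-at _ _ n) (cong ((h ^ suc k) n +_) (⊝-at _ n))) ⟩
      ι (suc k) * ((h ^ suc k) n - (h ^ k · θ h) n)
        ≡⟨ QSol.solve 3 (λ k a b → k :* (a :- b) := k :* a :- k :* b) refl (ι (suc k)) _ _ ⟩
      ι (suc k) * (h ^ suc k) n - ι (suc k) * (h ^ k · θ h) n
        ≡⟨ cong (λ t → ι (suc k) * (h ^ suc k) n - t) (trans (sym (∙-at (ι (suc k)) (h ^ k · θ h) n))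
             (trans (sym (at (θ-^ h k) n)) (θ-at (h ^ suc k) n))) ⟩
      ι (suc k) * (h ^ suc k) n - ι n * (h ^ suc k) n
        ≡⟨ QSol.solve 3 (λ k n a → k :* a :- n :* a := (k :- n) :* a) refl (ι (suc k)) (ι n) _ ⟩
      (ι (suc k) - ι n) * (h ^ suc k) n ∎
      where
      open ≡-Reasoning
      open QSol using (_:*_; _:-_; _:=_)
      lem : (ℓ · h ^ suc k) ≈ (h ^ suc k ⊖ h ^ k · θ h)
      lem = ≈-trans (SSol.solve 3 (λ l h p → l SSol.:* (h SSol.:* p) SSol.:= (h SSol.:* l) SSol.:* p) ≈-refl ℓ h (h ^ k))
        (≈-trans (·-congʳ (h ^ k) h·ℓ)
          (SSol.solve 3 (λ h t p → (h SSol.:- t) SSol.:* p SSol.:= h SSol.:* p SSol.:- p SSol.:* t) ≈-refl h (θ h) (h ^ k)))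

    -- Lagrange inversion: since w = q/h and θ w = w · ℓ, the summands w^i · ℓ · h^n with i ≠ n
    -- are exact up to the factor qⁿ and do not contribute.
    extract : ∀ n f → (sub f · (ℓ · h ^ n)) n ≡ f n
    extract zero f = begin
      (sub f · (ℓ · δ₀)) 0   ≡⟨ ·-zero (sub f) (ℓ · δ₀) ⟩
      sub f 0 * (ℓ · δ₀) 0   ≡⟨ cong₂ _*_ (trans (sub-at f 0) (trans (+-identityˡ (f 0 * 1ℚ)) (*-identityʳ (f 0))))
                                 (trans (at (SR.*-identityʳ ℓ) 0) ℓ₀) ⟩
      f 0 * 1ℚ               ≡⟨ *-identityʳ (f 0) ⟩
      f 0 ∎
      where
      open ≡-Reasoning
      ℓ₀ : ℓ 0 ≡ 1ℚ
      ℓ₀ = trans (⊕-at δ₀ _ 0) (cong (1ℚ +_) (trans (⊝-at _ 0) (cong -_ (trans (·-zero (θ h) h⁻¹)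
        (trans (cong (_* h⁻¹ 0) (trans (θ-at h 0) (*-zeroˡ (h 0)))) (*-zeroˡ (h⁻¹ 0)))))))
    extract (suc m) f = begin
      (sub f · L) (suc m)
        ≡⟨ at (·-congʳ L (sub-step f)) (suc m) ⟩
      ((const (f 0) ⊕ w · X) · L) (suc m)
        ≡⟨ at (SSol.solve 6 (λ c w x l h p → (c :+ w :* x) :* (l :* (h :* p)) := c :* (l :* (h :* p)) :+ w :*
            (h :* (x :* (l :* p))))
             ≈-refl (const (f 0)) w X ℓ h (h ^ m)) (suc m) ⟩
      (const (f 0) · L ⊕ w · (h · Y)) (suc m)
        ≡⟨ ⊕-at _ _ (suc m) ⟩
      (const (f 0) · L) (suc m) + (w · (h · Y)) (suc m)
        ≡⟨ cong₂ _+_ (trans (at (const-· (f 0) L) (suc m))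
            (trans (∙-at (f 0) L (suc m)) (trans (cong (f 0 *_) L₀) (*-zeroʳ (f 0)))))
             (w·-suc (h · Y) m) ⟩
      0ℚ + (h⁻¹ · (h · Y)) m
        ≡⟨ +-identityˡ _ ⟩
      (h⁻¹ · (h · Y)) m
        ≡⟨ at (≈-trans (≈-sym (SR.*-assoc h⁻¹ h Y)) (≈-trans (·-congʳ Y h⁻¹·h) (·-identityˡ Y))) m ⟩
      Y m
        ≡⟨ extract m (tail f) ⟩
      f (suc m) ∎
      where
      open ≡-Reasoning
      open SSol using (_:*_; _:+_; _:=_)
      L X Y : Series
      L = ℓ · h ^ suc m
      X = sub (tail f)
      Y = X · (ℓ · h ^ m)
      L₀ : L (suc m) ≡ 0ℚ
      L₀ = *-cancel _ 0ℚ (ι-suc≢0 m) (trans (ℓ-h^ m (suc m)) (trans (cong (_* (h ^ suc m) (suc m)) (+-inverseʳ (ι (suc m))))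
        (trans (*-zeroˡ ((h ^ suc m) (suc m))) (sym (*-zeroʳ (ι (suc m)))))))

    -- This is `extract` for `f = 1 + V`: by `sub-W` the weight `ℓ` cancels and `hⁿ` alone remains.
    h^n-at-n : ∀ n → (h ^ n) n ≡ (δ₀ ⊕ V) n
    h^n-at-n n = trans (sym (at (·-identityˡ (h ^ n)) n)) (trans (at (·-congʳ (h ^ n) (≈-sym sub-W)) n)
      (trans (at (SR.*-assoc (sub (δ₀ ⊕ V)) ℓ (h ^ n)) n) (extract n (δ₀ ⊕ V))))

    -- Here `P = E^(-R)` and `K = k + 1`. In degree `n = R + K` the power `hⁿ = h^R · h^K` cancels
    -- `P(w) = h^(-R)`, and `ℓ-h^` contributes `1 - n/K = -R/K`.
    negative-power : ∀ P R k → (P · tail Q ^ R) ≈ δ₀ →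
      ι (suc k) * P (R ℕ.+ suc k) ≡ - (ι R * (h ^ suc k) (R ℕ.+ suc k))
    negative-power P R k e = begin
      ι (suc k) * P n
        ≡⟨ cong (ι (suc k) *_) (sym (extract n P)) ⟩
      ι (suc k) * (sub P · (ℓ · h ^ n)) n
        ≡⟨ cong (ι (suc k) *_) (at lem n) ⟩
      ι (suc k) * (ℓ · h ^ suc k) n
        ≡⟨ ℓ-h^ k n ⟩
      (ι (suc k) - ι n) * (h ^ suc k) n
        ≡⟨ cong (λ t → (ι (suc k) - t) * (h ^ suc k) n) (ι-+ R (suc k)) ⟩
      (ι (suc k) - (ι R + ι (suc k))) * (h ^ suc k) n
        ≡⟨ QSol.solve 3 (λ k r x → (k :- (r :+ k)) :* x := :- (r :* x)) refl (ι (suc k)) (ι R) _ ⟩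
      - (ι R * (h ^ suc k) n) ∎
      where
      open ≡-Reasoning
      open QSol using (_:*_; _:-_; _:+_; :-_; _:=_)
      n : ℕ
      n = R ℕ.+ suc k
      lem : (sub P · (ℓ · h ^ n)) ≈ (ℓ · h ^ suc k)
      lem = ≈-trans (·-congˡ (sub P) (·-congˡ ℓ (^-+ h R (suc k))))
        (≈-trans (SSol.solve 4 (λ p l r k → p SSol.:* (l SSol.:* (r SSol.:* k)) SSol.:= (p SSol.:* r) SSol.:* (l SSol.:* k))
           ≈-refl (sub P) ℓ (h ^ R) (h ^ suc k))
        (≈-trans (·-congʳ _ (≈-trans (·-congˡ (sub P) (≈-sym (sub-^ (tail Q) R)))
          (≈-trans (≈-sym (sub-· P (tail Q ^ R))) (≈-trans (sub-cong e) sub-δ₀)))) (·-identityˡ _)))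

  qpow≢0 : ∀ {κ} n → κ ≢ 0ℚ → qpow κ n ≢ 0ℚ
  qpow≢0 zero    κ≢0 = λ ()
  qpow≢0 (suc n) κ≢0 = *-≢0 (qpow≢0 n κ≢0) κ≢0

  qpow-+ : ∀ x m n → qpow x (m ℕ.+ n) ≡ qpow x m * qpow x n
  qpow-+ x zero    n = sym (*-identityˡ _)
  qpow-+ x (suc m) n = trans (cong (_* x) (qpow-+ x m n))
    (QSol.solve 3 (λ a b x → a :* b :* x := a :* x :* b) refl (qpow x m) (qpow x n) x)
    where open QSol

  scale : ℚ → Series → Series
  scale κ f n = qpow κ n * f n

  opaque
    unfolding _·_

    scale-· : ∀ κ f g → (scale κ f · scale κ g) ≈ scale κ (f · g)
    scale-· κ f g = mk≈ λ n → trans (sum-cong (suc n) (λ i i<n → term n i (ℕₚ.≤-pred i<n)))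
        (sum-*ˡ (suc n) (qpow κ n) (λ i → f i * g (n ℕ.∸ i)))
      where
      open QSol
      term : ∀ n i → i ℕ.≤ n → (qpow κ i * f i) * (qpow κ (n ℕ.∸ i) * g (n ℕ.∸ i)) ≡ qpow κ n * (f i * g (n ℕ.∸ i))
      term n i i≤n = trans (solve 4 (λ a x b y → (a :* x) :* (b :* y) := (a :* b) :* (x :* y)) refl (qpow κ i) (f i)
          (qpow κ (n ℕ.∸ i)) (g (n ℕ.∸ i)))
        (cong (_* (f i * g (n ℕ.∸ i))) (trans (sym (qpow-+ κ i (n ℕ.∸ i))) (cong (qpow κ) (ℕₚ.m+[n∸m]≡n i≤n))))

  module Hauptmodul (a b : ℚ) where

    V : Series
    V = θ (Dser a b)

    W : Series
    W = δ₀ ⊕ V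

    open Inversion (qser a b) V refl refl (θ-expSer (Dser a b)) public

    W-suc : ∀ n → W (suc n) ≡ ι (suc n) * Dser a b (suc n)
    W-suc n = trans (⊕-at δ₀ V (suc n)) (trans (+-identityˡ _) (θ-at (Dser a b) (suc n)))

    -- The series inverted in `hauptH` is `z(κq)/q = κ · h⁻¹(κq)`, so its inverse is `h(κq)/κ`. For
    -- a p-adic unit `κ` this leaves integrality unchanged.
    hauptH-h : ∀ {κ} → κ ≢ 0ℚ → ∀ n → κ * hauptH a b κ n ≡ qpow κ n * h n
    hauptH-h {κ} κ≢0 n = begin
      κ * hauptH a b κ n                      ≡⟨ cong (κ *_) (at (inverse-unique (invSer-· Y₀≢0) Y·I) n) ⟩
      κ * (inv κ ∙ scale κ h) n               ≡⟨ cong (κ *_) (∙-at (inv κ) (scale κ h) n) ⟩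
      κ * (inv κ * (qpow κ n * h n))          ≡⟨ sym (*-assoc κ (inv κ) _) ⟩
      κ * inv κ * (qpow κ n * h n)            ≡⟨ cong (_* (qpow κ n * h n)) (inv-right κ≢0) ⟩
      1ℚ * (qpow κ n * h n)                   ≡⟨ *-identityˡ _ ⟩
      qpow κ n * h n ∎
      where
      open ≡-Reasoning
      Y : Series
      Y n = qpow κ (suc n) * zser a b (suc n)
      Y-scale : Y ≈ (κ ∙ scale κ h⁻¹)
      Y-scale = mk≈ λ n → trans (QSol.solve 3 (λ q k x → (q :* k) :* x := k :* (q :* x)) refl (qpow κ n) κ (h⁻¹ n))
        (sym (∙-at κ (scale κ h⁻¹) n))
        where open QSol
      Y₀≢0 : Y 0 ≢ 0ℚ
      Y₀≢0 = *-≢0 (qpow≢0 1 κ≢0) (λ ())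
      scale-δ₀ : scale κ δ₀ ≈ δ₀
      scale-δ₀ = mk≈ λ { zero → refl ; (suc n) → *-zeroʳ (qpow κ (suc n)) }
      Y·I : (Y · (inv κ ∙ scale κ h)) ≈ δ₀
      Y·I = ≈-trans (·-congʳ _ Y-scale) (≈-trans (∙-· κ _ _) (≈-trans (∙-cong κ (∙-·ʳ (inv κ) _ _))
        (≈-trans (∙-cong κ (∙-cong (inv κ)
            (≈-trans (scale-· κ h⁻¹ h) (≈-trans (mk≈ λ n → cong (qpow κ n *_) (at h⁻¹·h n)) scale-δ₀))))
        (mk≈ λ n → trans (∙-at κ _ n) (trans (cong (κ *_) (∙-at (inv κ) δ₀ n)) (trans (sym (*-assoc κ (inv κ) (δ₀ n)))
           (trans (cong (_* δ₀ n) (inv-right κ≢0)) (*-identityˡ (δ₀ n)))))))))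

-- The localisation of ℤ at `p`: integrality, units, divisibility, approximation by naturals.

module PAdicIntegers where

  open import Data.Nat.Divisibility using (_∣_; _∣?_; divides; ∣-trans; ∣1⇒≡1; n∣m*n; ∣⇒≤)
  open import Data.Nat.Primality using (Prime; euclidsLemma; prime⇒nonTrivial; prime⇒nonZero; prime⇒irreducible)
  import Data.Nat.Coprimality as Cop
  open import Data.Nat.GCD using (module Bézout)
  open import Data.Nat.Induction using (<-rec)
  open import Data.Integer as ℤ using (ℤ; +_; -[1+_])
  import Data.Integer.Properties as ℤₚ
  import Data.Integer.DivMod as ℤD
  open import Data.Rational using (_+_; _*_; _-_; -_)
  open import Data.Rational.Properties
  open FormalSeries
  open Composition
  open LagrangeInversion

  open QSol using (solve; _:+_; _:*_; _:-_; :-_; con; _:=_)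

  module Integrality (p : ℕ) (pr : Prime p) where

    1<p : 1 ℕ.< p
    1<p = ℕ.nonTrivial⇒n>1 p {{prime⇒nonTrivial pr}}

    p∤1 : ¬ p ∣ 1
    p∤1 d = ℕₚ.<-irrefl (sym (∣1⇒≡1 d)) 1<p

    ∣-* : ∀ {m n} → ¬ p ∣ m → ¬ p ∣ n → ¬ p ∣ m ℕ.* n
    ∣-* {m} {n} a b d = [ a , b ]′ (euclidsLemma m n pr d)

    ι≢0 : ∀ {n} → ¬ p ∣ n → ι n ≢ 0ℚ
    ι≢0 {zero}  ¬d _ = ¬d (divides 0 refl)
    ι≢0 {suc n} _    = ι-suc≢0 n

    π : ℚ
    π = ι p

    π≢0 : π ≢ 0ℚ
    π≢0 e = ℕₚ.<⇒≢ (ℕₚ.<-trans (s≤s z≤n) 1<p) (sym (ι-injective {p} {0} e))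

    -- The fraction need not be reduced, so sums and products require no cancellation; the link with
    -- the reduced denominator of `InZp` is made once, in `Zp⇒InZp` and `InZp⇒Zp`.
    record Zp (x : ℚ) : Set where
      constructor frac
      field
        den  : ℕ
        num  : ℤ
        ¬p∣d : ¬ p ∣ den
        eq   : x * ι den ≡ ιℤ num

    Zp-ιℤ : ∀ z → Zp (ιℤ z)
    Zp-ιℤ z = frac 1 z p∤1 (*-identityʳ (ιℤ z))

    Zp-ι : ∀ n → Zp (ι n)
    Zp-ι n = Zp-ιℤ (+ n)

    Zp-0 : Zp 0ℚ
    Zp-0 = Zp-ι 0

    Zp-1 : Zp 1ℚ
    Zp-1 = Zp-ι 1

    Zp-+ : ∀ {x y} → Zp x → Zp y → Zp (x + y)
    Zp-+ {x} {y} (frac d n ¬d e) (frac d′ n′ ¬d′ e′) = frac (d ℕ.* d′) (n ℤ.* + d′ ℤ.+ n′ ℤ.* + d) (∣-* ¬d ¬d′) (begin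
      (x + y) * ι (d ℕ.* d′)         ≡⟨ cong ((x + y) *_) (ι-* d d′) ⟩
      (x + y) * (ι d * ι d′)         ≡⟨ solve 4 (λ x y d e → (x :+ y) :* (d :* e) := x :* d :* e :+ y :* e :* d) refl
          x y (ι d) (ι d′) ⟩
      x * ι d * ι d′ + y * ι d′ * ι d ≡⟨ cong₂ (λ s t → s * ι d′ + t * ι d) e e′ ⟩
      ιℤ n * ι d′ + ιℤ n′ * ι d      ≡⟨ cong₂ _+_ (sym (ιℤ-* n (+ d′))) (sym (ιℤ-* n′ (+ d))) ⟩
      ιℤ (n ℤ.* + d′) + ιℤ (n′ ℤ.* + d) ≡⟨ sym (ιℤ-+ (n ℤ.* + d′) (n′ ℤ.* + d)) ⟩
      ιℤ (n ℤ.* + d′ ℤ.+ n′ ℤ.* + d) ∎)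
      where open ≡-Reasoning

    Zp-* : ∀ {x y} → Zp x → Zp y → Zp (x * y)
    Zp-* {x} {y} (frac d n ¬d e) (frac d′ n′ ¬d′ e′) = frac (d ℕ.* d′) (n ℤ.* n′) (∣-* ¬d ¬d′) (begin
      (x * y) * ι (d ℕ.* d′)         ≡⟨ cong ((x * y) *_) (ι-* d d′) ⟩
      (x * y) * (ι d * ι d′)         ≡⟨ solve 4 (λ x y d e → (x :* y) :* (d :* e) := (x :* d) :* (y :* e)) refl x y
          (ι d) (ι d′) ⟩
      (x * ι d) * (y * ι d′)         ≡⟨ cong₂ _*_ e e′ ⟩
      ιℤ n * ιℤ n′                   ≡⟨ sym (ιℤ-* n n′) ⟩
      ιℤ (n ℤ.* n′) ∎)
      where open ≡-Reasoning

    Zp-neg : ∀ {x} → Zp x → Zp (- x)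
    Zp-neg {x} (frac d n ¬d e) = frac d (ℤ.- n) ¬d
      (trans (sym (neg-distribˡ-* x (ι d))) (trans (cong -_ e) (sym (ιℤ-neg n))))

    Zp-- : ∀ {x y} → Zp x → Zp y → Zp (x - y)
    Zp-- zx zy = Zp-+ zx (Zp-neg zy)

    Zp-sum : ∀ n {f} → (∀ i → i ℕ.< n → Zp (f i)) → Zp (sumTo n f)
    Zp-sum zero    z = Zp-0
    Zp-sum (suc n) z = Zp-+ (Zp-sum n (λ i i<n → z i (ℕₚ.m<n⇒m<1+n i<n))) (z n ℕₚ.≤-refl)

    InZp⇒Zp : ∀ {x} → InZp p x → Zp x
    InZp⇒Zp {x} ¬d = frac (ℚ.denominatorℕ x) (ℚ.numerator x) ¬d (*-denominator x)

    -- Cross-multiplication shows that a factor `p` of the reduced denominator would also divide the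
    -- numerator.
    Zp⇒InZp : ∀ {x} → Zp x → InZp p x
    Zp⇒InZp {x} (frac d n ¬d e) p∣den = p∤1 (subst (p ∣_) (coprime x (p∣num , p∣den)) (divides 1 (sym (ℕₚ.*-identityˡ p))))
      where
      coprime : ∀ x {i} → i ∣ ℤ.∣ ℚ.numerator x ∣ × i ∣ ℚ.denominatorℕ x → i ≡ 1
      coprime (ℚ.mkℚ _ _ c) = Cop.recompute c
      cross : ℚ.numerator x ℤ.* + d ≡ n ℤ.* ℚ.denominator x
      cross = ιℤ-injective (begin
        ιℤ (ℚ.numerator x ℤ.* + d)     ≡⟨ ιℤ-* (ℚ.numerator x) (+ d) ⟩
        ιℤ (ℚ.numerator x) * ι d       ≡⟨ cong (_* ι d) (sym (*-denominator x)) ⟩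
        x * ι (ℚ.denominatorℕ x) * ι d ≡⟨ solve 3 (λ x a b → x :* a :* b := x :* b :* a) refl x _ (ι d) ⟩
        x * ι d * ι (ℚ.denominatorℕ x) ≡⟨ cong (_* ι (ℚ.denominatorℕ x)) e ⟩
        ιℤ n * ι (ℚ.denominatorℕ x)    ≡⟨ sym (ιℤ-* n (ℚ.denominator x)) ⟩
        ιℤ (n ℤ.* ℚ.denominator x) ∎)
        where open ≡-Reasoning
      p∣num : p ∣ ℤ.∣ ℚ.numerator x ∣
      p∣num = [ (λ q → q) , ⊥-elim ∘ ¬d ]′ (euclidsLemma _ d pr
        (subst (p ∣_) (trans (sym (ℤₚ.abs-* n (ℚ.denominator x)))
            (trans (cong ℤ.∣_∣ (sym cross)) (ℤₚ.abs-* (ℚ.numerator x) (+ d))))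
          (∣-trans p∣den (n∣m*n ℤ.∣ n ∣))))

    Zp? : ∀ x → Dec (Zp x)
    Zp? x with p ∣? ℚ.denominatorℕ x
    ... | yes d = no (λ z → Zp⇒InZp z d)
    ... | no ¬d = yes (InZp⇒Zp {x} ¬d)

    record Unit (x : ℚ) : Set where
      constructor mkUnit
      field
        integral         : Zp x
        inverse          : ℚ
        inverse-integral : Zp inverse
        inverse-right    : x * inverse ≡ 1ℚ

    Unit-≢0 : ∀ {x} → Unit x → x ≢ 0ℚ
    Unit-≢0 (mkUnit _ y _ e) refl with trans (sym e) (*-zeroˡ y)
    ... | ()

    Unit-inv : ∀ {x} → Unit x → Zp (inv x)
    Unit-inv {x} (mkUnit _ y zy e) = subst Zp (sym (inv-unique {x} e)) zy

    Unit-* : ∀ {x y} → Unit x → Unit y → Unit (x * y)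
    Unit-* {x} {y} (mkUnit zx x′ zx′ e) (mkUnit zy y′ zy′ e′) = mkUnit (Zp-* zx zy) (x′ * y′) (Zp-* zx′ zy′)
      (trans (solve 4 (λ a b c d → (a :* b) :* (c :* d) := (a :* c) :* (b :* d)) refl x y x′ y′) (cong₂ _*_ e e′))

    Unit-1 : Unit 1ℚ
    Unit-1 = mkUnit Zp-1 1ℚ Zp-1 refl

    Unit-ι : ∀ {n} → ¬ p ∣ n → Unit (ι n)
    Unit-ι {n} ¬d = mkUnit (Zp-ι n) (inv (ι n))
      (frac n (+ 1) ¬d (trans (*-comm (inv (ι n)) (ι n)) (inv-right (ι≢0 ¬d)))) (inv-right (ι≢0 ¬d))

    Unit-neg : ∀ {x} → Unit x → Unit (- x)
    Unit-neg {x} (mkUnit zx y zy e) = mkUnit (Zp-neg zx) (- y) (Zp-neg zy)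
      (trans (solve 2 (λ x y → (:- x) :* (:- y) := x :* y) refl x y) e)

    infixr 8 π^_
    π^_ : ℕ → ℚ
    π^ s = qpow π s

    -- Congruences modulo `p^s` are stated as `Div s (x - y)`, in the localisation and not in ℤ.
    record Div (s : ℕ) (x : ℚ) : Set where
      constructor mkDiv
      field
        quot     : ℚ
        integral : Zp quot
        eq       : x ≡ π^ s * quot

    ι-^ : ∀ s → ι (p ℕ.^ s) ≡ π^ s
    ι-^ zero    = refl
    ι-^ (suc s) = trans (ι-* p (p ℕ.^ s)) (trans (cong (π *_) (ι-^ s)) (*-comm π (π^ s)))

    Zp-π^ : ∀ s → Zp (π^ s)
    Zp-π^ s = subst Zp (ι-^ s) (Zp-ι (p ℕ.^ s))

    Div-resp : ∀ {s x y} → x ≡ y → Div s x → Div s y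
    Div-resp refl d = d

    Div⇒Zp : ∀ {s x} → Div s x → Zp x
    Div⇒Zp {s} (mkDiv q z e) = subst Zp (sym e) (Zp-* (Zp-π^ s) z)

    Zp⇒Div : ∀ {x} → Zp x → Div 0 x
    Zp⇒Div {x} z = mkDiv x z (sym (*-identityˡ x))

    Div-0 : ∀ {s} → Div s 0ℚ
    Div-0 {s} = mkDiv 0ℚ Zp-0 (sym (*-zeroʳ (π^ s)))

    Div-+ : ∀ {s x y} → Div s x → Div s y → Div s (x + y)
    Div-+ {s} (mkDiv q z refl) (mkDiv q′ z′ refl) = mkDiv (q + q′) (Zp-+ z z′) (sym (*-distribˡ-+ (π^ s) q q′))

    Div-neg : ∀ {s x} → Div s x → Div s (- x)
    Div-neg {s} (mkDiv q z refl) = mkDiv (- q) (Zp-neg z) (neg-distribʳ-* (π^ s) q)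

    Div-- : ∀ {s x y} → Div s x → Div s y → Div s (x - y)
    Div-- a b = Div-+ a (Div-neg b)

    Div-*ˡ : ∀ {s c x} → Zp c → Div s x → Div s (c * x)
    Div-*ˡ {s} {c} zc (mkDiv q z refl) = mkDiv (c * q) (Zp-* zc z)
      (solve 3 (λ c t q → c :* (t :* q) := t :* (c :* q)) refl c (π^ s) q)

    Div-*ʳ : ∀ {s c x} → Div s x → Zp c → Div s (x * c)
    Div-*ʳ {s} {c} {x} d zc = subst (Div s) (*-comm c x) (Div-*ˡ zc d)

    Div-* : ∀ {s t x y} → Div s x → Div t y → Div (s ℕ.+ t) (x * y)
    Div-* {s} {t} (mkDiv q z refl) (mkDiv q′ z′ refl) = mkDiv (q * q′) (Zp-* z z′)
      (trans (solve 4 (λ s q t r → (s :* q) :* (t :* r) := (s :* t) :* (q :* r)) refl (π^ s) q (π^ t) q′)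
        (cong (_* (q * q′)) (sym (qpow-+ π s t))))

    Div-π : ∀ {s x} → Div s x → Div (suc s) (π * x)
    Div-π {s} (mkDiv q z refl) = mkDiv q z (solve 3 (λ p s q → p :* (s :* q) := (s :* p) :* q) refl π (π^ s) q)

    Div-π⁻¹ : ∀ {s x} → Div (suc s) (π * x) → Div s x
    Div-π⁻¹ {s} {x} (mkDiv q z e) = mkDiv q z
        (*-cancel x _ π≢0 (trans e (solve 3 (λ p s q → (s :* p) :* q := p :* (s :* q)) refl π (π^ s) q)))

    Div-π^ : ∀ s → Div s (π^ s)
    Div-π^ s = mkDiv 1ℚ Zp-1 (sym (*-identityʳ (π^ s)))

    Div-mono : ∀ {s t x} → s ℕ.≤ t → Div t x → Div s x
    Div-mono {s} {t} s≤t (mkDiv q z refl) = mkDiv (π^ (t ℕ.∸ s) * q) (Zp-* (Zp-π^ (t ℕ.∸ s)) z)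
      (trans (cong (_* q) (trans (cong π^_ (sym (ℕₚ.m+[n∸m]≡n s≤t))) (qpow-+ π s (t ℕ.∸ s))))
          (*-assoc (π^ s) (π^ (t ℕ.∸ s)) q))

    Div-unit : ∀ {s u x} → Unit u → Div s (u * x) → Div s x
    Div-unit {s} {u} {x} (mkUnit _ y zy e) d = subst (Div s)
      (trans (solve 3 (λ y u x → y :* (u :* x) := (u :* y) :* x) refl y u x) (trans (cong (_* x) e) (*-identityˡ x)))
          (Div-*ˡ zy d)

    Div-sum : ∀ s n {f} → (∀ i → i ℕ.< n → Div s (f i)) → Div s (sumTo n f)
    Div-sum s zero    z = Div-0
    Div-sum s (suc n) z = Div-+ (Div-sum s n (λ i i<n → z i (ℕₚ.m<n⇒m<1+n i<n))) (z n ℕₚ.≤-refl)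

    Div-trans : ∀ {s} x y z → Div s (x - y) → Div s (y - z) → Div s (x - z)
    Div-trans {s} x y z a b = subst (Div s) (solve 3 (λ x y z → (x :- y) :+ (y :- z) := x :- z) refl x y z) (Div-+ a b)

    Div-swap : ∀ {s} x y → Div s (x - y) → Div s (y - x)
    Div-swap {s} x y a = subst (Div s) (solve 2 (λ x y → :- (x :- y) := y :- x) refl x y) (Div-neg a)

    Div-*-cong : ∀ {s x x′ y y′} → Zp x → Zp y′ → Div s (x - x′) → Div s (y - y′) → Div s (x * y - x′ * y′)
    Div-*-cong {s} {x} {x′} {y} {y′} zx zy′ a b = subst (Div s)
      (solve 4 (λ x x′ y y′ → x :* (y :- y′) :+ (x :- x′) :* y′ := x :* y :- x′ :* y′) refl x x′ y y′)
      (Div-+ (Div-*ˡ zx b) (Div-*ʳ a zy′))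

    Div-quot : ∀ {x d n k} → ¬ p ∣ d → x * ι d ≡ ιℤ n → n ≡ + p ℤ.* k → Div 1 x
    Div-quot {x} {d} {n} {k} ¬d e refl = mkDiv (inv π * x) (frac d k ¬d (*-cancel _ (ιℤ k) π≢0 (begin
        π * (inv π * x * ι d)    ≡⟨ solve 4 (λ p i x d → p :* (i :* x :* d) := (p :* i) :* (x :* d)) refl π (inv π) x (ι d) ⟩
        (π * inv π) * (x * ι d)  ≡⟨ cong₂ _*_ (inv-right π≢0) e ⟩
        1ℚ * ιℤ (+ p ℤ.* k)      ≡⟨ *-identityˡ _ ⟩
        ιℤ (+ p ℤ.* k)           ≡⟨ ιℤ-* (+ p) k ⟩
        π * ιℤ k ∎)))
      (sym (trans (solve 3 (λ p i x → (con 1ℚ :* p) :* (i :* x) := (p :* i) :* x) refl π (inv π) x)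
        (trans (cong (_* x) (inv-right π≢0)) (*-identityˡ x))))
      where open ≡-Reasoning

    Unit-ιℤ : ∀ n → ¬ p ∣ ℤ.∣ n ∣ → Unit (ιℤ n)
    Unit-ιℤ (+ m)    ¬d = Unit-ι ¬d
    Unit-ιℤ -[1+ m ] ¬d = subst Unit (sym (ιℤ-neg (+ suc m))) (Unit-neg (Unit-ι ¬d))

    -- The dichotomy of a local ring; it takes the place of valuations in the later case
    -- distinctions.
    Div₁⊎Unit : ∀ {x} → Zp x → Div 1 x ⊎ Unit x
    Div₁⊎Unit {x} zx@(frac d n ¬d e) with p ∣? ℤ.∣ n ∣
    ... | yes (divides q e′) = inj₁ (Div-quot ¬d e (proj₂ (multiple n e′)))
      where
      multiple : ∀ n → ℤ.∣ n ∣ ≡ q ℕ.* p → ∃ λ k → n ≡ + p ℤ.* k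
      multiple (+ m)    refl = + q , trans (cong +_ (ℕₚ.*-comm q p)) (ℤₚ.pos-* p q)
      multiple -[1+ m ] e″   = ℤ.- (+ q) , trans (cong (λ t → ℤ.- (+ t)) (trans e″ (ℕₚ.*-comm q p)))
        (trans (cong ℤ.-_ (ℤₚ.pos-* p q)) (ℤₚ.neg-distribʳ-* (+ p) (+ q)))
    ... | no ¬n with Unit-ιℤ n ¬n
    ... | mkUnit _ y zy e′ = inj₂ (mkUnit zx (ι d * y) (Zp-* (Zp-ι d) zy)
            (trans (sym (*-assoc x (ι d) y)) (trans (cong (_* y) e) e′)))

    ¬Div₁-1 : ¬ Div 1 1ℚ
    ¬Div₁-1 (mkDiv q (frac d n ¬d e) eq) = ¬d
        (divides ℤ.∣ n ∣ (trans (cong ℤ.∣_∣ key) (trans (ℤₚ.abs-* (+ p) n) (ℕₚ.*-comm p ℤ.∣ n ∣))))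
      where
      open ≡-Reasoning
      key : + d ≡ + p ℤ.* n
      key = ιℤ-injective (begin
        ι d               ≡⟨ sym (*-identityˡ (ι d)) ⟩
        1ℚ * ι d          ≡⟨ cong (_* ι d) eq ⟩
        π^ 1 * q * ι d    ≡⟨ solve 3 (λ p q d → (con 1ℚ :* p) :* q :* d := p :* (q :* d)) refl π q (ι d) ⟩
        π * (q * ι d)     ≡⟨ cong (π *_) e ⟩
        π * ιℤ n          ≡⟨ sym (ιℤ-* (+ p) n) ⟩
        ιℤ (+ p ℤ.* n) ∎)

    ¬Div₁-Unit : ∀ {x} → Unit x → ¬ Div 1 x
    ¬Div₁-Unit {x} u d = ¬Div₁-1 (Div-unit u (subst (Div 1) (sym (*-identityʳ x)) d))

    Div₁-ιℤ : ∀ n → Div 1 (ιℤ n) → p ∣ ℤ.∣ n ∣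
    Div₁-ιℤ n d with p ∣? ℤ.∣ n ∣
    ... | yes q = q
    ... | no ¬q = ⊥-elim (¬Div₁-Unit (Unit-ιℤ n ¬q) d)

    Div-ι : ∀ s n → Div s (ι n) → p ℕ.^ s ∣ n
    Div-ι zero    n d = divides n (sym (ℕₚ.*-identityʳ n))
    Div-ι (suc s) n d = step (Div₁-ιℤ (+ n) (Div-mono (s≤s z≤n) d))
      where
      step : p ∣ n → p ℕ.^ suc s ∣ n
      step (divides q e) = lift (Div-ι s q (Div-π⁻¹ (Div-resp (trans (cong ι e) (trans (ι-* q p) (*-comm (ι q) π))) d)))
        where
        lift : p ℕ.^ s ∣ q → p ℕ.^ suc s ∣ n
        lift (divides k e′) = divides k (trans e (trans (cong (ℕ._* p) e′)
          (trans (ℕₚ.*-assoc k (p ℕ.^ s) p) (cong (k ℕ.*_) (ℕₚ.*-comm (p ℕ.^ s) p)))))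

    n<p^n : ∀ n → n ℕ.< p ℕ.^ n
    n<p^n zero    = s≤s z≤n
    n<p^n (suc n) = begin
      1 ℕ.+ suc n              ≤⟨ ℕₚ.+-mono-≤ (ℕₚ.≤-trans (s≤s z≤n) (n<p^n n)) (n<p^n n) ⟩
      p ℕ.^ n ℕ.+ p ℕ.^ n      ≡⟨ cong (p ℕ.^ n ℕ.+_) (sym (ℕₚ.+-identityʳ _)) ⟩
      2 ℕ.* p ℕ.^ n            ≤⟨ ℕₚ.*-monoˡ-≤ (p ℕ.^ n) 1<p ⟩
      p ℕ.* p ℕ.^ n ∎
      where open ℕₚ.≤-Reasoning

    -- A positive `n` divisible by `p^n` would satisfy `p^n ≤ n`.
    Div-0-limit : ∀ n → (∀ s → Div s (ι n)) → n ≡ 0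
    Div-0-limit zero    d = refl
    Div-0-limit (suc n) d = ⊥-elim
        (ℕₚ.<-irrefl refl (ℕₚ.<-≤-trans (n<p^n (suc n)) (∣⇒≤ (Div-ι (suc n) (suc n) (d (suc n))))))

    Div-multiple : ∀ c → Zp c → Div 1 (c * π)
    Div-multiple c zc = mkDiv c zc (solve 2 (λ c p → c :* p := (con 1ℚ :* p) :* c) refl c π)

    residue-ℤ : ∀ n → ∃ λ r → Div 1 (ιℤ n - ι r)
    residue-ℤ n = r , Div-resp (begin
        ιℤ k * π                  ≡⟨ sym (ιℤ-* k (+ p)) ⟩
        ιℤ (k ℤ.* + p)            ≡⟨ solve 2 (λ r x → x := (r :+ x) :- r) refl (ι r) (ιℤ (k ℤ.* + p)) ⟩
        ι r + ιℤ (k ℤ.* + p) - ι r ≡⟨ cong (_- ι r) (sym (ιℤ-+ (+ r) (k ℤ.* + p))) ⟩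
        ιℤ (+ r ℤ.+ k ℤ.* + p) - ι r ≡⟨ cong (λ t → ιℤ t - ι r) (sym (ℤD.a≡a%ℕn+[a/ℕn]*n n p)) ⟩
        ιℤ n - ι r ∎) (Div-multiple (ιℤ k) (Zp-ιℤ k))
      where
      open ≡-Reasoning
      instance
        p≢0 : ℕ.NonZero p
        p≢0 = prime⇒nonZero pr
      r : ℕ
      r = n ℤD.%ℕ p
      k : ℤ
      k = n ℤD./ℕ p

    ∤⇒coprime : ∀ {d} → ¬ p ∣ d → Cop.Coprime d p
    ∤⇒coprime ¬d {i} (i∣d , i∣p) with prime⇒irreducible pr i∣p
    ... | inj₁ i≡1 = i≡1
    ... | inj₂ refl = ⊥-elim (¬d i∣d)

    -- Bézout inverts the denominator modulo `p`. The sign is that of Dwork's map, where `a + digit`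
    -- is a multiple of `p`.
    residue : ∀ {x} → Zp x → ∃ λ X → Div 1 (x + ι X)
    residue {x} (frac d n ¬d e) = step (Cop.coprime-Bézout (∤⇒coprime ¬d))
      where
      open ≡-Reasoning
      step : Bézout.Identity 1 d p → ∃ λ X → Div 1 (x + ι X)
      -- Here `u d ≡ 1`, so `r` is taken as a residue of `-n`.
      step (Bézout.+- u v eq) = r ℕ.* u , Div-unit (Unit-ι ¬d) (Div-resp (begin
          (- (ιℤ (ℤ.- n) - ι r)) + ι r * ι v * π
            ≡⟨ cong₂ (λ s t → (- (s - ι r)) + t) (ιℤ-neg n)
                 (solve 3 (λ r v p → r :* v :* p := r :* ((con 1ℚ :+ v :* p) :- con 1ℚ)) refl (ι r) (ι v) π) ⟩
          (- (- ιℤ n - ι r)) + ι r * ((1ℚ + ι v * π) - 1ℚ)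
            ≡⟨ cong (λ t → (- (- ιℤ n - ι r)) + ι r * (t - 1ℚ)) bezout ⟩
          (- (- ιℤ n - ι r)) + ι r * (ι u * ι d - 1ℚ)
            ≡⟨ solve 4 (λ n r u d → (:- (:- n :- r)) :+ r :* (u :* d :- con 1ℚ) := n :+ d :* (r :* u)) refl (ιℤ n)
                (ι r) (ι u) (ι d) ⟩
          ιℤ n + ι d * (ι r * ι u)
            ≡⟨ cong₂ (λ s t → s + ι d * t) (sym e) (sym (ι-* r u)) ⟩
          x * ι d + ι d * ι (r ℕ.* u)
            ≡⟨ solve 3 (λ x d t → x :* d :+ d :* t := d :* (x :+ t)) refl x (ι d) (ι (r ℕ.* u)) ⟩
          ι d * (x + ι (r ℕ.* u)) ∎)
          (Div-+ (Div-neg (proj₂ (residue-ℤ (ℤ.- n)))) (Div-multiple (ι r * ι v) (Zp-* (Zp-ι r) (Zp-ι v)))))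
        where
        r : ℕ
        r = proj₁ (residue-ℤ (ℤ.- n))
        bezout : 1ℚ + ι v * π ≡ ι u * ι d
        bezout = trans (cong (λ t → 1ℚ + t) (sym (ι-* v p))) (trans (sym (ι-+ 1 (v ℕ.* p))) (trans (cong ι eq) (ι-* u d)))
      -- Here `u d ≡ -1` already supplies the sign, so `r` is a residue of `n`.
      step (Bézout.-+ u v eq) = r ℕ.* u , Div-unit (Unit-ι ¬d) (Div-resp (begin
          (ιℤ n - ι r) + ι r * ι v * π
            ≡⟨ cong (λ t → (ιℤ n - ι r) + t) (*-assoc (ι r) (ι v) π) ⟩
          (ιℤ n - ι r) + ι r * (ι v * π)
            ≡⟨ cong (λ t → (ιℤ n - ι r) + ι r * t) (sym bezout) ⟩
          (ιℤ n - ι r) + ι r * (1ℚ + ι u * ι d)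
            ≡⟨ solve 4 (λ n r u d → (n :- r) :+ r :* (con 1ℚ :+ u :* d) := n :+ d :* (r :* u)) refl (ιℤ n) (ι r) (ι u)
                (ι d) ⟩
          ιℤ n + ι d * (ι r * ι u)
            ≡⟨ cong₂ (λ s t → s + ι d * t) (sym e) (sym (ι-* r u)) ⟩
          x * ι d + ι d * ι (r ℕ.* u)
            ≡⟨ solve 3 (λ x d t → x :* d :+ d :* t := d :* (x :+ t)) refl x (ι d) (ι (r ℕ.* u)) ⟩
          ι d * (x + ι (r ℕ.* u)) ∎)
          (Div-+ (proj₂ (residue-ℤ n)) (Div-multiple (ι r * ι v) (Zp-* (Zp-ι r) (Zp-ι v)))))
        where
        r : ℕ
        r = proj₁ (residue-ℤ n)
        bezout : 1ℚ + ι u * ι d ≡ ι v * π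
        bezout = trans (cong (λ t → 1ℚ + t) (sym (ι-* u d))) (trans (sym (ι-+ 1 (u ℕ.* d))) (trans (cong ι eq) (ι-* v p)))

    -- Digit by digit: the quotient of `x + X` by `p^s` is again integral, and its residue supplies
    -- the next digit.
    approximate : ∀ s {x} → Zp x → ∃ λ X → Div s (x + ι X)
    approximate zero    {x} z = 0 , Zp⇒Div (Zp-+ z Zp-0)
    approximate (suc s) {x} z = step (approximate s z)
      where
      open ≡-Reasoning
      refine : ∀ X q → x + ι X ≡ π^ s * q → (∃ λ Y → Div 1 (q + ι Y)) → ∃ λ X → Div (suc s) (x + ι X)
      refine X q e (Y , d) = X ℕ.+ p ℕ.^ s ℕ.* Y , Div-resp (begin
        π^ s * (q + ι Y)          ≡⟨ *-distribˡ-+ (π^ s) q (ι Y) ⟩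
        π^ s * q + π^ s * ι Y     ≡⟨ cong₂ _+_ (sym e) (trans (cong (_* ι Y) (sym (ι-^ s))) (sym (ι-* (p ℕ.^ s) Y))) ⟩
        x + ι X + ι (p ℕ.^ s ℕ.* Y) ≡⟨ +-assoc x (ι X) _ ⟩
        x + (ι X + ι (p ℕ.^ s ℕ.* Y)) ≡⟨ cong (λ t → x + t) (sym (ι-+ X _)) ⟩
        x + ι (X ℕ.+ p ℕ.^ s ℕ.* Y) ∎)
        (subst (λ t → Div t (π^ s * (q + ι Y))) (ℕₚ.+-comm s 1) (Div-* (Div-π^ s) d))
      step : (∃ λ X → Div s (x + ι X)) → ∃ λ X → Div (suc s) (x + ι X)
      step (X , mkDiv q zq e) = refine X q e (residue zq)

    p-part : ∀ n → n ≢ 0 → ∃₂ λ s m → n ≡ p ℕ.^ s ℕ.* m × ¬ p ∣ m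
    p-part = <-rec _ step
      where
      step : ∀ n → (∀ {k} → k ℕ.< n → k ≢ 0 → ∃₂ λ s m → k ≡ p ℕ.^ s ℕ.* m × ¬ p ∣ m) →
             n ≢ 0 → ∃₂ λ s m → n ≡ p ℕ.^ s ℕ.* m × ¬ p ∣ m
      step n rec n≢0 with p ∣? n
      ... | no ¬d = 0 , n , sym (ℕₚ.+-identityʳ n) , ¬d
      ... | yes (divides zero e) = ⊥-elim (n≢0 e)
      ... | yes (divides k@(suc _) refl) with rec (ℕₚ.m<m*n k p 1<p) (λ ())
      ... | s , m , e , ¬d = suc s , m , trans (cong (ℕ._* p) e)
          (trans (ℕₚ.*-comm (p ℕ.^ s ℕ.* m) p) (sym (ℕₚ.*-assoc p (p ℕ.^ s) m))) , ¬d

    -- The cofactor `m` is a unit, so only the p-part of `n` has to be cancelled. In this form the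
    -- Gauss congruences yield integrality.
    Div-by : ∀ {s m n x} → n ≡ p ℕ.^ s ℕ.* m → ¬ p ∣ m → Div s (ι n * x) → Zp x
    Div-by {s} {m} {n} {x} e₀ ¬d (mkDiv q zq e) = Div⇒Zp {0} (Div-unit (Unit-ι ¬d) (Zp⇒Div (subst Zp (sym eq) zq)))
      where
      eq : ι m * x ≡ q
      eq = *-cancel (ι m * x) q (qpow≢0 s π≢0) (trans (sym (*-assoc (π^ s) (ι m) x))
        (trans (cong (_* x) (trans (cong (_* ι m) (sym (ι-^ s))) (trans (sym (ι-* (p ℕ.^ s) m)) (cong ι (sym e₀))))) e))

    -- Allows the arbitrary constant in `PIntegral` to be replaced by a power of `p`. Up to sign,
    -- `y` is the denominator of `c` divided by the prime-to-p part of its numerator.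
    π^-multiple : ∀ {c} → c ≢ 0ℚ → ∃₂ λ k y → Zp y × π^ k ≡ y * c
    π^-multiple {c} c≢0 = step (p-part ℤ.∣ z ∣ (λ e → c≢0 (zero-num c e)))
      where
      open ≡-Reasoning
      z : ℤ
      z = ℚ.numerator c
      zero-num : ∀ c → ℤ.∣ ℚ.numerator c ∣ ≡ 0 → c ≡ 0ℚ
      zero-num c e = *-cancel c 0ℚ (ι-suc≢0 (ℚ.denominator-1 c)) (trans (*-comm _ c) (trans (*-denominator c)
        (trans (cong ιℤ (ℤₚ.∣i∣≡0⇒i≡0 {ℚ.numerator c} e)) (sym (*-zeroʳ (ι (suc (ℚ.denominator-1 c))))))))
      den : ℕ
      den = ℚ.denominatorℕ c
      abs-sign : ∀ z → ∃ λ s → + ℤ.∣ z ∣ ≡ s ℤ.* z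
      abs-sign (+ n)    = + 1 , sym (ℤₚ.*-identityˡ (+ n))
      abs-sign -[1+ n ] = ℤ.- (+ 1) , sym (ℤₚ.-1*i≡-i -[1+ n ])
      sign : ℤ
      sign = proj₁ (abs-sign z)
      signed : + ℤ.∣ z ∣ ≡ sign ℤ.* z
      signed = proj₂ (abs-sign z)
      step : (∃₂ λ s m → ℤ.∣ z ∣ ≡ p ℕ.^ s ℕ.* m × ¬ p ∣ m) → ∃₂ λ k y → Zp y × π^ k ≡ y * c
      step (k , m , e , ¬d) = k , inv (ι m) * (ιℤ sign * ι den) , Zp-* (Unit-inv (Unit-ι ¬d))
          (Zp-* (Zp-ιℤ sign) (Zp-ι den)) , (begin
        π^ k                                ≡⟨ sym (*-identityʳ (π^ k)) ⟩
        π^ k * 1ℚ                           ≡⟨ cong (π^ k *_) (sym (inv-right (ι≢0 ¬d))) ⟩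
        π^ k * (ι m * inv (ι m))            ≡⟨ solve 3 (λ a b c → a :* (b :* c) := c :* (a :* b)) refl (π^ k) (ι m)
            (inv (ι m)) ⟩
        inv (ι m) * (π^ k * ι m)            ≡⟨ cong (inv (ι m) *_)
            (trans (cong (_* ι m) (sym (ι-^ k))) (trans (sym (ι-* (p ℕ.^ k) m)) (cong ι (sym e)))) ⟩
        inv (ι m) * ι ℤ.∣ z ∣               ≡⟨ cong (inv (ι m) *_) (trans (cong ιℤ signed) (ιℤ-* sign z)) ⟩
        inv (ι m) * (ιℤ sign * ιℤ z)        ≡⟨ cong (λ t → inv (ι m) * (ιℤ sign * t)) (sym (*-denominator c)) ⟩
        inv (ι m) * (ιℤ sign * (c * ι den)) ≡⟨ solve 4 (λ i s c d → i :* (s :* (c :* d)) := i :* (s :* d) :* c) refl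
            (inv (ι m)) (ιℤ sign) c (ι den) ⟩
        inv (ι m) * (ιℤ sign * ι den) * c ∎)

    ·-Zp : ∀ {f g} → (∀ n → Zp (f n)) → (∀ n → Zp (g n)) → ∀ n → Zp ((f · g) n)
    ·-Zp {f} {g} zf zg n = subst Zp (sym (·-at f g n)) (Zp-sum (suc n) (λ i _ → Zp-* (zf i) (zg (n ℕ.∸ i))))

-- The congruence `f(z)^p ≡ f(z^p)` and its refinement to prime powers.

module FrobeniusLift where

  open import Data.Nat.Divisibility using (_∣_; divides; m∣m*n; ∣⇒≤)
  open import Data.Nat.Primality using (Prime; euclidsLemma)
  open import Data.Nat.Combinatorics using (_C_; nCn≡1; nCk≡n!/k![n-k]!; k![n∸k]!∣n!)
  open import Data.Nat.DivMod using (m/n*n≡m)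
  open import Data.Nat.Properties using (_!*_!≢0)
  open import Data.Fin as Fin using (Fin; toℕ; fromℕ; inject₁)
  import Data.Fin.Properties as Finₚ
  open import Data.Rational using (_+_; _*_; _-_; -_)
  open import Data.Rational.Properties
  import Algebra.Properties.CommutativeSemiring.Binomial as Binomial
  import Algebra.Properties.Monoid.Sum as MonoidSum
  import Algebra.Properties.Semiring.Exp as Exp
  import Algebra.Properties.Monoid.Mult as Mult
  open FormalSeries
  open Composition
  open LagrangeInversion
  open PAdicIntegers

  open QSol using (solve; _:+_; _:*_; _:-_; :-_; con; _:=_)

  δ₁-· : ∀ f n → (δ₁ · f) (suc n) ≡ f n
  δ₁-· f n = trans (Substitution.w·-suc δ₁ refl f n)
      (trans (at (·-congʳ f {tail δ₁} {δ₀} (mk≈ λ { zero → refl ; (suc _) → refl })) n) (at (·-identityˡ f) n))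

  δ₁^-at : ∀ k → (δ₁ ^ k) k ≡ 1ℚ
  δ₁^-at zero    = refl
  δ₁^-at (suc k) = trans (δ₁-· (δ₁ ^ k) k) (δ₁^-at k)

  δ₁^-off : ∀ k n → n ≢ k → (δ₁ ^ k) n ≡ 0ℚ
  δ₁^-off zero    zero    ne = ⊥-elim (ne refl)
  δ₁^-off zero    (suc n) ne = refl
  δ₁^-off (suc k) zero    ne = Substitution.w·-zero δ₁ refl (δ₁ ^ k)
  δ₁^-off (suc k) (suc n) ne = trans (δ₁-· (δ₁ ^ k) n) (δ₁^-off k n (ne ∘ cong suc))

  sum-pick : ∀ N k (f : ℕ → ℚ) → k ℕ.< N → (∀ i → i ≢ k → f i ≡ 0ℚ) → sumTo N f ≡ f k
  sum-pick (suc N) k f k<sN z with k ℕ.≟ N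
  ... | yes refl = trans (cong (_+ f N) (sum-0 N (λ i i<N → z i (ℕₚ.<⇒≢ i<N)))) (+-identityˡ (f N))
  ... | no ne    = trans (cong₂ _+_ (sum-pick N k f (ℕₚ.≤∧≢⇒< (ℕₚ.≤-pred k<sN) ne) z) (z N (ne ∘ sym))) (+-identityʳ (f k))

  ∙-^ : ∀ c f k → ((c ∙ f) ^ k) ≈ (qpow c k ∙ f ^ k)
  ∙-^ c f zero    = mk≈ λ n → sym (trans (∙-at 1ℚ δ₀ n) (*-identityˡ (δ₀ n)))
  ∙-^ c f (suc k) = ≈-trans (·-congˡ (c ∙ f) (∙-^ c f k))
      (≈-trans (∙-· c f _) (≈-trans (∙-cong c (∙-·ʳ (qpow c k) f (f ^ k)))
    (mk≈ λ n → trans (∙-at c _ n) (trans (cong (c *_) (∙-at (qpow c k) (f · f ^ k) n))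
      (trans (solve 3 (λ c q x → c :* (q :* x) := (q :* c) :* x) refl c (qpow c k) ((f · f ^ k) n))
          (sym (∙-at (qpow c (suc k)) (f ^ suc k) n)))))))

  ^-at-0 : ∀ f k → (f ^ k) 0 ≡ qpow (f 0) k
  ^-at-0 f zero    = refl
  ^-at-0 f (suc k) = trans (·-zero f (f ^ k)) (trans (cong (f 0 *_) (^-at-0 f k)) (*-comm (f 0) (qpow (f 0) k)))

  module Frobenius (p : ℕ) (pr : Prime p) where

    open Integrality p pr

    record ZpS (f : Series) : Set where
      constructor mkZpS
      field zpAt : ∀ n → Zp (f n)
    open ZpS public

    record DivS (s : ℕ) (f : Series) : Set where
      constructor mkDivS
      field divAt : ∀ n → Div s (f n)
    open DivS public

    ZpS-· : ∀ {f g} → ZpS f → ZpS g → ZpS (f · g)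
    ZpS-· zf zg = mkZpS (·-Zp (zpAt zf) (zpAt zg))

    ZpS-δ₀ : ZpS δ₀
    ZpS-δ₀ = mkZpS λ { zero → Zp-1 ; (suc _) → Zp-0 }

    ZpS-^ : ∀ {f} k → ZpS f → ZpS (f ^ k)
    ZpS-^ zero    zf = ZpS-δ₀
    ZpS-^ (suc k) zf = ZpS-· zf (ZpS-^ k zf)

    ZpS-⊕ : ∀ {f g} → ZpS f → ZpS g → ZpS (f ⊕ g)
    ZpS-⊕ {f} {g} zf zg = mkZpS λ n → subst Zp (sym (⊕-at f g n)) (Zp-+ (zpAt zf n) (zpAt zg n))

    ZpS-∙ : ∀ {c f} → Zp c → ZpS f → ZpS (c ∙ f)
    ZpS-∙ {c} {f} zc zf = mkZpS λ n → subst Zp (sym (∙-at c f n)) (Zp-* zc (zpAt zf n))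

    DivS-resp : ∀ {s f g} → f ≈ g → DivS s f → DivS s g
    DivS-resp e d = mkDivS λ n → Div-resp (at e n) (divAt d n)

    DivS-⊕ : ∀ {s f g} → DivS s f → DivS s g → DivS s (f ⊕ g)
    DivS-⊕ {f = f} {g} df dg = mkDivS λ n → Div-resp (sym (⊕-at f g n)) (Div-+ (divAt df n) (divAt dg n))

    DivS-∙′ : ∀ {s c f} → Div s c → ZpS f → DivS s (c ∙ f)
    DivS-∙′ {c = c} {f} dc zf = mkDivS λ n → Div-resp (sym (∙-at c f n)) (Div-*ʳ dc (zpAt zf n))

    DivS-0 : ∀ {s} → DivS s 0S
    DivS-0 = mkDivS λ _ → Div-0

    DivS-·ˡ : ∀ {s f g} → ZpS f → DivS s g → DivS s (f · g)
    DivS-·ˡ {s} {f} {g} zf dg = mkDivS λ n → Div-resp (sym (·-at f g n))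
      (Div-sum s (suc n) (λ i _ → Div-*ˡ (zpAt zf i) (divAt dg (n ℕ.∸ i))))

    DivS-·ʳ : ∀ {s f g} → DivS s f → ZpS g → DivS s (f · g)
    DivS-·ʳ {s} {f} {g} df zg = DivS-resp (·-comm g f) (DivS-·ˡ zg df)

    DivS-· : ∀ {s t f g} → DivS s f → DivS t g → DivS (s ℕ.+ t) (f · g)
    DivS-· {s} {t} {f} {g} df dg = mkDivS λ n → Div-resp (sym (·-at f g n))
      (Div-sum (s ℕ.+ t) (suc n) (λ i _ → Div-* (divAt df i) (divAt dg (n ℕ.∸ i))))

    ⊖-self : ∀ f → (f ⊖ f) ≈ 0S
    ⊖-self f = SR.-‿inverseʳ f

    DivS-refl : ∀ {s} f → DivS s (f ⊖ f)
    DivS-refl f = DivS-resp (≈-sym (⊖-self f)) DivS-0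

    DivS-trans : ∀ {s f g h} → DivS s (f ⊖ g) → DivS s (g ⊖ h) → DivS s (f ⊖ h)
    DivS-trans {s} {f} {g} {h} a b = DivS-resp
      (SSol.solve 3 (λ f g h → (f SSol.:- g) SSol.:+ (g SSol.:- h) SSol.:= f SSol.:- h) ≈-refl f g h) (DivS-⊕ a b)

    DivS-⊕-cong : ∀ {s f f′ g g′} → DivS s (f ⊖ f′) → DivS s (g ⊖ g′) → DivS s ((f ⊕ g) ⊖ (f′ ⊕ g′))
    DivS-⊕-cong {s} {f} {f′} {g} {g′} a b = DivS-resp
      (SSol.solve 4 (λ f f′ g g′ → (f SSol.:- f′) SSol.:+ (g SSol.:- g′) SSol.:= (f SSol.:+ g) SSol.:-
          (f′ SSol.:+ g′)) ≈-refl f f′ g g′) (DivS-⊕ a b)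

    DivS-·-cong : ∀ {s f f′ g g′} → ZpS f → ZpS g′ → DivS s (f ⊖ f′) → DivS s (g ⊖ g′) → DivS s (f · g ⊖ f′ · g′)
    DivS-·-cong {s} {f} {f′} {g} {g′} zf zg′ a b = DivS-resp
      (SSol.solve 4 (λ f f′ g g′ → f SSol.:* (g SSol.:- g′) SSol.:+ (f SSol.:- f′) SSol.:* g′ SSol.:= f SSol.:* g
          SSol.:- f′ SSol.:* g′) ≈-refl f f′ g g′)
      (DivS-⊕ (DivS-·ˡ zf b) (DivS-·ʳ a zg′))

    ⊖-cong : ∀ {f f′ g g′} → f ≈ f′ → g ≈ g′ → (f ⊖ g) ≈ (f′ ⊖ g′)
    ⊖-cong d e = ⊕-cong d (⊝-cong e)

    DivS-at : ∀ {s f g} → DivS s (f ⊖ g) → ∀ n → Div s (f n - g n)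
    DivS-at {f = f} {g} d n = Div-resp (trans (⊕-at f (⊝ g) n) (cong (f n +_) (⊝-at g n))) (divAt d n)

    DivS-from : ∀ {s f g} → (∀ n → Div s (f n - g n)) → DivS s (f ⊖ g)
    DivS-from {f = f} {g} d = mkDivS λ n → Div-resp (sym (trans (⊕-at f (⊝ g) n) (cong (f n +_) (⊝-at g n)))) (d n)

    DivS-^ : ∀ {s f g} k → ZpS f → ZpS g → DivS s (f ⊖ g) → DivS s (f ^ k ⊖ g ^ k)
    DivS-^ zero    zf zg d = DivS-refl δ₀
    DivS-^ (suc k) zf zg d = DivS-·-cong zf (ZpS-^ k zg) d (DivS-^ k zf zg d)

    private
      -- The cofactor `Σ f^i g^(k-1-i)` of `f - g` in `f^k - g^k`.
      quotient : Series → Series → ℕ → Series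
      quotient f g zero    = 0S
      quotient f g (suc k) = f · quotient f g k ⊕ g ^ k

      quotient-eq : ∀ f g k → (f ^ k ⊖ g ^ k) ≈ ((f ⊖ g) · quotient f g k)
      quotient-eq f g zero    = ≈-trans (⊖-self δ₀) (≈-sym (SR.zeroʳ (f ⊖ g)))
      quotient-eq f g (suc k) = ≈-trans
        (SSol.solve 4 (λ f g F G → f SSol.:* F SSol.:- g SSol.:* G SSol.:= f SSol.:* (F SSol.:- G) SSol.:+
            (f SSol.:- g) SSol.:* G) ≈-refl f g (f ^ k) (g ^ k))
        (≈-trans (⊕-cong (·-congˡ f (quotient-eq f g k)) ≈-refl)
        (SSol.solve 4 (λ f g q G → f SSol.:* ((f SSol.:- g) SSol.:* q) SSol.:+ (f SSol.:- g) SSol.:* G SSol.:=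
            (f SSol.:- g) SSol.:* (f SSol.:* q SSol.:+ G)) ≈-refl f g (quotient f g k) (g ^ k)))

      -- Modulo `p` all summands become the same power of `g`; with `p` summands the cofactor is
      -- therefore divisible by `p`.
      quotient-cong : ∀ {f g} k → ZpS f → ZpS g → DivS 1 (f ⊖ g) → DivS 1 (quotient f g (suc k) ⊖ (ι (suc k) ∙ g ^ k))
      quotient-cong {f} {g} zero zf zg d = DivS-resp (≈-sym (≈-trans
        (⊖-cong (≈-trans (⊕-cong (SR.zeroʳ f) ≈-refl) (SR.+-identityˡ δ₀)) (1∙ δ₀)) (⊖-self δ₀))) DivS-0
      quotient-cong {f} {g} (suc k) zf zg d = DivS-resp (⊖-cong ≈-refl
        (≈-trans (⊕-cong (∙-·ʳ (ι (suc k)) g (g ^ k)) ≈-refl)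
            (≈-trans (SR.+-comm _ _) (≈-sym (ι-∙-suc (suc k) (g ^ suc k))))))
        (DivS-⊕-cong (DivS-·-cong zf (ZpS-∙ (Zp-ι (suc k)) (ZpS-^ k zg)) d (quotient-cong k zf zg d))
            (DivS-refl (g ^ suc k)))

      p≡suc : ∃ λ k → p ≡ suc k
      p≡suc = ℕ.pred p , sym (ℕₚ.suc-pred p {{ℕ.>-nonZero (ℕₚ.<-trans (s≤s z≤n) 1<p)}})

    -- The extra factor `p` comes from the cofactor of `f - g` in `f^p - g^p`.
    DivS-lift : ∀ {s f g} → ZpS f → ZpS g → DivS (suc s) (f ⊖ g) → DivS (suc (suc s)) (f ^ p ⊖ g ^ p)
    DivS-lift {s} {f} {g} zf zg d = subst (λ t → DivS t (f ^ p ⊖ g ^ p)) (ℕₚ.+-comm (suc s) 1)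
      (DivS-resp (≈-sym (quotient-eq f g p)) (DivS-· d q-div))
      where
      d₁ : DivS 1 (f ⊖ g)
      d₁ = mkDivS λ n → Div-mono (s≤s z≤n) (divAt d n)
      q-div : DivS 1 (quotient f g p)
      q-div = subst (λ t → DivS 1 (quotient f g t)) (sym (proj₂ p≡suc)) (DivS-resp
        (SSol.solve 2 (λ a b → (a SSol.:- b) SSol.:+ b SSol.:= a) ≈-refl (quotient f g (suc k)) (ι (suc k) ∙ g ^ k))
        (DivS-⊕ (quotient-cong k zf zg d₁)
            (DivS-∙′ (subst (λ t → Div 1 (ι t)) (proj₂ p≡suc) (Div-resp (*-identityˡ π) (Div-multiple 1ℚ Zp-1)))
            (ZpS-^ k zg))))
        where
        k : ℕ
        k = proj₁ p≡suc

    DivS-lift-iterate : ∀ r {f g} → ZpS f → ZpS g → DivS 1 (f ⊖ g) → DivS (suc r) (f ^ (p ℕ.^ r) ⊖ g ^ (p ℕ.^ r))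
    DivS-lift-iterate zero zf zg d = DivS-resp (⊖-cong (≈-sym (SR.*-identityʳ _)) (≈-sym (SR.*-identityʳ _))) d
    DivS-lift-iterate (suc r) {f} {g} zf zg d = DivS-resp (⊖-cong (≈-sym (^-* f p (p ℕ.^ r))) (≈-sym (^-* g p (p ℕ.^ r))))
      (DivS-lift (ZpS-^ (p ℕ.^ r) zf) (ZpS-^ (p ℕ.^ r) zg) (DivS-lift-iterate r zf zg d))

    ∤-! : ∀ k → k ℕ.< p → ¬ p ∣ k ℕ.!
    ∤-! zero    _   = p∤1
    ∤-! (suc k) k<p = ∣-* (λ d → ℕₚ.<-irrefl refl (ℕₚ.<-≤-trans k<p (∣⇒≤ d))) (∤-! k (ℕₚ.<-trans (ℕₚ.n<1+n k) k<p))

    -- `p` divides `p!` but neither `k!` nor `(p - k)!`.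
    p∣C : ∀ k → 0 ℕ.< k → k ℕ.< p → p ∣ p C k
    p∣C k 0<k k<p = [ (λ d → d) , (λ d → ⊥-elim (∣-* (∤-! k k<p) (∤-! (p ℕ.∸ k) (ℕₚ.∸-monoʳ-< 0<k (ℕₚ.<⇒≤ k<p))) d)) ]′
      (euclidsLemma (p C k) (k ℕ.! ℕ.* (p ℕ.∸ k) ℕ.!) pr (subst (p ∣_) (sym eq) p∣p!))
      where
      instance
        nz : ℕ.NonZero (k ℕ.! ℕ.* (p ℕ.∸ k) ℕ.!)
        nz = k !* (p ℕ.∸ k) !≢0
      eq : (p C k) ℕ.* (k ℕ.! ℕ.* (p ℕ.∸ k) ℕ.!) ≡ p ℕ.!
      eq = trans (cong (ℕ._* (k ℕ.! ℕ.* (p ℕ.∸ k) ℕ.!)) (nCk≡n!/k![n-k]! (ℕₚ.<⇒≤ k<p))) (m/n*n≡m (k![n∸k]!∣n! (ℕₚ.<⇒≤ k<p)))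
      p∣p! : p ∣ p ℕ.!
      p∣p! = subst (λ t → t ∣ t ℕ.!) (sym (proj₂ p≡suc)) (m∣m*n (proj₁ p≡suc ℕ.!))

    private
      module B = Binomial SR.commutativeSemiring
      module S = MonoidSum SR.+-monoid
      module E = Exp SR.semiring
      module M = Mult SR.+-monoid

      ×-∙ : ∀ n f → (n M.× f) ≈ (ι n ∙ f)
      ×-∙ zero    f = ≈-sym (0∙ f)
      ×-∙ (suc n) f = ≈-trans (⊕-cong ≈-refl (×-∙ n f)) (≈-sym (ι-∙-suc n f))

      E-^ : ∀ f k → (f E.^ k) ≈ (f ^ k)
      E-^ f zero    = ≈-refl
      E-^ f (suc k) = ·-congˡ f (E-^ f k)

      DivS-sum : ∀ n (t : Fin n → Series) → (∀ i → DivS 1 (t i)) → DivS 1 (S.sum t)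
      DivS-sum zero    t d = DivS-0
      DivS-sum (suc n) t d = DivS-⊕ (d Fin.zero) (DivS-sum n (t ∘ Fin.suc) (d ∘ Fin.suc))

      outer : ∀ n (t : Fin (suc (suc n)) → Series) → (∀ (i : Fin n) → DivS 1 (t (Fin.suc (inject₁ i)))) →
        DivS 1 (S.sum t ⊖ (t (Fin.suc (fromℕ n)) ⊕ t Fin.zero))
      outer n t d = DivS-resp (≈-trans
        (SSol.solve 3 (λ a m l → m SSol.:= (a SSol.:+ (m SSol.:+ l)) SSol.:- (l SSol.:+ a)) ≈-refl (t Fin.zero) _
            (t (Fin.suc (fromℕ n))))
        (⊖-cong (⊕-cong ≈-refl (≈-sym (S.sum-init-last (t ∘ Fin.suc)))) ≈-refl))
        (DivS-sum n (λ i → t (Fin.suc (inject₁ i))) d)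

    freshman : ∀ {f g} → ZpS f → ZpS g → DivS 1 ((f ⊕ g) ^ p ⊖ (f ^ p ⊕ g ^ p))
    freshman {f} {g} zf zg = DivS-resp (⊖-cong (≈-trans (≈-sym (B.theorem p f g)) (E-^ (f ⊕ g) p)) ≈-refl)
      (subst (λ t → DivS 1 (B.binomialExpansion f g t ⊖ (f ^ t ⊕ g ^ t))) (sym (proj₂ p≡suc))
        (DivS-resp (⊖-cong ≈-refl (⊕-cong last first)) (outer k (B.binomialTerm f g (suc k)) middle)))
      where
      k : ℕ
      k = proj₁ p≡suc
      last : B.binomialTerm f g (suc k) (Fin.suc (fromℕ k)) ≈ (f ^ suc k)
      last = ≈-trans (×-∙ (suc k C suc (toℕ (fromℕ k))) _) (≈-trans
        (SR.reflexive (cong₂ (λ c e → ι c ∙ (f E.^ suc (toℕ (fromℕ k)) · g E.^ e)) C≡1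
            (trans (cong (k ℕ.∸_) (Finₚ.toℕ-fromℕ k)) (ℕₚ.n∸n≡0 k))))
        (≈-trans (1∙ _) (≈-trans (SR.*-identityʳ _)
            (≈-trans (SR.reflexive (cong (λ e → f E.^ suc e) (Finₚ.toℕ-fromℕ k))) (E-^ f (suc k))))))
        where
        C≡1 : suc k C suc (toℕ (fromℕ k)) ≡ 1
        C≡1 = trans (cong (λ e → suc k C suc e) (Finₚ.toℕ-fromℕ k)) (nCn≡1 (suc k))
      first : B.binomialTerm f g (suc k) Fin.zero ≈ (g ^ suc k)
      first = ≈-trans (×-∙ 1 _) (≈-trans (1∙ _) (≈-trans (·-identityˡ _) (E-^ g (suc k))))
      middle : ∀ (i : Fin k) → DivS 1 (B.binomialTerm f g (suc k) (Fin.suc (inject₁ i)))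
      middle i = DivS-resp (≈-sym (≈-trans (×-∙ (suc k C j) (f E.^ j · g E.^ (suc k ℕ.∸ j)))
          (∙-cong _ (·-cong (E-^ f j) (E-^ g (suc k ℕ.∸ j))))))
        (DivS-∙′ (divisible (subst (λ t → p ∣ t C j) (proj₂ p≡suc) (p∣C j (s≤s z≤n) j<p)))
            (ZpS-· (ZpS-^ j zf) (ZpS-^ (suc k ℕ.∸ j) zg)))
        where
        j : ℕ
        j = suc (toℕ (inject₁ i))
        j<p : j ℕ.< p
        j<p = subst (j ℕ.<_) (sym (proj₂ p≡suc)) (s≤s (subst (ℕ._< k) (sym (Finₚ.toℕ-inject₁ i)) (Finₚ.toℕ<n i)))
        divisible : ∀ {n} → p ∣ n → Div 1 (ι n)
        divisible (divides q refl) = Div-resp (sym (ι-* q p)) (Div-multiple (ι q) (Zp-ι q))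

    private
      const-at-0 : ∀ c → const c 0 ≡ c
      const-at-0 c = trans (∙-at c δ₀ 0) (*-identityʳ c)

      ZpS-const : ∀ {c} → Zp c → ZpS (const c)
      ZpS-const zc = ZpS-∙ zc ZpS-δ₀

      -- Induction on `X`, where `(1 + X)^p ≡ 1 + X^p` is `freshman` for constant series, read in
      -- degree 0.
      fermat-ℕ : ∀ X → Div 1 (qpow (ι X) p - ι X)
      fermat-ℕ zero = subst (λ t → Div 1 (qpow (ι 0) t - ι 0)) (sym (proj₂ p≡suc))
        (Div-resp (sym (trans (cong (_- ι 0) (*-zeroʳ (qpow (ι 0) (proj₁ p≡suc)))) refl)) Div-0)
      fermat-ℕ (suc X) = Div-resp eq (Div-+ (DivS-at (freshman (ZpS-const Zp-1) (ZpS-const (Zp-ι X))) 0) (fermat-ℕ X))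
        where
        open ≡-Reasoning
        pw : ∀ c → (const c ^ p) 0 ≡ qpow c p
        pw c = trans (^-at-0 (const c) p) (cong (λ t → qpow t p) (const-at-0 c))
        qpow-1 : ∀ n → qpow 1ℚ n ≡ 1ℚ
        qpow-1 zero    = refl
        qpow-1 (suc n) = trans (*-identityʳ _) (qpow-1 n)
        sumpow : ((const 1ℚ ⊕ const (ι X)) ^ p) 0 ≡ qpow (ι (suc X)) p
        sumpow = trans (^-at-0 _ p) (cong (λ t → qpow t p) (trans (⊕-at (const 1ℚ) (const (ι X)) 0)
          (trans (cong₂ _+_ (const-at-0 1ℚ) (const-at-0 (ι X))) (sym (ι-suc X)))))
        eq : (((const 1ℚ ⊕ const (ι X)) ^ p) 0 - (const 1ℚ ^ p ⊕ const (ι X) ^ p) 0) + (qpow (ι X) p - ι X) ≡ qpow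
            (ι (suc X)) p - ι (suc X)
        eq = begin
          (((const 1ℚ ⊕ const (ι X)) ^ p) 0 - (const 1ℚ ^ p ⊕ const (ι X) ^ p) 0) + (qpow (ι X) p - ι X)
            ≡⟨ cong₂ (λ s t → (s - t) + (qpow (ι X) p - ι X)) sumpow
                (trans (⊕-at _ _ 0) (cong₂ _+_ (trans (pw 1ℚ) (qpow-1 p)) (pw (ι X)))) ⟩
          (qpow (ι (suc X)) p - (1ℚ + qpow (ι X) p)) + (qpow (ι X) p - ι X)
            ≡⟨ solve 3 (λ s q x → (s :- (con 1ℚ :+ q)) :+ (q :- x) := s :- (con 1ℚ :+ x)) refl (qpow (ι (suc X)) p)
                (qpow (ι X) p) (ι X) ⟩
          qpow (ι (suc X)) p - (1ℚ + ι X)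
            ≡⟨ cong (λ t → qpow (ι (suc X)) p - t) (sym (ι-suc X)) ⟩
          qpow (ι (suc X)) p - ι (suc X) ∎

    Div-qpow : ∀ {s x y} k → Zp x → Zp y → Div s (x - y) → Div s (qpow x k - qpow y k)
    Div-qpow zero    zx zy d = Div-resp (sym (+-inverseʳ 1ℚ)) Div-0
    Div-qpow {x = x} {y} (suc k) zx zy d = Div-*-cong (Zp-qpow k) zy (Div-qpow k zx zy d) d
      where
      Zp-qpow : ∀ k → Zp (qpow x k)
      Zp-qpow zero    = Zp-1
      Zp-qpow (suc k) = Zp-* (Zp-qpow k) zx

    fermat : ∀ {c} → Zp c → Div 1 (qpow c p - c)
    fermat {c} zc = step (residue (Zp-neg zc))
      where
      step : (∃ λ X → Div 1 (- c + ι X)) → Div 1 (qpow c p - c)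
      step (X , d) = Div-trans (qpow c p) (qpow (ι X) p) c (Div-qpow p zc (Zp-ι X) (Div-swap (ι X) c d′))
        (Div-trans (qpow (ι X) p) (ι X) c (fermat-ℕ X) d′)
        where
        d′ : Div 1 (ι X - c)
        d′ = Div-resp (+-comm (- c) (ι X)) d

    private
      z^p₀ : (δ₁ ^ p) 0 ≡ 0ℚ
      z^p₀ = δ₁^-off p 0 (λ e → ℕₚ.<⇒≢ (ℕₚ.<-trans (s≤s z≤n) 1<p) e)

    open Substitution (δ₁ ^ p) z^p₀ public using () renaming
      (sub to stretch; sub-· to stretch-·; sub-⊕ to stretch-⊕; sub-∙ to stretch-∙; sub-^ to stretch-^; sub-cong to
          stretch-cong)

    stretch-at : ∀ f n → stretch f (n ℕ.* p) ≡ f n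
    stretch-at f n = trans (Substitution.sub-at (δ₁ ^ p) z^p₀ f (n ℕ.* p)) (trans
      (sum-pick (suc (n ℕ.* p)) n _ (s≤s (ℕₚ.m≤m*n n p {{ℕ.>-nonZero (ℕₚ.<-trans (s≤s z≤n) 1<p)}}))
        (λ i ne → trans (cong (f i *_) (trans (sym (at (^-* δ₁ i p) (n ℕ.* p))) (δ₁^-off (i ℕ.* p) (n ℕ.* p)
           (λ e → ne (sym (ℕₚ.*-cancelʳ-≡ n i p {{ℕ.>-nonZero (ℕₚ.<-trans (s≤s z≤n) 1<p)}} e)))))) (*-zeroʳ (f i))))
      (trans (cong (f n *_) (trans (sym (at (^-* δ₁ n p) (n ℕ.* p))) (δ₁^-at (n ℕ.* p)))) (*-identityʳ (f n))))

    stretch-off : ∀ f n → ¬ p ∣ n → stretch f n ≡ 0ℚ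
    stretch-off f n ¬d = trans (Substitution.sub-at (δ₁ ^ p) z^p₀ f n) (sum-0 (suc n) (λ i _ →
      trans (cong (f i *_) (trans (sym (at (^-* δ₁ i p) n)) (δ₁^-off (i ℕ.* p) n (λ e → ¬d (divides i e)))))
          (*-zeroʳ (f i))))

    -- Truncation written as a finite sum of monomials, the form to which `freshman` applies one
    -- term at a time.
    trunc : Series → ℕ → Series
    trunc f zero    = 0S
    trunc f (suc N) = trunc f N ⊕ (f N ∙ δ₁ ^ N)

    trunc-≥ : ∀ f N i → N ℕ.≤ i → trunc f N i ≡ 0ℚ
    trunc-≥ f zero    i _   = refl
    trunc-≥ f (suc N) i N<i = trans (⊕-at _ _ i) (cong₂ _+_ (trunc-≥ f N i (ℕₚ.<⇒≤ N<i))
      (trans (∙-at (f N) (δ₁ ^ N) i) (trans (cong (f N *_) (δ₁^-off N i (ℕₚ.>⇒≢ N<i))) (*-zeroʳ (f N)))))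

    trunc-< : ∀ f N i → i ℕ.< N → trunc f N i ≡ f i
    trunc-< f (suc N) i i<sN with i ℕ.≟ N
    ... | yes refl = trans (⊕-at _ _ i) (trans (cong₂ _+_ (trunc-≥ f i i ℕₚ.≤-refl)
            (trans (∙-at (f i) (δ₁ ^ i) i) (trans (cong (f i *_) (δ₁^-at i)) (*-identityʳ (f i))))) (+-identityˡ (f i)))
    ... | no ne = trans (⊕-at _ _ i) (trans (cong₂ _+_ (trunc-< f N i (ℕₚ.≤∧≢⇒< (ℕₚ.≤-pred i<sN) ne))
            (trans (∙-at (f N) (δ₁ ^ N) i) (trans (cong (f N *_) (δ₁^-off N i ne)) (*-zeroʳ (f N))))) (+-identityʳ (f i)))

    ZpS-δ₁^ : ∀ k → ZpS (δ₁ ^ k)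
    ZpS-δ₁^ k = ZpS-^ k (mkZpS λ { zero → Zp-0 ; (suc zero) → Zp-1 ; (suc (suc _)) → Zp-0 })

    ZpS-trunc : ∀ {f} N → (∀ i → i ℕ.< N → Zp (f i)) → ZpS (trunc f N)
    ZpS-trunc zero    zf = mkZpS λ _ → Zp-0
    ZpS-trunc (suc N) zf = ZpS-⊕ (ZpS-trunc N (λ i i<N → zf i (ℕₚ.m<n⇒m<1+n i<N))) (ZpS-∙ (zf N ℕₚ.≤-refl) (ZpS-δ₁^ N))

    private
      stretch-0S : stretch 0S ≈ 0S
      stretch-0S = ≈-trans (stretch-cong (≈-sym (0∙ 0S))) (≈-trans (stretch-∙ (ι 0) 0S) (0∙ _))

      stretch-δ₁^ : ∀ N → stretch (δ₁ ^ N) ≈ ((δ₁ ^ p) ^ N)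
      stretch-δ₁^ N = ≈-trans (stretch-^ δ₁ N) (^-cong N (≈-trans (Substitution.sub-step (δ₁ ^ p) z^p₀ δ₁)
        (≈-trans (⊕-cong const-0 (≈-trans
            (·-congˡ (δ₁ ^ p) (≈-trans (stretch-cong {tail δ₁} {δ₀} (mk≈ λ { zero → refl ; (suc _) → refl }))
          (Substitution.sub-δ₀ (δ₁ ^ p) z^p₀))) (SR.*-identityʳ _))) (SR.+-identityˡ _))))

      frobenius-trunc : ∀ {f} N → ZpS f → DivS 1 (trunc f N ^ p ⊖ stretch (trunc f N))
      frobenius-trunc zero zf = DivS-resp
          (≈-sym (≈-trans (⊖-cong (≈-trans (SR.reflexive (cong (0S ^_) (proj₂ p≡suc))) (SR.zeroˡ _)) stretch-0S)
          (⊖-self 0S))) DivS-0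
      frobenius-trunc {f} (suc N) zf = DivS-trans (freshman (ZpS-trunc N (λ i _ → zpAt zf i))
          (ZpS-∙ (zpAt zf N) (ZpS-δ₁^ N)))
        (DivS-resp (⊖-cong ≈-refl (≈-sym (stretch-⊕ _ _))) (DivS-⊕-cong (frobenius-trunc N zf)
          (DivS-resp (⊖-cong (≈-sym (≈-trans (∙-^ (f N) (δ₁ ^ N) p) (∙-cong _ exponents)))
              (≈-sym (≈-trans (stretch-∙ (f N) (δ₁ ^ N)) (∙-cong (f N) (stretch-δ₁^ N)))))
            (DivS-from (λ n → Div-resp
                (trans (solve 3 (λ a b x → (a :- b) :* x := a :* x :- b :* x) refl (qpow (f N) p) (f N) (((δ₁ ^ p) ^ N) n))
               (sym (cong₂ _-_ (∙-at (qpow (f N) p) ((δ₁ ^ p) ^ N) n) (∙-at (f N) ((δ₁ ^ p) ^ N) n))))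
               (Div-*ʳ (fermat (zpAt zf N)) (zpAt (ZpS-^ N (ZpS-δ₁^ p)) n)))))))
        where
        exponents : ((δ₁ ^ N) ^ p) ≈ ((δ₁ ^ p) ^ N)
        exponents = ≈-trans (≈-sym (^-* δ₁ p N)) (≈-trans (SR.reflexive (cong (δ₁ ^_) (ℕₚ.*-comm p N))) (^-* δ₁ N p))

    -- Degree `n` of either side depends only on coefficients up to `n`, so the case of polynomials
    -- suffices; there `freshman` separates the monomials and `fermat` treats their coefficients.
    frobenius : ∀ {f} → ZpS f → DivS 1 (f ^ p ⊖ stretch f)
    frobenius {f} zf = DivS-from (λ n → Div-resp
      (cong₂ _-_ (^-local p n (λ i i≤n → trunc-< f (suc n) i (s≤s i≤n)))
        (trans (Substitution.sub-at (δ₁ ^ p) z^p₀ _ n)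
            (trans (sum-cong (suc n) (λ i i<n → cong (_* ((δ₁ ^ p) ^ i) n) (trunc-< f (suc n) i i<n)))
          (sym (Substitution.sub-at (δ₁ ^ p) z^p₀ f n)))))
      (DivS-at (frobenius-trunc (suc n) zf) n))

    ZpS-stretch : ∀ {f} → ZpS f → ZpS (stretch f)
    ZpS-stretch {f} zf = mkZpS λ n → subst Zp (sym (Substitution.sub-at (δ₁ ^ p) z^p₀ f n))
      (Zp-sum (suc n) (λ i _ → Zp-* (zpAt zf i) (zpAt (ZpS-^ i (ZpS-δ₁^ p)) n)))

    -- `f^(np) = (f^p)^n ≡ f(z^p)^n` modulo `p^(r+1)`, since raising a congruence modulo `p` to the
    -- power `p^r` gains `r` factors; then the coefficients of `z^(np)` are compared.
    gauss-power : ∀ r m {f} → ZpS f → let n = p ℕ.^ r ℕ.* m in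
      Div (suc r) ((f ^ (n ℕ.* p)) (n ℕ.* p) - (f ^ n) n)
    gauss-power r m {f} zf = Div-resp (cong (λ t → (f ^ (n ℕ.* p)) (n ℕ.* p) - t) (stretch-at (f ^ n) n))
        (DivS-at congruence (n ℕ.* p))
      where
      n : ℕ
      n = p ℕ.^ r ℕ.* m
      split : ∀ g → (g ^ n) ≈ ((g ^ (p ℕ.^ r)) ^ m)
      split g = ≈-trans (SR.reflexive (cong (g ^_) (ℕₚ.*-comm (p ℕ.^ r) m))) (^-* g m (p ℕ.^ r))
      congruence : DivS (suc r) (f ^ (n ℕ.* p) ⊖ stretch (f ^ n))
      congruence = DivS-resp (⊖-cong (≈-sym (≈-trans (^-* f n p) (split (f ^ p))))
          (≈-sym (≈-trans (stretch-^ f n) (split (stretch f)))))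
        (DivS-^ m (ZpS-^ (p ℕ.^ r) (ZpS-^ p zf)) (ZpS-^ (p ℕ.^ r) (ZpS-stretch zf))
          (DivS-lift-iterate r (ZpS-^ p zf) (ZpS-stretch zf) (frobenius zf)))

-- Integrality of `h` from Gauss congruences, and from bounded denominators.

module GaussCongruences where

  open import Data.Nat.Divisibility using (_∣_; divides; m≤n⇒m!∣n!)
  open import Data.Nat.DivMod using (/-monoˡ-≤; m<n*o⇒m/o<n; m*n/n≡m)
  open import Data.Nat.Primality using (Prime)
  open import Data.Nat.Induction using (<-rec)
  open import Data.Rational using (_+_; _*_; _-_; -_)
  open import Data.Rational.Properties
  open FormalSeries
  open Composition
  open LagrangeInversion
  open PAdicIntegers
  open FrobeniusLift

  open QSol using (solve; _:+_; _:*_; _:-_; :-_; con; _:=_)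

  ·-top : ∀ m {f f′ g g′} → (∀ i → i ℕ.≤ m → f i ≡ f′ i) → (∀ i → i ℕ.≤ m → g i ≡ g′ i) →
    (f · g) (suc m) - (f′ · g′) (suc m) ≡ (f (suc m) - f′ (suc m)) * g 0 + f 0 * (g (suc m) - g′ (suc m))
  ·-top m {f} {f′} {g} {g′} ef eg = trans (cong₂ _-_ (expand f g) (trans (expand f′ g′)
      (cong₂ _+_ (cong₂ (λ s t → s * g′ (suc m) + t) (sym (ef 0 z≤n)) (sum-cong m (λ i i<m →
         cong₂ _*_ (sym (ef (suc i) i<m)) (sym (eg (m ℕ.∸ i) (ℕₚ.m∸n≤m m i)))))) (cong (f′ (suc m) *_) (sym (eg 0 z≤n))))))
    (solve 7 (λ a x s y z b y′ → (a :* x :+ s :+ y :* b) :- (a :* z :+ s :+ y′ :* b) := (y :- y′) :* b :+ a :*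
        (x :- z)) refl (f 0) (g (suc m)) S (f (suc m)) (g′ (suc m)) (g 0) (f′ (suc m)))
    where
    S : ℚ
    S = sumTo m (λ i → f (suc i) * g (m ℕ.∸ i))
    expand : ∀ f g → (f · g) (suc m) ≡ f 0 * g (suc m) + sumTo m (λ i → f (suc i) * g (m ℕ.∸ i)) + f (suc m) * g 0
    expand f g = trans (·-suc f g m) (trans (cong (f 0 * g (suc m) +_) (trans (·-at (tail f) g m)
      (cong (λ t → sumTo m (λ i → f (suc i) * g (m ℕ.∸ i)) + f (suc m) * g t) (ℕₚ.n∸n≡0 m))))
      (sym (+-assoc (f 0 * g (suc m)) S′ (f (suc m) * g 0))))
      where
      S′ : ℚ
      S′ = sumTo m (λ i → f (suc i) * g (m ℕ.∸ i))

  -- The first coefficient in which `f` and `t` differ enters the `k`-th power linearly, once per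
  -- factor, with cofactor `f(0)^(k-1) = 1`.
  ^-top : ∀ m k {f t} → f 0 ≡ 1ℚ → (∀ i → i ℕ.≤ m → f i ≡ t i) →
    (f ^ k) (suc m) - (t ^ k) (suc m) ≡ ι k * (f (suc m) - t (suc m))
  ^-top m zero    {f} {t} f₀ e = sym (*-zeroˡ (f (suc m) - t (suc m)))
  ^-top m (suc k) {f} {t} f₀ e = begin
    (f · f ^ k) (suc m) - (t · t ^ k) (suc m)
      ≡⟨ ·-top m e (λ i i≤m → ^-local k i (λ j j≤i → e j (ℕₚ.≤-trans j≤i i≤m))) ⟩
    d * (f ^ k) 0 + f 0 * ((f ^ k) (suc m) - (t ^ k) (suc m))
      ≡⟨ cong₂ _+_ (cong (d *_) (^-0 k f₀)) (cong₂ _*_ f₀ (^-top m k f₀ e)) ⟩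
    d * 1ℚ + 1ℚ * (ι k * d)
      ≡⟨ solve 2 (λ d k → d :* con 1ℚ :+ con 1ℚ :* (k :* d) := (con 1ℚ :+ k) :* d) refl d (ι k) ⟩
    (1ℚ + ι k) * d
      ≡⟨ cong (_* d) (sym (ι-suc k)) ⟩
    ι (suc k) * d ∎
    where
    open ≡-Reasoning
    d : ℚ
    d = f (suc m) - t (suc m)

  module Criterion (p : ℕ) (pr : Prime p) where

    open Integrality p pr
    open Frobenius p pr

    -- `m` may still be divisible by `p`: for a given index the largest admissible `r` gives the
    -- strongest congruence, and the others follow from it.
    GaussCongruence : Series → Series → Set
    GaussCongruence W W′ = ∀ r m → Div (suc r) (W (p ℕ.^ r ℕ.* m ℕ.* p) - W′ (p ℕ.^ r ℕ.* m))

    -- With t the truncation of h below degree n, n h_n = (hⁿ)_n - (tⁿ)_n, and both terms on the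
    -- right satisfy the Gauss congruence.
    gauss⇒integral : ∀ {W h} → h 0 ≡ 1ℚ → (∀ n → (h ^ n) n ≡ W n) → ZpS W → GaussCongruence W W → ∀ n → Zp (h n)
    gauss⇒integral {W} {h} h₀ diag zW gauss = <-rec (λ n → Zp (h n)) step
      where
      step : ∀ n → (∀ {i} → i ℕ.< n → Zp (h i)) → Zp (h n)
      step zero    _   = subst Zp (sym h₀) Zp-1
      step (suc m) rec = by (p-part n (λ ()))
        where
        n : ℕ
        n = suc m
        t : Series
        t = trunc h n
        zt : ZpS t
        zt = ZpS-trunc n (λ i i<n → rec i<n)
        agree : ∀ k i → k ℕ.< n → i ℕ.≤ k → h i ≡ t i
        agree k i k<n i≤k = sym (trunc-< h n i (ℕₚ.≤-<-trans i≤k k<n))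
        n·h : (h ^ n) n - (t ^ n) n ≡ ι n * h n
        n·h = trans (^-top m n h₀ (λ i → agree m i ℕₚ.≤-refl)) (cong (ι n *_)
          (trans (cong (λ x → h n - x) (trunc-≥ h n n ℕₚ.≤-refl)) (+-identityʳ (h n))))
        by : (∃₂ λ s u → n ≡ p ℕ.^ s ℕ.* u × ¬ p ∣ u) → Zp (h n)
        by (zero , u , e , ¬d) = Div-by {0} {u} e ¬d
            (Div-resp n·h (Zp⇒Div (Zp-- (subst Zp (sym (diag n)) (zpAt zW n)) (zpAt (ZpS-^ n zt) n))))
        by (suc r , u , e , ¬d) = Div-by {suc r} {u} e ¬d (Div-resp (trans eq n·h) (Div-- (gauss r u) (gauss-power r u zt)))
          where
          n′ : ℕ
          n′ = p ℕ.^ r ℕ.* u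
          n≡ : n ≡ n′ ℕ.* p
          n≡ = trans e (trans (ℕₚ.*-assoc p (p ℕ.^ r) u) (ℕₚ.*-comm p n′))
          n′<n : n′ ℕ.< n
          n′<n = subst (n′ ℕ.<_) (sym n≡) (ℕₚ.m<m*n n′ p {{n′≢0}} 1<p)
            where
            n′≢0 : ℕ.NonZero n′
            n′≢0 = ℕ.≢-nonZero (λ e′ → ℕₚ.1+n≢0 (trans n≡ (cong (ℕ._* p) e′)))
          -- Truncation at `n` is invisible in degree `n′ < n`, so the lower term of the congruence
          -- for `t` is again `W n′` and cancels against that of `W`.
          lower : (t ^ n′) n′ ≡ W n′
          lower = trans (sym (^-local n′ n′ (λ i → agree n′ i n′<n))) (diag n′)
          eq : (W (n′ ℕ.* p) - W n′) - ((t ^ (n′ ℕ.* p)) (n′ ℕ.* p) - (t ^ n′) n′) ≡ (h ^ n) n - (t ^ n) n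
          eq = trans (cong₂ (λ x y → (x - W n′) - (y - (t ^ n′) n′))
              (trans (sym (diag (n′ ℕ.* p))) (cong (λ k → (h ^ k) k) (sym n≡)))
                 (cong (λ k → (t ^ k) k) (sym n≡)))
            (trans (cong (λ x → ((h ^ n) n - W n′) - ((t ^ n) n - x)) lower)
              (solve 3 (λ a w b → (a :- w) :- (b :- w) := a :- b) refl ((h ^ n) n) (W n′) ((t ^ n) n)))

    integral⇒gauss : ∀ {W h} → (∀ n → (h ^ n) n ≡ W n) → ZpS h → GaussCongruence W W
    integral⇒gauss {W} {h} diag zh r m = Div-resp (cong₂ _-_ (diag _) (diag _)) (gauss-power r m zh)

    -- The reduction of `f` modulo `p` has order exactly `N`. As in Gauss's lemma, these orders add
    -- under multiplication.
    record Lead (N : ℕ) (f : Series) : Set where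
      constructor mkLead
      field
        zpS   : ZpS f
        below : ∀ i → i ℕ.< N → Div 1 (f i)
        unit  : Unit (f N)

    Unit-cong : ∀ {x y} → Unit x → Zp y → Div 1 (y - x) → Unit y
    Unit-cong {x} {y} u zy d with Div₁⊎Unit zy
    ... | inj₂ v = v
    ... | inj₁ v = ⊥-elim (¬Div₁-Unit u (Div-resp (solve 2 (λ x y → y :- (y :- x) := x) refl x y) (Div-- v d)))

    Div₁-sum-pick : ∀ M k (f : ℕ → ℚ) → k ℕ.< M → (∀ i → i ℕ.< M → i ≢ k → Div 1 (f i)) → Div 1 (sumTo M f - f k)
    Div₁-sum-pick (suc M) k f k<sM d with k ℕ.≟ M
    ... | yes refl = Div-resp (solve 2 (λ a b → a := (a :+ b) :- b) refl (sumTo M f) (f M))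
            (Div-sum 1 M (λ i i<M → d i (ℕₚ.m<n⇒m<1+n i<M) (ℕₚ.<⇒≢ i<M)))
    ... | no ne = Div-resp (solve 3 (λ a b c → (a :- c) :+ b := (a :+ b) :- c) refl (sumTo M f) (f M) (f k))
            (Div-+ (Div₁-sum-pick M k f (ℕₚ.≤∧≢⇒< (ℕₚ.≤-pred k<sM) ne) (λ i i<M → d i (ℕₚ.m<n⇒m<1+n i<M)))
                (d M ℕₚ.≤-refl (ne ∘ sym)))

    Lead-· : ∀ {N M f g} → Lead N f → Lead M g → Lead (N ℕ.+ M) (f · g)
    Lead-· {N} {M} {f} {g} (mkLead zf bf uf) (mkLead zg bg ug) = mkLead (ZpS-· zf zg) below
      (Unit-cong (Unit-* uf ug) (zpAt (ZpS-· zf zg) (N ℕ.+ M))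
        (Div-resp (cong₂ (λ s t → s - f N * g t) (sym (·-at f g (N ℕ.+ M))) (ℕₚ.m+n∸m≡n N M))
          (Div₁-sum-pick (suc (N ℕ.+ M)) N (λ i → f i * g (N ℕ.+ M ℕ.∸ i)) (s≤s (ℕₚ.m≤m+n N M)) top)))
      where
      term : ∀ n i → i ℕ.≤ n → i ℕ.< N ⊎ n ℕ.∸ i ℕ.< M → Div 1 (f i * g (n ℕ.∸ i))
      term n i _ (inj₁ i<N) = Div-*ʳ (bf i i<N) (zpAt zg (n ℕ.∸ i))
      term n i _ (inj₂ j<M) = Div-*ˡ (zpAt zf i) (bg (n ℕ.∸ i) j<M)
      below : ∀ n → n ℕ.< N ℕ.+ M → Div 1 ((f · g) n)
      below n n<N+M = Div-resp (sym (·-at f g n))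
          (Div-sum 1 (suc n) (λ i i<n → term n i (ℕₚ.≤-pred i<n) (side i (ℕₚ.≤-pred i<n))))
        where
        side : ∀ i → i ℕ.≤ n → i ℕ.< N ⊎ n ℕ.∸ i ℕ.< M
        side i i≤n with i ℕ.<? N
        ... | yes i<N = inj₁ i<N
        ... | no  i≮N = inj₂ (ℕₚ.+-cancelˡ-< i _ _ (subst (ℕ._< i ℕ.+ M) (sym (ℕₚ.m+[n∸m]≡n i≤n))
            (ℕₚ.<-≤-trans n<N+M (ℕₚ.+-monoˡ-≤ M (ℕₚ.≮⇒≥ i≮N)))))
      top : ∀ i → i ℕ.< suc (N ℕ.+ M) → i ≢ N → Div 1 (f i * g (N ℕ.+ M ℕ.∸ i))
      top i i<n i≢N = term (N ℕ.+ M) i (ℕₚ.≤-pred i<n) (side (i ℕ.<? N))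
        where
        side : Dec (i ℕ.< N) → i ℕ.< N ⊎ N ℕ.+ M ℕ.∸ i ℕ.< M
        side (yes i<N) = inj₁ i<N
        side (no  i≮N) = inj₂ (ℕₚ.+-cancelˡ-< i _ _ (subst (ℕ._< i ℕ.+ M) (sym (ℕₚ.m+[n∸m]≡n (ℕₚ.≤-pred i<n)))
          (ℕₚ.+-monoˡ-< M (ℕₚ.≤∧≢⇒< (ℕₚ.≮⇒≥ i≮N) (i≢N ∘ sym)))))

    Lead-^ : ∀ {N f} k → Lead N f → Lead (k ℕ.* N) (f ^ k)
    Lead-^ zero    l = mkLead ZpS-δ₀ (λ _ ()) Unit-1
    Lead-^ (suc k) l = Lead-· l (Lead-^ k l)

    -- A minimal counterexample by bounded search; it is available constructively because
    -- integrality is decided by `Zp?`.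
    first-failure : ∀ {Q : ℕ → Set} → (∀ n → Dec (Q n)) → ∀ n → ¬ Q n → ∃ λ N → ¬ Q N × (∀ i → i ℕ.< N → Q i)
    first-failure {Q} Q? n ¬Qn = go n 0 (λ _ ()) (subst (λ t → ¬ Q t) (sym (ℕₚ.+-identityʳ n)) ¬Qn)
      where
      go : ∀ d k → (∀ i → i ℕ.< k → Q i) → ¬ Q (d ℕ.+ k) → ∃ λ N → ¬ Q N × (∀ i → i ℕ.< N → Q i)
      go zero    k below ¬Q = k , ¬Q , below
      go (suc d) k below ¬Q with Q? k
      ... | no ¬Qk = k , ¬Qk , below
      ... | yes Qk = go d (suc k) ext (subst (λ t → ¬ Q t) (sym (ℕₚ.+-suc d k)) ¬Q)
        where
        ext : ∀ i → i ℕ.< suc k → Q i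
        ext i i<sk with i ℕ.≟ k
        ... | yes refl = Qk
        ... | no ne = below i (ℕₚ.≤∧≢⇒< (ℕₚ.≤-pred i<sk) ne)

    module _ {E V : Series} (E₀ : E 0 ≡ 1ℚ) (V₀ : V 0 ≡ 0ℚ) (θE : θ E ≈ (E · V)) (zV : ZpS V) where

      private
        E⁻¹ : Series
        E⁻¹ = invSer E

        E·E⁻¹ : (E · E⁻¹) ≈ δ₀
        E·E⁻¹ = invSer-· (λ e → 1≢0 (trans (sym E₀) e))

        θE⁻¹ : θ E⁻¹ ≈ (E⁻¹ · (⊝ V))
        θE⁻¹ = begin
          θ E⁻¹                                         ≈⟨ ≈-sym (·-identityˡ _) ⟩
          δ₀ · θ E⁻¹                                    ≈⟨ ·-congʳ _ (≈-sym E·E⁻¹) ⟩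
          E · E⁻¹ · θ E⁻¹                               ≈⟨ SSol.solve 4 (λ e i t v → e SSol.:* i SSol.:* t SSol.:= i
              SSol.:* ((e SSol.:* v) SSol.:* i SSol.:+ e SSol.:* t) SSol.:- i SSol.:* (v SSol.:* (e SSol.:* i)))
              ≈-refl E E⁻¹ (θ E⁻¹) V ⟩
          E⁻¹ · ((E · V) · E⁻¹ ⊕ E · θ E⁻¹) ⊖ E⁻¹ · (V · (E · E⁻¹)) ≈⟨ ⊖-cong
              (≈-trans (·-congˡ E⁻¹ θ-unit) (SR.zeroʳ E⁻¹)) (·-congˡ E⁻¹ (≈-trans (·-congˡ V E·E⁻¹) (SR.*-identityʳ V))) ⟩
          0S ⊖ E⁻¹ · V                                  ≈⟨ SR.+-identityˡ _ ⟩
          ⊝ (E⁻¹ · V)                                   ≈⟨ SSol.solve 2 (λ i v → SSol.:- (i SSol.:* v) SSol.:= i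
              SSol.:* (SSol.:- v)) ≈-refl E⁻¹ V ⟩
          E⁻¹ · (⊝ V) ∎
          where
          open import Relation.Binary.Reasoning.Setoid SR.setoid
          θ-unit : ((E · V) · E⁻¹ ⊕ E · θ E⁻¹) ≈ 0S
          θ-unit = ≈-trans (⊕-cong (·-congʳ E⁻¹ (≈-sym θE)) ≈-refl)
              (≈-trans (≈-sym (θ-· E E⁻¹)) (≈-trans (θ-cong E·E⁻¹) θ-δ₀))

      negPow : ℕ → Series
      negPow R = E⁻¹ ^ R

      negPow-· : ∀ R → (negPow R · E ^ R) ≈ δ₀
      negPow-· R = ≈-trans (≈-sym (·-^ R E⁻¹ E)) (≈-trans (^-cong R (≈-trans (·-comm E⁻¹ E) E·E⁻¹)) (δ₀-^ R))

      -- For K = p^e dividing the exponent, the recursion m P_m = N K · (…) only loses the p-part of m/K.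
      negPow-bound : ∀ e N m → .{{_ : ℕ.NonZero (p ℕ.^ e)}} → Zp (ι ((m ℕ./ p ℕ.^ e) ℕ.!) * negPow (N ℕ.* p ℕ.^ e) m)
      negPow-bound e N = <-rec _ step
        where
        K R : ℕ
        K = p ℕ.^ e
        R = N ℕ.* K
        P : Series
        P = negPow R
        zp : ∀ m → ZpS (⊝ V)
        zp m = mkZpS λ n → subst Zp (sym (⊝-at V n)) (Zp-neg (zpAt zV n))
        X : ℕ → ℚ
        X m = (P · (⊝ V)) m
        -- Degree `m` of `θ P = R · P · (-V)` with `R = N K`.
        recursion : ∀ m → ι m * P m ≡ ι K * (ι N * X m)
        recursion m = trans (sym (θ-at P m))
            (trans (at (θ-^-log R θE⁻¹) m) (trans (∙-at (ι R) _ m) (trans (cong (_* X m) (ι-* N K))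
          (solve 3 (λ n k x → n :* k :* x := k :* (n :* x)) refl (ι N) (ι K) (X m)))))
        step : ∀ m → (∀ {i} → i ℕ.< m → .{{_ : ℕ.NonZero K}} → Zp (ι ((i ℕ./ K) ℕ.!) * P i)) → .{{_ : ℕ.NonZero K}} →
            Zp (ι ((m ℕ./ K) ℕ.!) * P m)
        step zero    rec = Zp-* (Zp-ι ((zero ℕ./ K) ℕ.!))
            (subst Zp (sym (trans (^-at-0 E⁻¹ R) (trans (cong (λ t → qpow t R) E⁻¹₀) (qpow-1 R)))) Zp-1)
          where
          E⁻¹₀ : E⁻¹ 0 ≡ 1ℚ
          E⁻¹₀ = trans (sym (*-identityˡ (E⁻¹ 0)))
              (trans (cong (_* E⁻¹ 0) (sym E₀)) (trans (sym (·-zero E E⁻¹)) (at E·E⁻¹ 0)))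
          qpow-1 : ∀ n → qpow 1ℚ n ≡ 1ℚ
          qpow-1 zero    = refl
          qpow-1 (suc n) = trans (*-identityʳ _) (qpow-1 n)
        step m@(suc m-1) rec = by (p-part m (λ ()))
          where
          -- If all quotients `i / K` with `i < m` are at most `a`, then `a!` clears the
          -- denominators of all earlier `P i`. The term `i = m` drops out because `V` has no
          -- constant term.
          zX : ∀ a → (∀ i → i ℕ.< m → i ℕ./ K ℕ.≤ a) → Zp (ι (a ℕ.!) * X m)
          zX a below = subst Zp (trans (sum-*ˡ (suc m) (ι (a ℕ.!)) _) (cong (ι (a ℕ.!) *_) (sym (·-at P (⊝ V) m))))
            (Zp-sum (suc m) (λ i i<sm → subst Zp (*-assoc (ι (a ℕ.!)) (P i) ((⊝ V) (m ℕ.∸ i)))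
                (term i (ℕₚ.m<1+n⇒m<n∨m≡n i<sm))))
            where
            multiple : ∀ {b c x} → b ∣ c → Zp (ι b * x) → Zp (ι c * x)
            multiple {b} {c} {x} (divides q e) z = subst Zp
                (trans (sym (*-assoc (ι q) (ι b) x)) (cong (_* x) (trans (sym (ι-* q b)) (cong ι (sym e)))))
                (Zp-* (Zp-ι q) z)
            term : ∀ i → i ℕ.< m ⊎ i ≡ m → Zp (ι (a ℕ.!) * P i * (⊝ V) (m ℕ.∸ i))
            term i (inj₁ i<m) = Zp-* (multiple (m≤n⇒m!∣n! (below i i<m)) (rec i<m)) (zpAt (zp m) (m ℕ.∸ i))
            term i (inj₂ refl) = subst Zp (sym (trans (cong (ι (a ℕ.!) * P i *_) (trans (cong (⊝ V) (ℕₚ.n∸n≡0 i))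
              (trans (⊝-at V 0) (cong -_ V₀)))) (*-zeroʳ (ι (a ℕ.!) * P i)))) Zp-0
          by : (∃₂ λ s u → m ≡ p ℕ.^ s ℕ.* u × ¬ p ∣ u) → Zp (ι ((m ℕ./ K) ℕ.!) * P m)
          by (s , u , eq , ¬d) with s ℕ.<? e
          -- If `p^e` does not divide `m`, the factor `K` in the recursion outweighs the p-part of
          -- `m`.
          ... | yes s<e = Div-by {s} {u} eq ¬d
              (Div-mono (ℕₚ.<⇒≤ s<e) (Div-resp eq′
              (mkDiv _ (Zp-* (Zp-ι N) (zX (m ℕ./ K) (λ i i<m → /-monoˡ-≤ K (ℕₚ.<⇒≤ i<m)))) refl)))
            where
            A : ℚ
            A = ι ((m ℕ./ K) ℕ.!)
            eq′ : π^ e * (ι N * (A * X m)) ≡ ι m * (A * P m)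
            eq′ = trans (cong (_* (ι N * (A * X m))) (sym (ι-^ e))) (trans
              (solve 4 (λ k n a x → k :* (n :* (a :* x)) := a :* (k :* (n :* x))) refl (ι K) (ι N) A (X m))
              (trans (cong (A *_) (sym (recursion m))) (solve 3 (λ a m p → a :* (m :* p) := m :* (a :* p)) refl A
                  (ι m) (P m))))
          -- Otherwise `m = (a + 1) K`. Cancelling `K` leaves a division by `a + 1`, the new factor
          -- of `(a + 1)!`, while all earlier quotients are at most `a`.
          ... | no s≮e = whole (p ℕ.^ (s ℕ.∸ e) ℕ.* u)
              (trans eq (trans (cong (λ t → p ℕ.^ t ℕ.* u) (sym (ℕₚ.m+[n∸m]≡n (ℕₚ.≮⇒≥ s≮e))))
                (trans (cong (ℕ._* u) (trans (ℕₚ.^-distribˡ-+-* p e (s ℕ.∸ e)) (ℕₚ.*-comm K _)))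
                    (trans (ℕₚ.*-assoc (p ℕ.^ (s ℕ.∸ e)) K u)
                  (trans (cong (p ℕ.^ (s ℕ.∸ e) ℕ.*_) (ℕₚ.*-comm K u)) (sym (ℕₚ.*-assoc (p ℕ.^ (s ℕ.∸ e)) u K)))))))
            where
            whole : ∀ a → m ≡ a ℕ.* K → Zp (ι ((m ℕ./ K) ℕ.!) * P m)
            whole zero ()
            whole (suc a) m≡ = subst (λ t → Zp (ι (t ℕ.!) * P m)) (sym m/K)
                (subst Zp (sym value) (Zp-* (Zp-ι N) (zX a (λ i i<m →
                ℕₚ.≤-pred (m<n*o⇒m/o<n (subst (i ℕ.<_) m≡ i<m))))))
              where
              m/K : m ℕ./ K ≡ suc a
              m/K = trans (cong (ℕ._/ K) m≡) (m*n/n≡m (suc a) K)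
              cancel : ι (suc a) * P m ≡ ι N * X m
              cancel = *-cancel _ _ (λ e₀ → ℕ.≢-nonZero⁻¹ K (ι-injective {K} {0} e₀))
                  (trans (sym (*-assoc (ι K) (ι (suc a)) (P m)))
                (trans (cong (_* P m) (trans (*-comm (ι K) (ι (suc a)))
                    (trans (sym (ι-* (suc a) K)) (cong ι (sym m≡))))) (recursion m)))
              value : ι (suc a ℕ.!) * P m ≡ ι N * (ι (a ℕ.!) * X m)
              value = trans (cong (_* P m) (ι-* (suc a) (a ℕ.!)))
                  (trans (solve 3 (λ s f p → s :* f :* p := f :* (s :* p)) refl (ι (suc a)) (ι (a ℕ.!)) (P m))
                (trans (cong (ι (a ℕ.!) *_) cancel) (solve 3 (λ f n x → f :* (n :* x) := n :* (f :* x)) refl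
                    (ι (a ℕ.!)) (ι N) (X m))))

    module _ (a b : ℚ) where

      open Hauptmodul a b

      private
        E : Series
        E = tail (qser a b)

      -- Let N be the first degree in which πᵏ h fails to be integral, K = p^e and R = (N - 1) K.  By
      -- Lagrange inversion the coefficient of E^(-R) in degree N K is 1 - N times that of h^K, so its
      -- denominator is p^(K (k + 1)) up to a factor independent of e.
      descend : ZpS V → ∀ k → (∀ n → Zp (π^ suc k * h n)) → ∀ n → Zp (π^ k * h n)
      descend zV k z n = decide (Zp? (π^ k * h n))
        where
        j : Series
        j = (π^ suc k) ∙ h
        zj : ZpS j
        zj = mkZpS λ i → subst Zp (sym (∙-at (π^ suc k) h i)) (z i)
        j-at : ∀ i → j i ≡ π * (π^ k * h i)
        j-at i = trans (∙-at (π^ suc k) h i) (solve 3 (λ a p x → (a :* p) :* x := p :* (a :* x)) refl (π^ k) π (h i))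
        impossible : ∀ N → ¬ Zp (π^ k * h N) → (∀ i → i ℕ.< N → Zp (π^ k * h i)) → ⊥
        impossible zero ¬z _ = ¬z (subst Zp (sym (trans (cong (π^ k *_) h₀) (*-identityʳ (π^ k)))) (Zp-π^ k))
        -- `h 1 = W 1` is integral, so a failure has `N ≥ 2` and the factor `N - 1` below is
        -- nonzero.
        impossible (suc zero) ¬z _ = ¬z (Zp-* (Zp-π^ k) (subst Zp (trans (sym (h^n-at-n 1)) (at (SR.*-identityʳ h) 1))
          (subst Zp (sym (trans (⊕-at δ₀ V 1) (+-identityˡ (V 1)))) (zpAt zV 1))))
        -- The contradiction is that the nonzero number `(N - 1) N!` would be divisible by every
        -- power of `p`.
        impossible N@(suc (suc M)) ¬z below = ℕ.≢-nonZero⁻¹ (suc M ℕ.* N ℕ.!)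
            {{ℕₚ.m*n≢0 (suc M) (N ℕ.!) {{_}} {{N ℕₚ.!≢0}}}} (Div-0-limit (suc M ℕ.* N ℕ.!) divisible)
          where
          lead : Lead N j
          lead = mkLead zj (λ i i<N → Div-resp (sym (j-at i)) (Div-π (Zp⇒Div (below i i<N)))) (by (Div₁⊎Unit (zpAt zj N)))
            where
            by : Div 1 (j N) ⊎ Unit (j N) → Unit (j N)
            by (inj₂ u) = u
            by (inj₁ d) = ⊥-elim (¬z (Div⇒Zp {0} (Div-π⁻¹ (Div-resp (j-at N) d))))
          divisible : ∀ e → Div e (ι (suc M ℕ.* N ℕ.!))
          -- Since orders modulo `p` add, `j ^ K` has a unit in degree `d = K N`. In `eq` the power
          -- `p^(K (k+1))` must therefore divide the other factor, and `e ≤ K (k + 1)`.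
          divisible e = Div-unit (Lead.unit (Lead-^ K lead)) (Div-mono e≤ (mkDiv _ (Zp-neg bound) eq))
            where
            K R d : ℕ
            K = p ℕ.^ e
            R = suc M ℕ.* K
            d = K ℕ.* N
            instance
              K≢0 : ℕ.NonZero K
              K≢0 = ℕₚ.m^n≢0 p e {{ℕ.>-nonZero (ℕₚ.<-trans (s≤s z≤n) 1<p)}}
            V₀ : V 0 ≡ 0ℚ
            V₀ = trans (θ-at (Dser a b) 0) (*-zeroˡ (Dser a b 0))
            P : Series
            P = negPow {E} {V} refl V₀ (θ-expSer (Dser a b)) zV R
            bound : Zp (ι (N ℕ.!) * P d)
            bound = subst (λ t → Zp (ι (t ℕ.!) * P d)) (trans (cong (ℕ._/ K) (ℕₚ.*-comm K N)) (m*n/n≡m N K))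
              (negPow-bound {E} {V} refl V₀ (θ-expSer (Dser a b)) zV e (suc M) d)
            e≤ : e ℕ.≤ K ℕ.* suc k
            e≤ = ℕₚ.≤-trans (ℕₚ.<⇒≤ (n<p^n e)) (ℕₚ.m≤m*n K (suc k))
            K-1 : ℕ
            K-1 = ℕ.pred K
            K≡ : suc K-1 ≡ K
            K≡ = ℕₚ.suc-pred K
            d≡ : R ℕ.+ suc K-1 ≡ d
            d≡ = trans (cong (R ℕ.+_) K≡) (trans (ℕₚ.+-comm R K) (ℕₚ.*-comm N K))
            lagrange : P d ≡ - (ι (suc M) * (h ^ K) d)
            lagrange = *-cancel _ _ (λ e₀ → ℕ.≢-nonZero⁻¹ K (ι-injective {K} {0} e₀)) (begin
              ι K * P d
                ≡⟨ cong₂ (λ s t → ι s * P t) (sym K≡) (sym d≡) ⟩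
              ι (suc K-1) * P (R ℕ.+ suc K-1)
                ≡⟨ negative-power P R K-1 (negPow-· {E} {V} refl V₀ (θ-expSer (Dser a b)) zV R) ⟩
              - (ι R * (h ^ suc K-1) (R ℕ.+ suc K-1))
                ≡⟨ cong -_ (cong₂ _*_ (ι-* (suc M) K) (cong₂ (λ s t → (h ^ s) t) K≡ d≡)) ⟩
              - (ι (suc M) * ι K * (h ^ K) d)
                ≡⟨ solve 3 (λ m k x → :- (m :* k :* x) := k :* (:- (m :* x))) refl (ι (suc M)) (ι K) ((h ^ K) d) ⟩
              ι K * - (ι (suc M) * (h ^ K) d) ∎)
              where open ≡-Reasoning
            powers : (j ^ K) d ≡ π^ (K ℕ.* suc k) * (h ^ K) d
            powers = trans (at (∙-^ (π^ suc k) h K) d) (trans (∙-at _ (h ^ K) d) (cong (_* (h ^ K) d) (qpow-qpow K)))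
              where
              qpow-qpow : ∀ n → qpow (π^ suc k) n ≡ π^ (n ℕ.* suc k)
              qpow-qpow zero    = refl
              qpow-qpow (suc n) = trans (cong (_* π^ suc k) (qpow-qpow n))
                  (trans (*-comm (π^ (n ℕ.* suc k)) (π^ suc k)) (sym (qpow-+ π (suc k) (n ℕ.* suc k))))
            eq : (j ^ K) d * ι (suc M ℕ.* N ℕ.!) ≡ π^ (K ℕ.* suc k) * - (ι (N ℕ.!) * P d)
            eq = trans (cong₂ _*_ powers (ι-* (suc M) (N ℕ.!))) (trans
              (solve 4 (λ q h m f → (q :* h) :* (m :* f) := q :* (:- (f :* (:- (m :* h))))) refl (π^ (K ℕ.* suc k))
                  ((h ^ K) d) (ι (suc M)) (ι (N ℕ.!)))
              (cong (λ t → π^ (K ℕ.* suc k) * - (ι (N ℕ.!) * t)) (sym lagrange)))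
        decide : Dec (Zp (π^ k * h n)) → Zp (π^ k * h n)
        decide (yes y) = y
        decide (no ¬y) = ⊥-elim (refute (first-failure (λ i → Zp? (π^ k * h i)) n ¬y))
          where
          refute : (∃ λ N → ¬ Zp (π^ k * h N) × (∀ i → i ℕ.< N → Zp (π^ k * h i))) → ⊥
          refute (N , ¬z , below) = impossible N ¬z below

      bounded⇒integral : ZpS V → ∀ k → (∀ n → Zp (π^ k * h n)) → ∀ n → Zp (h n)
      bounded⇒integral zV zero    z n = subst Zp (*-identityˡ (h n)) (z n)
      bounded⇒integral zV (suc k) z   = bounded⇒integral zV k (descend zV k z)

-- Dual numbers, Dwork's map, and the splitting of Pochhammer products into blocks of length `p`.

module DworkMap where

  open import Data.Nat.Divisibility using (_∣_; ∣⇒≤; ∣m+n∣m⇒∣n; n∣m*n)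
  open import Data.Nat.Primality using (Prime)
  open import Data.Rational using (_+_; _*_; _-_; -_)
  open import Data.Rational.Properties
  open import Relation.Binary.Definitions using (Tri; tri<; tri≈; tri>)
  open FormalSeries
  open Composition
  open LagrangeInversion
  open PAdicIntegers
  open FrobeniusLift
  open GaussCongruences

  open QSol using (solve; _:+_; _:*_; _:-_; :-_; con; _:=_)

  infix 4 _,ε_
  -- Dual numbers `re + ep ε` with `ε² = 0`; a product of them carries a product of rationals
  -- together with its derivative.
  record Dual : Set where
    constructor _,ε_
    field re ep : ℚ
  open Dual public

  infixl 7 _⊗_
  _⊗_ : Dual → Dual → Dual
  (x ,ε x′) ⊗ (y ,ε y′) = x * y ,ε x′ * y + x * y′

  1D : Dual
  1D = 1ℚ ,ε 0ℚ

  dual≡ : ∀ {x x′ y y′} → x ≡ y → x′ ≡ y′ → (x ,ε x′) ≡ (y ,ε y′)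
  dual≡ refl refl = refl

  ⊗-comm : ∀ u v → u ⊗ v ≡ v ⊗ u
  ⊗-comm (x ,ε x′) (y ,ε y′) = dual≡ (*-comm x y) (solve 4 (λ x x′ y y′ → x′ :* y :+ x :* y′ := y′ :* x :+ y :* x′)
      refl x x′ y y′)

  ⊗-assoc : ∀ u v w → (u ⊗ v) ⊗ w ≡ u ⊗ (v ⊗ w)
  ⊗-assoc (x ,ε x′) (y ,ε y′) (z ,ε z′) = dual≡ (*-assoc x y z)
    (solve 6 (λ x x′ y y′ z z′ → (x′ :* y :+ x :* y′) :* z :+ (x :* y) :* z′ := x′ :* (y :* z) :+ x :*
        (y′ :* z :+ y :* z′)) refl x x′ y y′ z z′)

  ⊗-identityˡ : ∀ u → 1D ⊗ u ≡ u
  ⊗-identityˡ (x ,ε x′) = dual≡ (*-identityˡ x) (solve 2 (λ x x′ → con 0ℚ :* x :+ con 1ℚ :* x′ := x′) refl x x′)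

  ⊗-identityʳ : ∀ u → u ⊗ 1D ≡ u
  ⊗-identityʳ u = trans (⊗-comm u 1D) (⊗-identityˡ u)

  ⊗-interchange : ∀ u v w z → (u ⊗ v) ⊗ (w ⊗ z) ≡ (u ⊗ w) ⊗ (v ⊗ z)
  ⊗-interchange u v w z = trans (⊗-assoc u v (w ⊗ z)) (trans (cong (u ⊗_) (trans (sym (⊗-assoc v w z))
    (trans (cong (_⊗ z) (⊗-comm v w)) (⊗-assoc w v z)))) (sym (⊗-assoc u w (v ⊗ z))))

  prod : ℕ → (ℕ → Dual) → Dual
  prod zero    f = 1D
  prod (suc n) f = prod n f ⊗ f n

  prod-cong : ∀ n {f g} → (∀ i → i ℕ.< n → f i ≡ g i) → prod n f ≡ prod n g
  prod-cong zero    e = refl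
  prod-cong (suc n) e = cong₂ _⊗_ (prod-cong n (λ i i<n → e i (ℕₚ.m<n⇒m<1+n i<n))) (e n ℕₚ.≤-refl)

  prod-⊗ : ∀ n f g → prod n (λ i → f i ⊗ g i) ≡ prod n f ⊗ prod n g
  prod-⊗ zero    f g = sym (⊗-identityˡ 1D)
  prod-⊗ (suc n) f g = trans (cong (_⊗ (f n ⊗ g n)) (prod-⊗ n f g)) (⊗-interchange (prod n f) (prod n g) (f n) (g n))

  prod-+ : ∀ m n f → prod (m ℕ.+ n) f ≡ prod m f ⊗ prod n (λ i → f (m ℕ.+ i))
  prod-+ m zero    f = trans (cong (λ t → prod t f) (ℕₚ.+-identityʳ m)) (sym (⊗-identityʳ (prod m f)))
  prod-+ m (suc n) f = trans (cong (λ t → prod t f) (ℕₚ.+-suc m n)) (trans (cong (_⊗ f (m ℕ.+ n)) (prod-+ m n f))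
    (⊗-assoc (prod m f) (prod n (λ i → f (m ℕ.+ i))) (f (m ℕ.+ n))))

  prod-pick : ∀ n k f → k ℕ.< n → (∀ i → i ℕ.< n → i ≢ k → f i ≡ 1D) → prod n f ≡ f k
  prod-pick (suc n) k f k<sn e with k ℕ.≟ n
  ... | yes refl = trans (cong (_⊗ f n) (trans (prod-cong n (λ i i<n → e i (ℕₚ.m<n⇒m<1+n i<n) (ℕₚ.<⇒≢ i<n)))
      (prod-1 n))) (⊗-identityˡ (f n))
    where
    prod-1 : ∀ n → prod n (λ _ → 1D) ≡ 1D
    prod-1 zero    = refl
    prod-1 (suc n) = trans (cong (_⊗ 1D) (prod-1 n)) (⊗-identityˡ 1D)
  ... | no ne = trans (cong₂ _⊗_ (prod-pick n k f (ℕₚ.≤∧≢⇒< (ℕₚ.≤-pred k<sn) ne) (λ i i<n → e i (ℕₚ.m<n⇒m<1+n i<n)))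
      (e n ℕₚ.≤-refl (ne ∘ sym)))
      (⊗-identityʳ (f k))

  prodℚ : ℕ → (ℕ → ℚ) → ℚ
  prodℚ zero    f = 1ℚ
  prodℚ (suc n) f = prodℚ n f * f n

  re-prod : ∀ n f → re (prod n f) ≡ prodℚ n (re ∘ f)
  re-prod zero    f = refl
  re-prod (suc n) f = cong (_* re (f n)) (re-prod n f)

  prodℚ-cong : ∀ n {f g} → (∀ i → i ℕ.< n → f i ≡ g i) → prodℚ n f ≡ prodℚ n g
  prodℚ-cong zero    e = refl
  prodℚ-cong (suc n) e = cong₂ _*_ (prodℚ-cong n (λ i i<n → e i (ℕₚ.m<n⇒m<1+n i<n))) (e n ℕₚ.≤-refl)

  prodℚ-* : ∀ n f g → prodℚ n (λ i → f i * g i) ≡ prodℚ n f * prodℚ n g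
  prodℚ-* zero    f g = refl
  prodℚ-* (suc n) f g = trans (cong (_* (f n * g n)) (prodℚ-* n f g))
    (solve 4 (λ a b c d → (a :* b) :* (c :* d) := (a :* c) :* (b :* d)) refl (prodℚ n f) (prodℚ n g) (f n) (g n))

  prodℚ-+ : ∀ m n f → prodℚ (m ℕ.+ n) f ≡ prodℚ m f * prodℚ n (λ i → f (m ℕ.+ i))
  prodℚ-+ m zero    f = trans (cong (λ t → prodℚ t f) (ℕₚ.+-identityʳ m)) (sym (*-identityʳ (prodℚ m f)))
  prodℚ-+ m (suc n) f = trans (cong (λ t → prodℚ t f) (ℕₚ.+-suc m n)) (trans (cong (_* f (m ℕ.+ n)) (prodℚ-+ m n f))
    (*-assoc (prodℚ m f) (prodℚ n (λ i → f (m ℕ.+ i))) (f (m ℕ.+ n))))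

  -- `x + ε` and `1 / (x + ε)`.
  linear recip : ℚ → Dual
  linear x = x ,ε 1ℚ
  recip  x = inv x ,ε - (inv x * inv x)

  factor : ℚ → ℕ → Dual
  factor a i = linear (a + ι i) ⊗ recip (1ℚ + ι i)

  -- (a + ε)ₙ / (1 + ε)ₙ, whose ε-part carries the harmonic sums in the coefficients of G
  ρ : ℚ → ℕ → Dual
  ρ a n = prod n (factor a)

  module Blocks (p : ℕ) (pr : Prime p) where

    open Integrality p pr
    open Criterion p pr using (Unit-cong)

    Div₁? : ∀ x → Dec (Div 1 x)
    Div₁? x with Zp? (inv π * x)
    ... | yes z = yes (mkDiv (inv π * x) z (eq x))
      where
      eq : ∀ x → x ≡ π^ 1 * (inv π * x)
      eq x = sym (trans (solve 3 (λ p i x → (con 1ℚ :* p) :* (i :* x) := (p :* i) :* x) refl π (inv π) x)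
          (trans (cong (_* x) (inv-right π≢0)) (*-identityˡ x)))
    ... | no ¬z = no (λ { (mkDiv q zq refl) → ¬z
        (subst Zp (sym (trans (solve 3 (λ p i x → i :* ((con 1ℚ :* p) :* x) := (p :* i) :* x) refl π (inv π) q)
                    (trans (cong (_* q) (inv-right π≢0)) (*-identityˡ q)))) zq) })

    ¬Div₁⇒Unit : ∀ {x} → Zp x → ¬ Div 1 x → Unit x
    ¬Div₁⇒Unit zx ¬d with Div₁⊎Unit zx
    ... | inj₁ d = ⊥-elim (¬d d)
    ... | inj₂ u = u

    -- Sorts the factors of a Pochhammer product into p-adic units and multiples of `p`. A factor of
    -- the wrong kind becomes `1D`, so that both products keep the same index range; `D` will be
    -- `linear` or `recip`.
    unitPart nonunitPart : (ℚ → Dual) → ℚ → Dual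
    unitPart D x with Div₁? x
    ... | yes _ = 1D
    ... | no  _ = D x
    nonunitPart D x with Div₁? x
    ... | yes _ = D x
    ... | no  _ = 1D

    parts : ∀ D x → D x ≡ unitPart D x ⊗ nonunitPart D x
    parts D x with Div₁? x
    ... | yes _ = sym (⊗-identityˡ (D x))
    ... | no  _ = sym (⊗-identityʳ (D x))

    nonunit-yes : ∀ D {x} → Div 1 x → nonunitPart D x ≡ D x
    nonunit-yes D {x} d with Div₁? x
    ... | yes _ = refl
    ... | no ¬d = ⊥-elim (¬d d)

    nonunit-no : ∀ D {x} → Unit x → nonunitPart D x ≡ 1D
    nonunit-no D {x} u with Div₁? x
    ... | yes d = ⊥-elim (¬Div₁-Unit u d)
    ... | no _  = refl

    ZpD : Dual → Set
    ZpD u = Zp (re u) × Zp (ep u)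

    ZpD-⊗ : ∀ {u v} → ZpD u → ZpD v → ZpD (u ⊗ v)
    ZpD-⊗ (a , b) (c , d) = Zp-* a c , Zp-+ (Zp-* b c) (Zp-* a d)

    ZpD-1 : ZpD 1D
    ZpD-1 = Zp-1 , Zp-0

    ZpD-prod : ∀ n {f} → (∀ i → i ℕ.< n → ZpD (f i)) → ZpD (prod n f)
    ZpD-prod zero    z = ZpD-1
    ZpD-prod (suc n) z = ZpD-⊗ (ZpD-prod n (λ i i<n → z i (ℕₚ.m<n⇒m<1+n i<n))) (z n ℕₚ.≤-refl)

    ZpD-recip : ∀ {x} → Unit x → ZpD (recip x)
    ZpD-recip u = Unit-inv u , Zp-neg (Zp-* (Unit-inv u) (Unit-inv u))

    ZpD-unitPart : ∀ D x → (Unit x → ZpD (D x)) → Zp x → ZpD (unitPart D x)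
    ZpD-unitPart D x z zx with Div₁? x
    ... | yes _ = ZpD-1
    ... | no ¬d = z (¬Div₁⇒Unit zx ¬d)

    up : ℚ → ℚ
    up x = re (unitPart linear x)

    up-unit : ∀ {x} → Zp x → Unit (up x)
    up-unit {x} zx with Div₁? x
    ... | yes _ = Unit-1
    ... | no ¬d = ¬Div₁⇒Unit zx ¬d

    re-recip : ∀ x → re (unitPart recip x) ≡ inv (up x)
    re-recip x with Div₁? x
    ... | yes _ = refl
    ... | no  _ = refl

    up-cong : ∀ {s x y} → Zp x → Zp y → Div (suc s) (x - y) → Div (suc s) (up x - up y)
    up-cong {s} {x} {y} zx zy d with Div₁? x | Div₁? y
    ... | yes _  | yes _  = Div-resp (sym (+-inverseʳ 1ℚ)) Div-0
    ... | no _   | no _   = d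
    ... | yes dx | no ¬dy = ⊥-elim
        (¬dy (Div-resp (solve 2 (λ x y → x :- (x :- y) := y) refl x y) (Div-- dx (Div-mono (s≤s z≤n) d))))
    ... | no ¬dx | yes dy = ⊥-elim
        (¬dx (Div-resp (solve 2 (λ x y → (x :- y) :+ y := x) refl x y) (Div-+ (Div-mono (s≤s z≤n) d) dy)))

    -- The product of the p-adic units among `x, x + 1, …, x + n - 1`; up to sign it is a quotient
    -- of values of Morita's p-adic gamma function.
    Φ : ℚ → ℕ → ℚ
    Φ x n = prodℚ n (λ i → up (x + ι i))

    Zp-prodℚ : ∀ n {f} → (∀ i → i ℕ.< n → Zp (f i)) → Zp (prodℚ n f)
    Zp-prodℚ zero    z = Zp-1
    Zp-prodℚ (suc n) z = Zp-* (Zp-prodℚ n (λ i i<n → z i (ℕₚ.m<n⇒m<1+n i<n))) (z n ℕₚ.≤-refl)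

    Zp-up : ∀ {x} → Zp x → Zp (up x)
    Zp-up zx = Unit.integral (up-unit zx)

    Zp-Φ : ∀ {x} n → Zp x → Zp (Φ x n)
    Zp-Φ n zx = Zp-prodℚ n (λ i _ → Zp-up (Zp-+ zx (Zp-ι i)))

    Φ-cong : ∀ {s x y} n → Zp x → Zp y → Div (suc s) (x - y) → Div (suc s) (Φ x n - Φ y n)
    Φ-cong zero    zx zy d = Div-resp (sym (+-inverseʳ 1ℚ)) Div-0
    Φ-cong {x = x} {y} (suc n) zx zy d = Div-*-cong (Zp-Φ n zx) (Zp-up (Zp-+ zy (Zp-ι n))) (Φ-cong n zx zy d)
      (up-cong (Zp-+ zx (Zp-ι n)) (Zp-+ zy (Zp-ι n))
          (Div-resp (solve 3 (λ x y n → x :- y := (x :+ n) :- (y :+ n)) refl x y (ι n)) d))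

    Φ-shift : ∀ x n → up x * Φ (x + 1ℚ) n ≡ Φ x n * up (x + ι n)
    Φ-shift x zero    = trans (*-identityʳ (up x)) (trans (cong up (sym (+-identityʳ x))) (sym (*-identityˡ _)))
    Φ-shift x (suc n) = trans (sym (*-assoc (up x) (Φ (x + 1ℚ) n) _)) (trans (cong₂ _*_ (Φ-shift x n) (cong up (trans
      (solve 2 (λ x n → x :+ con 1ℚ :+ n := x :+ (con 1ℚ :+ n)) refl x (ι n)) (cong (λ t → x + t) (sym (ι-suc n)))))) refl)

    -- As in the proof of Wilson's theorem, moving the start by one exchanges two congruent unit factors.
    Φ-period : ∀ s k {x y} → Zp x → Zp y → let n = p ℕ.^ s ℕ.* k ℕ.* p in Div (suc s) (Φ x n - Φ y n)
    Φ-period s k {x} {y} zx zy = Div-trans (Φ x n) (Φ 0ℚ n) (Φ y n) (to-0 zx) (Div-swap (Φ y n) (Φ 0ℚ n) (to-0 zy))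
      where
      n : ℕ
      n = p ℕ.^ s ℕ.* k ℕ.* p
      ι-n : Div (suc s) (ι n)
      ι-n = Div-resp (sym (trans (ι-* (p ℕ.^ s ℕ.* k) p) (cong (_* π) (trans (ι-* (p ℕ.^ s) k) (cong (_* ι k) (ι-^ s))))))
        (mkDiv (ι k) (Zp-ι k) (solve 3 (λ a k p → (a :* k) :* p := (a :* p) :* k) refl (π^ s) (ι k) π))
      one : ∀ {x} → Zp x → Div (suc s) (Φ (x + 1ℚ) n - Φ x n)
      one {x} zx = Div-unit (up-unit zx) (Div-resp eq (Div-*ˡ (Zp-Φ n zx) (up-cong (Zp-+ zx (Zp-ι n)) zx
        (Div-resp (solve 2 (λ x n → n := (x :+ n) :- x) refl x (ι n)) ι-n))))
        where
        eq : Φ x n * (up (x + ι n) - up x) ≡ up x * (Φ (x + 1ℚ) n - Φ x n)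
        eq = trans (solve 3 (λ f v u → f :* (v :- u) := f :* v :- u :* f) refl (Φ x n) (up (x + ι n)) (up x))
          (trans (cong (λ t → t - up x * Φ x n) (sym (Φ-shift x n)))
              (solve 3 (λ u g f → u :* g :- u :* f := u :* (g :- f)) refl (up x) (Φ (x + 1ℚ) n) (Φ x n)))
      many : ∀ X {x} → Zp x → Div (suc s) (Φ (x + ι X) n - Φ x n)
      many zero    {x} zx = Div-resp (sym (trans (cong (λ t → Φ t n - Φ x n) (+-identityʳ x)) (+-inverseʳ (Φ x n)))) Div-0
      many (suc X) {x} zx = Div-trans (Φ (x + ι (suc X)) n) (Φ (x + ι X) n) (Φ x n)
        (Div-resp (cong (λ t → Φ t n - Φ (x + ι X) n)
            (trans (solve 2 (λ x i → x :+ i :+ con 1ℚ := x :+ (con 1ℚ :+ i)) refl x (ι X))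
            (cong (λ t → x + t) (sym (ι-suc X)))))
          (one (Zp-+ zx (Zp-ι X)))) (many X zx)
      -- `x` is congruent to some `-X`, so `X` shifts by one lead to a start congruent to 0; any two
      -- starting points are compared through 0.
      to-0 : ∀ {x} → Zp x → Div (suc s) (Φ x n - Φ 0ℚ n)
      to-0 {x} zx = by (approximate (suc s) zx)
        where
        by : (∃ λ X → Div (suc s) (x + ι X)) → Div (suc s) (Φ x n - Φ 0ℚ n)
        by (X , d) = Div-trans (Φ x n) (Φ (x + ι X) n) (Φ 0ℚ n) (Div-swap (Φ (x + ι X) n) (Φ x n) (many X zx))
          (Φ-cong n (Zp-+ zx (Zp-ι X)) Zp-0 (Div-resp (sym (+-identityʳ (x + ι X))) d))

    -- A p-adic Lipschitz condition with one factor `p` to spare, as holds for functions of `i p`;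
    -- this factor allows the division by `p` in `claim`. Arguments stay within `0 … N` because the
    -- sums there pair `i` with `N - i`.
    record Lip (N : ℕ) (f : ℕ → ℚ) : Set where
      constructor mkLip
      field
        lipZp : ∀ i → i ℕ.≤ N → Zp (f i)
        lip   : ∀ s i k → i ℕ.+ p ℕ.^ s ℕ.* k ℕ.≤ N → Div (suc s) (f (i ℕ.+ p ℕ.^ s ℕ.* k) - f i)
    open Lip public

    Lip-* : ∀ {N f g} → Lip N f → Lip N g → Lip N (λ i → f i * g i)
    Lip-* lf lg = mkLip (λ i i≤N → Zp-* (lipZp lf i i≤N) (lipZp lg i i≤N))
      (λ s i k le → Div-*-cong (lipZp lf _ le) (lipZp lg i (ℕₚ.≤-trans (ℕₚ.m≤m+n i _) le)) (lip lf s i k le)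
          (lip lg s i k le))

    Lip-prodℚ : ∀ {N} n {f : ℕ → ℕ → ℚ} → (∀ c → c ℕ.< n → Lip N (f c)) → Lip N (λ i → prodℚ n (λ c → f c i))
    Lip-prodℚ zero    l = mkLip (λ _ _ → Zp-1) (λ _ _ _ _ → Div-resp (sym (+-inverseʳ 1ℚ)) Div-0)
    Lip-prodℚ (suc n) l = Lip-* (Lip-prodℚ n (λ c c<n → l c (ℕₚ.m<n⇒m<1+n c<n))) (l n ℕₚ.≤-refl)

    Lip-cong : ∀ {N f g} → (∀ i → f i ≡ g i) → Lip N f → Lip N g
    Lip-cong e l = mkLip (λ i i≤N → subst Zp (e i) (lipZp l i i≤N)) (λ s i k le → Div-resp (cong₂ _-_ (e _) (e _))
        (lip l s i k le))

    Lip-reflect : ∀ {N f} → Lip N f → Lip N (λ i → f (N ℕ.∸ i))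
    Lip-reflect {N} {f} l = mkLip (λ i _ → lipZp l (N ℕ.∸ i) (ℕₚ.m∸n≤m N i)) lip′
      where
      lip′ : ∀ s i k → i ℕ.+ p ℕ.^ s ℕ.* k ℕ.≤ N → Div (suc s) (f (N ℕ.∸ (i ℕ.+ p ℕ.^ s ℕ.* k)) - f (N ℕ.∸ i))
      lip′ s i k le = Div-swap (f (N ℕ.∸ i)) (f j)
          (Div-resp (cong (λ t → f t - f j) eq) (lip l s j k (subst (ℕ._≤ N) (sym eq) (ℕₚ.m∸n≤m N i))))
        where
        j d : ℕ
        d = p ℕ.^ s ℕ.* k
        j = N ℕ.∸ (i ℕ.+ d)
        eq : j ℕ.+ d ≡ N ℕ.∸ i
        eq = trans (cong (ℕ._+ d) (sym (ℕₚ.∸-+-assoc N i d)))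
            (ℕₚ.m∸n+n≡m (ℕₚ.m+n≤o⇒m≤o∸n d (subst (ℕ._≤ N) (ℕₚ.+-comm i d) le)))

    Lip-linear : ∀ {N x} → Zp x → Lip N (λ i → x + ι (i ℕ.* p))
    Lip-linear {N} {x} zx = mkLip (λ i _ → Zp-+ zx (Zp-ι (i ℕ.* p))) (λ s i k _ → mkDiv (ι k) (Zp-ι k) (eq s i k))
      where
      eq : ∀ s i k → (x + ι ((i ℕ.+ p ℕ.^ s ℕ.* k) ℕ.* p)) - (x + ι (i ℕ.* p)) ≡ π^ suc s * ι k
      eq s i k = trans (cong₂ (λ u v → (x + u) - (x + v)) (trans (ι-* (i ℕ.+ p ℕ.^ s ℕ.* k) p) (cong (_* π) (trans (ι-+ i _)
          (cong (λ t → ι i + t) (trans (ι-* (p ℕ.^ s) k) (cong (_* ι k) (ι-^ s))))))) (ι-* i p))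
        (solve 5 (λ x i a k p → (x :+ (i :+ a :* k) :* p) :- (x :+ i :* p) := (a :* p) :* k) refl x (ι i) (π^ s) (ι k) π)

    Lip-inv : ∀ {N f} → Lip N f → (∀ i → i ℕ.≤ N → Unit (f i)) → Lip N (λ i → inv (f i))
    Lip-inv {N} {f} l u = mkLip (λ i i≤N → Unit-inv (u i i≤N))
        (λ s i k le → diff (u _ le) (u i (ℕₚ.≤-trans (ℕₚ.m≤m+n i _) le)) (lip l s i k le))
      where
      diff : ∀ {s x y} → Unit x → Unit y → Div s (x - y) → Div s (inv x - inv y)
      diff {s} {x} {y} ux uy d = Div-unit ux (Div-unit uy (Div-resp eq (Div-neg d)))
        where
        eq : - (x - y) ≡ y * (x * (inv x - inv y))
        eq = sym (trans (solve 4 (λ x y i j → y :* (x :* (i :- j)) := y :* (x :* i) :- x :* (y :* j)) refl x y (inv x)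
            (inv y))
          (trans (cong₂ (λ s t → y * s - x * t) (inv-right (Unit-≢0 ux)) (inv-right (Unit-≢0 uy)))
            (solve 2 (λ x y → y :* con 1ℚ :- x :* con 1ℚ := :- (x :- y)) refl x y)))

    -- a′ is the image of a under Dwork's map.

    record Step (a a′ : ℚ) : Set where
      constructor mkStep
      field
        digit   : ℕ
        digit<p : digit ℕ.< p
        eq      : a + ι digit ≡ π * a′

    -- 1 is a fixed point with digit `p - 1`, so the denominators `n!` keep their form under Dwork's
    -- map.
    step-1 : Step 1ℚ 1ℚ
    step-1 = mkStep (ℕ.pred p) (ℕₚ.≤-reflexive sp) (trans (sym (ι-suc (ℕ.pred p))) (trans (cong ι sp) (sym (*-identityʳ π))))
      where
      sp : suc (ℕ.pred p) ≡ p
      sp = ℕₚ.suc-pred p {{ℕ.>-nonZero (ℕₚ.<-trans (s≤s z≤n) 1<p)}}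

    Unit-difference : ∀ {i j} → i ℕ.< p → j ℕ.< p → i ≢ j → Unit (ι i - ι j)
    Unit-difference {i} {j} i<p j<p i≢j = by (ℕₚ.<-cmp i j)
      where
      unit-> : ∀ {i j} → i ℕ.< j → j ℕ.< p → Unit (ι j - ι i)
      unit-> {i} {j} i<j j<p = subst Unit
        (trans (solve 2 (λ d i → d := (d :+ i) :- i) refl (ι (j ℕ.∸ i)) (ι i))
            (cong (λ t → t - ι i) (trans (sym (ι-+ (j ℕ.∸ i) i)) (cong ι (ℕₚ.m∸n+n≡m (ℕₚ.<⇒≤ i<j))))))
        (Unit-ι (λ d → ℕₚ.<-irrefl refl (ℕₚ.<-≤-trans (ℕₚ.≤-<-trans (ℕₚ.m∸n≤m j i) j<p)
            (∣⇒≤ {{ℕ.>-nonZero (ℕₚ.m<n⇒0<n∸m i<j)}} d))))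
      by : Tri (i ℕ.< j) (i ≡ j) (j ℕ.< i) → Unit (ι i - ι j)
      by (tri≈ _ e _)   = ⊥-elim (i≢j e)
      by (tri< i<j _ _) = subst Unit (solve 2 (λ i j → :- (j :- i) := i :- j) refl (ι i) (ι j)) (Unit-neg (unit-> i<j j<p))
      by (tri> _ _ j<i) = unit-> j<i i<p

    -- Among the `p` consecutive numbers of a block only the one at the digit of `a` is a multiple
    -- of `p`, namely `p (a′ + l)`; the others differ from it by a nonzero residue.
    nonunit-block : ∀ D {a a′} → Zp a′ → Step a a′ → ∀ l →
      prod p (λ c → nonunitPart D (a + ι (l ℕ.* p ℕ.+ c))) ≡ D (π * (a′ + ι l))
    nonunit-block D {a} {a′} za′ (mkStep m m<p eq) l = trans (prod-pick p m _ m<p others)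
      (trans (cong (nonunitPart D) at-m) (nonunit-yes D (Div-resp (*-comm (a′ + ι l) π) (Div-multiple (a′ + ι l) z))))
      where
      z : Zp (a′ + ι l)
      z = Zp-+ za′ (Zp-ι l)
      rewriteι : ∀ c → a + ι (l ℕ.* p ℕ.+ c) ≡ π * (a′ + ι l) + (ι c - ι m)
      rewriteι c = trans (cong (λ t → a + t) (trans (ι-+ (l ℕ.* p) c) (cong (_+ ι c) (ι-* l p)))) (trans
        (solve 5 (λ a l p c m → a :+ (l :* p :+ c) := (a :+ m) :+ p :* l :+ (c :- m)) refl a (ι l) π (ι c) (ι m))
        (cong (_+ (ι c - ι m)) (trans (cong (_+ π * ι l) eq) (sym (*-distribˡ-+ π a′ (ι l))))))
      at-m : a + ι (l ℕ.* p ℕ.+ m) ≡ π * (a′ + ι l)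
      at-m = trans (rewriteι m) (trans (cong (π * (a′ + ι l) +_) (+-inverseʳ (ι m))) (+-identityʳ _))
      others : ∀ c → c ℕ.< p → c ≢ m → nonunitPart D (a + ι (l ℕ.* p ℕ.+ c)) ≡ 1D
      others c c<p c≢m = nonunit-no D (subst Unit (sym (rewriteι c)) (Unit-cong (Unit-difference c<p m<p c≢m)
        (Zp-+ (Zp-* (Zp-ι p) z) (Zp-- (Zp-ι c) (Zp-ι m)))
        (Div-resp (solve 3 (λ p x d → x :* p := (p :* x :+ d) :- d) refl π (a′ + ι l) (ι c - ι m))
            (Div-multiple (a′ + ι l) z))))

    -- The substitution `ε ↦ ε / p`, forced by `p x + ε = p (x + ε / p)`. It is the source of the
    -- `1/p` in Dwork's congruence.
    σ : Dual → Dual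
    σ (x ,ε x′) = x ,ε inv π * x′

    σ-⊗ : ∀ u v → σ (u ⊗ v) ≡ σ u ⊗ σ v
    σ-⊗ (x ,ε x′) (y ,ε y′) = dual≡ refl
        (solve 5 (λ x x′ y y′ i → i :* (x′ :* y :+ x :* y′) := (i :* x′) :* y :+ x :* (i :* y′)) refl x x′ y y′ (inv π))

    inv-π* : ∀ x → x ≢ 0ℚ → inv (π * x) ≡ inv π * inv x
    inv-π* x x≢0 = inv-unique {π * x} (trans (solve 4 (λ p x i j → (p :* x) :* (i :* j) := (p :* i) :* (x :* j)) refl
        π x (inv π) (inv x))
      (trans (cong₂ _*_ (inv-right π≢0) (inv-right x≢0)) refl))

    -- The factor `p` cancels between numerator and denominator, and only the rescaling of `ε`
    -- remains.
    σ-factor : ∀ a i → linear (π * (a + ι i)) ⊗ recip (π * (1ℚ + ι i)) ≡ σ (factor a i)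
    σ-factor a i = trans (cong (λ t → linear (π * x) ⊗ (t ,ε - (t * t))) (inv-π* y y≢0)) (dual≡
      (trans (solve 4 (λ p x i j → (p :* x) :* (i :* j) := (p :* i) :* (x :* j)) refl π x (inv π) (inv y))
          (trans (cong (_* (x * inv y)) (inv-right π≢0)) (*-identityˡ _)))
      (trans (solve 4 (λ p x i j → con 1ℚ :* (i :* j) :+ (p :* x) :* (:- ((i :* j) :* (i :* j))) := i :*
          (con 1ℚ :* j :+ (p :* i) :* (x :* (:- (j :* j))))) refl π x (inv π) (inv y))
        (cong (λ t → inv π * (1ℚ * inv y + t)) (trans (cong (_* (x * - (inv y * inv y))) (inv-right π≢0)) (*-identityˡ _)))))
      where
      x y : ℚ
      x = a + ι i
      y = 1ℚ + ι i
      y≢0 : y ≢ 0ℚ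
      y≢0 e = ι-suc≢0 i (trans (ι-suc i) e)

    module _ {a a′ : ℚ} (za : Zp a) (za′ : Zp a′) (st : Step a a′) where

      private
        unitFactor : ℕ → Dual
        unitFactor j = unitPart linear (a + ι j) ⊗ unitPart recip (1ℚ + ι j)

        nonunitFactor : ℕ → Dual
        nonunitFactor j = nonunitPart linear (a + ι j) ⊗ nonunitPart recip (1ℚ + ι j)

      -- The quotient of `ρ a (i p + c)` by the rescaled `ρ a′ i`: the unit factors of the first `i`
      -- blocks and all factors of the incomplete last block, whose denominators are units because
      -- `c < p`.
      lam : ℕ → ℕ → Dual
      lam c i = prod (i ℕ.* p) unitFactor ⊗ prod c (λ c′ → factor a (i ℕ.* p ℕ.+ c′))

      private
        nonunit-prod : ∀ i → prod (i ℕ.* p) nonunitFactor ≡ σ (ρ a′ i)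
        nonunit-prod zero    = dual≡ refl (sym (*-zeroʳ (inv π)))
        nonunit-prod (suc i) = begin
          prod (p ℕ.+ i ℕ.* p) nonunitFactor
            ≡⟨ cong (λ t → prod t nonunitFactor) (ℕₚ.+-comm p (i ℕ.* p)) ⟩
          prod (i ℕ.* p ℕ.+ p) nonunitFactor
            ≡⟨ prod-+ (i ℕ.* p) p nonunitFactor ⟩
          prod (i ℕ.* p) nonunitFactor ⊗ prod p (λ c → nonunitFactor (i ℕ.* p ℕ.+ c))
            ≡⟨ cong₂ _⊗_ (nonunit-prod i) (prod-⊗ p _ _) ⟩
          σ (ρ a′ i) ⊗ (prod p (λ c → nonunitPart linear (a + ι (i ℕ.* p ℕ.+ c))) ⊗ prod p
              (λ c → nonunitPart recip (1ℚ + ι (i ℕ.* p ℕ.+ c))))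
            ≡⟨ cong (σ (ρ a′ i) ⊗_) (cong₂ _⊗_ (nonunit-block linear za′ st i) (nonunit-block recip Zp-1 step-1 i)) ⟩
          σ (ρ a′ i) ⊗ (linear (π * (a′ + ι i)) ⊗ recip (π * (1ℚ + ι i)))
            ≡⟨ cong (σ (ρ a′ i) ⊗_) (σ-factor a′ i) ⟩
          σ (ρ a′ i) ⊗ σ (factor a′ i)
            ≡⟨ sym (σ-⊗ (ρ a′ i) (factor a′ i)) ⟩
          σ (ρ a′ (suc i)) ∎
          where open ≡-Reasoning

      ρ-lam : ∀ c i → ρ a (i ℕ.* p ℕ.+ c) ≡ lam c i ⊗ σ (ρ a′ i)
      ρ-lam c i = begin
        prod (i ℕ.* p ℕ.+ c) (factor a)
          ≡⟨ prod-+ (i ℕ.* p) c (factor a) ⟩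
        prod (i ℕ.* p) (factor a) ⊗ Q
          ≡⟨ cong (_⊗ Q) (trans (prod-cong (i ℕ.* p)
              (λ j _ → trans (cong₂ _⊗_ (parts linear (a + ι j)) (parts recip (1ℚ + ι j)))
              (⊗-interchange (unitPart linear (a + ι j)) (nonunitPart linear (a + ι j)) (unitPart recip (1ℚ + ι j))
              (nonunitPart recip (1ℚ + ι j)))))
               (prod-⊗ (i ℕ.* p) unitFactor nonunitFactor)) ⟩
        prod (i ℕ.* p) unitFactor ⊗ prod (i ℕ.* p) nonunitFactor ⊗ Q
          ≡⟨ trans (⊗-assoc U N Q) (trans (cong (U ⊗_) (⊗-comm N Q)) (sym (⊗-assoc U Q N))) ⟩
        prod (i ℕ.* p) unitFactor ⊗ Q ⊗ prod (i ℕ.* p) nonunitFactor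
          ≡⟨ cong (prod (i ℕ.* p) unitFactor ⊗ Q ⊗_) (nonunit-prod i) ⟩
        lam c i ⊗ σ (ρ a′ i) ∎
        where
        open ≡-Reasoning
        Q U N : Dual
        Q = prod c (λ c′ → factor a (i ℕ.* p ℕ.+ c′))
        U = prod (i ℕ.* p) unitFactor
        N = prod (i ℕ.* p) nonunitFactor

      private
        den-unit : ∀ i c → suc c ℕ.< p → Unit (1ℚ + ι (i ℕ.* p ℕ.+ c))
        den-unit i c c<p = subst Unit (ι-suc (i ℕ.* p ℕ.+ c)) (Unit-ι (λ d → ℕₚ.<-irrefl refl (ℕₚ.<-≤-trans c<p
          (∣⇒≤ (∣m+n∣m⇒∣n (subst (p ∣_) (sym (ℕₚ.+-suc (i ℕ.* p) c)) d) (n∣m*n i))))))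

      ZpD-lam : ∀ c i → c ℕ.< p → ZpD (lam c i)
      ZpD-lam c i c<p = ZpD-⊗
        (ZpD-prod (i ℕ.* p) (λ j _ → ZpD-⊗
          (ZpD-unitPart linear (a + ι j) (λ u → Unit.integral u , Zp-1) (Zp-+ za (Zp-ι j)))
          (ZpD-unitPart recip (1ℚ + ι j) ZpD-recip (Zp-+ Zp-1 (Zp-ι j)))))
        (ZpD-prod c (λ c′ c′<c → ZpD-⊗ (Zp-+ za (Zp-ι (i ℕ.* p ℕ.+ c′)) , Zp-1)
            (ZpD-recip (den-unit i c′ (ℕₚ.≤-<-trans c′<c c<p)))))

      -- Passing from `i` to `i + p^s k` adds complete blocks, whose unit products in numerator and
      -- denominator are congruent by `Φ-period` and thus have a ratio congruent to 1. The
      -- incomplete block is built from functions of `i p`.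
      Lip-lam : ∀ N c → c ℕ.< p → Lip N (λ i → re (lam c i))
      Lip-lam N c c<p = Lip-* (Lip-cong (λ i → sym (re-prod (i ℕ.* p) unitFactor)) units)
        (Lip-cong (λ i → sym (re-prod c _)) (Lip-prodℚ c (λ c′ c′<c → Lip-*
          (Lip-cong (λ i → rearrange a i c′) (Lip-linear (Zp-+ za (Zp-ι c′))))
          (Lip-inv (Lip-cong (λ i → rearrange 1ℚ i c′) (Lip-linear (Zp-+ Zp-1 (Zp-ι c′))))
              (λ i _ → den-unit i c′ (ℕₚ.≤-<-trans c′<c c<p))))))
        where
        rearrange : ∀ x i c → x + ι c + ι (i ℕ.* p) ≡ x + ι (i ℕ.* p ℕ.+ c)
        rearrange x i c = trans (solve 3 (λ x c j → x :+ c :+ j := x :+ (j :+ c)) refl x (ι c) (ι (i ℕ.* p)))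
            (cong (λ t → x + t) (sym (ι-+ (i ℕ.* p) c)))
        Φ⁻ : ℚ → ℕ → ℚ
        Φ⁻ x n = prodℚ n (λ j → inv (up (x + ι j)))
        Φ·Φ⁻ : ∀ {x} n → Zp x → Φ x n * Φ⁻ x n ≡ 1ℚ
        Φ·Φ⁻ {x} n zx = trans (sym (prodℚ-* n _ _))
            (trans (prodℚ-cong n (λ j _ → inv-right (Unit-≢0 (up-unit (Zp-+ zx (Zp-ι j)))))) (ones n))
          where
          ones : ∀ n → prodℚ n (λ _ → 1ℚ) ≡ 1ℚ
          ones zero    = refl
          ones (suc n) = trans (*-identityʳ _) (ones n)
        Zp-Φ⁻ : ∀ {x} n → Zp x → Zp (Φ⁻ x n)
        Zp-Φ⁻ n zx = Zp-prodℚ n (λ j _ → Unit-inv (up-unit (Zp-+ zx (Zp-ι j))))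
        f : ℕ → ℚ
        f n = prodℚ n (re ∘ unitFactor)
        Zp-f : ∀ n → Zp (f n)
        Zp-f n = Zp-prodℚ n (λ j _ → Zp-* (Zp-up (Zp-+ za (Zp-ι j)))
            (subst Zp (sym (re-recip (1ℚ + ι j))) (Unit-inv (up-unit (Zp-+ Zp-1 (Zp-ι j))))))
        f-+ : ∀ m n → f (m ℕ.+ n) ≡ f m * (Φ (a + ι m) n * Φ⁻ (1ℚ + ι m) n)
        f-+ m n = trans (prodℚ-+ m n (re ∘ unitFactor)) (cong (f m *_) (trans (prodℚ-cong n (λ j _ → cong₂ _*_
            (cong up (shift a j)) (trans (re-recip (1ℚ + ι (m ℕ.+ j))) (cong (inv ∘ up) (shift 1ℚ j))))) (prodℚ-* n _ _)))
          where
          shift : ∀ x j → x + ι (m ℕ.+ j) ≡ x + ι m + ι j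
          shift x j = trans (cong (λ t → x + t) (ι-+ m j)) (sym (+-assoc x (ι m) (ι j)))
        units : Lip N (λ i → f (i ℕ.* p))
        units = mkLip (λ i _ → Zp-f (i ℕ.* p)) lip′
          where
          lip′ : ∀ s i k → i ℕ.+ p ℕ.^ s ℕ.* k ℕ.≤ N → Div (suc s) (f ((i ℕ.+ p ℕ.^ s ℕ.* k) ℕ.* p) - f (i ℕ.* p))
          lip′ s i k _ = Div-resp eq (Div-*ˡ (Zp-f (i ℕ.* p)) (Div-*ʳ (Φ-period s k zx zy) (Zp-Φ⁻ n zy)))
            where
            n : ℕ
            n = p ℕ.^ s ℕ.* k ℕ.* p
            x y : ℚ
            x = a + ι (i ℕ.* p)
            y = 1ℚ + ι (i ℕ.* p)
            zx : Zp x
            zx = Zp-+ za (Zp-ι (i ℕ.* p))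
            zy : Zp y
            zy = Zp-+ Zp-1 (Zp-ι (i ℕ.* p))
            eq : f (i ℕ.* p) * ((Φ x n - Φ y n) * Φ⁻ y n) ≡ f ((i ℕ.+ p ℕ.^ s ℕ.* k) ℕ.* p) - f (i ℕ.* p)
            eq = trans (solve 4 (λ f u v w → f :* ((u :- v) :* w) := f :* (u :* w) :- f :* (v :* w)) refl
                (f (i ℕ.* p)) (Φ x n) (Φ y n) (Φ⁻ y n))
              (cong₂ _-_ (trans (sym (f-+ (i ℕ.* p) n)) (cong f (sym (ℕₚ.*-distribʳ-+ p i (p ℕ.^ s ℕ.* k)))))
                (trans (cong (f (i ℕ.* p) *_) (Φ·Φ⁻ n zy)) (*-identityʳ _)))

-- Dwork's congruence for the pair `F`, `G` along an orbit of parameters.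

module DworkTheorem where

  open import Data.Nat.Divisibility using (_∣_; divides; ∣⇒≤; ∣m+n∣m⇒∣n; n∣m*n)
  open import Data.Nat.DivMod using (m≡m%n+[m/n]*n; m%n<n; m/n*n≤m; /-monoˡ-≤; m*n/n≡m; m/n<m; m<n⇒m/n≡0; +-distrib-/-∣ˡ)
  open import Data.Nat.Induction using (<-rec)
  open import Data.Nat.Primality using (Prime)
  open import Data.Rational using (_+_; _*_; _-_; -_)
  open import Data.Rational.Properties
  open FormalSeries
  open Composition
  open LagrangeInversion
  open PAdicIntegers
  open FrobeniusLift
  open GaussCongruences
  open DworkMap

  open QSol using (solve; _:+_; _:*_; _:-_; :-_; con; _:=_)

  sum-shorten : ∀ M k g → k ℕ.≤ M → (∀ i → k ℕ.≤ i → g i ≡ 0ℚ) → sumTo M g ≡ sumTo k g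
  sum-shorten zero    zero g _   z = refl
  sum-shorten (suc M) k    g k≤M z with k ℕ.≟ suc M
  ... | yes refl = refl
  ... | no ne    = trans (cong₂ _+_ (sum-shorten M k g k≤M′ z) (z M k≤M′)) (+-identityʳ (sumTo k g))
    where
    k≤M′ : k ℕ.≤ M
    k≤M′ = ℕₚ.≤-pred (ℕₚ.≤∧≢⇒< k≤M ne)

  sum-append : ∀ m n g → sumTo (m ℕ.+ n) g ≡ sumTo m g + sumTo n (λ i → g (m ℕ.+ i))
  sum-append m zero    g = trans (cong (λ t → sumTo t g) (ℕₚ.+-identityʳ m)) (sym (+-identityʳ (sumTo m g)))
  sum-append m (suc n) g = trans (cong (λ t → sumTo t g) (ℕₚ.+-suc m n)) (trans (cong (_+ g (m ℕ.+ n)) (sum-append m n g))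
    (+-assoc (sumTo m g) (sumTo n (λ i → g (m ℕ.+ i))) (g (m ℕ.+ n))))

  sum-blocks : ∀ M p g → sumTo (M ℕ.* p) g ≡ sumTo M (λ i → sumTo p (λ c → g (i ℕ.* p ℕ.+ c)))
  sum-blocks zero    p g = refl
  sum-blocks (suc M) p g = trans (cong (λ t → sumTo t g) (ℕₚ.+-comm p (M ℕ.* p))) (trans (sum-append (M ℕ.* p) p g)
    (cong (_+ sumTo p (λ c → g (M ℕ.* p ℕ.+ c))) (sum-blocks M p g)))

  module Dwork (p : ℕ) (pr : Prime p) where

    open Integrality p pr
    open Frobenius p pr
    open Criterion p pr
    open Blocks p pr

    private
      instance
        p≢0 : ℕ.NonZero p
        p≢0 = ℕ.>-nonZero (ℕₚ.<-trans (s≤s z≤n) 1<p)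

      -- The number of `i` with `i p + c ≤ N`; the separate case is due to truncated subtraction.
      count : ℕ → ℕ → ℕ
      count N c with c ℕ.≤? N
      ... | yes _ = suc ((N ℕ.∸ c) ℕ./ p)
      ... | no  _ = 0

      count-yes : ∀ {N c} → c ℕ.≤ N → count N c ≡ suc ((N ℕ.∸ c) ℕ./ p)
      count-yes {N} {c} le with c ℕ.≤? N
      ... | yes _ = refl
      ... | no ¬le = ⊥-elim (¬le le)

      count-no : ∀ {N c} → ¬ c ℕ.≤ N → count N c ≡ 0
      count-no {N} {c} ¬le with c ℕ.≤? N
      ... | yes le = ⊥-elim (¬le le)
      ... | no _ = refl

      i≤quot⇒ : ∀ {N c i} → c ℕ.≤ N → i ℕ.≤ (N ℕ.∸ c) ℕ./ p → i ℕ.* p ℕ.+ c ℕ.≤ N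
      i≤quot⇒ {N} {c} {i} c≤N i≤ = subst (i ℕ.* p ℕ.+ c ℕ.≤_) (ℕₚ.m∸n+n≡m c≤N)
        (ℕₚ.+-monoˡ-≤ c (ℕₚ.≤-trans (ℕₚ.*-monoˡ-≤ p i≤) (m/n*n≤m (N ℕ.∸ c) p)))

      <count⇒ : ∀ {N c i} → i ℕ.< count N c → i ℕ.* p ℕ.+ c ℕ.≤ N
      <count⇒ {N} {c} {i} lt with c ℕ.≤? N
      ... | yes c≤N = i≤quot⇒ c≤N (ℕₚ.≤-pred lt)

      ⇒<count : ∀ {N c i} → i ℕ.* p ℕ.+ c ℕ.≤ N → i ℕ.< count N c
      ⇒<count {N} {c} {i} le with c ℕ.≤? N
      ... | yes c≤N = s≤s (subst (ℕ._≤ (N ℕ.∸ c) ℕ./ p) (m*n/n≡m i p) (/-monoˡ-≤ p (ℕₚ.m+n≤o⇒m≤o∸n (i ℕ.* p) le)))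
      ... | no ¬c≤N = ⊥-elim (¬c≤N (ℕₚ.≤-trans (ℕₚ.m≤n+m c (i ℕ.* p)) le))

      count≤ : ∀ N c → count N c ℕ.≤ suc N
      count≤ N c with c ℕ.≤? N
      ... | yes _ = s≤s (ℕₚ.≤-trans (/-monoˡ-≤ p (ℕₚ.m∸n≤m N c)) (ℕₚ.≤-trans (ℕₚ.m≤m*n (N ℕ./ p) p) (m/n*n≤m N p)))
      ... | no _  = z≤n

      cut : ℕ → (ℕ → ℚ) → ℕ → ℚ
      cut N f i with i ℕ.≤? N
      ... | yes _ = f i
      ... | no _  = 0ℚ

      cut-≤ : ∀ {N} f {i} → i ℕ.≤ N → cut N f i ≡ f i
      cut-≤ {N} f {i} le with i ℕ.≤? N
      ... | yes _ = refl
      ... | no ¬le = ⊥-elim (¬le le)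

      cut-> : ∀ {N} f {i} → ¬ i ℕ.≤ N → cut N f i ≡ 0ℚ
      cut-> {N} f {i} ¬le with i ℕ.≤? N
      ... | yes le = ⊥-elim (¬le le)
      ... | no _ = refl

    -- Sorts a sum by residue classes modulo `p`. The summand is first extended by zero so that the
    -- range can be padded to a multiple of `p`.
    regroup : ∀ N f → sumTo (suc N) f ≡ sumTo p (λ c → sumTo (count N c) (λ i → f (i ℕ.* p ℕ.+ c)))
    regroup N f = begin
      sumTo (suc N) f
        ≡⟨ sum-cong (suc N) (λ i i<N → sym (cut-≤ f (ℕₚ.≤-pred i<N))) ⟩
      sumTo (suc N) (cut N f)
        ≡⟨ sym (sum-shorten (suc N ℕ.* p) (suc N) (cut N f) (ℕₚ.m≤m*n (suc N) p) (λ i N<i → cut-> f (ℕₚ.<⇒≱ N<i))) ⟩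
      sumTo (suc N ℕ.* p) (cut N f)
        ≡⟨ sum-blocks (suc N) p (cut N f) ⟩
      sumTo (suc N) (λ i → sumTo p (λ c → cut N f (i ℕ.* p ℕ.+ c)))
        ≡⟨ sum-swap (suc N) p (λ i c → cut N f (i ℕ.* p ℕ.+ c)) ⟩
      sumTo p (λ c → sumTo (suc N) (λ i → cut N f (i ℕ.* p ℕ.+ c)))
        ≡⟨ sum-cong′ p (λ c → trans (sum-shorten (suc N) (count N c) (λ i → cut N f (i ℕ.* p ℕ.+ c)) (count≤ N c)
             (λ i ge → cut-> f (λ le → ℕₚ.<⇒≱ (⇒<count le) ge))) (sum-cong (count N c) (λ i lt → cut-≤ f (<count⇒ lt)))) ⟩
      sumTo p (λ c → sumTo (count N c) (λ i → f (i ℕ.* p ℕ.+ c))) ∎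
      where open ≡-Reasoning

    -- The stretched series lives in degrees divisible by `p`, so one residue class of `f`
    -- contributes; the final reversal makes the index of `f` the free one.
    ·-stretch : ∀ f g N r → r ℕ.< p → (f · stretch g) (N ℕ.* p ℕ.+ r) ≡ sumTo (suc N) (λ i → f (i ℕ.* p ℕ.+ r) * g (N ℕ.∸ i))
    ·-stretch f g N r r<p = begin
      (f · stretch g) n
        ≡⟨ at (·-comm f (stretch g)) n ⟩
      (stretch g · f) n
        ≡⟨ ·-at (stretch g) f n ⟩
      sumTo (suc n) term
        ≡⟨ regroup n term ⟩
      sumTo p part
        ≡⟨ cong (λ t → sumTo t part) (sym (ℕₚ.suc-pred p)) ⟩
      sumTo (suc (ℕ.pred p)) part
        ≡⟨ sum-first (ℕ.pred p) part ⟩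
      part 0 + sumTo (ℕ.pred p) (part ∘ suc)
        ≡⟨ cong₂ _+_ part-0 (sum-0 (ℕ.pred p) part-suc) ⟩
      sumTo (suc N) (λ i → g i * f ((N ℕ.∸ i) ℕ.* p ℕ.+ r)) + 0ℚ
        ≡⟨ +-identityʳ _ ⟩
      sumTo (suc N) (λ i → g i * f ((N ℕ.∸ i) ℕ.* p ℕ.+ r))
        ≡⟨ sum-reverse N (λ i → g i * f ((N ℕ.∸ i) ℕ.* p ℕ.+ r)) ⟩
      sumTo (suc N) (λ i → g (N ℕ.∸ i) * f ((N ℕ.∸ (N ℕ.∸ i)) ℕ.* p ℕ.+ r))
        ≡⟨ sum-cong (suc N) (λ i i<N → trans (*-comm (g (N ℕ.∸ i)) _) (cong (λ t → f (t ℕ.* p ℕ.+ r) * g (N ℕ.∸ i))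
            (ℕₚ.m∸[m∸n]≡n (ℕₚ.≤-pred i<N)))) ⟩
      sumTo (suc N) (λ i → f (i ℕ.* p ℕ.+ r) * g (N ℕ.∸ i)) ∎
      where
      open ≡-Reasoning
      n : ℕ
      n = N ℕ.* p ℕ.+ r
      term : ℕ → ℚ
      term j = stretch g j * f (n ℕ.∸ j)
      part : ℕ → ℚ
      part c = sumTo (count n c) (λ i → term (i ℕ.* p ℕ.+ c))
      n/p : n ℕ./ p ≡ N
      n/p = trans (+-distrib-/-∣ˡ r (n∣m*n N)) (trans (cong₂ ℕ._+_ (m*n/n≡m N p) (m<n⇒m/n≡0 r<p)) (ℕₚ.+-identityʳ N))
      part-0 : part 0 ≡ sumTo (suc N) (λ i → g i * f ((N ℕ.∸ i) ℕ.* p ℕ.+ r))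
      part-0 = trans (cong (λ t → sumTo t (λ i → term (i ℕ.* p ℕ.+ 0))) (trans (count-yes z≤n) (cong suc n/p)))
        (sum-cong (suc N) (λ i i<N → trans (cong term (ℕₚ.+-identityʳ (i ℕ.* p)))
            (cong₂ _*_ (stretch-at g i) (cong f (rest i (ℕₚ.≤-pred i<N))))))
        where
        rest : ∀ i → i ℕ.≤ N → n ℕ.∸ i ℕ.* p ≡ (N ℕ.∸ i) ℕ.* p ℕ.+ r
        rest i i≤N = trans (ℕₚ.+-∸-comm r (ℕₚ.*-monoˡ-≤ p i≤N)) (cong (ℕ._+ r) (sym (ℕₚ.*-distribʳ-∸ p N i)))
      part-suc : ∀ c → c ℕ.< ℕ.pred p → part (suc c) ≡ 0ℚ
      part-suc c c<p = sum-0 (count n (suc c)) (λ i _ → trans (cong (_* f (n ℕ.∸ (i ℕ.* p ℕ.+ suc c)))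
        (stretch-off g _ (λ d → ℕₚ.<⇒≱ (subst (suc c ℕ.<_) (ℕₚ.suc-pred p) (s≤s c<p)) (∣⇒≤ (∣m+n∣m⇒∣n d (n∣m*n i))))))
            (*-zeroˡ (f (n ℕ.∸ (i ℕ.* p ℕ.+ suc c)))))

    ZpS-cancel : ∀ {f X} → f 0 ≡ 1ℚ → ZpS f → ZpS (f · X) → ZpS X
    ZpS-cancel {f} {X} f₀ zf z = mkZpS (<-rec (λ n → Zp (X n)) step)
      where
      step : ∀ n → (∀ {i} → i ℕ.< n → Zp (X i)) → Zp (X n)
      step zero    _   = subst Zp (trans (·-zero f X) (trans (cong (_* X 0) f₀) (*-identityˡ (X 0)))) (zpAt z 0)
      step (suc n) rec = subst Zp
          (trans (cong (λ t → t - (tail f · X) n) (trans (·-suc f X n) (cong (λ t → t * X (suc n) + (tail f · X) n) f₀)))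
          (solve 2 (λ x t → con 1ℚ :* x :+ t :- t := x) refl (X (suc n)) ((tail f · X) n)))
        (Zp-- (zpAt z (suc n)) (subst Zp (sym (·-at (tail f) X n))
            (Zp-sum (suc n) (λ i _ → Zp-* (zpAt zf (suc i)) (rec (s≤s (ℕₚ.m∸n≤m n i)))))))

    module Chain (α β : ℕ → ℚ) (zα : ∀ t → Zp (α t)) (zβ : ∀ t → Zp (β t))
      (sα : ∀ t → Step (α t) (α (suc t))) (sβ : ∀ t → Step (β t) (β (suc t))) where

      A : ℕ → ℕ → Dual
      A t n = ρ (α t) n ⊗ ρ (β t) n

      -- The coefficients of `F` and `G` at stage `t` of the orbit, as `re-Fser` and `ep-Gser`
      -- confirm.
      x g : ℕ → ℕ → ℚ
      x t n = re (A t n)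
      g t n = ep (A t n)

      private
        L : ℕ → ℕ → ℕ → Dual
        L t c i = lam (zα t) (zα (suc t)) (sα t) c i ⊗ lam (zβ t) (zβ (suc t)) (sβ t) c i

        ZpD-L : ∀ t c i → c ℕ.< p → ZpD (L t c i)
        ZpD-L t c i c<p = ZpD-⊗ (ZpD-lam (zα t) (zα (suc t)) (sα t) c i c<p) (ZpD-lam (zβ t) (zβ (suc t)) (sβ t) c i c<p)

        Lip-L : ∀ N t c → c ℕ.< p → Lip N (λ i → re (L t c i))
        Lip-L N t c c<p = Lip-* (Lip-lam (zα t) (zα (suc t)) (sα t) N c c<p) (Lip-lam (zβ t) (zβ (suc t)) (sβ t) N c c<p)

        A-L : ∀ t c i → A t (i ℕ.* p ℕ.+ c) ≡ L t c i ⊗ σ (A (suc t) i)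
        A-L t c i = trans (cong₂ _⊗_ (ρ-lam (zα t) (zα (suc t)) (sα t) c i) (ρ-lam (zβ t) (zβ (suc t)) (sβ t) c i))
          (trans (⊗-interchange la (σ (ρ (α (suc t)) i)) lb (σ (ρ (β (suc t)) i)))
              (cong (L t c i ⊗_) (sym (σ-⊗ (ρ (α (suc t)) i) (ρ (β (suc t)) i)))))
          where
          la lb : Dual
          la = lam (zα t) (zα (suc t)) (sα t) c i
          lb = lam (zβ t) (zβ (suc t)) (sβ t) c i

        x-L : ∀ t c i → x t (i ℕ.* p ℕ.+ c) ≡ re (L t c i) * x (suc t) i
        x-L t c i = cong re (A-L t c i)

        g-L : ∀ t c i → g t (i ℕ.* p ℕ.+ c) ≡ ep (L t c i) * x (suc t) i + re (L t c i) * (inv π * g (suc t) i)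
        g-L t c i = cong ep (A-L t c i)

      -- For `n = i p + c` the factor `re (L t c i)` is integral and `x (suc t) i` has a smaller
      -- index, so integrality descends along the base-p digits, for all stages at once.
      Zp-x : ∀ n t → Zp (x t n)
      Zp-x = <-rec (λ n → ∀ t → Zp (x t n)) step
        where
        step : ∀ n → (∀ {i} → i ℕ.< n → ∀ t → Zp (x t i)) → ∀ t → Zp (x t n)
        step zero    rec t = Zp-1
        step n@(suc _) rec t = subst Zp (sym (trans (cong (x t) n≡) (x-L t c i)))
          (Zp-* (proj₁ (ZpD-L t c i (m%n<n n p))) (rec (m/n<m n p 1<p) (suc t)))
          where
          i c : ℕ
          i = n ℕ./ p
          c = n ℕ.% p
          n≡ : n ≡ i ℕ.* p ℕ.+ c
          n≡ = trans (m≡m%n+[m/n]*n n p) (ℕₚ.+-comm c (i ℕ.* p))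

      -- The summands of `G F - F G` in degree `N`. Their plain sum is 0 by antisymmetry; the point
      -- is what remains of this when they are weighted by a function `Λ`.
      w : ℕ → ℕ → ℕ → ℚ
      w t N i = g t i * x t (N ℕ.∸ i) - x t i * g t (N ℕ.∸ i)

      private
        antisymmetric : ∀ t N → sumTo (suc N) (w t N) ≡ 0ℚ
        antisymmetric t N = *-cancel {ι 2} S 0ℚ (ι-suc≢0 1) (begin
          ι 2 * S         ≡⟨ solve 1 (λ s → con (ι 2) :* s := s :+ s) refl S ⟩
          S + S           ≡⟨ cong (λ t → S + t)
              (trans (sum-reverse N (w t N)) (trans (sum-cong (suc N) (λ i i<N → flip i (ℕₚ.≤-pred i<N)))
                               (sum-*ˡ (suc N) (- 1ℚ) (w t N)))) ⟩
          S + (- 1ℚ) * S  ≡⟨ solve 1 (λ s → s :+ con (- 1ℚ) :* s := con 0ℚ) refl S ⟩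
          0ℚ              ≡⟨ sym (*-zeroʳ (ι 2)) ⟩
          ι 2 * 0ℚ ∎)
          where
          open ≡-Reasoning
          S : ℚ
          S = sumTo (suc N) (w t N)
          flip : ∀ i → i ℕ.≤ N → w t N (N ℕ.∸ i) ≡ (- 1ℚ) * w t N i
          flip i i≤N = trans (cong (λ j → g t (N ℕ.∸ i) * x t j - x t (N ℕ.∸ i) * g t j) (ℕₚ.m∸[m∸n]≡n i≤N))
            (solve 4 (λ a b c d → a :* b :- c :* d := con (- 1ℚ) :* (d :* c :- b :* a)) refl (g t (N ℕ.∸ i)) (x t i)
                (x t (N ℕ.∸ i)) (g t i))

      -- Only the non-constant part of Λ matters; on the residue class i ≡ c modulo p it combines with
      -- the factors re L into a function of the same kind for the next step of the chain.
      Claim : ℕ → Set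
      Claim N = ∀ t Λ → Lip N Λ → Div 1 (sumTo (suc N) (λ i → Λ i * w t N i))

      claim : ∀ N → Claim N
      claim = <-rec Claim step
        where
        step : ∀ N → (∀ {M} → M ℕ.< N → Claim M) → Claim N
        step zero rec t Λ l = Div-resp (solve 3 (λ a x y → con 0ℚ := con 0ℚ :+ a :* (x :* y :- y :* x)) refl (Λ 0)
            (g t 0) (x t 0)) Div-0
        step N@(suc _) rec t Λ l = Div-resp (sym total) (Div-sum 1 p (λ c c<p → part c c<p (c ℕ.≤? N)))
          where
          open ≡-Reasoning
          -- A constant weight contributes 0 by `antisymmetric`, so `Λ` may be replaced by
          -- `Λ - Λ 0`, which is divisible by `p`. The freed `p` is moved to `w`, where it will
          -- cancel the `1/p` of `σ`.
          Λ₁ : ℕ → ℚ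
          Λ₁ i = inv π * (Λ i - Λ 0)
          f : ℕ → ℚ
          f i = Λ₁ i * (π * w t N i)
          total : sumTo (suc N) (λ i → Λ i * w t N i) ≡ sumTo p (λ c → sumTo (count N c) (λ i → f (i ℕ.* p ℕ.+ c)))
          total = begin
            sumTo (suc N) (λ i → Λ i * w t N i)
              ≡⟨ sum-cong′ (suc N) (λ i → split (Λ i) (Λ 0) (w t N i)) ⟩
            sumTo (suc N) (λ i → Λ 0 * w t N i + f i)
              ≡⟨ sum-+ (suc N) (λ i → Λ 0 * w t N i) f ⟩
            sumTo (suc N) (λ i → Λ 0 * w t N i) + sumTo (suc N) f
              ≡⟨ cong (_+ sumTo (suc N) f)
                  (trans (sum-*ˡ (suc N) (Λ 0) (w t N)) (trans (cong (Λ 0 *_) (antisymmetric t N)) (*-zeroʳ (Λ 0)))) ⟩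
            0ℚ + sumTo (suc N) f
              ≡⟨ +-identityˡ _ ⟩
            sumTo (suc N) f
              ≡⟨ regroup N f ⟩
            sumTo p (λ c → sumTo (count N c) (λ i → f (i ℕ.* p ℕ.+ c))) ∎
            where
            split : ∀ a b y → a * y ≡ b * y + inv π * (a - b) * (π * y)
            split a b y = sym (trans (solve 5 (λ a b y p i → b :* y :+ i :* (a :- b) :* (p :* y) := b :* y :+ (p :* i)
                :* ((a :- b) :* y)) refl a b y π (inv π))
              (trans (cong (λ s → b * y + s * ((a - b) * y)) (inv-right π≢0))
                  (solve 3 (λ a b y → b :* y :+ con 1ℚ :* ((a :- b) :* y) := a :* y) refl a b y)))
          divide : ∀ {s y} → Div (suc s) y → Div s (inv π * y)
          divide {s} {y} d = Div-π⁻¹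
              (Div-resp (sym (trans (sym (*-assoc π (inv π) y)) (trans (cong (_* y) (inv-right π≢0)) (*-identityˡ y)))) d)
          Zp-Λ₁ : ∀ i → i ℕ.≤ N → Zp (Λ₁ i)
          Zp-Λ₁ i i≤N = Div⇒Zp {0} (divide (Div-resp (cong (λ j → Λ j - Λ 0) (ℕₚ.*-identityˡ i))
              (lip l 0 0 i (subst (ℕ._≤ N) (sym (ℕₚ.*-identityˡ i)) i≤N))))
          part : ∀ c → c ℕ.< p → Dec (c ℕ.≤ N) → Div 1 (sumTo (count N c) (λ i → f (i ℕ.* p ℕ.+ c)))
          part c c<p (no c≰N) = Div-resp (sym (cong (λ k → sumTo k (λ i → f (i ℕ.* p ℕ.+ c))) (count-no c≰N))) Div-0
          part c c<p (yes c≤N) = Div-resp (sym eq) (Div-+ (rec M<N (suc t) Λ′ Lip-Λ′) (Div-resp (sym (sum-*ˡ (suc M) π e))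
              (Div-resp (*-comm S π) (Div-multiple S (Zp-sum (suc M) (λ i i<M → Zp-e i (ℕₚ.≤-pred i<M)))))))
            where
            -- With `N - c = M p + c′` the index `i p + c` is paired with `(M - i) p + c′`, so each
            -- residue class gives a sum of the same shape with `M` in place of `N`.
            M c′ : ℕ
            M  = (N ℕ.∸ c) ℕ./ p
            c′ = (N ℕ.∸ c) ℕ.% p
            c′<p : c′ ℕ.< p
            c′<p = m%n<n (N ℕ.∸ c) p
            M<N : M ℕ.< N
            M<N = ℕₚ.≤-<-trans (/-monoˡ-≤ p (ℕₚ.m∸n≤m N c)) (m/n<m N p 1<p)
            rest : ∀ i → i ℕ.≤ M → N ℕ.∸ (i ℕ.* p ℕ.+ c) ≡ (M ℕ.∸ i) ℕ.* p ℕ.+ c′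
            rest i i≤M = trans (cong (N ℕ.∸_) (ℕₚ.+-comm (i ℕ.* p) c)) (trans (sym (ℕₚ.∸-+-assoc N c (i ℕ.* p))) (trans
              (cong (ℕ._∸ i ℕ.* p) (trans (m≡m%n+[m/n]*n (N ℕ.∸ c) p) (ℕₚ.+-comm c′ (M ℕ.* p))))
              (trans (ℕₚ.+-∸-comm c′ (ℕₚ.*-monoˡ-≤ p i≤M)) (cong (ℕ._+ c′) (sym (ℕₚ.*-distribʳ-∸ p M i))))))
            bound : ∀ i → i ℕ.≤ M → i ℕ.* p ℕ.+ c ℕ.≤ N
            bound i i≤M = i≤quot⇒ c≤N i≤M
            -- After `g-L` and `x-L` are inserted, the terms with `inv π` form `Λ′` times the kernel
            -- of the next stage; the others keep the freed `p` and are collected in `e`.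
            Λ′ e : ℕ → ℚ
            Λ′ i = Λ₁ (i ℕ.* p ℕ.+ c) * (re (L t c i) * re (L t c′ (M ℕ.∸ i)))
            e i = Λ₁ (i ℕ.* p ℕ.+ c) * ((ep (L t c i) * re (L t c′ (M ℕ.∸ i)) - re (L t c i) * ep (L t c′ (M ℕ.∸ i)))
                * (x (suc t) i * x (suc t) (M ℕ.∸ i)))
            S : ℚ
            S = sumTo (suc M) e
            Zp-e : ∀ i → i ℕ.≤ M → Zp (e i)
            Zp-e i i≤M = Zp-* (Zp-Λ₁ _ (bound i i≤M))
                (Zp-* (Zp-- (Zp-* (proj₂ l₁) (proj₁ l₂)) (Zp-* (proj₁ l₁) (proj₂ l₂)))
                (Zp-* (Zp-x i (suc t)) (Zp-x (M ℕ.∸ i) (suc t))))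
              where
              l₁ : ZpD (L t c i)
              l₁ = ZpD-L t c i c<p
              l₂ : ZpD (L t c′ (M ℕ.∸ i))
              l₂ = ZpD-L t c′ (M ℕ.∸ i) c′<p
            Lip-Λ′ : Lip M Λ′
            Lip-Λ′ = Lip-* lipΛ₁ (Lip-* (Lip-L M t c c<p) (Lip-reflect (Lip-L M t c′ c′<p)))
              where
              lipΛ₁ : Lip M (λ i → Λ₁ (i ℕ.* p ℕ.+ c))
              lipΛ₁ = mkLip (λ i i≤M → Zp-Λ₁ _ (bound i i≤M)) (λ s i k le → Div-resp
                (solve 4 (λ i a b z → i :* (a :- b) := i :* (a :- z) :- i :* (b :- z)) refl (inv π)
                    (Λ ((i ℕ.+ p ℕ.^ s ℕ.* k) ℕ.* p ℕ.+ c)) (Λ (i ℕ.* p ℕ.+ c)) (Λ 0))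
                (divide (Div-resp (cong (λ j → Λ j - Λ (i ℕ.* p ℕ.+ c)) (sym (index s i k)))
                  (lip l (suc s) (i ℕ.* p ℕ.+ c) k (subst (ℕ._≤ N) (index s i k) (bound (i ℕ.+ p ℕ.^ s ℕ.* k) le))))))
                where
                index : ∀ s i k → (i ℕ.+ p ℕ.^ s ℕ.* k) ℕ.* p ℕ.+ c ≡ i ℕ.* p ℕ.+ c ℕ.+ p ℕ.^ suc s ℕ.* k
                index s i k = trans (cong (ℕ._+ c) (trans (ℕₚ.*-distribʳ-+ p i (p ℕ.^ s ℕ.* k)) (cong (i ℕ.* p ℕ.+_)
                  (trans (ℕₚ.*-comm (p ℕ.^ s ℕ.* k) p) (sym (ℕₚ.*-assoc p (p ℕ.^ s) k))))))
                  (trans (ℕₚ.+-assoc (i ℕ.* p) (p ℕ.^ suc s ℕ.* k) c)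
                      (trans (cong (i ℕ.* p ℕ.+_) (ℕₚ.+-comm (p ℕ.^ suc s ℕ.* k) c))
                      (sym (ℕₚ.+-assoc (i ℕ.* p) c (p ℕ.^ suc s ℕ.* k)))))
            term : ∀ i → i ℕ.≤ M → f (i ℕ.* p ℕ.+ c) ≡ Λ′ i * w (suc t) M i + π * e i
            term i i≤M = trans (cong (λ s → l₁ * (π * s)) (cong₂ _-_
                (cong₂ _*_ (g-L t c i) (trans (cong (x t) (rest i i≤M)) (x-L t c′ j)))
                (cong₂ _*_ (x-L t c i) (trans (cong (g t) (rest i i≤M)) (g-L t c′ j)))))
              (trans (solve 11 (λ l p i a b a′ b′ u v u′ v′ →
                   l :* (p :* ((b :* u :+ a :* (i :* v)) :* (a′ :* u′) :- (a :* u) :* (b′ :* u′ :+ a′ :* (i :* v′)))) :=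
                   (p :* i) :* (l :* (a :* a′) :* (v :* u′ :- u :* v′)) :+ p :*
                       (l :* ((b :* a′ :- a :* b′) :* (u :* u′)))) refl
                   l₁ π (inv π) (re (L t c i)) (ep (L t c i)) (re (L t c′ j)) (ep (L t c′ j)) (x (suc t) i)
                       (g (suc t) i) (x (suc t) j) (g (suc t) j))
                (cong (_+ π * e i) (trans (cong (_* (Λ′ i * w (suc t) M i)) (inv-right π≢0))
                    (*-identityˡ (Λ′ i * w (suc t) M i)))))
              where
              j : ℕ
              j = M ℕ.∸ i
              l₁ : ℚ
              l₁ = Λ₁ (i ℕ.* p ℕ.+ c)
            eq : sumTo (count N c) (λ i → f (i ℕ.* p ℕ.+ c)) ≡ sumTo (suc M) (λ i → Λ′ i * w (suc t) M i) + sumTo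
                (suc M) (λ i → π * e i)
            eq = trans (cong (λ k → sumTo k (λ i → f (i ℕ.* p ℕ.+ c))) (count-yes c≤N))
              (trans (sum-cong (suc M) (λ i i<M → term i (ℕₚ.≤-pred i<M))) (sum-+ (suc M) (λ i → Λ′ i * w (suc t) M i)
                  (λ i → π * e i)))

      -- In degree `n` the factorisation through `L` gives `1/p` times a weighted sum of the
      -- antisymmetric kernel plus an integral sum, and `claim` makes the weighted sum divisible by
      -- `p`.
      cross-integral : ∀ t → ZpS (g t · stretch (x (suc t)) ⊖ inv π ∙ (x t · stretch (g (suc t))))
      cross-integral t = mkZpS λ n → subst Zp (sym (eq n)) (Zp-+ (main n) (error n))
        where
        q c : ℕ → ℕ
        q n = n ℕ./ p
        c n = n ℕ.% p
        Λ : ℕ → ℕ → ℚ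
        Λ n i = re (L t (c n) i)
        main : ∀ n → Zp (inv π * sumTo (suc (q n)) (λ i → Λ n i * w (suc t) (q n) i))
        main n = Div⇒Zp {0} (Div-π⁻¹
            (Div-resp (sym (trans (sym (*-assoc π (inv π) S)) (trans (cong (_* S) (inv-right π≢0)) (*-identityˡ S))))
          (claim (q n) (suc t) (Λ n) (Lip-L (q n) t (c n) (m%n<n n p)))))
          where
          S : ℚ
          S = sumTo (suc (q n)) (λ i → Λ n i * w (suc t) (q n) i)
        error : ∀ n → Zp (sumTo (suc (q n)) (λ i → ep (L t (c n) i) * (x (suc t) i * x (suc t) (q n ℕ.∸ i))))
        error n = Zp-sum (suc (q n)) (λ i _ → Zp-* (proj₂ (ZpD-L t (c n) i (m%n<n n p)))
            (Zp-* (Zp-x i (suc t)) (Zp-x (q n ℕ.∸ i) (suc t))))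
        eq : ∀ n → (g t · stretch (x (suc t)) ⊖ inv π ∙ (x t · stretch (g (suc t)))) n ≡
          inv π * sumTo (suc (q n)) (λ i → Λ n i * w (suc t) (q n) i) + sumTo (suc (q n))
              (λ i → ep (L t (c n) i) * (x (suc t) i * x (suc t) (q n ℕ.∸ i)))
        eq n = begin
          (X ⊖ inv π ∙ Y) n
            ≡⟨ trans (⊕-at X _ n) (cong (λ s → X n + s) (trans (⊝-at _ n) (cong -_ (∙-at (inv π) Y n)))) ⟩
          X n - inv π * Y n
            ≡⟨ cong₂ (λ s u → s - inv π * u) (trans (cong X n≡) (·-stretch (g t) (x (suc t)) (q n) (c n) (m%n<n n p)))
                 (trans (cong Y n≡) (·-stretch (x t) (g (suc t)) (q n) (c n) (m%n<n n p))) ⟩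
          sumTo (suc (q n)) f₁ - inv π * sumTo (suc (q n)) f₂
            ≡⟨ trans (solve 3 (λ i s u → s :- i :* u := s :+ (:- i) :* u) refl (inv π) (sumTo (suc (q n)) f₁)
                (sumTo (suc (q n)) f₂))
                 (cong (λ s → sumTo (suc (q n)) f₁ + s) (sym (sum-*ˡ (suc (q n)) (- inv π) f₂))) ⟩
          sumTo (suc (q n)) f₁ + sumTo (suc (q n)) (λ i → (- inv π) * f₂ i)
            ≡⟨ sym (sum-+ (suc (q n)) f₁ (λ i → (- inv π) * f₂ i)) ⟩
          sumTo (suc (q n)) (λ i → f₁ i + (- inv π) * f₂ i)
            ≡⟨ sum-cong′ (suc (q n)) term ⟩
          sumTo (suc (q n)) (λ i → inv π * h₁ i + h₂ i)
            ≡⟨ sum-+ (suc (q n)) (λ i → inv π * h₁ i) h₂ ⟩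
          sumTo (suc (q n)) (λ i → inv π * h₁ i) + sumTo (suc (q n)) h₂
            ≡⟨ cong (_+ sumTo (suc (q n)) h₂) (sum-*ˡ (suc (q n)) (inv π) h₁) ⟩
          inv π * sumTo (suc (q n)) h₁ + sumTo (suc (q n)) h₂ ∎
          where
          open ≡-Reasoning
          X Y : Series
          X = g t · stretch (x (suc t))
          Y = x t · stretch (g (suc t))
          f₁ f₂ h₁ h₂ : ℕ → ℚ
          f₁ i = g t (i ℕ.* p ℕ.+ c n) * x (suc t) (q n ℕ.∸ i)
          f₂ i = x t (i ℕ.* p ℕ.+ c n) * g (suc t) (q n ℕ.∸ i)
          h₁ i = Λ n i * w (suc t) (q n) i
          h₂ i = ep (L t (c n) i) * (x (suc t) i * x (suc t) (q n ℕ.∸ i))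
          n≡ : n ≡ q n ℕ.* p ℕ.+ c n
          n≡ = trans (m≡m%n+[m/n]*n n p) (ℕₚ.+-comm (c n) (q n ℕ.* p))
          term : ∀ i → f₁ i + (- inv π) * f₂ i ≡ inv π * h₁ i + h₂ i
          term i = trans (cong₂ (λ s u → s * x (suc t) (q n ℕ.∸ i) + (- inv π) * (u * g (suc t) (q n ℕ.∸ i)))
              (g-L t (c n) i) (x-L t (c n) i))
            (solve 7 (λ a b i u v u′ v′ → (b :* u :+ a :* (i :* v)) :* u′ :+ (:- i) :* ((a :* u) :* v′) := i :*
                (a :* (v :* u′ :- u :* v′)) :+ b :* (u :* u′)) refl
              (re (L t (c n) i)) (ep (L t (c n) i)) (inv π) (x (suc t) i) (g (suc t) i) (x (suc t) (q n ℕ.∸ i))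
                  (g (suc t) (q n ℕ.∸ i)))

  inv-* : ∀ {x y} → x ≢ 0ℚ → y ≢ 0ℚ → inv (x * y) ≡ inv x * inv y
  inv-* {x} {y} x≢0 y≢0 = inv-unique {x * y}
      (trans (solve 4 (λ x y i j → (x :* y) :* (i :* j) := (x :* i) :* (y :* j)) refl x y (inv x) (inv y))
    (trans (cong₂ _*_ (inv-right x≢0) (inv-right y≢0)) refl))

  ι-!≢0 : ∀ n → ι (n ℕ.!) ≢ 0ℚ
  ι-!≢0 n e = ℕ.≢-nonZero⁻¹ (n ℕ.!) {{n ℕₚ.!≢0}} (ι-injective {n ℕ.!} {0} e)

  re-ρ : ∀ a n → re (ρ a n) ≡ poch a n * inv (ι (n ℕ.!))
  re-ρ a zero    = refl
  re-ρ a (suc n) = begin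
    re (ρ a n) * ((a + ι n) * inv (1ℚ + ι n))
      ≡⟨ cong₂ (λ s t → s * ((a + ι n) * inv t)) (re-ρ a n) (sym (ι-suc n)) ⟩
    poch a n * inv (ι (n ℕ.!)) * ((a + ι n) * inv (ι (suc n)))
      ≡⟨ solve 4 (λ p i r j → p :* i :* (r :* j) := p :* r :* (j :* i)) refl (poch a n) (inv (ι (n ℕ.!))) (a + ι n)
          (inv (ι (suc n))) ⟩
    poch a n * (a + ι n) * (inv (ι (suc n)) * inv (ι (n ℕ.!)))
      ≡⟨ cong (poch a n * (a + ι n) *_) (trans (sym (inv-* (ι-suc≢0 n) (ι-!≢0 n))) (cong inv (sym (ι-* (suc n) (n ℕ.!))))) ⟩
    poch a n * (a + ι n) * inv (ι (suc n ℕ.!)) ∎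
    where open ≡-Reasoning

  -- Logarithmic differentiation of the product; the harmonic sum is its logarithmic derivative.
  ep-ρ : ∀ a n → (∀ i → a + ι i ≢ 0ℚ) → ep (ρ a n) ≡ re (ρ a n) * sumTo n (λ i → inv (a + ι i) - inv (1ℚ + ι i))
  ep-ρ a zero    nz = sym (*-zeroʳ 1ℚ)
  ep-ρ a (suc n) nz = begin
    ep (ρ a n) * (r * j) + re (ρ a n) * (1ℚ * j + r * - (j * j))
      ≡⟨ cong₂ (λ s t → s * (r * j) + re (ρ a n) * (t * j + r * - (j * j))) (ep-ρ a n nz) (sym (inv-right (nz n))) ⟩
    re (ρ a n) * S * (r * j) + re (ρ a n) * (r * inv r * j + r * - (j * j))
      ≡⟨ solve 5 (λ e s r j i → e :* s :* (r :* j) :+ e :* (r :* i :* j :+ r :* (:- (j :* j))) := e :* (r :* j) :*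
          (s :+ (i :- j))) refl (re (ρ a n)) S r j (inv r) ⟩
    re (ρ a n) * (r * j) * (S + (inv r - j)) ∎
    where
    open ≡-Reasoning
    r j S : ℚ
    r = a + ι n
    j = inv (1ℚ + ι n)
    S = sumTo n (λ i → inv (a + ι i) - inv (1ℚ + ι i))

  re-Fser : ∀ a b n → re (ρ a n ⊗ ρ b n) ≡ Fser a b n
  re-Fser a b n = trans (cong₂ _*_ (re-ρ a n) (re-ρ b n)) (trans
    (solve 3 (λ p q i → (p :* i) :* (q :* i) := p :* q :* (i :* i)) refl (poch a n) (poch b n) (inv (ι (n ℕ.!))))
    (cong (poch a n * poch b n *_) (trans (sym (inv-* (ι-!≢0 n) (ι-!≢0 n))) (cong inv (sym (ι-* (n ℕ.!) (n ℕ.!)))))))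

  ep-Gser : ∀ a b n → (∀ i → a + ι i ≢ 0ℚ) → (∀ i → b + ι i ≢ 0ℚ) → ep (ρ a n ⊗ ρ b n) ≡ Gser a b n
  ep-Gser a b n nza nzb = begin
    ep (ρ a n) * re (ρ b n) + re (ρ a n) * ep (ρ b n)
      ≡⟨ cong₂ (λ s t → s * re (ρ b n) + re (ρ a n) * t) (ep-ρ a n nza) (ep-ρ b n nzb) ⟩
    re (ρ a n) * S a * re (ρ b n) + re (ρ a n) * (re (ρ b n) * S b)
      ≡⟨ solve 4 (λ x y s t → x :* s :* y :+ x :* (y :* t) := x :* y :* (s :+ t)) refl (re (ρ a n)) (re (ρ b n)) (S a)
          (S b) ⟩
    re (ρ a n ⊗ ρ b n) * (S a + S b)
      ≡⟨ cong₂ _*_ (re-Fser a b n) (trans (sym (sum-+ n (f a) (f b))) (sum-cong′ n term)) ⟩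
    Gser a b n ∎
    where
    open ≡-Reasoning
    f : ℚ → ℕ → ℚ
    f a i = inv (a + ι i) - inv (1ℚ + ι i)
    S : ℚ → ℚ
    S a = sumTo n (f a)
    term : ∀ i → f a i + f b i ≡ inv (a + ι i) + inv (b + ι i) - ι 2 * inv (ι (suc i))
    term i = trans (solve 3 (λ u v j → (u :- j) :+ (v :- j) := u :+ v :- con (ι 2) :* j) refl (inv (a + ι i))
        (inv (b + ι i)) (inv (1ℚ + ι i)))
      (cong (λ t → inv (a + ι i) + inv (b + ι i) - ι 2 * inv t) (sym (ι-suc i)))

  module DworkCongruence (p : ℕ) (pr : Prime p) where

    open Integrality p pr
    open Frobenius p pr
    open Criterion p pr
    open Blocks p pr
    open Dwork p pr

    module _ (α β : ℕ → ℚ) (zα : ∀ t → Zp (α t)) (zβ : ∀ t → Zp (β t))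
      (sα : ∀ t → Step (α t) (α (suc t))) (sβ : ∀ t → Step (β t) (β (suc t)))
      (nα : ∀ t i → α t + ι i ≢ 0ℚ) (nβ : ∀ t i → β t + ι i ≢ 0ℚ) where

      open Chain α β zα zβ sα sβ

      private
        D X : ℕ → Series
        D t = Dser (α t) (β t)
        X t = D t ⊖ inv π ∙ stretch (D (suc t))

        x·D : ∀ t → (x t · D t) ≈ g t
        x·D t = ≈-trans (·-congʳ (D t) (mk≈ (re-Fser (α t) (β t))))
            (≈-trans (F-Dser (α t) (β t)) (≈-sym (mk≈ λ n → ep-Gser (α t) (β t) n (nα t) (nβ t))))

        ZpS-x : ∀ t → ZpS (x t)
        ZpS-x t = mkZpS λ n → Zp-x n t

        -- `cross-integral` is divided by the product of `F` and the stretched `F` of the next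
        -- stage, an integral series with constant term 1.
        ZpS-X : ∀ t → ZpS (X t)
        ZpS-X t = ZpS-cancel {x t · x′} {X t}
            (trans (·-zero (x t) x′) (trans (cong (x t 0 *_) (stretch-at (x (suc t)) 0)) refl))
          (ZpS-· (ZpS-x t) (ZpS-stretch (ZpS-x (suc t))))
          (mkZpS λ n → subst Zp (sym (at eq n)) (zpAt (cross-integral t) n))
          where
          x′ d′ : Series
          x′ = stretch (x (suc t))
          d′ = stretch (D (suc t))
          eq : (x t · x′ · X t) ≈ (g t · x′ ⊖ inv π ∙ (x t · stretch (g (suc t))))
          eq = ≈-trans (SSol.solve 4 (λ a b d e → a SSol.:* b SSol.:* (d SSol.:- e) SSol.:= (a SSol.:* d) SSol.:* b
              SSol.:- (a SSol.:* b) SSol.:* e) ≈-refl (x t) x′ (D t) (inv π ∙ d′))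
            (⊖-cong (·-congʳ x′ (x·D t))
                (≈-trans (∙-·ʳ (inv π) (x t · x′) d′) (∙-cong (inv π) (≈-trans (SR.*-assoc (x t) x′ d′)
              (·-congˡ (x t) (≈-trans (≈-sym (stretch-· (x (suc t)) (D (suc t)))) (stretch-cong (x·D (suc t)))))))))

        D-X : ∀ t n → D t n ≡ X t n + inv π * stretch (D (suc t)) n
        D-X t n = sym (trans (cong (_+ inv π * stretch (D (suc t)) n)
            (trans (⊕-at (D t) _ n) (cong (λ s → D t n + s)
            (trans (⊝-at _ n) (cong -_ (∙-at (inv π) (stretch (D (suc t))) n))))))
          (solve 2 (λ d s → d :- s :+ s := d) refl (D t n) (inv π * stretch (D (suc t)) n)))

        -- In degree `n p` the `1/p` before the stretched series cancels against the factor `p` that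
        -- `θ` produces.
        block : ∀ t n → ι (n ℕ.* p) * D t (n ℕ.* p) ≡ ι n * π * X t (n ℕ.* p) + ι n * D (suc t) n
        block t n = trans (cong₂ _*_ (ι-* n p)
            (trans (D-X t (n ℕ.* p)) (cong (λ s → X t (n ℕ.* p) + inv π * s) (stretch-at (D (suc t)) n))))
          (trans (solve 5 (λ n p x i d → (n :* p) :* (x :+ i :* d) := n :* p :* x :+ (p :* i) :* (n :* d)) refl (ι n)
              π (X t (n ℕ.* p)) (inv π) (D (suc t) n))
            (cong (λ s → ι n * π * X t (n ℕ.* p) + s) (trans (cong (_* (ι n * D (suc t) n)) (inv-right π≢0))
                (*-identityˡ (ι n * D (suc t) n)))))

      -- Off the multiples of `p` the stretched series vanishes and `D` agrees with the integral
      -- `X`. In degree `k p` the formula `block` passes to degree `k` at the next stage, so the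
      -- induction covers all `t`.
      θD-integral : ∀ t → ZpS (θ (D t))
      θD-integral t = mkZpS λ n → subst Zp (sym (θ-at (D t) n)) (go n t)
        where
        open import Data.Nat.Divisibility using (_∣?_)
        go : ∀ n t → Zp (ι n * D t n)
        go = <-rec (λ n → ∀ t → Zp (ι n * D t n)) step
          where
          step : ∀ n → (∀ {i} → i ℕ.< n → ∀ t → Zp (ι i * D t i)) → ∀ t → Zp (ι n * D t n)
          step zero      rec t = subst Zp (sym (*-zeroˡ (D t 0))) Zp-0
          step n@(suc _) rec t = by (p ∣? n)
            where
            multiple : ∀ k → n ≡ k ℕ.* p → Zp (ι n * D t n)
            multiple zero    ()
            multiple k@(suc _) e = subst Zp (trans (sym (block t k)) (cong (λ s → ι s * D t s) (sym e)))
              (Zp-+ (Zp-* (Zp-* (Zp-ι k) (Zp-ι p)) (zpAt (ZpS-X t) (k ℕ.* p)))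
                  (rec (subst (k ℕ.<_) (sym e) (ℕₚ.m<m*n k p 1<p)) (suc t)))
            by : Dec (p ∣ n) → Zp (ι n * D t n)
            by (yes (divides k e)) = multiple k e
            by (no ¬d) = Zp-* (Zp-ι n)
                (subst Zp (sym (trans (D-X t n) (trans (cong (λ s → X t n + inv π * s) (stretch-off (D (suc t)) n ¬d))
              (trans (cong (λ s → X t n + s) (*-zeroʳ (inv π))) (+-identityʳ (X t n)))))) (zpAt (ZpS-X t) n))

      -- By `block` the difference is exactly `n p` times an integral coefficient of `X`, where
      -- `n = p^r m`.
      gauss-step : ∀ t → GaussCongruence (Hauptmodul.W (α t) (β t)) (Hauptmodul.W (α (suc t)) (β (suc t)))
      gauss-step t r m = Div-resp (sym eq) (mkDiv (ι m * X t (n ℕ.* p)) (Zp-* (Zp-ι m) (zpAt (ZpS-X t) (n ℕ.* p))) value)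
        where
        n : ℕ
        n = p ℕ.^ r ℕ.* m
        W-at : ∀ t k → Hauptmodul.W (α t) (β t) k ≡ δ₀ k + ι k * D t k
        W-at t k = trans (⊕-at δ₀ (θ (D t)) k) (cong (λ s → δ₀ k + s) (θ-at (D t) k))
        δ₀-p : ∀ n → δ₀ (n ℕ.* p) ≡ δ₀ n
        δ₀-p zero    = refl
        δ₀-p (suc n) = cong (λ q → δ₀ (q ℕ.+ n ℕ.* p)) (sym (ℕₚ.suc-pred p {{ℕ.>-nonZero (ℕₚ.<-trans (s≤s z≤n) 1<p)}}))
        eq : Hauptmodul.W (α t) (β t) (n ℕ.* p) - Hauptmodul.W (α (suc t)) (β (suc t)) n ≡ ι n * π * X t (n ℕ.* p)
        eq = trans (cong₂ _-_ (trans (W-at t (n ℕ.* p)) (cong₂ _+_ (δ₀-p n) (block t n))) (W-at (suc t) n))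
          (solve 3 (λ d s v → (d :+ (s :+ v)) :- (d :+ v) := s) refl (δ₀ n) (ι n * π * X t (n ℕ.* p)) (ι n * D (suc t) n))
        value : ι n * π * X t (n ℕ.* p) ≡ π^ suc r * (ι m * X t (n ℕ.* p))
        value = trans (cong (λ s → s * π * X t (n ℕ.* p)) (trans (ι-* (p ℕ.^ r) m) (cong (_* ι m) (ι-^ r))))
          (solve 4 (λ q m p x → q :* m :* p :* x := q :* p :* (m :* x)) refl (π^ r) (ι m) π (X t (n ℕ.* p)))

-- The hypergeometric equation, Euler's transformation for `F` and `G`, and the first coefficients
-- of `W`.

module EulerTransformation where

  open import Data.Rational using (_+_; _*_; _-_; -_)
  open import Data.Rational.Properties
  open FormalSeries
  open Composition
  open LagrangeInversion
  open FrobeniusLift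
  open DworkMap
  open DworkTheorem

  open QSol using (solve; _:+_; _:*_; _:-_; :-_; con; _:=_)

  ·-cancel : ∀ {f X Y} → f 0 ≡ 1ℚ → (f · X) ≈ (f · Y) → X ≈ Y
  ·-cancel {f} {X} {Y} f₀ e = ≈-trans (lem X) (≈-trans (·-congˡ (invSer f) e) (≈-sym (lem Y)))
    where
    lem : ∀ X → X ≈ (invSer f · (f · X))
    lem X = ≈-trans (≈-sym (·-identityˡ X)) (≈-trans (·-congʳ X (≈-sym (invSer-· (λ z → 1≢0 (trans (sym f₀) z)))))
      (SSol.solve 3 (λ f i x → f SSol.:* i SSol.:* x SSol.:= i SSol.:* (f SSol.:* x)) ≈-refl f (invSer f) X))

  Dser-unique : ∀ {a b X} → (Fser a b · X) ≈ Gser a b → X ≈ Dser a b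
  Dser-unique {a} {b} e = ·-cancel {Fser a b} refl (≈-trans e (≈-sym (F-Dser a b)))

  Dser-comm : ∀ a b → Dser a b ≈ Dser b a
  Dser-comm a b = Dser-unique (≈-trans (·-congʳ (Dser a b) (mk≈ λ n → F-comm b a n))
      (≈-trans (F-Dser a b) (mk≈ λ n → cong₂ _*_ (F-comm a b n)
    (sum-cong′ n (λ i → cong (λ t → t - ι 2 * inv (ι (suc i))) (+-comm (inv (a + ι i)) (inv (b + ι i))))))))
    where
    F-comm : ∀ a b n → Fser a b n ≡ Fser b a n
    F-comm a b n = cong (_* inv (ι (n ℕ.! ℕ.* n ℕ.!))) (*-comm (poch a n) (poch b n))

  -- The hypergeometric operator `θ² - z (θ + a)(θ + b)` with `S = a + b` and `Q = a b`, which are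
  -- taken as series so that the ring solver can treat them as variables.
  hyperOp : Series → Series → Series → Series
  hyperOp S Q f = θ (θ f) ⊖ δ₁ · (θ (θ f) ⊕ S · θ f ⊕ Q · f)

  hyperOp-at : ∀ s q f n → hyperOp (const s) (const q) f (suc n) ≡
    ι (suc n) * (ι (suc n) * f (suc n)) - (ι n * ι n + s * ι n + q) * f n
  hyperOp-at s q f n = trans (⊕-at _ _ (suc n))
      (cong₂ _+_ (trans (θ-at (θ f) (suc n)) (cong (ι (suc n) *_) (θ-at f (suc n))))
    (trans (⊝-at _ (suc n)) (cong -_ (trans (δ₁-· _ n) (trans (⊕-at _ _ n) (trans (cong₂ _+_ (trans (⊕-at _ _ n) (cong₂ _+_
      (trans (θ-at (θ f) n) (cong (ι n *_) (θ-at f n))) (scalar s (θ f) (ι n * f n) (θ-at f n)))) (scalar q f (f n) refl))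
      (solve 4 (λ n s q x → n :* (n :* x) :+ s :* (n :* x) :+ q :* x := (n :* n :+ s :* n :+ q) :* x) refl (ι n) s q
          (f n))))))))
    where
    scalar : ∀ c g v → g n ≡ v → (const c · g) n ≡ c * v
    scalar c g v e = trans (at (const-· c g) n) (trans (∙-at c g n) (cong (c *_) e))

  hyperOp-zero : ∀ S Q f → hyperOp S Q f 0 ≡ 0ℚ
  hyperOp-zero S Q f = trans (⊕-at _ _ 0) (cong₂ _+_ (trans (θ-at (θ f) 0) (*-zeroˡ (θ f 0)))
    (trans (⊝-at _ 0) (cong -_ (Substitution.w·-zero δ₁ refl _))))

  -- In the coefficient recursion the newest term has the invertible factor `(n + 1)²`, so the
  -- constant term determines the rest.
  hyperOp-unique : ∀ s q {f g} → f 0 ≡ g 0 → hyperOp (const s) (const q) f ≈ hyperOp (const s) (const q) g → f ≈ g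
  hyperOp-unique s q {f} {g} e₀ e = mk≈ go
    where
    go : ∀ n → f n ≡ g n
    go zero    = e₀
    go (suc n) = *-cancel _ _ (ι-suc≢0 n) (*-cancel _ _ (ι-suc≢0 n) (begin
      ι (suc n) * (ι (suc n) * f (suc n))
        ≡⟨ solve 2 (λ a b → a := (a :- b) :+ b) refl (ι (suc n) * (ι (suc n) * f (suc n))) (c * f n) ⟩
      (ι (suc n) * (ι (suc n) * f (suc n)) - c * f n) + c * f n
        ≡⟨ cong₂ (λ u v → u + c * v) (trans (sym (hyperOp-at s q f n)) (trans (at e (suc n)) (hyperOp-at s q g n))) (go n) ⟩
      (ι (suc n) * (ι (suc n) * g (suc n)) - c * g n) + c * g n
        ≡⟨ solve 2 (λ a b → (a :- b) :+ b := a) refl (ι (suc n) * (ι (suc n) * g (suc n))) (c * g n) ⟩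
      ι (suc n) * (ι (suc n) * g (suc n)) ∎))
      where
      open ≡-Reasoning
      c : ℚ
      c = ι n * ι n + s * ι n + q

  θδ₁ : θ δ₁ ≈ δ₁
  θδ₁ = mk≈ λ { zero → θ-at δ₁ 0 ; (suc zero) → θ-at δ₁ 1 ; (suc (suc n)) → trans (θ-at δ₁ (suc (suc n)))
      (*-zeroʳ (ι (suc (suc n)))) }

  -- If P = (1 - z)^(s-1), multiplication by P turns the operator with parameters (s , q) into the
  -- one with parameters (2 - s , 1 - s + q).
  module _ {P : Series} {s : ℚ} (θP : θ P ≈ (δ₁ · (θ P ⊕ (const 1ℚ ⊖ const s) · P))) where

    private
      S U : Series
      S = const s
      U = const 1ℚ ⊖ S

      θU : θ U ≈ 0S
      θU = ≈-trans (θ-⊕ (const 1ℚ) (⊝ S))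
          (≈-trans (⊕-cong (θ-const 1ℚ) (≈-trans (θ-cong (≈-sym (const-neg s))) (θ-const (- s)))) (SR.+-identityˡ 0S))

      θθP : θ (θ P) ≈ (δ₁ · (θ P ⊕ U · P) ⊕ δ₁ · (θ (θ P) ⊕ U · θ P))
      θθP = ≈-trans (θ-cong θP) (≈-trans (θ-· δ₁ (θ P ⊕ U · P))
          (⊕-cong (·-congʳ _ θδ₁) (·-congˡ δ₁ (≈-trans (θ-⊕ (θ P) (U · P))
        (⊕-cong ≈-refl (≈-trans (θ-· U P) (≈-trans (⊕-cong (≈-trans (·-congʳ P θU) (SR.zeroˡ P)) ≈-refl)
            (SR.+-identityˡ (U · θ P)))))))))

      vanish : ∀ {f g} → f ≈ g → (f ⊖ g) ≈ 0S
      vanish {f} {g} e = ≈-trans (⊕-cong e ≈-refl) (SR.-‿inverseʳ g)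

    hyperOp-euler : ∀ Q f → hyperOp (const (ι 2) ⊖ S) (const 1ℚ ⊖ S ⊕ Q) (P · f) ≈ (P · hyperOp S Q f)
    hyperOp-euler Q f = begin
      θ (θ (P · f)) ⊖ δ₁ · (θ (θ (P · f)) ⊕ (const (ι 2) ⊖ S) · θ (P · f) ⊕ (const 1ℚ ⊖ S ⊕ Q) · (P · f))
        ≈⟨ ⊕-cong second (⊝-cong (·-congˡ δ₁ (⊕-cong (⊕-cong second (·-congˡ _ (θ-· P f))) ≈-refl))) ⟩
      E ⊖ δ₁ · (E ⊕ (const (ι 2) ⊖ S) · (θ P · f ⊕ P · θ f) ⊕ (const 1ℚ ⊖ S ⊕ Q) · (P · f))
        -- The two sides differ by `f` times the `θ`-derivative of the equation for `P` and by
        -- `2 θ f` times that equation itself; both are displayed as brackets that vanish.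
        ≈⟨ SSol.solve 9 (λ z s q f₀ f₁ f₂ p₀ p₁ p₂ →
             let e = (p₂ ✶ f₀ ⊹ p₁ ✶ f₁) ⊹ (p₁ ✶ f₁ ⊹ p₀ ✶ f₂) ; u = C 1ℚ ∸ s in
             e ∸ z ✶ (e ⊹ (C (ι 2) ∸ s) ✶ (p₁ ✶ f₀ ⊹ p₀ ✶ f₁) ⊹ (C 1ℚ ∸ s ⊹ q) ✶ (p₀ ✶ f₀)) ≔
             p₀ ✶ (f₂ ∸ z ✶ (f₂ ⊹ s ✶ f₁ ⊹ q ✶ f₀)) ⊹ f₀ ✶ (p₂ ∸ (z ✶ (p₁ ⊹ u ✶ p₀) ⊹ z ✶ (p₂ ⊹ u ✶ p₁))) ⊹ C (ι 2) ✶
                 (f₁ ✶ (p₁ ∸ z ✶ (p₁ ⊹ u ✶ p₀))))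
             ≈-refl δ₁ S Q f (θ f) (θ (θ f)) P (θ P) (θ (θ P)) ⟩
      P · hyperOp S Q f ⊕ f · (θ (θ P) ⊖ (δ₁ · (θ P ⊕ U · P) ⊕ δ₁ · (θ (θ P) ⊕ U · θ P))) ⊕ const (ι 2) ·
          (θ f · (θ P ⊖ δ₁ · (θ P ⊕ U · P)))
        ≈⟨ ⊕-cong (⊕-cong ≈-refl (≈-trans (·-congˡ f (vanish θθP)) (SR.zeroʳ f)))
             (≈-trans (·-congˡ _ (≈-trans (·-congˡ (θ f) (vanish θP)) (SR.zeroʳ (θ f)))) (SR.zeroʳ (const (ι 2)))) ⟩
      P · hyperOp S Q f ⊕ 0S ⊕ 0S
        ≈⟨ ≈-trans (SR.+-identityʳ _) (SR.+-identityʳ _) ⟩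
      P · hyperOp S Q f ∎
      where
      open import Relation.Binary.Reasoning.Setoid SR.setoid
      open SSol using () renaming (_:*_ to infixl 7 _✶_; _:+_ to infixl 6 _⊹_; _:-_ to infixl 6 _∸_; _:=_ to infix 4
          _≔_; con to C)
      E : Series
      E = (θ (θ P) · f ⊕ θ P · θ f) ⊕ (θ P · θ f ⊕ P · θ (θ f))
      second : θ (θ (P · f)) ≈ E
      second = ≈-trans (θ-cong (θ-· P f)) (≈-trans (θ-⊕ (θ P · f) (P · θ f)) (⊕-cong (θ-· (θ P) f) (θ-· P (θ f))))

    -- The inhomogeneous term of the equation for G (see hyperOp-g) transforms in the same way.
    log-euler : ∀ f → (⊝ (const (ι 2) · θ (P · f)) ⊕ δ₁ · (const (ι 2) · θ (P · f) ⊕ (const (ι 2) ⊖ S) · (P · f))) ≈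
      (P · (⊝ (const (ι 2) · θ f) ⊕ δ₁ · (const (ι 2) · θ f ⊕ S · f)))
    log-euler f = begin
      ⊝ (const (ι 2) · θ (P · f)) ⊕ δ₁ · (const (ι 2) · θ (P · f) ⊕ (const (ι 2) ⊖ S) · (P · f))
        ≈⟨ ⊕-cong (⊝-cong (·-congˡ _ (θ-· P f))) (·-congˡ δ₁ (⊕-cong (·-congˡ _ (θ-· P f)) ≈-refl)) ⟩
      ⊝ (const (ι 2) · (θ P · f ⊕ P · θ f)) ⊕ δ₁ · (const (ι 2) · (θ P · f ⊕ P · θ f) ⊕ (const (ι 2) ⊖ S) · (P · f))
        ≈⟨ SSol.solve 6 (λ z s f₀ f₁ p₀ p₁ →
             ─ (C (ι 2) ✶ (p₁ ✶ f₀ ⊹ p₀ ✶ f₁)) ⊹ z ✶ (C (ι 2) ✶ (p₁ ✶ f₀ ⊹ p₀ ✶ f₁) ⊹ (C (ι 2) ∸ s) ✶ (p₀ ✶ f₀)) ≔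
             p₀ ✶ (─ (C (ι 2) ✶ f₁) ⊹ z ✶ (C (ι 2) ✶ f₁ ⊹ s ✶ f₀)) ∸ C (ι 2) ✶
                 (f₀ ✶ (p₁ ∸ z ✶ (p₁ ⊹ (C 1ℚ ∸ s) ✶ p₀)))) ≈-refl δ₁ S f (θ f) P (θ P) ⟩
      P · (⊝ (const (ι 2) · θ f) ⊕ δ₁ · (const (ι 2) · θ f ⊕ S · f)) ⊖ const (ι 2) · (f · (θ P ⊖ δ₁ · (θ P ⊕ U · P)))
        ≈⟨ ⊕-cong ≈-refl (⊝-cong (≈-trans (·-congˡ _ (≈-trans (·-congˡ f (vanish θP)) (SR.zeroʳ f)))
            (SR.zeroʳ (const (ι 2))))) ⟩
      P · (⊝ (const (ι 2) · θ f) ⊕ δ₁ · (const (ι 2) · θ f ⊕ S · f)) ⊖ 0S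
        ≈⟨ ≈-trans (⊕-cong ≈-refl (mk≈ λ n → ⊝-at 0S n)) (SR.+-identityʳ _) ⟩
      P · (⊝ (const (ι 2) · θ f) ⊕ δ₁ · (const (ι 2) · θ f ⊕ S · f)) ∎
      where
      open import Relation.Binary.Reasoning.Setoid SR.setoid
      open SSol using () renaming (_:*_ to infixl 7 _✶_; _:+_ to infixl 6 _⊹_; _:-_ to infixl 6 _∸_; _:=_ to infix 4
          _≔_; con to C; :-_ to infix 8 ─_)

  recip-linear : ∀ {y} → y ≢ 0ℚ → recip y ⊗ linear y ≡ 1D
  recip-linear {y} y≢0 = dual≡ (trans (*-comm (inv y) y) (inv-right y≢0))
    (trans (solve 2 (λ y i → (:- (i :* i)) :* y :+ i :* con 1ℚ := i :* (con 1ℚ :- y :* i)) refl y (inv y))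
        (trans (cong (λ t → inv y * (1ℚ - t)) (inv-right y≢0)) (*-zeroʳ (inv y))))

  ρ-suc : ∀ a n → ρ a (suc n) ⊗ linear (ι (suc n)) ≡ ρ a n ⊗ linear (a + ι n)
  ρ-suc a n = trans (cong (λ t → ρ a n ⊗ (linear (a + ι n) ⊗ recip t) ⊗ linear (ι (suc n))) (sym (ι-suc n)))
    (trans (⊗-assoc (ρ a n) _ _)
        (cong (ρ a n ⊗_) (trans (⊗-assoc (linear (a + ι n)) (recip (ι (suc n))) (linear (ι (suc n))))
      (trans (cong (linear (a + ι n) ⊗_) (recip-linear (ι-suc≢0 n))) (⊗-identityʳ _)))))

  module Hypergeometric (a b : ℚ) where

    A : ℕ → Dual
    A n = ρ a n ⊗ ρ b n

    x g : Series
    x n = re (A n)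
    g n = ep (A n)

    -- One recursion for dual numbers: its real part is that of the coefficients of `F`, its
    -- `ε`-part that of `G`.
    A-suc : ∀ n → A (suc n) ⊗ (linear (ι (suc n)) ⊗ linear (ι (suc n))) ≡ A n ⊗ (linear (a + ι n) ⊗ linear (b + ι n))
    A-suc n = trans (⊗-interchange (ρ a (suc n)) (ρ b (suc n)) (linear (ι (suc n))) (linear (ι (suc n))))
      (trans (cong₂ _⊗_ (ρ-suc a n) (ρ-suc b n)) (⊗-interchange (ρ a n) (linear (a + ι n)) (ρ b n) (linear (b + ι n))))

    x-suc : ∀ n → ι (suc n) * (ι (suc n) * x (suc n)) ≡ (a + ι n) * (b + ι n) * x n
    x-suc n = trans (solve 2 (λ i x → i :* (i :* x) := x :* (i :* i)) refl (ι (suc n)) (x (suc n)))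
      (trans (cong re (A-suc n)) (*-comm (x n) _))

    g-suc : ∀ n → ι (suc n) * (ι (suc n) * g (suc n)) ≡ (a + ι n) * (b + ι n) * g n + (a + b + ι 2 * ι n) * x n - ι 2
        * ι (suc n) * x (suc n)
    g-suc n = trans (solve 3 (λ i x g → i :* (i :* g) := (g :* (i :* i) :+ x :* (con 1ℚ :* i :+ i :* con 1ℚ)) :- con
        (ι 2) :* i :* x) refl (ι (suc n)) (x (suc n)) (g (suc n)))
      (cong (λ t → t - ι 2 * ι (suc n) * x (suc n)) (trans (cong ep (A-suc n))
        (solve 5 (λ a b n x g → g :* ((a :+ n) :* (b :+ n)) :+ x :* (con 1ℚ :* (b :+ n) :+ (a :+ n) :* con 1ℚ) :=
            (a :+ n) :* (b :+ n) :* g :+ (a :+ b :+ con (ι 2) :* n) :* x) refl a b (ι n) (x n) (g n))))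

    hyperOp-x : hyperOp (const (a + b)) (const (a * b)) x ≈ 0S
    hyperOp-x = mk≈ λ
      { zero    → hyperOp-zero _ _ x
      ; (suc n) → trans (hyperOp-at (a + b) (a * b) x n)
          (trans (cong (λ t → t - (ι n * ι n + (a + b) * ι n + a * b) * x n) (x-suc n))
          (solve 4 (λ a b n x → (a :+ n) :* (b :+ n) :* x :- (n :* n :+ (a :+ b) :* n :+ a :* b) :* x := con 0ℚ) refl
              a b (ι n) (x n))) }

    -- Frobenius's method at the double exponent 0: replace `θ` by `θ + ε` in the equation for `F`
    -- and take the part linear in `ε`. In coefficients this is `g-suc`.
    hyperOp-g : hyperOp (const (a + b)) (const (a * b)) g ≈
        (⊝ (const (ι 2) · θ x) ⊕ δ₁ · (const (ι 2) · θ x ⊕ const (a + b) · x))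
    hyperOp-g = mk≈ λ
      { zero    → trans (hyperOp-zero _ _ g)
          (sym (trans (⊕-at _ _ 0) (trans (cong₂ _+_ (trans (⊝-at _ 0) (cong -_ (twice 0))) (Substitution.w·-zero δ₁ refl _))
          (solve 1 (λ x → (:- (con (ι 2) :* (con (ι 0) :* x))) :+ con 0ℚ := con 0ℚ) refl (x 0)))))
      ; (suc n) → trans (hyperOp-at (a + b) (a * b) g n)
          (trans (cong (λ t → t - (ι n * ι n + (a + b) * ι n + a * b) * g n) (g-suc n)) (trans
          (solve 7 (λ a b n m x x₁ g → ((a :+ n) :* (b :+ n) :* g :+ (a :+ b :+ con (ι 2) :* n) :* x :- con (ι 2) :* m
              :* x₁) :- (n :* n :+ (a :+ b) :* n :+ a :* b) :* g :=
             (:- (con (ι 2) :* (m :* x₁))) :+ (con (ι 2) :* (n :* x) :+ (a :+ b) :* x)) refl a b (ι n) (ι (suc n))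
                 (x n) (x (suc n)) (g n))
          (sym (trans (⊕-at _ _ (suc n)) (cong₂ _+_ (trans (⊝-at _ (suc n)) (cong -_ (twice (suc n))))
            (trans (δ₁-· _ n) (trans (⊕-at _ _ n)
                (cong₂ _+_ (twice n) (trans (at (const-· (a + b) x) n) (∙-at (a + b) x n)))))))))) }
      where
      twice : ∀ n → (const (ι 2) · θ x) n ≡ ι 2 * (ι n * x n)
      twice n = trans (at (const-· (ι 2) (θ x)) n) (trans (∙-at (ι 2) (θ x) n) (cong (ι 2 *_) (θ-at x n)))

    x₁ : x 1 ≡ a * b
    x₁ = trans (solve 1 (λ x → x := con (ι 1) :* (con (ι 1) :* x)) refl (x 1)) (trans (x-suc 0)
      (solve 2 (λ a b → (a :+ con (ι 0)) :* (b :+ con (ι 0)) :* con 1ℚ := a :* b) refl a b))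

    g₁ : g 1 ≡ a + b - ι 2 * (a * b)
    g₁ = trans (solve 1 (λ x → x := con (ι 1) :* (con (ι 1) :* x)) refl (g 1)) (trans (g-suc 0) (trans
      (cong (λ t → (a + ι 0) * (b + ι 0) * g 0 + (a + b + ι 2 * ι 0) * x 0 - ι 2 * ι 1 * t) x₁)
      (solve 2 (λ a b → (a :+ con (ι 0)) :* (b :+ con (ι 0)) :* con 0ℚ :+ (a :+ b :+ con (ι 2) :* con (ι 0)) :* con 1ℚ
          :- con (ι 2) :* con (ι 1) :* (a :* b) := a :+ b :- con (ι 2) :* (a :* b)) refl a b)))

    4x₂ : ι 4 * x 2 ≡ (a + 1ℚ) * (b + 1ℚ) * (a * b)
    4x₂ = trans (solve 1 (λ x → con (ι 4) :* x := con (ι 2) :* (con (ι 2) :* x)) refl (x 2))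
        (trans (x-suc 1) (cong ((a + 1ℚ) * (b + 1ℚ) *_) x₁))

    4g₂ : ι 4 * g 2 ≡ (a + 1ℚ) * (b + 1ℚ) * (a + b - ι 2 * (a * b)) + (a + b + ι 2) * (a * b) - (a + 1ℚ) * (b + 1ℚ) * (a * b)
    4g₂ = trans (solve 1 (λ x → con (ι 4) :* x := con (ι 2) :* (con (ι 2) :* x)) refl (g 2)) (trans (g-suc 1)
      (trans (cong₂ (λ u v → (a + 1ℚ) * (b + 1ℚ) * u + (a + b + ι 2 * 1ℚ) * v - ι 2 * ι 2 * x 2) g₁ x₁)
        (trans (cong (λ t → (a + 1ℚ) * (b + 1ℚ) * (a + b - ι 2 * (a * b)) + (a + b + ι 2 * 1ℚ) * (a * b) - t) 4x₂) refl)))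

  module _ {a b : ℚ} (nza : ∀ i → a + ι i ≢ 0ℚ) (nzb : ∀ i → b + ι i ≢ 0ℚ) where

    open Hypergeometric a b

    x·D : (x · Dser a b) ≈ g
    x·D = ≈-trans (·-congʳ (Dser a b) (mk≈ (re-Fser a b))) (≈-trans (F-Dser a b) (≈-sym (mk≈ λ n → ep-Gser a b n nza nzb)))

    private
      d₀ : Dser a b 0 ≡ 0ℚ
      d₀ = trans (sym (*-identityˡ (Dser a b 0))) (trans (sym (·-zero x (Dser a b))) (at x·D 0))

      d₁ : Dser a b 1 ≡ a + b - ι 2 * (a * b)
      d₁ = trans (solve 2 (λ d x → d := (con 0ℚ :+ con 1ℚ :* d) :+ x :* con 0ℚ) refl (Dser a b 1) (x 1))
        (trans (cong (λ t → (0ℚ + 1ℚ * Dser a b 1) + x 1 * t) (sym d₀))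
            (trans (sym (·-at x (Dser a b) 1)) (trans (at x·D 1) g₁)))

      d₂ : Dser a b 2 ≡ g 2 - a * b * (a + b - ι 2 * (a * b))
      d₂ = trans (solve 4 (λ d x y u → d := ((con 0ℚ :+ con 1ℚ :* d) :+ x :* y :+ u :* con 0ℚ) :- x :* y) refl
          (Dser a b 2) (x 1) (Dser a b 1) (x 2))
        (cong₂ _-_ (trans (cong (λ t → ((0ℚ + 1ℚ * Dser a b 2) + x 1 * Dser a b 1) + x 2 * t) (sym d₀))
            (trans (sym (·-at x (Dser a b) 2)) (at x·D 2)))
          (cong₂ _*_ x₁ d₁))

    -- Written in `1 - 2a` and `1 - 2b` because these merely change sign under `x ↦ 1 - x`.
    W₁ : ι 2 * Hauptmodul.W a b 1 ≡ 1ℚ - (1ℚ - ι 2 * a) * (1ℚ - ι 2 * b)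
    W₁ = trans (cong (ι 2 *_) (trans (Hauptmodul.W-suc a b 0) (cong (ι 1 *_) d₁)))
      (solve 2 (λ a b → con (ι 2) :* (con (ι 1) :* (a :+ b :- con (ι 2) :* (a :* b))) := con 1ℚ :-
          (con 1ℚ :- con (ι 2) :* a) :* (con 1ℚ :- con (ι 2) :* b)) refl a b)

    -- The weights 8, 2 and 5 are the ones that eliminate everything but `(1 - a - b)²`. Like the
    -- right side of `W₁`, it is invariant under exchange and under `x ↦ 1 - x` in both parameters.
    W₂ : ι 8 * Hauptmodul.W a b 2 - ι 2 * Hauptmodul.W a b 1 - ι 5 * (Hauptmodul.W a b 1 * Hauptmodul.W a b 1) ≡ 1ℚ -
        (1ℚ - (a + b)) * (1ℚ - (a + b))
    W₂ = trans (cong₂ (λ u v → ι 8 * u - ι 2 * v - ι 5 * (v * v)) (trans (Hauptmodul.W-suc a b 1) (cong (ι 2 *_) d₂))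
        (trans (Hauptmodul.W-suc a b 0) (cong (ι 1 *_) d₁)))
      (trans (solve 3 (λ a b g → let q = a :* b ; d = a :+ b :- con (ι 2) :* q in
          con (ι 8) :* (con (ι 2) :* (g :- q :* d)) :- con (ι 2) :* (con (ι 1) :* d) :- con (ι 5) :*
              ((con (ι 1) :* d) :* (con (ι 1) :* d)) :=
          con (ι 4) :* (con (ι 4) :* g) :- (con (ι 16) :* (q :* d) :+ con (ι 2) :* d :+ con (ι 5) :* (d :* d))) refl a
              b (g 2))
        (trans (cong (λ t → ι 4 * t - (ι 16 * (a * b * d) + ι 2 * d + ι 5 * (d * d))) 4g₂)
          (solve 2 (λ a b → let q = a :* b ; d = a :+ b :- con (ι 2) :* q in
            con (ι 4) :* ((a :+ con 1ℚ) :* (b :+ con 1ℚ) :* d :+ (a :+ b :+ con (ι 2)) :* q :- (a :+ con 1ℚ) :*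
                (b :+ con 1ℚ) :* q) :- (con (ι 16) :* (q :* d) :+ con (ι 2) :* d :+ con (ι 5) :* (d :* d)) :=
            con 1ℚ :- (con 1ℚ :- (a :+ b)) :* (con 1ℚ :- (a :+ b))) refl a b)))
      where
      d : ℚ
      d = a + b - ι 2 * (a * b)

  -- Euler's transformation F(1-a,1-b|z) = (1-z)^(a+b-1) F(a,b|z), and likewise for G.
  Dser-euler : ∀ {a b} → (∀ i → a + ι i ≢ 0ℚ) → (∀ i → b + ι i ≢ 0ℚ) →
    (∀ i → 1ℚ - a + ι i ≢ 0ℚ) → (∀ i → 1ℚ - b + ι i ≢ 0ℚ) → Dser (1ℚ - a) (1ℚ - b) ≈ Dser a b
  Dser-euler {a} {b} nza nzb nza′ nzb′ = ·-cancel {H′.x} refl (≈-trans (x·D nza′ nzb′) (≈-trans (≈-sym g-euler)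
      (≈-trans (·-congˡ P (≈-sym (x·D nza nzb))) (≈-trans (≈-sym (SR.*-assoc P H.x (Dser a b)))
          (·-congʳ (Dser a b) x-euler)))))
    where
    module H  = Hypergeometric a b
    module H′ = Hypergeometric (1ℚ - a) (1ℚ - b)
    s q : ℚ
    s = a + b
    q = a * b
    -- The binomial series of `(1 - z)^(s - 1)`.
    P : Series
    P n = re (ρ (1ℚ - s) n)
    P-suc : ∀ n → ι (suc n) * P (suc n) ≡ (1ℚ - s + ι n) * P n
    P-suc n = trans (*-comm (ι (suc n)) (P (suc n))) (trans (cong re (ρ-suc (1ℚ - s) n)) (*-comm (P n) _))
    θP : θ P ≈ (δ₁ · (θ P ⊕ (const 1ℚ ⊖ const s) · P))
    θP = mk≈ λ
      { zero    → trans (θ-at P 0) (trans (*-zeroˡ (P 0)) (sym (Substitution.w·-zero δ₁ refl _)))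
      ; (suc n) → trans (θ-at P (suc n))
          (trans (P-suc n) (sym (trans (δ₁-· _ n) (trans (⊕-at _ _ n) (trans (cong₂ _+_ (θ-at P n) (U n))
          (solve 3 (λ n s p → n :* p :+ (con 1ℚ :- s) :* p := (con 1ℚ :- s :+ n) :* p) refl (ι n) s (P n))))))) }
      where
      U : ∀ n → ((const 1ℚ ⊖ const s) · P) n ≡ (1ℚ - s) * P n
      U n = trans (at (·-congʳ P (≈-trans (⊕-cong ≈-refl (≈-sym (const-neg s))) (≈-sym (const-+ 1ℚ (- s))))) n)
          (trans (at (const-· (1ℚ - s) P) n) (∙-at (1ℚ - s) P n))
    S′≈ : const ((1ℚ - a) + (1ℚ - b)) ≈ (const (ι 2) ⊖ const s)
    S′≈ = ≈-trans (SR.reflexive (cong const (solve 2 (λ a b → (con 1ℚ :- a) :+ (con 1ℚ :- b) := con (ι 2) :- (a :+ b))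
        refl a b)))
      (≈-trans (const-+ (ι 2) (- s)) (⊕-cong ≈-refl (const-neg s)))
    Q′≈ : const ((1ℚ - a) * (1ℚ - b)) ≈ (const 1ℚ ⊖ const s ⊕ const q)
    Q′≈ = ≈-trans (SR.reflexive
        (cong const (solve 2 (λ a b → (con 1ℚ :- a) :* (con 1ℚ :- b) := con 1ℚ :- (a :+ b) :+ a :* b) refl a b)))
      (≈-trans (const-+ (1ℚ - s) q) (⊕-cong (≈-trans (const-+ 1ℚ (- s)) (⊕-cong ≈-refl (const-neg s))) ≈-refl))
    transport : ∀ f → hyperOp (const ((1ℚ - a) + (1ℚ - b))) (const ((1ℚ - a) * (1ℚ - b))) (P · f) ≈
        (P · hyperOp (const s) (const q) f)
    transport f = ≈-trans (⊕-cong ≈-refl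
        (⊝-cong (·-congˡ δ₁ (⊕-cong (⊕-cong ≈-refl (·-congʳ _ S′≈)) (·-congʳ _ Q′≈)))))
        (hyperOp-euler {P} {s} θP (const q) f)
    x-euler : (P · H.x) ≈ H′.x
    x-euler = hyperOp-unique _ _ (trans (·-zero P H.x) refl)
      (≈-trans (transport H.x) (≈-trans (·-congˡ P H.hyperOp-x) (≈-trans (SR.zeroʳ P) (≈-sym H′.hyperOp-x))))
    g-euler : (P · H.g) ≈ H′.g
    g-euler = hyperOp-unique _ _ (trans (·-zero P H.g) refl)
      (≈-trans (transport H.g) (≈-trans (·-congˡ P H.hyperOp-g) (≈-trans (≈-sym (log-euler {P} {s} θP H.x))
        (≈-trans (⊕-cong (⊝-cong (·-congˡ _ (θ-cong x-euler)))
            (·-congˡ δ₁ (⊕-cong (·-congˡ _ (θ-cong x-euler)) (·-cong (≈-sym S′≈) x-euler))))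
          (≈-sym H′.hyperOp-g)))))

-- Dwork's map on numerators over a common denominator, and integrality as a matching of numerators.

module NumeratorOrbits where

  open import Data.Nat.DivMod using (m%n<n; m≡m%n+[m/n]*n)
  open import Data.Nat.Divisibility using (_∣_; divides; ∣⇒≤)
  open import Data.Nat.Primality using (Prime)
  open import Data.Integer as ℤ using (+_)
  open import Data.Rational using (_+_; _*_; _-_; -_)
  open import Data.Rational.Properties
  open import Function.Bundles using (_⇔_; mk⇔)
  open FormalSeries
  open Composition
  open LagrangeInversion
  open PAdicIntegers
  open FrobeniusLift
  open GaussCongruences
  open DworkMap
  open DworkTheorem
  open EulerTransformation

  open QSol using (solve; _:+_; _:*_; _:-_; :-_; con; _:=_)

  module Residues (p : ℕ) (pr : Prime p) (N : ℕ) (0<N : 0 ℕ.< N) (N<p : N ℕ.< p) where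

    open Integrality p pr
    open Frobenius p pr
    open Criterion p pr
    open Blocks p pr
    open Dwork p pr
    open DworkCongruence p pr

    private
      instance
        p≢0 : ℕ.NonZero p
        p≢0 = ℕ.>-nonZero (ℕₚ.<-trans (s≤s z≤n) 1<p)

    <p⇒∤ : ∀ {n} → 0 ℕ.< n → n ℕ.< p → ¬ p ∣ n
    <p⇒∤ {n} 0<n n<p d = ℕₚ.<⇒≱ n<p (∣⇒≤ {{ℕ.>-nonZero 0<n}} d)

    unit-N : Unit (ι N)
    unit-N = Unit-ι (<p⇒∤ 0<N N<p)

    over : ℕ → ℚ
    over A = ι A * inv (ι N)

    over-N : ∀ A → ι N * over A ≡ ι A
    over-N A = trans (solve 3 (λ n a i → n :* (a :* i) := (n :* i) :* a) refl (ι N) (ι A) (inv (ι N)))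
      (trans (cong (_* ι A) (inv-right (Unit-≢0 unit-N))) (*-identityˡ (ι A)))

    over-unique : ∀ {x A} → ι N * x ≡ ι A → x ≡ over A
    over-unique {x} {A} e = *-cancel x (over A) (Unit-≢0 unit-N) (trans e (sym (over-N A)))

    over-complement : ∀ {A} → A ℕ.≤ N → over (N ℕ.∸ A) ≡ 1ℚ - over A
    over-complement {A} A≤N = sym
        (over-unique {1ℚ - over A} {N ℕ.∸ A} (trans (solve 2 (λ n a → n :* (con 1ℚ :- a) := n :- n :* a) refl (ι N) (over A))
      (trans (cong (λ t → ι N - t) (over-N A))
          (trans (cong (_- ι A) (trans (cong ι (sym (ℕₚ.m∸n+n≡m A≤N))) (ι-+ (N ℕ.∸ A) A)))
        (solve 2 (λ x a → x :+ a :- a := x) refl (ι (N ℕ.∸ A)) (ι A))))))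

    Zp-over : ∀ A → Zp (over A)
    Zp-over A = Zp-* (Zp-ι A) (Unit-inv unit-N)

    over-≢0 : ∀ {A} → 0 ℕ.< A → ∀ i → over A + ι i ≢ 0ℚ
    over-≢0 {A} 0<A i e = ℕₚ.<⇒≢ (ℕₚ.<-≤-trans 0<A (ℕₚ.m≤m+n A (N ℕ.* i))) (sym (ι-injective {A ℕ.+ N ℕ.* i} {0} (begin
      ι (A ℕ.+ N ℕ.* i)       ≡⟨ trans (ι-+ A (N ℕ.* i)) (cong₂ _+_ (sym (over-N A)) (ι-* N i)) ⟩
      ι N * over A + ι N * ι i ≡⟨ sym (*-distribˡ-+ (ι N) (over A) (ι i)) ⟩
      ι N * (over A + ι i)    ≡⟨ cong (ι N *_) e ⟩
      ι N * 0ℚ                ≡⟨ *-zeroʳ (ι N) ⟩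
      0ℚ ∎)))
      where open ≡-Reasoning

    -- Numerators below `N < p` differ by less than `p`, so their difference is a unit unless they
    -- coincide.
    over-cong : ∀ {A B} → A ℕ.< N → B ℕ.< N → Div 1 (over A - over B) → A ≡ B
    over-cong {A} {B} A<N B<N d = decide (A ℕ.≟ B)
      where
      decide : Dec (A ≡ B) → A ≡ B
      decide (yes e) = e
      decide (no ne) = ⊥-elim (¬Div₁-Unit (Unit-difference (ℕₚ.<-trans A<N N<p) (ℕₚ.<-trans B<N N<p) ne)
        (Div-resp (trans (solve 3 (λ n a b → n :* (a :- b) := n :* a :- n :* b) refl (ι N) (over A) (over B))
            (cong₂ _-_ (over-N A) (over-N B))) (Div-*ˡ (Zp-ι N) d)))

    record Residue : Set where
      constructor mkResidue
      field
        value : ℕ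
        pos   : 0 ℕ.< value
        bound : value ℕ.< N
    open Residue

    record Next (A : Residue) : Set where
      constructor mkNext
      field
        result  : Residue
        digit   : ℕ
        digit<p : digit ℕ.< p
        eq      : value A ℕ.+ N ℕ.* digit ≡ p ℕ.* value result

    opaque

      -- The digit is the residue of `-A/N` modulo `p`. From `A + N · digit ≤ A + N (p - 1) < N p`
      -- the new numerator is again below `N`. Kept opaque because later arguments use only the
      -- fields of `Next`.
      next : ∀ A → Next A
      next A = step (residue (Zp-over (value A)))
        where
        a : ℕ
        a = value A
        step : (∃ λ X → Div 1 (over a + ι X)) → Next A
        step (X , d) = build (Div₁-ιℤ (+ (a ℕ.+ N ℕ.* m))
            (Div-resp eq₁ (Div-- (Div-*ˡ (Zp-ι N) d) (Div-multiple (ι N * ι q) (Zp-* (Zp-ι N) (Zp-ι q))))))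
          where
          m q : ℕ
          m = X ℕ.% p
          q = X ℕ./ p
          eq₁ : ι N * (over a + ι X) - ι N * ι q * π ≡ ι (a ℕ.+ N ℕ.* m)
          eq₁ = begin
            ι N * (over a + ι X) - ι N * ι q * π
              ≡⟨ cong (λ t → ι N * (over a + t) - ι N * ι q * π)
                  (trans (cong ι (m≡m%n+[m/n]*n X p)) (trans (ι-+ m (q ℕ.* p)) (cong (λ t → ι m + t) (ι-* q p)))) ⟩
            ι N * (over a + (ι m + ι q * π)) - ι N * ι q * π
              ≡⟨ solve 5 (λ n a m q p → n :* (a :+ (m :+ q :* p)) :- n :* q :* p := n :* a :+ n :* m) refl (ι N)
                  (over a) (ι m) (ι q) π ⟩
            ι N * over a + ι N * ι m
              ≡⟨ cong₂ _+_ (over-N a) (sym (ι-* N m)) ⟩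
            ι a + ι (N ℕ.* m)
              ≡⟨ sym (ι-+ a (N ℕ.* m)) ⟩
            ι (a ℕ.+ N ℕ.* m) ∎
            where open ≡-Reasoning
          build : p ∣ (a ℕ.+ N ℕ.* m) → Next A
          build (divides a′ e) = mkNext (mkResidue a′ 0<a′ a′<N) m (m%n<n X p) (trans e (ℕₚ.*-comm a′ p))
            where
            0<a′ : 0 ℕ.< a′
            0<a′ = ℕₚ.n≢0⇒n>0 (λ z → ℕₚ.<⇒≢ (ℕₚ.<-≤-trans (pos A) (ℕₚ.m≤m+n a (N ℕ.* m))) (sym (trans e (cong (ℕ._* p) z))))
            a′<N : a′ ℕ.< N
            a′<N = ℕₚ.*-cancelʳ-< p a′ N
                (ℕₚ.≤-<-trans (ℕₚ.≤-reflexive (sym e)) (ℕₚ.<-≤-trans (ℕₚ.+-monoˡ-< (N ℕ.* m) (bound A))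
              (ℕₚ.≤-trans (ℕₚ.≤-reflexive (sym (ℕₚ.*-suc N m))) (ℕₚ.*-monoʳ-≤ N (m%n<n X p)))))

    -- The induction behind Dwork's congruence passes through all iterates, so the whole orbit is
    -- supplied although the resulting congruence compares stages 0 and 1.
    orbit : Residue → ℕ → Residue
    orbit A zero    = A
    orbit A (suc t) = Next.result (next (orbit A t))

    next-step : ∀ A → Step (over (value A)) (over (value (Next.result (next A))))
    next-step A = mkStep (Next.digit n) (Next.digit<p n) (*-cancel _ _ (Unit-≢0 unit-N) (begin
      ι N * (over (value A) + ι (Next.digit n))        ≡⟨ *-distribˡ-+ (ι N) (over (value A)) (ι (Next.digit n)) ⟩
      ι N * over (value A) + ι N * ι (Next.digit n)    ≡⟨ cong₂ _+_ (over-N (value A)) (sym (ι-* N (Next.digit n))) ⟩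
      ι (value A) + ι (N ℕ.* Next.digit n)             ≡⟨ sym (ι-+ (value A) _) ⟩
      ι (value A ℕ.+ N ℕ.* Next.digit n)               ≡⟨ trans (cong ι (Next.eq n)) (ι-* p r) ⟩
      π * ι r                                          ≡⟨ cong (π *_) (sym (over-N r)) ⟩
      π * (ι N * over r)                               ≡⟨ solve 3 (λ p n r → p :* (n :* r) := n :* (p :* r)) refl π
          (ι N) (over r) ⟩
      ι N * (π * over r) ∎))
      where
      open ≡-Reasoning
      n : Next A
      n = next A
      r : ℕ
      r = value (Next.result n)

    pUnit⇒Unit : ∀ {κ} → pUnit p κ → Unit κ
    pUnit⇒Unit {κ} (¬num , ¬den) = by (Div₁⊎Unit (InZp⇒Zp {κ} ¬den))
      where
      by : Div 1 κ ⊎ Unit κ → Unit κ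
      by (inj₂ u) = u
      by (inj₁ d) = ⊥-elim (¬num (Div₁-ιℤ (ℚ.numerator κ) (Div-resp (*-denominator κ) (Div-*ʳ d (Zp-ι (ℚ.denominatorℕ κ))))))

    -- Equality of the two unordered pairs up to the simultaneous reflection `X ↦ N - X`.
    Match : ℕ → ℕ → ℕ → ℕ → Set
    Match A B A′ B′ = (A ≡ A′ × B ≡ B′) ⊎ (A ≡ B′ × B ≡ A′) ⊎ (A ℕ.+ A′ ≡ N × B ℕ.+ B′ ≡ N) ⊎ (A ℕ.+ B′ ≡ N × B ℕ.+ A′ ≡ N)

    module _ (RA RB : Residue) where

      private
        RA′ RB′ : Residue
        RA′ = Next.result (next RA)
        RB′ = Next.result (next RB)

        A B A′ B′ : ℕ
        A  = value RA
        B  = value RB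
        A′ = value RA′
        B′ = value RB′

        a b a′ b′ : ℚ
        a  = over A
        b  = over B
        a′ = over A′
        b′ = over B′

        nz : ∀ (R : Residue) i → over (value R) + ι i ≢ 0ℚ
        nz R = over-≢0 (pos R)

        module H  = Hauptmodul a b
        module H′ = Hauptmodul a′ b′

        α β : ℕ → ℚ
        α t = over (value (orbit RA t))
        β t = over (value (orbit RB t))

        θD : ZpS (θ (Dser a b))
        θD = θD-integral α β (λ t → Zp-over (value (orbit RA t))) (λ t → Zp-over (value (orbit RB t)))
            (λ t → next-step (orbit RA t)) (λ t → next-step (orbit RB t)) (λ t → nz (orbit RA t)) (λ t → nz (orbit RB t)) 0

        gauss : GaussCongruence H.W H′.W
        gauss = gauss-step α β (λ t → Zp-over (value (orbit RA t))) (λ t → Zp-over (value (orbit RB t)))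
            (λ t → next-step (orbit RA t)) (λ t → next-step (orbit RB t)) (λ t → nz (orbit RA t)) (λ t → nz (orbit RB t)) 0

        complement : ∀ {m n} → m ℕ.+ n ≡ N → over n ≡ 1ℚ - over m
        complement {m} {n} e = trans (cong over (trans (sym (ℕₚ.m+n∸m≡n m n)) (cong (ℕ._∸ m) e)))
            (over-complement (subst (m ℕ.≤_) e (ℕₚ.m≤m+n m n)))

        D-complement : ∀ R S R′ S′ → value R ℕ.+ value R′ ≡ N → value S ℕ.+ value S′ ≡ N →
          Dser (over (value R)) (over (value S)) ≈ Dser (over (value R′)) (over (value S′))
        D-complement R S R′ S′ e f = ≈-trans
            (≈-sym (Dser-euler {over (value R)} {over (value S)} (nz R) (nz S) (nz′ R R′ e) (nz′ S S′ f)))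
          (SR.reflexive (cong₂ Dser (sym (complement {value R} {value R′} e)) (sym (complement {value S} {value S′} f))))
          where
          nz′ : ∀ R R′ → value R ℕ.+ value R′ ≡ N → ∀ i → 1ℚ - over (value R) + ι i ≢ 0ℚ
          nz′ R R′ e i z = nz R′ i (trans (cong (_+ ι i) (complement {value R} {value R′} e)) z)

        match⇒D : Match A B A′ B′ → Dser a b ≈ Dser a′ b′
        match⇒D (inj₁ (e , f)) = SR.reflexive (cong₂ (λ m n → Dser (over m) (over n)) e f)
        match⇒D (inj₂ (inj₁ (e , f))) = ≈-trans (Dser-comm a b) (SR.reflexive (cong₂ (λ m n → Dser (over m) (over n)) f e))
        match⇒D (inj₂ (inj₂ (inj₁ (e , f)))) = D-complement RA RB RA′ RB′ e f
        match⇒D (inj₂ (inj₂ (inj₂ (e , f)))) = ≈-trans (D-complement RA RB RB′ RA′ e f) (Dser-comm b′ a′)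

        match⇒integral : Match A B A′ B′ → ∀ n → Zp (H.h n)
        match⇒integral match = gauss⇒integral H.h₀ H.h^n-at-n (ZpS-⊕ ZpS-δ₀ θD)
          (λ r m → Div-resp (cong (λ t → H.W (p ℕ.^ r ℕ.* m ℕ.* p) - t)
              (sym (at (⊕-cong (≈-refl {δ₀}) (θ-cong (match⇒D match))) (p ℕ.^ r ℕ.* m)))) (gauss r m))

        same : ∀ {m n} → m ℕ.< N → n ℕ.< N → Div 1 ((1ℚ - ι 2 * over m) - (1ℚ - ι 2 * over n)) → m ≡ n
        same {m} {n} m<N n<N d = sym (over-cong n<N m<N (Div-unit 2-unit (Div-resp
          (solve 2 (λ x y → (con 1ℚ :- con (ι 2) :* x) :- (con 1ℚ :- con (ι 2) :* y) := con (ι 2) :* (y :- x)) refl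
              (over m) (over n)) d)))
          where
          2-unit : Unit (ι 2)
          2-unit = Unit-ι (<p⇒∤ (s≤s z≤n) (ℕₚ.≤-<-trans (ℕₚ.≤-trans (s≤s (pos RA)) (bound RA)) N<p))

        opposite : ∀ {m n} → m ℕ.< N → 0 ℕ.< n → n ℕ.< N → Div 1 ((1ℚ - ι 2 * over m) + (1ℚ - ι 2 * over n)) → m ℕ.+ n ≡ N
        opposite {m} {n} m<N 0<n n<N d = trans (cong (ℕ._+ n) (same {m} {N ℕ.∸ n} m<N (ℕₚ.∸-monoʳ-< 0<n (ℕₚ.<⇒≤ n<N))
          (Div-resp (trans (solve 2 (λ x y → (con 1ℚ :- con (ι 2) :* x) :+ (con 1ℚ :- con (ι 2) :* y) :=
              (con 1ℚ :- con (ι 2) :* x) :- (con 1ℚ :- con (ι 2) :* (con 1ℚ :- y))) refl (over m) (over n))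
            (cong (λ t → (1ℚ - ι 2 * over m) - (1ℚ - ι 2 * t)) (sym (over-complement (ℕₚ.<⇒≤ n<N))))) d)))
                (ℕₚ.m∸n+n≡m (ℕₚ.<⇒≤ n<N))

        Div₁-* : ∀ {x y} → Zp x → Div 1 (x * y) → Div 1 x ⊎ Div 1 y
        Div₁-* {x} {y} zx d = by (Div₁⊎Unit zx)
          where
          by : Div 1 x ⊎ Unit x → Div 1 x ⊎ Div 1 y
          by (inj₁ dx) = inj₁ dx
          by (inj₂ u)  = inj₂ (Div-unit u d)

        -- Modulo p the series W determines (1 - 2a)(1 - 2b) and (1 - a - b)²,
        -- hence the pair 1 - 2a , 1 - 2b up to order and a common sign.
        congruent⇒match : Div 1 (H.W 1 - H′.W 1) → Div 1 (H.W 2 - H′.W 2) → Match A B A′ B′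
        -- As `u` is half of `x + y`, `squares` fixes `x + y` modulo `p` up to sign. Together with
        -- `products` this makes `x` a root of `(T - x′)(T - y′)` or of `(T + x′)(T + y′)` modulo
        -- `p`.
        congruent⇒match d₁ d₂ = by
            (Div₁-* {u - u′} {u + u′} (Zp-- zu zu′)
            (Div-resp (solve 2 (λ u v → u :* u :- v :* v := (u :- v) :* (u :+ v)) refl u u′) squares))
          where
          u u′ x y x′ y′ : ℚ
          u  = 1ℚ - (a + b)
          u′ = 1ℚ - (a′ + b′)
          x  = 1ℚ - ι 2 * a
          y  = 1ℚ - ι 2 * b
          x′ = 1ℚ - ι 2 * a′
          y′ = 1ℚ - ι 2 * b′
          zu : Zp u
          zu = Zp-- Zp-1 (Zp-+ (Zp-over A) (Zp-over B))
          zu′ : Zp u′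
          zu′ = Zp-- Zp-1 (Zp-+ (Zp-over A′) (Zp-over B′))
          zx : ∀ C → Zp (1ℚ - ι 2 * over C)
          zx C = Zp-- Zp-1 (Zp-* (Zp-ι 2) (Zp-over C))
          w₁ w₁′ w₂ w₂′ : ℚ
          w₁  = H.W 1
          w₁′ = H′.W 1
          w₂  = H.W 2
          w₂′ = H′.W 2
          formula₁ : ι 2 * w₁ ≡ 1ℚ - x * y
          formula₁ = W₁ (nz RA) (nz RB)
          formula₁′ : ι 2 * w₁′ ≡ 1ℚ - x′ * y′
          formula₁′ = W₁ (nz RA′) (nz RB′)
          formula₂ : ι 8 * w₂ - ι 2 * w₁ - ι 5 * (w₁ * w₁) ≡ 1ℚ - u * u
          formula₂ = W₂ (nz RA) (nz RB)
          formula₂′ : ι 8 * w₂′ - ι 2 * w₁′ - ι 5 * (w₁′ * w₁′) ≡ 1ℚ - u′ * u′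
          formula₂′ = W₂ (nz RA′) (nz RB′)
          zw₁ : Zp w₁
          zw₁ = zpAt (ZpS-⊕ ZpS-δ₀ θD) 1
          zw₁′ : Zp w₁′
          zw₁′ = subst Zp (solve 2 (λ w v → w :- (w :- v) := v) refl w₁ w₁′) (Zp-- zw₁ (Div⇒Zp d₁))
          products : Div 1 (x * y - x′ * y′)
          products = Div-resp (trans (solve 2 (λ w v → :- (con (ι 2) :* (w :- v)) := con (ι 2) :* v :- con (ι 2) :* w)
              refl w₁ w₁′)
              (trans (cong₂ _-_ formula₁′ formula₁) (solve 2 (λ s t → (con 1ℚ :- t) :- (con 1ℚ :- s) := s :- t) refl
                  (x * y) (x′ * y′))))
            (Div-neg (Div-*ˡ (Zp-ι 2) d₁))
          squares : Div 1 (u * u - u′ * u′)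
          squares = Div-resp (trans (solve 4
              (λ w v s t → :- (con (ι 8) :* (s :- t) :- con (ι 2) :* (w :- v) :- con (ι 5) :* (w :* w :- v :* v)) :=
                (con (ι 8) :* t :- con (ι 2) :* v :- con (ι 5) :* (v :* v)) :-
                    (con (ι 8) :* s :- con (ι 2) :* w :- con (ι 5) :* (w :* w))) refl w₁ w₁′ w₂ w₂′)
              (trans (cong₂ _-_ formula₂′ formula₂) (solve 2 (λ s t → (con 1ℚ :- t) :- (con 1ℚ :- s) := s :- t) refl
                  (u * u) (u′ * u′))))
            (Div-neg (Div-- (Div-- (Div-*ˡ (Zp-ι 8) d₂) (Div-*ˡ (Zp-ι 2) d₁)) (Div-*ˡ (Zp-ι 5) (Div-*-cong zw₁ zw₁′ d₁ d₁))))
          by : Div 1 (u - u′) ⊎ Div 1 (u + u′) → Match A B A′ B′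
          by (inj₁ d) = pick (Div₁-* {x - x′} {x - y′} (Zp-- (zx A) (zx A′)) (Div-resp
              (solve 4 (λ a b c e → let x = con 1ℚ :- con (ι 2) :* a ; y = con 1ℚ :- con (ι 2) :* b ; x′ = con 1ℚ :- con (ι 2) :* c ; y′ = con 1ℚ :- con (ι 2) :* e in
                 x :* (con (ι 2) :* ((con 1ℚ :- (a :+ b)) :- (con 1ℚ :- (c :+ e)))) :- (x :* y :- x′ :* y′) :=
                     (x :- x′) :* (x :- y′)) refl a b a′ b′)
              (Div-- (Div-*ˡ (zx A) (Div-*ˡ (Zp-ι 2) d)) products)))
            where
            pick : Div 1 (x - x′) ⊎ Div 1 (x - y′) → Match A B A′ B′
            pick (inj₁ e) = inj₁ (same (bound RA) (bound RA′) e , same (bound RB) (bound RB′) (Div-resp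
              (solve 4 (λ a b c e → let t = con (ι 2) in t :* ((con 1ℚ :- (a :+ b)) :- (con 1ℚ :- (c :+ e))) :- ((con 1ℚ :- t :* a) :- (con 1ℚ :- t :* c)) := (con 1ℚ :- t :* b) :- (con 1ℚ :- t :* e)) refl a b a′ b′)
              (Div-- (Div-*ˡ (Zp-ι 2) d) e)))
            pick (inj₂ e) = inj₂ (inj₁ (same (bound RA) (bound RB′) e , same (bound RB) (bound RA′) (Div-resp
              (solve 4 (λ a b c e → let t = con (ι 2) in t :* ((con 1ℚ :- (a :+ b)) :- (con 1ℚ :- (c :+ e))) :- ((con 1ℚ :- t :* a) :- (con 1ℚ :- t :* e)) := (con 1ℚ :- t :* b) :- (con 1ℚ :- t :* c)) refl a b a′ b′)
              (Div-- (Div-*ˡ (Zp-ι 2) d) e))))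
          by (inj₂ d) = pick (Div₁-* {x + x′} {x + y′} (Zp-+ (zx A) (zx A′)) (Div-resp
              (solve 4 (λ a b c e → let x = con 1ℚ :- con (ι 2) :* a ; y = con 1ℚ :- con (ι 2) :* b ; x′ = con 1ℚ :- con (ι 2) :* c ; y′ = con 1ℚ :- con (ι 2) :* e in
                 x :* (con (ι 2) :* ((con 1ℚ :- (a :+ b)) :+ (con 1ℚ :- (c :+ e)))) :- (x :* y :- x′ :* y′) :=
                     (x :+ x′) :* (x :+ y′)) refl a b a′ b′)
              (Div-- (Div-*ˡ (zx A) (Div-*ˡ (Zp-ι 2) d)) products)))
            where
            pick : Div 1 (x + x′) ⊎ Div 1 (x + y′) → Match A B A′ B′
            pick (inj₁ e) = inj₂ (inj₂
                (inj₁ (opposite (bound RA) (pos RA′) (bound RA′) e , opposite (bound RB) (pos RB′) (bound RB′) (Div-resp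
              (solve 4 (λ a b c e → let t = con (ι 2) in t :* ((con 1ℚ :- (a :+ b)) :+ (con 1ℚ :- (c :+ e))) :- ((con 1ℚ :- t :* a) :+ (con 1ℚ :- t :* c)) := (con 1ℚ :- t :* b) :+ (con 1ℚ :- t :* e)) refl a b a′ b′)
              (Div-- (Div-*ˡ (Zp-ι 2) d) e)))))
            pick (inj₂ e) = inj₂ (inj₂
                (inj₂ (opposite (bound RA) (pos RB′) (bound RB′) e , opposite (bound RB) (pos RA′) (bound RA′) (Div-resp
              (solve 4 (λ a b c e → let t = con (ι 2) in t :* ((con 1ℚ :- (a :+ b)) :+ (con 1ℚ :- (c :+ e))) :- ((con 1ℚ :- t :* a) :+ (con 1ℚ :- t :* e)) := (con 1ℚ :- t :* b) :+ (con 1ℚ :- t :* c)) refl a b a′ b′)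
              (Div-- (Div-*ˡ (Zp-ι 2) d) e)))))

        -- For `r = 0` the Gauss congruence of `W` with itself and Dwork's congruence with `W′`
        -- share the coefficient of index `m p`, so `W ≡ W′` modulo `p`.
        integral⇒match : ZpS H.h → Match A B A′ B′
        integral⇒match zh = congruent⇒match (agree 1) (agree 2)
          where
          agree : ∀ m → Div 1 (H.W m - H′.W m)
          agree m = Div-resp (cong (λ k → H.W k - H′.W k) (ℕₚ.*-identityˡ m)) (Div-trans (H.W k) (H.W (k ℕ.* p)) (H′.W k)
            (Div-swap (H.W (k ℕ.* p)) (H.W k) (integral⇒gauss H.h^n-at-n zh 0 m)) (gauss 0 m))
            where
            k : ℕ
            k = 1 ℕ.* m

      pIntegral⇔match : ∀ {κ} → Unit κ → PIntegral p (hauptH (over (value RA)) (over (value RB)) κ) ⇔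
        Match (value RA) (value RB) (value (Next.result (next RA))) (value (Next.result (next RB)))
      pIntegral⇔match {κ} uκ = mk⇔ forward backward
        where
        κ≢0 : κ ≢ 0ℚ
        κ≢0 = Unit-≢0 uκ
        u^ : ∀ n → Unit (qpow κ n)
        u^ zero    = Unit-1
        u^ (suc n) = Unit-* (u^ n) uκ
        forward : PIntegral p (hauptH a b κ) → Match A B A′ B′
        forward (c , c≢0 , z) = from (π^-multiple c≢0)
          where
          from : (∃₂ λ k y → Zp y × π^ k ≡ y * c) → Match A B A′ B′
          -- Multiplication by `y` turns the constant `c` into `p^k`, and the powers of the unit `κ`
          -- are removed degree by degree.
          from (k , y , zy , e) = integral⇒match
              (mkZpS (bounded⇒integral a b θD k (λ n → Div⇒Zp {0} (Div-unit (u^ n) (Zp⇒Div (subst Zp (eq n)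
              (Zp-* (Unit.integral uκ) (Zp-* zy (InZp⇒Zp {c * hauptH a b κ n} (z n))))))))))
            where
            eq : ∀ n → κ * (y * (c * hauptH a b κ n)) ≡ qpow κ n * (π^ k * H.h n)
            eq n = trans (solve 4 (λ k y c h → k :* (y :* (c :* h)) := (y :* c) :* (k :* h)) refl κ y c (hauptH a b κ n))
              (trans (cong₂ _*_ (sym e) (H.hauptH-h κ≢0 n)) (solve 3 (λ a q h → a :* (q :* h) := q :* (a :* h)) refl
                  (π^ k) (qpow κ n) (H.h n)))
        backward : Match A B A′ B′ → PIntegral p (hauptH a b κ)
        backward match = 1ℚ , (λ ()) , λ n → Zp⇒InZp (subst Zp (sym (*-identityˡ (hauptH a b κ n)))
          (Div⇒Zp {0} (Div-unit uκ (Zp⇒Div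
              (subst Zp (sym (H.hauptH-h κ≢0 n)) (Zp-* (Unit.integral (u^ n)) (match⇒integral match n)))))))

-- Translation of the matching condition into congruences for `p` modulo `2m₁`, `2m₂` and `2m`.

module TriangleGroups where

  import Data.Nat.Divisibility as ℕD
  import Data.Nat.Coprimality as Cop
  open import Data.Nat.DivMod using (m%n<n; m≡m%n+[m/n]*n)
  open import Data.Nat.Primality using (Prime; prime⇒irreducible)
  open import Data.Integer as ℤ using (ℤ; +_)
  import Data.Integer.Properties as ℤₚ
  import Data.Integer.DivMod as ℤD
  open import Data.Integer.Divisibility.Signed using (divides; ∣ᵤ⇒∣; ∣⇒∣ᵤ; ∣m∣n⇒∣m+n; ∣m∣n⇒∣m-n; ∣m⇒∣-m) renaming (_∣_ to _∣ₛ_)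
  open import Data.Integer.Divisibility using () renaming (_∣_ to _∣ᵤ_)
  import Data.Integer.Solver as ℤSolver
  open import Data.Rational using (½; _+_; _*_; _-_; -_)
  open import Data.Rational.Properties
  open import Function.Bundles using (_⇔_; mk⇔; Equivalence)
  open FormalSeries
  open PAdicIntegers
  open NumeratorOrbits

  module ZSol = ℤSolver.+-*-Solver

  parity : ∀ z → (∃ λ c → z ≡ + 2 ℤ.* c) ⊎ (∃ λ c → z ≡ + 1 ℤ.+ + 2 ℤ.* c)
  parity z = by (z ℤD.%ℕ 2) (ℤD.n%ℕd<d z 2) (ℤD.a≡a%ℕn+[a/ℕn]*n z 2)
    where
    c : ℤ
    c = z ℤD./ℕ 2
    by : ∀ r → r ℕ.< 2 → z ≡ + r ℤ.+ c ℤ.* + 2 → (∃ λ c → z ≡ + 2 ℤ.* c) ⊎ (∃ λ c → z ≡ + 1 ℤ.+ + 2 ℤ.* c)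
    by 0 _ e = inj₁ (c , trans e (trans (ℤₚ.+-identityˡ _) (ℤₚ.*-comm c (+ 2))))
    by 1 _ e = inj₂ (c , trans e (cong (λ t → + 1 ℤ.+ t) (ℤₚ.*-comm c (+ 2))))
    by (suc (suc _)) (s≤s (s≤s ())) e

  odd-prime : ∀ {p} → Prime p → 2 ℕ.< p → ∃ λ h → p ≡ 1 ℕ.+ h ℕ.* 2
  odd-prime {p} pr 2<p = by (p ℕ.% 2) (m%n<n p 2) (m≡m%n+[m/n]*n p 2)
    where
    by : ∀ r → r ℕ.< 2 → p ≡ r ℕ.+ (p ℕ./ 2) ℕ.* 2 → ∃ λ h → p ≡ 1 ℕ.+ h ℕ.* 2
    by 1 _ e = p ℕ./ 2 , e
    by 0 _ e = ⊥-elim (two (prime⇒irreducible pr (ℕD.divides (p ℕ./ 2) e)))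
      where
      two : 2 ≡ 1 ⊎ 2 ≡ p → ⊥
      two (inj₂ e′) = ℕₚ.<⇒≢ 2<p e′
    by (suc (suc _)) (s≤s (s≤s ())) e

  -- u = m₁ (k + l) and v = m₂ (k - l), where k + l and k - l have the same parity.
  even-or-odd-multiples : ∀ m₁ m₂ u v → .{{_ : ℤ.NonZero m₁}} → .{{_ : ℤ.NonZero m₂}} →
    (+ 2 ℤ.* m₁ ℤ.* m₂ ∣ₛ u ℤ.* m₂ ℤ.+ v ℤ.* m₁) × (+ 2 ℤ.* m₁ ℤ.* m₂ ∣ₛ u ℤ.* m₂ ℤ.- v ℤ.* m₁) →
    ((+ 2 ℤ.* m₁ ∣ₛ u) × (+ 2 ℤ.* m₂ ∣ₛ v)) ⊎ ((+ 2 ℤ.* m₁ ∣ₛ u ℤ.- m₁) × (+ 2 ℤ.* m₂ ∣ₛ v ℤ.- m₂))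
  even-or-odd-multiples m₁ m₂ u v (divides k e , divides l f) = by (parity (k ℤ.+ l))
    where
    open ZSol
    u≡ : u ≡ m₁ ℤ.* (k ℤ.+ l)
    u≡ = ℤₚ.*-cancelʳ-≡ u _ m₂ (ℤₚ.*-cancelˡ-≡ (+ 2) _ _ (trans
      (solve 4 (λ u v m₁ m₂ → con (+ 2) :* (u :* m₂) := (u :* m₂ :+ v :* m₁) :+ (u :* m₂ :- v :* m₁)) refl u v m₁ m₂)
      (trans (cong₂ ℤ._+_ e f) (solve 4 (λ k l m₁ m₂ → k :* (con (+ 2) :* m₁ :* m₂) :+ l :* (con (+ 2) :* m₁ :* m₂) :=
          con (+ 2) :* (m₁ :* (k :+ l) :* m₂)) refl k l m₁ m₂))))
    v≡ : v ≡ m₂ ℤ.* (k ℤ.- l)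
    v≡ = ℤₚ.*-cancelʳ-≡ v _ m₁ (ℤₚ.*-cancelˡ-≡ (+ 2) _ _ (trans
      (solve 4 (λ u v m₁ m₂ → con (+ 2) :* (v :* m₁) := (u :* m₂ :+ v :* m₁) :- (u :* m₂ :- v :* m₁)) refl u v m₁ m₂)
      (trans (cong₂ ℤ._-_ e f) (solve 4 (λ k l m₁ m₂ → k :* (con (+ 2) :* m₁ :* m₂) :- l :* (con (+ 2) :* m₁ :* m₂) :=
          con (+ 2) :* (m₂ :* (k :- l) :* m₁)) refl k l m₁ m₂))))
    by : (∃ λ c → k ℤ.+ l ≡ + 2 ℤ.* c) ⊎ (∃ λ c → k ℤ.+ l ≡ + 1 ℤ.+ + 2 ℤ.* c) →
      ((+ 2 ℤ.* m₁ ∣ₛ u) × (+ 2 ℤ.* m₂ ∣ₛ v)) ⊎ ((+ 2 ℤ.* m₁ ∣ₛ u ℤ.- m₁) × (+ 2 ℤ.* m₂ ∣ₛ v ℤ.- m₂))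
    by (inj₁ (c , e₂)) = inj₁ (divides c
        (trans u≡ (trans (cong (m₁ ℤ.*_) e₂) (solve 2 (λ m c → m :* (con (+ 2) :* c) := c :* (con (+ 2) :* m)) refl m₁ c))) ,
      divides (c ℤ.- l) (trans v≡ (trans (cong (m₂ ℤ.*_) (solve 2 (λ k l → k :- l := (k :+ l) :- con (+ 2) :* l) refl k l))
        (trans (cong (λ t → m₂ ℤ.* (t ℤ.- + 2 ℤ.* l)) e₂)
            (solve 3 (λ m c l → m :* (con (+ 2) :* c :- con (+ 2) :* l) := (c :- l) :* (con (+ 2) :* m)) refl m₂ c l)))))
    by (inj₂ (c , e₂)) = inj₂ (divides c (trans (cong (ℤ._- m₁) (trans u≡ (cong (m₁ ℤ.*_) e₂)))
        (solve 2 (λ m c → m :* (con (+ 1) :+ con (+ 2) :* c) :- m := c :* (con (+ 2) :* m)) refl m₁ c)) ,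
      divides (c ℤ.- l) (trans (cong (ℤ._- m₂)
          (trans v≡ (trans (cong (m₂ ℤ.*_) (solve 2 (λ k l → k :- l := (k :+ l) :- con (+ 2) :* l) refl k l))
          (cong (λ t → m₂ ℤ.* (t ℤ.- + 2 ℤ.* l)) e₂))))
        (solve 3 (λ m c l → m :* (con (+ 1) :+ con (+ 2) :* c :- con (+ 2) :* l) :- m := (c :- l) :* (con (+ 2) :* m))
            refl m₂ c l)))

  -- In the second alternative `u / m₁` and `v / m₂` are both odd, so their sum and difference are
  -- even as in the first.
  multiples⇒ : ∀ m₁ m₂ u v →
    ((+ 2 ℤ.* m₁ ∣ₛ u) × (+ 2 ℤ.* m₂ ∣ₛ v)) ⊎ ((+ 2 ℤ.* m₁ ∣ₛ u ℤ.- m₁) × (+ 2 ℤ.* m₂ ∣ₛ v ℤ.- m₂)) →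
    (+ 2 ℤ.* m₁ ℤ.* m₂ ∣ₛ u ℤ.* m₂ ℤ.+ v ℤ.* m₁) × (+ 2 ℤ.* m₁ ℤ.* m₂ ∣ₛ u ℤ.* m₂ ℤ.- v ℤ.* m₁)
  multiples⇒ m₁ m₂ u v (inj₁ (divides c refl , divides d refl)) =
    divides (c ℤ.+ d) (solve 4 (λ c d m₁ m₂ → c :* (con (+ 2) :* m₁) :* m₂ :+ d :* (con (+ 2) :* m₂) :* m₁ := (c :+ d)
        :* (con (+ 2) :* m₁ :* m₂)) refl c d m₁ m₂) ,
    divides (c ℤ.- d) (solve 4 (λ c d m₁ m₂ → c :* (con (+ 2) :* m₁) :* m₂ :- d :* (con (+ 2) :* m₂) :* m₁ := (c :- d)
        :* (con (+ 2) :* m₁ :* m₂)) refl c d m₁ m₂)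
    where open ZSol
  multiples⇒ m₁ m₂ u v (inj₂ (divides c e , divides d f)) =
    divides (+ 1 ℤ.+ c ℤ.+ d) (trans (cong₂ (λ s t → s ℤ.* m₂ ℤ.+ t ℤ.* m₁) u≡ v≡)
      (solve 4 (λ c d m₁ m₂ → (m₁ :+ c :* (con (+ 2) :* m₁)) :* m₂ :+ (m₂ :+ d :* (con (+ 2) :* m₂)) :* m₁ :=
          (con (+ 1) :+ c :+ d) :* (con (+ 2) :* m₁ :* m₂)) refl c d m₁ m₂)) ,
    divides (c ℤ.- d) (trans (cong₂ (λ s t → s ℤ.* m₂ ℤ.- t ℤ.* m₁) u≡ v≡)
      (solve 4 (λ c d m₁ m₂ → (m₁ :+ c :* (con (+ 2) :* m₁)) :* m₂ :- (m₂ :+ d :* (con (+ 2) :* m₂)) :* m₁ := (c :- d)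
          :* (con (+ 2) :* m₁ :* m₂)) refl c d m₁ m₂))
    where
    open ZSol
    u≡ : u ≡ m₁ ℤ.+ c ℤ.* (+ 2 ℤ.* m₁)
    u≡ = trans (solve 2 (λ u m → u := m :+ (u :- m)) refl u m₁) (cong (λ t → m₁ ℤ.+ t) e)
    v≡ : v ≡ m₂ ℤ.+ d ℤ.* (+ 2 ℤ.* m₂)
    v≡ = trans (solve 2 (λ u m → u := m :+ (u :- m)) refl v m₂) (cong (λ t → m₂ ℤ.+ t) f)

  module Numerators (p : ℕ) (pr : Prime p) (M : ℕ) (0<M : 0 ℕ.< M) (N<p : 2 ℕ.* M ℕ.< p) where

    N : ℕ
    N = 2 ℕ.* M

    open Integrality p pr
    open Residues p pr N (ℕₚ.<-≤-trans 0<M (ℕₚ.m≤m+n M _)) N<p public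
    open Residue public

    -- num R / M = 1 - 2a for a = value R / N
    num : Residue → ℤ
    num R = + M ℤ.- + value R

    private
      2<p : 2 ℕ.< p
      2<p = ℕₚ.≤-<-trans (ℕₚ.*-monoʳ-≤ 2 0<M) N<p

      h : ℕ
      h = proj₁ (odd-prime pr 2<p)

      p≡ : + p ≡ + 1 ℤ.+ + h ℤ.* + 2
      p≡ = trans (cong +_ (proj₂ (odd-prime pr 2<p))) (cong (λ t → + 1 ℤ.+ t) (ℤₚ.pos-* h 2))

      N≡ : + N ≡ + 2 ℤ.* + M
      N≡ = ℤₚ.pos-* 2 M

    -- Centring the numerators at `M` costs `p M - M`, a multiple of `N = 2 M` because `p` is odd;
    -- `h` is `(p - 1) / 2`.
    num-next : ∀ R → + N ∣ₛ + p ℤ.* num (Next.result (next R)) ℤ.- num R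
    num-next R = divides (+ h ℤ.- + d) (begin
      + p ℤ.* (+ M ℤ.- + r′) ℤ.- (+ M ℤ.- + r)
        ≡⟨ solve 4 (λ p m r′ r → p :* (m :- r′) :- (m :- r) := p :* m :- m :+ r :- p :* r′) refl (+ p) (+ M) (+ r′) (+ r) ⟩
      + p ℤ.* + M ℤ.- + M ℤ.+ + r ℤ.- + p ℤ.* + r′
        ≡⟨ cong₂ (λ s t → s ℤ.* + M ℤ.- + M ℤ.+ + r ℤ.- t) p≡
            (trans (sym (ℤₚ.pos-* p r′)) (trans (cong +_ (sym (Next.eq (next R))))
            (cong (λ t → + r ℤ.+ t) (trans (ℤₚ.pos-* N d) (cong (ℤ._* + d) N≡))))) ⟩
      (+ 1 ℤ.+ + h ℤ.* + 2) ℤ.* + M ℤ.- + M ℤ.+ + r ℤ.- (+ r ℤ.+ + 2 ℤ.* + M ℤ.* + d)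
        ≡⟨ solve 4 (λ h m r d → (con (+ 1) :+ h :* con (+ 2)) :* m :- m :+ r :- (r :+ con (+ 2) :* m :* d) := (h :- d)
            :* (con (+ 2) :* m)) refl (+ h) (+ M) (+ r) (+ d) ⟩
      (+ h ℤ.- + d) ℤ.* (+ 2 ℤ.* + M)
        ≡⟨ cong ((+ h ℤ.- + d) ℤ.*_) (sym N≡) ⟩
      (+ h ℤ.- + d) ℤ.* + N ∎)
      where
      open ≡-Reasoning
      open ZSol
      r r′ d : ℕ
      r  = value R
      r′ = value (Next.result (next R))
      d  = Next.digit (next R)

    cancel-p : ∀ z → + N ∣ₛ + p ℤ.* z → + N ∣ₛ z
    cancel-p z d = ∣ᵤ⇒∣ (Cop.coprime-divisor (∤⇒coprime (<p⇒∤ (ℕₚ.<-≤-trans 0<M (ℕₚ.m≤m+n M _)) N<p))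
      (subst (N ℕD.∣_) (ℤₚ.abs-* (+ p) z) (∣⇒∣ᵤ d)))

    num-equal : ∀ R S → value R ≡ value S → num R ≡ num S
    num-equal R S e = cong (λ t → + M ℤ.- + t) e

    num-opposite : ∀ R S → value R ℕ.+ value S ≡ N → num S ≡ ℤ.- num R
    num-opposite R S e = trans (solve 3 (λ m r s → m :- s := (con (+ 2) :* m :- (r :+ s)) :- (m :- r)) refl (+ M)
        (+ value R) (+ value S))
      (trans (cong (ℤ._- num R) (trans (cong (λ t → + 2 ℤ.* + M ℤ.- t) (trans (cong +_ e) N≡))
          (ℤₚ.+-inverseʳ (+ 2 ℤ.* + M)))) (ℤₚ.+-identityˡ _))
      where open ZSol

    ∣-difference : ∀ R S → + N ∣ₛ num S ℤ.- num R → value R ≡ value S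
    ∣-difference R S d = ℤₚ.+-injective
        (ℤₚ.i-j≡0⇒i≡j (+ value R) (+ value S) (ℤₚ.∣i∣≡0⇒i≡0 (small (∣⇒∣ᵤ (subst (+ N ∣ₛ_) eq d)))))
      where
      open ZSol
      eq : num S ℤ.- num R ≡ + value R ℤ.- + value S
      eq = solve 3 (λ m r s → (m :- s) :- (m :- r) := r :- s) refl (+ M) (+ value R) (+ value S)
      <N : ℤ.∣ + value R ℤ.- + value S ∣ ℕ.< N
      <N = subst (λ t → ℤ.∣ t ∣ ℕ.< N) (sym (ℤₚ.m-n≡m⊖n (value R) (value S)))
          (ℕₚ.≤-<-trans (ℤₚ.∣m⊝n∣≤m⊔n (value R) (value S)) (ℕₚ.⊔-lub (bound R) (bound S)))
      small : N ℕD.∣ ℤ.∣ + value R ℤ.- + value S ∣ → ℤ.∣ + value R ℤ.- + value S ∣ ≡ 0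
      small = zero-of ℤ.∣ + value R ℤ.- + value S ∣ <N
        where
        zero-of : ∀ k → k ℕ.< N → N ℕD.∣ k → k ≡ 0
        zero-of zero    _   _ = refl
        zero-of (suc k) k<N d = ⊥-elim (ℕD.>⇒∤ k<N d)

    -- The sum of two numerators lies strictly between 0 and `2 N`, so as a multiple of `N` it is
    -- `N`.
    ∣-sum : ∀ R S → + N ∣ₛ num S ℤ.+ num R → value R ℕ.+ value S ≡ N
    ∣-sum R S d = by (∣⇒∣ᵤ (subst (+ N ∣ₛ_) eq (∣m∣n⇒∣m-n (divides (+ 1) (sym (ℤₚ.*-identityˡ (+ N)))) d)))
      where
      open ZSol
      eq : + N ℤ.- (num S ℤ.+ num R) ≡ + (value R ℕ.+ value S)
      eq = trans (cong (ℤ._- (num S ℤ.+ num R)) N≡)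
          (solve 3 (λ m r s → con (+ 2) :* m :- ((m :- s) :+ (m :- r)) := r :+ s) refl (+ M) (+ value R) (+ value S))
      by : N ℕD.∣ value R ℕ.+ value S → value R ℕ.+ value S ≡ N
      by (ℕD.divides 0 e) = ⊥-elim (ℕₚ.<⇒≢ (ℕₚ.<-≤-trans (pos R) (ℕₚ.m≤m+n _ _)) (sym e))
      by (ℕD.divides 1 e) = trans e (ℕₚ.+-identityʳ N)
      by (ℕD.divides (suc (suc q)) e) = ⊥-elim (ℕₚ.<⇒≱ (ℕₚ.+-mono-< (bound R) (bound S))
        (subst (N ℕ.+ N ℕ.≤_) (trans (ℕₚ.+-assoc N N (q ℕ.* N)) (sym e)) (ℕₚ.m≤m+n (N ℕ.+ N) (q ℕ.* N))))

    -- `p` is invertible modulo `N`, so two solutions of `p x ≡ n` have the same residue. In use,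
    -- `R′` is the image of a residue with centred numerator `n` under Dwork's map.
    equal : ∀ R R′ n → + N ∣ₛ + p ℤ.* num R′ ℤ.- n → + N ∣ₛ + p ℤ.* num R ℤ.- n → value R ≡ value R′
    equal R R′ n d e = ∣-difference R R′ (cancel-p _ (subst (+ N ∣ₛ_)
      (solve 4 (λ p x y n → (p :* x :- n) :- (p :* y :- n) := p :* (x :- y)) refl (+ p) (num R′) (num R) n) (∣m∣n⇒∣m-n d e)))
      where open ZSol

    opposite : ∀ R R′ n → + N ∣ₛ + p ℤ.* num R′ ℤ.- n → + N ∣ₛ + p ℤ.* num R ℤ.+ n → value R ℕ.+ value R′ ≡ N
    opposite R R′ n d e = ∣-sum R R′ (cancel-p _ (subst (+ N ∣ₛ_)
      (solve 4 (λ p x y n → (p :* x :- n) :+ (p :* y :+ n) := p :* (x :+ y)) refl (+ p) (num R′) (num R) n) (∣m∣n⇒∣m+n d e)))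
      where open ZSol

  Sign : ℤ → Set
  Sign ε = ε ≡ + 1 ⊎ ε ≡ ℤ.- + 1

  module Finite (m₁ m₂ p : ℕ) (0<m₁ : 1 ℕ.≤ m₁) (m₁≤m₂ : m₁ ℕ.≤ m₂) (hyperbolic : m₁ ℕ.+ m₂ ℕ.< m₁ ℕ.* m₂)
    (pr : Prime p) (large : 2 ℕ.* m₁ ℕ.* m₂ ℕ.< p) where

    M : ℕ
    M = m₁ ℕ.* m₂

    0<M : 0 ℕ.< M
    0<M = ℕₚ.≤-<-trans z≤n hyperbolic

    open Integrality p pr
    open Numerators p pr M 0<M (subst (ℕ._< p) (ℕₚ.*-assoc 2 m₁ m₂) large)

    -- The numerators of `a` and `b` over `N = 2 m₁ m₂`. Hyperbolicity gives `B > 0`, and `m₁ ≤ m₂`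
    -- gives `A ≤ M`.
    A B : ℕ
    A = M ℕ.+ m₁ ℕ.∸ m₂
    B = M ℕ.∸ (m₁ ℕ.+ m₂)

    m₂<M : m₂ ℕ.< M
    m₂<M = ℕₚ.≤-<-trans (ℕₚ.m≤n+m m₂ m₁) hyperbolic

    A-eq : A ℕ.+ m₂ ≡ M ℕ.+ m₁
    A-eq = ℕₚ.m∸n+n≡m (ℕₚ.≤-trans (ℕₚ.<⇒≤ m₂<M) (ℕₚ.m≤m+n M m₁))

    B-eq : B ℕ.+ (m₁ ℕ.+ m₂) ≡ M
    B-eq = ℕₚ.m∸n+n≡m (ℕₚ.<⇒≤ hyperbolic)

    M<N : M ℕ.< N
    M<N = ℕₚ.<-≤-trans (ℕₚ.m<m+n M 0<M) (ℕₚ.≤-reflexive (cong (M ℕ.+_) (sym (ℕₚ.+-identityʳ M))))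

    RA RB RA′ RB′ : Residue
    RA = mkResidue A (ℕₚ.m<n⇒0<n∸m (ℕₚ.<-≤-trans m₂<M (ℕₚ.m≤m+n M m₁)))
      (ℕₚ.≤-<-trans (ℕₚ.+-cancelʳ-≤ m₂ A M (subst (ℕ._≤ M ℕ.+ m₂) (sym A-eq) (ℕₚ.+-monoʳ-≤ M m₁≤m₂))) M<N)
    RB = mkResidue B (ℕₚ.m<n⇒0<n∸m hyperbolic) (ℕₚ.≤-<-trans (ℕₚ.m∸n≤m M (m₁ ℕ.+ m₂)) M<N)
    RA′ = Next.result (next RA)
    RB′ = Next.result (next RB)

    num-A : num RA ≡ + m₂ ℤ.- + m₁
    num-A = trans (solve 3 (λ m a n → m :- a := n :+ m :- (a :+ n)) refl (+ M) (+ A) (+ m₂))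
        (trans (cong (λ t → + m₂ ℤ.+ + M ℤ.- t) (cong +_ A-eq))
      (solve 3 (λ m a n → n :+ m :- (m :+ a) := n :- a) refl (+ M) (+ m₁) (+ m₂)))
      where open ZSol

    num-B : num RB ≡ + m₁ ℤ.+ + m₂
    num-B = trans (cong (λ t → t ℤ.- + B) (cong +_ (sym B-eq))) (solve 3 (λ b m n → (b :+ (m :+ n)) :- b := m :+ n)
        refl (+ B) (+ m₁) (+ m₂))
      where open ZSol

    Condition : Set
    Condition = Σ ℤ λ ε → Σ ℤ λ ε′ → (ε ≡ + 1 ⊎ ε ≡ ℤ.- + 1) × (ε′ ≡ + 1 ⊎ ε′ ≡ ℤ.- + 1) ×
      (((+ (2 ℕ.* m₁) ∣ᵤ (+ p ℤ.- ε)) × (+ (2 ℕ.* m₂) ∣ᵤ (+ p ℤ.- ε′ ℤ.* ε)))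
      ⊎ ((+ (2 ℕ.* m₁) ∣ᵤ (+ p ℤ.- (+ m₁ ℤ.+ ε))) × (+ (2 ℕ.* m₂) ∣ᵤ (+ p ℤ.- (+ m₂ ℤ.+ ε′ ℤ.* ε)))))

    -- The congruences `p/m₁ ± p/m₂ ≡ ε/m₁ ± ε′ε/m₂` modulo 2 with denominators cleared, where
    -- `u = p - ε` and `v = p - ε′ε`.
    Combined : ℤ → ℤ → Set
    Combined u v = (+ N ∣ₛ u ℤ.* + m₂ ℤ.+ v ℤ.* + m₁) × (+ N ∣ₛ u ℤ.* + m₂ ℤ.- v ℤ.* + m₁)

    private
      N≡ : + N ≡ + 2 ℤ.* + m₁ ℤ.* + m₂
      N≡ = trans (cong +_ (sym (ℕₚ.*-assoc 2 m₁ m₂))) (trans (ℤₚ.pos-* (2 ℕ.* m₁) m₂) (cong (ℤ._* + m₂) (ℤₚ.pos-* 2 m₁)))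

      shift : ∀ m ε → + p ℤ.- (m ℤ.+ ε) ≡ (+ p ℤ.- ε) ℤ.- m
      shift m ε = ZSol.solve 3 (λ p m e → p :- (m :+ e) := (p :- e) :- m) refl (+ p) m ε
        where open ZSol using (_:-_; _:+_; _:=_)

      instance
        m₁≢0 : ℤ.NonZero (+ m₁)
        m₁≢0 = ℕ.>-nonZero 0<m₁
        m₂≢0 : ℤ.NonZero (+ m₂)
        m₂≢0 = ℕ.>-nonZero (ℕₚ.≤-trans 0<m₁ m₁≤m₂)

      signed : ∀ {m z y} → z ≡ y → + (2 ℕ.* m) ∣ᵤ z → + 2 ℤ.* + m ∣ₛ y
      signed {m} {z} {y} refl d = subst (_∣ₛ z) (ℤₚ.pos-* 2 m) (∣ᵤ⇒∣ {+ (2 ℕ.* m)} {z} d)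

      unsigned : ∀ {m z y} → y ≡ z → + 2 ℤ.* + m ∣ₛ z → + (2 ℕ.* m) ∣ᵤ y
      unsigned {m} {z} {y} refl d = ∣⇒∣ᵤ {+ (2 ℕ.* m)} {y} (subst (_∣ₛ y) (sym (ℤₚ.pos-* 2 m)) d)

    combined⇒condition : ∀ ε ε′ → Sign ε → Sign ε′ → Combined (+ p ℤ.- ε) (+ p ℤ.- ε′ ℤ.* ε) → Condition
    combined⇒condition ε ε′ sε sε′ (d , e) = ε , ε′ , sε , sε′ ,
      by (even-or-odd-multiples (+ m₁) (+ m₂) u v (subst (_∣ₛ u ℤ.* + m₂ ℤ.+ v ℤ.* + m₁) N≡ d , subst
          (_∣ₛ u ℤ.* + m₂ ℤ.- v ℤ.* + m₁) N≡ e))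
      where
      u v : ℤ
      u = + p ℤ.- ε
      v = + p ℤ.- ε′ ℤ.* ε
      by : ((+ 2 ℤ.* + m₁ ∣ₛ u) × (+ 2 ℤ.* + m₂ ∣ₛ v)) ⊎ ((+ 2 ℤ.* + m₁ ∣ₛ u ℤ.- + m₁) × (+ 2 ℤ.* + m₂ ∣ₛ v ℤ.- + m₂)) →
        ((+ (2 ℕ.* m₁) ∣ᵤ u) × (+ (2 ℕ.* m₂) ∣ᵤ v)) ⊎ ((+ (2 ℕ.* m₁) ∣ᵤ (+ p ℤ.- (+ m₁ ℤ.+ ε))) ×
            (+ (2 ℕ.* m₂) ∣ᵤ (+ p ℤ.- (+ m₂ ℤ.+ ε′ ℤ.* ε))))
      by (inj₁ (d , e)) = inj₁ (unsigned {m₁} refl d , unsigned {m₂} refl e)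
      by (inj₂ (d , e)) = inj₂ (unsigned {m₁} (shift (+ m₁) ε) d , unsigned {m₂} (shift (+ m₂) (ε′ ℤ.* ε)) e)

    SignedCombined : Set
    SignedCombined = Σ ℤ λ ε → Σ ℤ λ ε′ → Sign ε × Sign ε′ × Combined (+ p ℤ.- ε) (+ p ℤ.- ε′ ℤ.* ε)

    condition⇒combined : Condition → SignedCombined
    condition⇒combined (ε , ε′ , sε , sε′ , c) = ε , ε′ , sε , sε′ , subst (_∣ₛ u ℤ.* + m₂ ℤ.+ v ℤ.* + m₁) (sym N≡)
        (proj₁ both) , subst (_∣ₛ u ℤ.* + m₂ ℤ.- v ℤ.* + m₁) (sym N≡) (proj₂ both)
      where
      u v : ℤ
      u = + p ℤ.- ε
      v = + p ℤ.- ε′ ℤ.* ε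
      by : ((+ (2 ℕ.* m₁) ∣ᵤ u) × (+ (2 ℕ.* m₂) ∣ᵤ v)) ⊎ ((+ (2 ℕ.* m₁) ∣ᵤ (+ p ℤ.- (+ m₁ ℤ.+ ε))) ×
          (+ (2 ℕ.* m₂) ∣ᵤ (+ p ℤ.- (+ m₂ ℤ.+ ε′ ℤ.* ε)))) →
        ((+ 2 ℤ.* + m₁ ∣ₛ u) × (+ 2 ℤ.* + m₂ ∣ₛ v)) ⊎ ((+ 2 ℤ.* + m₁ ∣ₛ u ℤ.- + m₁) × (+ 2 ℤ.* + m₂ ∣ₛ v ℤ.- + m₂))
      by (inj₁ (d , e)) = inj₁ (signed {m₁} refl d , signed {m₂} refl e)
      by (inj₂ (d , e)) = inj₂ (signed {m₁} (shift (+ m₁) ε) d , signed {m₂} (shift (+ m₂) (ε′ ℤ.* ε)) e)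
      both : (+ 2 ℤ.* + m₁ ℤ.* + m₂ ∣ₛ u ℤ.* + m₂ ℤ.+ v ℤ.* + m₁) × (+ 2 ℤ.* + m₁ ℤ.* + m₂ ∣ₛ u ℤ.* + m₂ ℤ.- v ℤ.* + m₁)
      both = multiples⇒ (+ m₁) (+ m₂) (+ p ℤ.- ε) (+ p ℤ.- ε′ ℤ.* ε) (by c)

    private
      open ZSol using (solve; _:-_; _:+_; _:*_; :-_; _:=_; con)

      x y : ℤ
      x = + m₂ ℤ.- + m₁
      y = + m₁ ℤ.+ + m₂

      next-A : + N ∣ₛ + p ℤ.* num RA′ ℤ.- x
      next-A = subst (λ t → + N ∣ₛ + p ℤ.* num RA′ ℤ.- t) num-A (num-next RA)

      next-B : + N ∣ₛ + p ℤ.* num RB′ ℤ.- y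
      next-B = subst (λ t → + N ∣ₛ + p ℤ.* num RB′ ℤ.- t) num-B (num-next RB)

    -- The four matches correspond to the four sign choices: `ε = -1` for the reflection
    -- `X ↦ N - X`, and `ε′ = -1` for the exchange of the parameters, which reverses the sign of
    -- `1/m₂` against that of `1/m₁`.
    match⇒condition : Match A B (value RA′) (value RB′) → Condition
    match⇒condition (inj₁ (e , f)) = combined⇒condition (+ 1) (+ 1) (inj₁ refl) (inj₁ refl)
      (subst (+ N ∣ₛ_) (trans (cong (λ t → + p ℤ.* t ℤ.- y) (trans (sym (num-equal RB RB′ f)) num-B))
         (solve 3 (λ p m n → p :* (m :+ n) :- (m :+ n) := (p :- con (+ 1)) :* n :+ (p :- con (+ 1)) :* m) refl (+ p)
             (+ m₁) (+ m₂))) next-B ,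
       subst (+ N ∣ₛ_) (trans (cong (λ t → + p ℤ.* t ℤ.- x) (trans (sym (num-equal RA RA′ e)) num-A))
         (solve 3 (λ p m n → p :* (n :- m) :- (n :- m) := (p :- con (+ 1)) :* n :- (p :- con (+ 1)) :* m) refl (+ p)
             (+ m₁) (+ m₂))) next-A)
    match⇒condition (inj₂ (inj₁ (e , f))) = combined⇒condition (+ 1) (ℤ.- + 1) (inj₁ refl) (inj₂ refl)
      (subst (+ N ∣ₛ_) (trans (cong (λ t → + p ℤ.* t ℤ.- x) (trans (sym (num-equal RB RA′ f)) num-B))
         (solve 3 (λ p m n → p :* (m :+ n) :- (n :- m) := (p :- con (+ 1)) :* n :+ (p :- con (ℤ.- + 1)) :* m) refl
             (+ p) (+ m₁) (+ m₂))) next-A ,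
       subst (+ N ∣ₛ_) (trans (cong (λ t → + p ℤ.* t ℤ.- y) (trans (sym (num-equal RA RB′ e)) num-A))
         (solve 3 (λ p m n → p :* (n :- m) :- (m :+ n) := (p :- con (+ 1)) :* n :- (p :- con (ℤ.- + 1)) :* m) refl
             (+ p) (+ m₁) (+ m₂))) next-B)
    match⇒condition (inj₂ (inj₂ (inj₁ (e , f)))) = combined⇒condition (ℤ.- + 1) (+ 1) (inj₂ refl) (inj₁ refl)
      (subst (+ N ∣ₛ_) (trans (cong (λ t → ℤ.- (+ p ℤ.* t ℤ.- y)) (trans (num-opposite RB RB′ f) (cong ℤ.-_ num-B)))
         (solve 3 (λ p m n → :- (p :* (:- (m :+ n)) :- (m :+ n)) := (p :- con (ℤ.- + 1)) :* n :+ (p :- con (ℤ.- + 1))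
             :* m) refl (+ p) (+ m₁) (+ m₂))) (∣m⇒∣-m next-B) ,
       subst (+ N ∣ₛ_) (trans (cong (λ t → ℤ.- (+ p ℤ.* t ℤ.- x)) (trans (num-opposite RA RA′ e) (cong ℤ.-_ num-A)))
         (solve 3 (λ p m n → :- (p :* (:- (n :- m)) :- (n :- m)) := (p :- con (ℤ.- + 1)) :* n :- (p :- con (ℤ.- + 1))
             :* m) refl (+ p) (+ m₁) (+ m₂))) (∣m⇒∣-m next-A))
    match⇒condition (inj₂ (inj₂ (inj₂ (e , f)))) = combined⇒condition (ℤ.- + 1) (ℤ.- + 1) (inj₂ refl) (inj₂ refl)
      (subst (+ N ∣ₛ_) (trans (cong (λ t → ℤ.- (+ p ℤ.* t ℤ.- x)) (trans (num-opposite RB RA′ f) (cong ℤ.-_ num-B)))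
         (solve 3 (λ p m n → :- (p :* (:- (m :+ n)) :- (n :- m)) := (p :- con (ℤ.- + 1)) :* n :+ (p :- con (+ 1)) :*
             m) refl (+ p) (+ m₁) (+ m₂))) (∣m⇒∣-m next-A) ,
       subst (+ N ∣ₛ_) (trans (cong (λ t → ℤ.- (+ p ℤ.* t ℤ.- y)) (trans (num-opposite RA RB′ e) (cong ℤ.-_ num-A)))
         (solve 3 (λ p m n → :- (p :* (:- (n :- m)) :- (m :+ n)) := (p :- con (ℤ.- + 1)) :* n :- (p :- con (+ 1)) :*
             m) refl (+ p) (+ m₁) (+ m₂))) (∣m⇒∣-m next-B))

    condition⇒match : Condition → Match A B (value RA′) (value RB′)
    condition⇒match c = by (condition⇒combined c)
      where
      from : ∀ {z} z′ → z ≡ z′ → + N ∣ₛ z → + N ∣ₛ z′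
      from _ refl d = d
      by : SignedCombined → Match A B (value RA′) (value RB′)
      by (_ , _ , inj₁ refl , inj₁ refl , s , t) = inj₁ (
        equal RA RA′ x next-A (from (+ p ℤ.* num RA ℤ.- x)
            (trans (solve 3 (λ p m n → (p :- con (+ 1)) :* n :- (p :- con (+ 1)) :* m := p :* (n :- m) :- (n :- m))
            refl (+ p) (+ m₁) (+ m₂)) (cong (λ z → + p ℤ.* z ℤ.- x) (sym num-A))) t) ,
        equal RB RB′ y next-B (from (+ p ℤ.* num RB ℤ.- y)
            (trans (solve 3 (λ p m n → (p :- con (+ 1)) :* n :+ (p :- con (+ 1)) :* m := p :* (m :+ n) :- (m :+ n))
            refl (+ p) (+ m₁) (+ m₂)) (cong (λ z → + p ℤ.* z ℤ.- y) (sym num-B))) s))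
      by (_ , _ , inj₁ refl , inj₂ refl , s , t) = inj₂ (inj₁ (
        equal RA RB′ y next-B (from (+ p ℤ.* num RA ℤ.- y)
            (trans (solve 3 (λ p m n → (p :- con (+ 1)) :* n :- (p :- con (ℤ.- + 1)) :* m := p :* (n :- m) :-
            (m :+ n)) refl (+ p) (+ m₁) (+ m₂)) (cong (λ z → + p ℤ.* z ℤ.- y) (sym num-A))) t) ,
        equal RB RA′ x next-A (from (+ p ℤ.* num RB ℤ.- x)
            (trans (solve 3 (λ p m n → (p :- con (+ 1)) :* n :+ (p :- con (ℤ.- + 1)) :* m := p :* (m :+ n) :-
            (n :- m)) refl (+ p) (+ m₁) (+ m₂)) (cong (λ z → + p ℤ.* z ℤ.- x) (sym num-B))) s)))
      by (_ , _ , inj₂ refl , inj₁ refl , s , t) = inj₂ (inj₂ (inj₁ (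
        opposite RA RA′ x next-A (from (+ p ℤ.* num RA ℤ.+ x)
            (trans (solve 3 (λ p m n → (p :- con (ℤ.- + 1)) :* n :- (p :- con (ℤ.- + 1)) :* m := p :* (n :- m) :+
            (n :- m)) refl (+ p) (+ m₁) (+ m₂)) (cong (λ z → + p ℤ.* z ℤ.+ x) (sym num-A))) t) ,
        opposite RB RB′ y next-B (from (+ p ℤ.* num RB ℤ.+ y)
            (trans (solve 3 (λ p m n → (p :- con (ℤ.- + 1)) :* n :+ (p :- con (ℤ.- + 1)) :* m := p :* (m :+ n) :+
            (m :+ n)) refl (+ p) (+ m₁) (+ m₂)) (cong (λ z → + p ℤ.* z ℤ.+ y) (sym num-B))) s))))
      by (_ , _ , inj₂ refl , inj₂ refl , s , t) = inj₂ (inj₂ (inj₂ (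
        opposite RA RB′ y next-B (from (+ p ℤ.* num RA ℤ.+ y)
            (trans (solve 3 (λ p m n → (p :- con (ℤ.- + 1)) :* n :- (p :- con (+ 1)) :* m := p :* (n :- m) :+
            (m :+ n)) refl (+ p) (+ m₁) (+ m₂)) (cong (λ z → + p ℤ.* z ℤ.+ y) (sym num-A))) t) ,
        opposite RB RA′ x next-A (from (+ p ℤ.* num RB ℤ.+ x)
            (trans (solve 3 (λ p m n → (p :- con (ℤ.- + 1)) :* n :+ (p :- con (+ 1)) :* m := p :* (m :+ n) :+
            (n :- m)) refl (+ p) (+ m₁) (+ m₂)) (cong (λ z → + p ℤ.* z ℤ.+ x) (sym num-B))) s))))

    private
      m₁≢0ℚ : ι m₁ ≢ 0ℚ
      m₁≢0ℚ e = ℕₚ.<⇒≢ 0<m₁ (sym (ι-injective {m₁} {0} e))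

      m₂≢0ℚ : ι m₂ ≢ 0ℚ
      m₂≢0ℚ e = ℕₚ.<⇒≢ (ℕₚ.≤-trans 0<m₁ m₁≤m₂) (sym (ι-injective {m₂} {0} e))

      ι-N : ι N ≡ ι 2 * (ι m₁ * ι m₂)
      ι-N = trans (ι-* 2 M) (cong (ι 2 *_) (ι-* m₁ m₂))

      -- c = 1 gives a and c = -1 gives b
      clear : ∀ c → ι N * (½ * (1ℚ - inv (ι m₁) + c * inv (ι m₂))) ≡ ι m₁ * ι m₂ - ι m₂ + c * ι m₁
      clear c = trans (cong (_* (½ * (1ℚ - inv (ι m₁) + c * inv (ι m₂)))) ι-N) (trans
        (QSol.solve 5 (λ m n i j c → con₂ (ι 2) ⊠ (m ⊠ n) ⊠ (con₂ ½ ⊠ (con₂ 1ℚ ⊟ i ⊞ c ⊠ j)) ≔ m ⊠ n ⊟ (m ⊠ i) ⊠ n ⊞ c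
            ⊠ m ⊠ (n ⊠ j)) refl (ι m₁) (ι m₂) (inv (ι m₁)) (inv (ι m₂)) c)
        (trans (cong₂ (λ s t → ι m₁ * ι m₂ - s * ι m₂ + c * ι m₁ * t) (inv-right m₁≢0ℚ) (inv-right m₂≢0ℚ))
          (QSol.solve 3 (λ m n c → m ⊠ n ⊟ con₂ 1ℚ ⊠ n ⊞ c ⊠ m ⊠ con₂ 1ℚ ≔ m ⊠ n ⊟ n ⊞ c ⊠ m) refl (ι m₁) (ι m₂) c)))
        where open QSol using () renaming (con to con₂; _:*_ to infixl 7 _⊠_; _:+_ to infixl 6 _⊞_; _:-_ to infixl 6 _⊟_; _:=_ to infix 4 _≔_)

      ι-M : ι M ≡ ι m₁ * ι m₂
      ι-M = ι-* m₁ m₂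

      a≡ : aFin m₁ m₂ ≡ over A
      a≡ = over-unique {aFin m₁ m₂} {A}
          (trans (cong (λ t → ι N * (½ * (1ℚ - inv (ι m₁) + t))) (sym (*-identityˡ (inv (ι m₂))))) (trans (clear 1ℚ)
        (trans (cong (λ t → t - ι m₂ + 1ℚ * ι m₁) (sym ι-M))
            (trans (QSol.solve 3 (λ m n k → k ⊟ n ⊞ con₂ 1ℚ ⊠ m ≔ (k ⊞ m) ⊟ n) refl (ι m₁) (ι m₂) (ι M))
          (trans (cong (λ t → t - ι m₂) (trans (sym (ι-+ M m₁)) (trans (cong ι (sym A-eq)) (ι-+ A m₂))))
              (QSol.solve 2 (λ a n → a ⊞ n ⊟ n ≔ a) refl (ι A) (ι m₂)))))))
        where open QSol using () renaming (con to con₂; _:*_ to infixl 7 _⊠_; _:+_ to infixl 6 _⊞_; _:-_ to infixl 6 _⊟_; _:=_ to infix 4 _≔_)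

      b≡ : bFin m₁ m₂ ≡ over B
      b≡ = over-unique {bFin m₁ m₂} {B}
          (trans (cong (λ t → ι N * (½ * (1ℚ - inv (ι m₁) + t))) (QSol.solve 1 (λ j → ⊝′ j ≔ con₂ (- 1ℚ) ⊠ j) refl
          (inv (ι m₂)))) (trans (clear (- 1ℚ))
        (trans (cong (λ t → t - ι m₂ + (- 1ℚ) * ι m₁)
            (trans (sym ι-M) (trans (cong ι (sym B-eq)) (trans (ι-+ B (m₁ ℕ.+ m₂)) (cong (λ t → ι B + t) (ι-+ m₁ m₂))))))
          (QSol.solve 3 (λ m n b → b ⊞ (m ⊞ n) ⊟ n ⊞ con₂ (- 1ℚ) ⊠ m ≔ b) refl (ι m₁) (ι m₂) (ι B)))))
        where open QSol using () renaming (con to con₂; :-_ to infix 8 ⊝′_; _:*_ to infixl 7 _⊠_; _:+_ to infixl 6 _⊞_; _:-_ to infixl 6 _⊟_; _:=_ to infix 4 _≔_)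

      -- 2, `m₁` and `m₂` are all smaller than `p`, so rescaling by `κ` does not affect integrality.
      unit-κ : Unit (κFin m₁ m₂)
      unit-κ = Unit-neg (Unit-ι (∣-* (∣-* (∤ (s≤s z≤n) (ℕₚ.*-monoʳ-≤ 2 0<M)) (∣-* ∤m₁ ∤m₁)) (∣-* ∤m₂ ∤m₂)))
        where
        ∤ : ∀ {n} → 0 ℕ.< n → n ℕ.≤ N → ¬ p ℕD.∣ n
        ∤ 0<n n≤N = <p⇒∤ 0<n (ℕₚ.≤-<-trans n≤N (subst (ℕ._< p) (ℕₚ.*-assoc 2 m₁ m₂) large))
        ∤m₁ : ¬ p ℕD.∣ m₁
        ∤m₁ = ∤ 0<m₁ (ℕₚ.≤-trans m₁≤m₂ (ℕₚ.<⇒≤ (ℕₚ.<-trans m₂<M M<N)))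
        ∤m₂ : ¬ p ℕD.∣ m₂
        ∤m₂ = ∤ (ℕₚ.≤-trans 0<m₁ m₁≤m₂) (ℕₚ.<⇒≤ (ℕₚ.<-trans m₂<M M<N))

    criterion : PIntegral p (JFin m₁ m₂) ⇔ Condition
    criterion = mk⇔ (λ z → match⇒condition (Equivalence.to eqv (subst (PIntegral p) J≡ z)))
      (λ c → subst (PIntegral p) (sym J≡) (Equivalence.from eqv (condition⇒match c)))
      where
      J≡ : JFin m₁ m₂ ≡ hauptH (over (value RA)) (over (value RB)) (κFin m₁ m₂)
      J≡ = cong₂ (λ a b → hauptH a b (κFin m₁ m₂)) a≡ b≡
      eqv : PIntegral p (hauptH (over (value RA)) (over (value RB)) (κFin m₁ m₂)) ⇔
        Match (value RA) (value RB) (value (Next.result (next RA))) (value (Next.result (next RB)))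
      eqv = pIntegral⇔match RA RB {κFin m₁ m₂} unit-κ

  module Infinite (m p : ℕ) (κ : ℚ) (2≤m : 2 ℕ.≤ m) (pr : Prime p) (large : 2 ℕ.* m ℕ.< p) (pu : pUnit p κ) where

    0<m : 0 ℕ.< m
    0<m = ℕₚ.≤-trans (s≤s z≤n) 2≤m

    open Integrality p pr
    open Numerators p pr m 0<m large

    -- Here `a = b = (m - 1) / 2m`, so `1 - 2a = 1/m` and the centred numerator is 1.
    A : ℕ
    A = m ℕ.∸ 1

    A-eq : A ℕ.+ 1 ≡ m
    A-eq = ℕₚ.m∸n+n≡m 0<m

    R R′ : Residue
    R = mkResidue A (ℕₚ.m<n⇒0<n∸m 2≤m)
        (ℕₚ.≤-<-trans (ℕₚ.m∸n≤m m 1)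
        (ℕₚ.<-≤-trans (ℕₚ.m<m+n m 0<m) (ℕₚ.≤-reflexive (cong (m ℕ.+_) (sym (ℕₚ.+-identityʳ m))))))
    R′ = Next.result (next R)

    num-A : num R ≡ + 1
    num-A = trans (cong (λ t → t ℤ.- + A) (cong +_ (sym A-eq)))
        (ZSol.solve 1 (λ a → (a :+ con (+ 1)) :- a := con (+ 1)) refl (+ A))
      where open ZSol using (_:-_; _:+_; _:=_; con)

    next-A : + N ∣ₛ + p ℤ.* num R′ ℤ.- + 1
    next-A = subst (λ t → + N ∣ₛ + p ℤ.* num R′ ℤ.- t) num-A (num-next R)

    Condition : Set
    Condition = (+ (2 ℕ.* m) ∣ᵤ (+ p ℤ.- + 1)) ⊎ (+ (2 ℕ.* m) ∣ᵤ (+ p ℤ.+ + 1))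

    -- With equal parameters the exchange is invisible, so the four matches give only two signs.
    match⇒condition : Match A A (value R′) (value R′) → Condition
    match⇒condition = λ
      { (inj₁ (e , _))               → inj₁ (plus e)
      ; (inj₂ (inj₁ (e , _)))        → inj₁ (plus e)
      ; (inj₂ (inj₂ (inj₁ (e , _)))) → inj₂ (minus e)
      ; (inj₂ (inj₂ (inj₂ (e , _)))) → inj₂ (minus e) }
      where
      open ZSol using (solve; _:-_; _:+_; _:*_; :-_; _:=_; con)
      plus : A ≡ value R′ → + N ∣ᵤ (+ p ℤ.- + 1)
      plus e = ∣⇒∣ᵤ {+ N} {+ p ℤ.- + 1}
          (subst (+ N ∣ₛ_) (trans (cong (λ t → + p ℤ.* t ℤ.- + 1) (trans (sym (num-equal R R′ e)) num-A))
        (cong (ℤ._- + 1) (ℤₚ.*-identityʳ (+ p)))) next-A)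
      minus : A ℕ.+ value R′ ≡ N → + N ∣ᵤ (+ p ℤ.+ + 1)
      minus e = ∣⇒∣ᵤ {+ N} {+ p ℤ.+ + 1}
          (subst (+ N ∣ₛ_) (trans (cong (λ t → ℤ.- (+ p ℤ.* t ℤ.- + 1)) (trans (num-opposite R R′ e) (cong ℤ.-_ num-A)))
        (solve 1 (λ p → :- (p :* con (ℤ.- + 1) :- con (+ 1)) := p :+ con (+ 1)) refl (+ p))) (∣m⇒∣-m next-A))

    condition⇒match : Condition → Match A A (value R′) (value R′)
    condition⇒match (inj₁ d) = inj₁ (e , e)
      where
      e : A ≡ value R′
      e = equal R R′ (+ 1) next-A
          (subst (+ N ∣ₛ_) (cong (ℤ._- + 1) (trans (sym (ℤₚ.*-identityʳ (+ p))) (cong (λ t → + p ℤ.* t) (sym num-A))))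
          (∣ᵤ⇒∣ {+ N} {+ p ℤ.- + 1} d))
    condition⇒match (inj₂ d) = inj₂ (inj₂ (inj₁ (e , e)))
      where
      e : A ℕ.+ value R′ ≡ N
      e = opposite R R′ (+ 1) next-A
          (subst (+ N ∣ₛ_) (cong (ℤ._+ + 1) (trans (sym (ℤₚ.*-identityʳ (+ p))) (cong (λ t → + p ℤ.* t) (sym num-A))))
          (∣ᵤ⇒∣ {+ N} {+ p ℤ.+ + 1} d))

    a≡ : aInf m ≡ over A
    a≡ = over-unique {aInf m} {A} (trans (cong (_* aInf m) (ι-* 2 m)) (trans
      (solve 2 (λ m i → con (ι 2) :* m :* (con ½ :* (con 1ℚ :- i)) := m :- m :* i) refl (ι m) (inv (ι m)))
      (trans (cong₂ (λ s t → s - t) (trans (cong ι (sym A-eq)) (ι-+ A 1))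
          (inv-right (λ e → ℕₚ.<⇒≢ 0<m (sym (ι-injective {m} {0} e)))))
        (solve 1 (λ a → a :+ con 1ℚ :- con 1ℚ := a) refl (ι A)))))
      where open QSol

    criterion : PIntegral p (JInf m κ) ⇔ Condition
    criterion = mk⇔ (λ z → match⇒condition (Equivalence.to eqv (subst (PIntegral p) J≡ z)))
      (λ c → subst (PIntegral p) (sym J≡) (Equivalence.from eqv (condition⇒match c)))
      where
      J≡ : JInf m κ ≡ hauptH (over (value R)) (over (value R)) κ
      J≡ = cong (λ a → hauptH a a κ) a≡
      eqv : PIntegral p (hauptH (over (value R)) (over (value R)) κ) ⇔
        Match (value R) (value R) (value (Next.result (next R))) (value (Next.result (next R)))
      eqv = pIntegral⇔match R R {κ} (pUnit⇒Unit pu)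

open import Data.Nat using (ℕ; _+_; _*_; _≤_; _<_)
open import Data.Nat.Primality using (Prime)
open import Data.Integer as ℤ using (ℤ; +_; -_)
open import Data.Integer.Divisibility using (_∣_)
open import Data.Rational as ℚ using (ℚ; 0ℚ)
open import Data.Product using (Σ; ∃; _×_; _,_)
open import Data.Sum using (_⊎_)
open import Function.Bundles using (_⇔_)
open import Relation.Binary.PropositionalEquality using (_≡_; _≢_)

theorem1 : (∀ (m₁ m₂ p : ℕ) → 1 ≤ m₁ → m₁ ≤ m₂ → m₁ + m₂ < m₁ * m₂ →
    Prime p → 2 * m₁ * m₂ < p →
    PIntegral p (JFin m₁ m₂) ⇔
    (Σ ℤ λ ε → Σ ℤ λ ε′ → (ε ≡ + 1 ⊎ ε ≡ - + 1) × (ε′ ≡ + 1 ⊎ ε′ ≡ - + 1) ×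
    (((+ (2 * m₁) ∣ (+ p ℤ.- ε)) × (+ (2 * m₂) ∣ (+ p ℤ.- ε′ ℤ.* ε)))
    ⊎ ((+ (2 * m₁) ∣ (+ p ℤ.- (+ m₁ ℤ.+ ε)))
    × (+ (2 * m₂) ∣ (+ p ℤ.- (+ m₂ ℤ.+ ε′ ℤ.* ε)))))))
    × (∀ (m p : ℕ) (κ : ℚ) → 2 ≤ m → Prime p → 2 * m < p →
    κ ≢ 0ℚ → pUnit p κ →
    PIntegral p (JInf m κ) ⇔
    ((+ (2 * m) ∣ (+ p ℤ.- + 1)) ⊎ (+ (2 * m) ∣ (+ p ℤ.+ + 1))))
theorem1 =
  (λ m₁ m₂ p 0<m₁ m₁≤m₂ hyperbolic pr large → TriangleGroups.Finite.criterion m₁ m₂ p 0<m₁ m₁≤m₂ hyperbolic pr large) ,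
  (λ m p κ 2≤m pr large _ unit → TriangleGroups.Infinite.criterion m p κ 2≤m pr large unit)
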